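{- Let $q$ be an odd prime power and $d\ge 2$. Let $E\subseteq\mathbb{F}_q^d$ and $R\subseteq\mathbb{F}_q\setminus\{0\}$, and let $\ell=(d+2)\lceil\log_2 q\rceil+16$. Suppose $|E|>C=72|R|^{1/2}q^{(d+1)/2}$. Let $\mathcal{H}$ be an $R$-distance subdivision of a complete graph $K_\Delta$ with distance at least $\ell$ between each pair of branching vertices. If $d\ge 3$ and $|V(\mathcal{H})|\le |E|-C$, then $E$ contains $\mathcal{H}$. If $d=2$, $\Delta\le (1/4)q^{ -1}|E|$ and $|V(\mathcal{H})|\le|E|-C$, then $E$ contains $\mathcal{H}$.
   Context: For $x\in\mathbb{F}_q^d$, $\|x\|=x_1^2+\dots+x_d^2$. A distance graph is a simple graph $H$ together with a function $f:E(H)\to\mathbb{F}_q^*$; it is an $R$-distance graph if $f$ takes values in $R$. An $R$-distance subdivision of $K_\Delta$ is an $R$-distance graph whose underlying graph is obtained from $K_\Delta$ by replacing its edges with internally vertex-disjoint paths; the $\Delta$ original vertices are the branching vertices, and "distance at least $\ell$ between branching vertices" means each of these paths has length at least $\ell$. A set $E$ contains the distance graph $(H,f)$ if there is an injective map $\phi:V(H)\to E$ with $\|\phi(u)-\phi(v)\|=f(uv)$ for every edge $uv\in E(H)$. -}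

module Defs where

open import Level using (0ℓ)
open import Data.Nat as ℕ using (ℕ; suc; _≤_; _<_)
open import Data.Nat.Primality using (Prime)
open import Data.Fin using (Fin)
open import Data.Vec using (Vec; foldr; zipWith; map)
open import Data.List using (List; []; _∷_; _++_; [_])
open import Data.List.Membership.Propositional using (_∈_)
open import Data.List.Relation.Unary.Unique.Propositional using (Unique)
open import Data.Product using (Σ; _×_; ∃; ∃-syntax)
open import Data.Sum using (_⊎_)
open import Relation.Nullary using (¬_)
open import Relation.Binary.PropositionalEquality using (_≡_)
open import Relation.Binary.Definitions using (DecidableEquality)
open import Algebra.Structures using (IsCommutativeRing)
open import Function.Definitions using (Injective)

record FiniteField : Set₁ where
  infixl 6 _+_
  infixl 7 _*_
  field
    F          : Set
    _≟_        : DecidableEquality F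
    _+_ _*_    : F → F → F
    -_         : F → F
    0# 1#      : F
    isCommRing : IsCommutativeRing _≡_ _+_ _*_ -_ 0# 1#
    0≢1        : ¬ (0# ≡ 1#)
    inverse    : ∀ x → ¬ (x ≡ 0#) → Σ F (λ y → x * y ≡ 1#)
    elements   : List F
    complete   : ∀ x → x ∈ elements
    distinct   : Unique elements

  order : ℕ
  order = Data.List.length elements

OddPrimePower : ℕ → Set
OddPrimePower q = ∃[ p ] ∃[ k ] (Prime p × ¬ (p ≡ 2) × 1 ≤ k × q ≡ p ℕ.^ k)

data Consec {A : Set} (u v : A) : List A → Set where
  here  : ∀ {xs} → Consec u v (u ∷ v ∷ xs)
  there : ∀ {x xs} → Consec u v xs → Consec u v (x ∷ xs)

module _ (𝔽 : FiniteField) where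
  open FiniteField 𝔽

  ‖_‖ : ∀ {d} → Vec F d → F
  ‖ x ‖ = foldr _ _+_ 0# (map (λ a → a * a) x)

  _-ᵥ_ : ∀ {d} → Vec F d → Vec F d → Vec F d
  x -ᵥ y = zipWith (λ a b → a + (- b)) x y

  record DistanceGraph : Set₁ where
    field
      n       : ℕ
      Adj     : Fin n → Fin n → Set
      adjSym  : ∀ {u v} → Adj u v → Adj v u
      irrefl  : ∀ {u} → ¬ Adj u u
      f       : Fin n → Fin n → F
      fSym    : ∀ {u v} → Adj u v → f u v ≡ f v u
      fNonzero : ∀ {u v} → Adj u v → ¬ (f u v ≡ 0#)

  IsRDistance : List F → DistanceGraph → Set
  IsRDistance R H = ∀ u v → Adj u v → f u v ∈ R
    where open DistanceGraph H

  IsWalk : (H : DistanceGraph) → List (Fin (DistanceGraph.n H)) → Set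
  IsWalk H xs = ∀ u v → Consec u v xs → DistanceGraph.Adj H u v

  record SubdivisionOfK (Δ ℓ : ℕ) (H : DistanceGraph) : Set where
    open DistanceGraph H
    field
      branch      : Fin Δ → Fin n
      branchInj   : Injective _≡_ _≡_ branch
      internal    : (i j : Fin Δ) → i Data.Fin.< j → List (Fin n)
    pathOf : (i j : Fin Δ) → i Data.Fin.< j → List (Fin n)
    pathOf i j p = branch i ∷ (internal i j p ++ [ branch j ])
    field
      pathWalk    : ∀ i j p → IsWalk H (pathOf i j p)
      pathUnique  : ∀ i j p → Unique (pathOf i j p)
      pathLong    : ∀ i j p → ℓ ≤ suc (Data.List.length (internal i j p))
      internalNotBranch : ∀ i j p v → v ∈ internal i j p → ∀ k → ¬ (v ≡ branch k)
      internalDisjoint  : ∀ i j p i′ j′ p′ v → v ∈ internal i j p → v ∈ internal i′ j′ p′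
                          → i ≡ i′ × j ≡ j′
      coversVertices : ∀ v → (∃[ k ] v ≡ branch k)
                             ⊎ (∃[ i ] ∃[ j ] Σ (i Data.Fin.< j) λ p → v ∈ internal i j p)
      coversEdges    : ∀ u v → Adj u v
                       → ∃[ i ] ∃[ j ] Σ (i Data.Fin.< j) λ p →
                           Consec u v (pathOf i j p) ⊎ Consec v u (pathOf i j p)

  Contains : ∀ {d} → List (Vec F d) → DistanceGraph → Set
  Contains {d} E H =
    ∃[ φ ] (Injective _≡_ _≡_ φ × (∀ v → φ v ∈ E)
            × (∀ u v → Adj u v → ‖ φ u -ᵥ φ v ‖ ≡ f u v))
    where open DistanceGraph H

{-# OPTIONS --safe #-}
-- Spectral part. Write e(x) = q·[x = 0] − 1, the sum of all nontrivial additive characters at x, so that everything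
-- stays in ℤ. The L² norm of the discrepancy Σ_y g(y) e(‖x − y‖ − r) is expanded in Fourier coefficients; completing
-- squares leaves, in even dimension, Kloosterman sums, which satisfy a Weil bound : doubling them along the tower
-- of quadratic extensions of F squares any excess over the bound, while Stepanov's method (an auxiliary polynomial
-- found by the pigeonhole principle) gives a bound on every level that the excess would eventually violate. Hence
-- the graph of each distance r ≠ 0 satisfies Σ_x (q·|N_r(x) ∩ Y| − |Y|)² ≤ 5 q^(d+1) |Y|.
--
-- Combinatorial part (Friedman–Pippenger with deletions). Let κ = ⌈√(5 |R| q^(d+1))⌉. After discarding O(κ) vertices,
-- E is "extendable" : all small sets of (vertex, distance) pairs expand into the unused vertices. The stars around
-- the branching vertices are chosen greedily. To join two leaves by a path with prescribed distances, grow a path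
-- and two binary trees of more than √(5 q^(d+1)) leaves keeping extendability; some edge of the right distance joins the two
-- sets of leaves, and the unused branches are removed again, which also preserves extendability.
module Submission where

open import Data.Bool using (Bool; _∧_; _∨_; false; if_then_else_; true)
open import Data.Bool.ListAction using (any)
open import Data.Fin using (Fin)
open import Data.List using (List; []; [_]; _++_; _∷_; allFin; cartesianProduct; filter; filterᵇ; length; map; take)
open import Data.List.Membership.Propositional using (_∈_)
open import Data.List.Membership.Propositional.Properties using (∈-++⁺ʳ; ∈-++⁺ˡ; ∈-++⁻; ∈-cartesianProduct⁺; ∈-filter⁺; ∈-filter⁻; ∈-map⁺; ∈-map⁻)
open import Data.List.Properties using (length-++; length-map; length-tabulate; length-take)
open import Data.List.Relation.Unary.All using (All)
open import Data.List.Relation.Unary.Any using (Any; here; there)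
open import Data.List.Relation.Unary.Unique.Propositional using (Unique)
open import Data.Maybe using (Maybe; just; nothing)
open import Data.Product using (_,_; _×_; proj₁; proj₂; uncurry; ∃; ∃₂)
open import Data.Product.Properties using (≡-dec)
open import Data.Sum using (_⊎_; inj₁; inj₂)
open import Data.Vec using (Vec; replicate)
open import Function using (_∘_)
open import Relation.Binary.Definitions using (DecidableEquality; tri<; tri>; tri≈)
open import Relation.Nullary using (Dec; contradiction; no; yes; ¬_)
open import Relation.Nullary.Decidable using (_×-dec_; ⌊_⌋)
open import Relation.Binary.PropositionalEquality hiding ([_])

module SumLib where

  open import Algebra.Structures using (IsCommutativeMonoid)
  open import Data.Nat using (_+_; _*_)
  open import Data.List.Membership.Propositional.Properties.WithK using (unique∧set⇒bag)
  open import Data.List.Relation.Binary.BagAndSetEquality using (∼bag⇒↭)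
  open import Data.List.Relation.Binary.Permutation.Propositional as Perm using (_↭_)
  open import Data.List.Relation.Unary.All as All using ([]; _∷_)
  open import Data.List.Relation.Unary.AllPairs using ([]; _∷_)
  import Data.List.Relation.Unary.Unique.Propositional.Properties as Uniq
  open import Function using (mk⇔)

  record Finite (A : Set) : Set where
    field
      elems    : List A
      complete : ∀ x → x ∈ elems
      distinct : Unique elems
      _≟_      : DecidableEquality A

    size = length elems

  open Finite public using (elems)

  length-cartesianProduct : ∀ {A B : Set} (xs : List A) (ys : List B) → length (cartesianProduct xs ys) ≡ length xs * length ys
  length-cartesianProduct []       ys = refl
  length-cartesianProduct (x ∷ xs) ys = trans (length-++ (map (x ,_) ys))
    (cong₂ _+_ (length-map (x ,_) ys) (length-cartesianProduct xs ys))

  ×-finite : ∀ {A B} → Finite A → Finite B → Finite (A × B)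
  ×-finite FA FB = record
    { elems    = cartesianProduct (elems FA) (elems FB)
    ; complete = λ (x , y) → ∈-cartesianProduct⁺ (Finite.complete FA x) (Finite.complete FB y)
    ; distinct = Uniq.cartesianProduct⁺ (Finite.distinct FA) (Finite.distinct FB)
    ; _≟_      = ≡-dec (Finite._≟_ FA) (Finite._≟_ FB) }

  module _ {A B : Set} (FA : Finite A) (FB : Finite B)
           (σ : A → B) (τ : B → A) (στ : ∀ y → σ (τ y) ≡ y) (τσ : ∀ x → τ (σ x) ≡ x) where
    private
      module A = Finite FA
      module B = Finite FB

    map-elems-↭ : map σ A.elems ↭ B.elems
    map-elems-↭ = ∼bag⇒↭ (unique∧set⇒bag (Uniq.map⁺ inj A.distinct) B.distinct
        (λ {y} → mk⇔ (λ _ → B.complete y) (λ _ → subst (_∈ map σ A.elems) (στ y) (∈-map⁺ σ (A.complete (τ y))))))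
      where
      inj : ∀ {x y} → σ x ≡ σ y → x ≡ y
      inj {x} {y} eq = trans (sym (τσ x)) (trans (cong τ eq) (τσ y))

  module Sum {M : Set} {_∙_ : M → M → M} {ε : M} (isCM : IsCommutativeMonoid _≡_ _∙_ ε) where
    open IsCommutativeMonoid isCM using (assoc; comm; identityˡ; identityʳ)
    open ≡-Reasoning

    private variable
      A B : Set

    ∑ : List A → (A → M) → M
    ∑ []       f = ε
    ∑ (x ∷ xs) f = f x ∙ ∑ xs f

    ∑-cong∈ : ∀ (xs : List A) {f g : A → M} → (∀ x → x ∈ xs → f x ≡ g x) → ∑ xs f ≡ ∑ xs g
    ∑-cong∈ []       eq = refl
    ∑-cong∈ (x ∷ xs) eq = cong₂ _∙_ (eq x (here refl)) (∑-cong∈ xs (λ y y∈ → eq y (there y∈)))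

    ∑-cong : ∀ (xs : List A) {f g : A → M} → (∀ x → f x ≡ g x) → ∑ xs f ≡ ∑ xs g
    ∑-cong xs eq = ∑-cong∈ xs (λ x _ → eq x)

    ∑-ε : ∀ (xs : List A) → ∑ xs (λ _ → ε) ≡ ε
    ∑-ε []       = refl
    ∑-ε (x ∷ xs) = trans (identityˡ _) (∑-ε xs)

    ∑-zero∈ : ∀ (xs : List A) {f : A → M} → (∀ x → x ∈ xs → f x ≡ ε) → ∑ xs f ≡ ε
    ∑-zero∈ xs eq = trans (∑-cong∈ xs eq) (∑-ε xs)

    interchange : ∀ a b c d → (a ∙ b) ∙ (c ∙ d) ≡ (a ∙ c) ∙ (b ∙ d)
    interchange a b c d = begin
      (a ∙ b) ∙ (c ∙ d) ≡⟨ assoc a b _ ⟩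
      a ∙ (b ∙ (c ∙ d)) ≡⟨ cong (a ∙_) (trans (sym (assoc b c d)) (trans (cong (_∙ d) (comm b c)) (assoc c b d))) ⟩
      a ∙ (c ∙ (b ∙ d)) ≡⟨ sym (assoc a c _) ⟩
      (a ∙ c) ∙ (b ∙ d) ∎

    ∑-∙ : ∀ (xs : List A) (f g : A → M) → ∑ xs (λ x → f x ∙ g x) ≡ ∑ xs f ∙ ∑ xs g
    ∑-∙ []       f g = sym (identityˡ ε)
    ∑-∙ (x ∷ xs) f g = trans (cong ((f x ∙ g x) ∙_) (∑-∙ xs f g)) (interchange _ _ _ _)

    ∑-swap : ∀ (xs : List A) (ys : List B) (f : A → B → M) →
             ∑ xs (λ x → ∑ ys (f x)) ≡ ∑ ys (λ y → ∑ xs (λ x → f x y))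
    ∑-swap []       ys f = sym (∑-ε ys)
    ∑-swap (x ∷ xs) ys f = trans (cong (∑ ys (f x) ∙_) (∑-swap xs ys f)) (sym (∑-∙ ys _ _))

    ∑-++ : ∀ (xs ys : List A) (f : A → M) → ∑ (xs ++ ys) f ≡ ∑ xs f ∙ ∑ ys f
    ∑-++ []       ys f = sym (identityˡ _)
    ∑-++ (x ∷ xs) ys f = trans (cong (f x ∙_) (∑-++ xs ys f)) (sym (assoc _ _ _))

    ∑-map : ∀ (h : A → B) (xs : List A) (f : B → M) → ∑ (map h xs) f ≡ ∑ xs (f ∘ h)
    ∑-map h []       f = refl
    ∑-map h (x ∷ xs) f = cong (f (h x) ∙_) (∑-map h xs f)

    ∑-× : ∀ (xs : List A) (ys : List B) (f : A × B → M) →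
          ∑ (cartesianProduct xs ys) f ≡ ∑ xs (λ x → ∑ ys (λ y → f (x , y)))
    ∑-× []       ys f = refl
    ∑-× (x ∷ xs) ys f = trans (∑-++ (map (x ,_) ys) _ f) (cong₂ _∙_ (∑-map (x ,_) ys f) (∑-× xs ys f))

    ∑-↭ : ∀ {xs ys : List A} (f : A → M) → xs ↭ ys → ∑ xs f ≡ ∑ ys f
    ∑-↭ f Perm.refl          = refl
    ∑-↭ f (Perm.prep x p)    = cong (f x ∙_) (∑-↭ f p)
    ∑-↭ f (Perm.swap x y p)  = trans (sym (assoc _ _ _)) (trans (cong₂ _∙_ (comm _ _) (∑-↭ f p)) (assoc _ _ _))
    ∑-↭ f (Perm.trans p p′)  = trans (∑-↭ f p) (∑-↭ f p′)

    ∑-reindex : (FA : Finite A) (FB : Finite B) (σ : A → B) (τ : B → A) →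
                (∀ y → σ (τ y) ≡ y) → (∀ x → τ (σ x) ≡ x) → (f : B → M) →
                ∑ (elems FA) (f ∘ σ) ≡ ∑ (elems FB) f
    ∑-reindex FA FB σ τ στ τσ f =
      trans (sym (∑-map σ (elems FA) f)) (∑-↭ f (map-elems-↭ FA FB σ τ στ τσ))

    ∑-δ∈ : ∀ (xs : List A) → Unique xs → ∀ a → a ∈ xs → (f : A → M) →
           (∀ x → x ∈ xs → x ≢ a → f x ≡ ε) → ∑ xs f ≡ f a
    ∑-δ∈ (x ∷ xs) (x∉ ∷ u) a (here refl) f z =
      trans (cong (f x ∙_) (∑-zero∈ xs (λ y y∈ → z y (there y∈) (λ y≡x → All.lookup x∉ y∈ (sym y≡x))))) (identityʳ _)
    ∑-δ∈ (x ∷ xs) (x∉ ∷ u) a (there a∈) f z =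
      trans (cong (_∙ ∑ xs f) (z x (here refl) (All.lookup x∉ a∈)))
            (trans (identityˡ _) (∑-δ∈ xs u a a∈ f (λ y y∈ → z y (there y∈))))

    ∑-δ : (FA : Finite A) (a : A) (f : A → M) → (∀ x → x ≢ a → f x ≡ ε) → ∑ (elems FA) f ≡ f a
    ∑-δ FA a f z = ∑-δ∈ (elems FA) (Finite.distinct FA) a (Finite.complete FA a) f (λ x _ → z x)

module IntSum where

  open SumLib
  open import Data.Integer using (ℤ; +_; -[1+_]; 0ℤ; 1ℤ; _+_; _*_; -_; _-_; _≤_; +≤+)
  import Data.Integer.Properties as ℤₚ
  open import Data.Nat using (z≤n)

  open Sum ℤₚ.+-0-isCommutativeMonoid public

  private variable
    A B : Set

  ind : ∀ {P : Set} → Dec P → ℤ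
  ind (yes _) = 1ℤ
  ind (no _)  = 0ℤ

  ind-yes : ∀ {P : Set} (d : Dec P) → P → ind d ≡ 1ℤ
  ind-yes (yes _) p = refl
  ind-yes (no ¬p) p = contradiction p ¬p

  ind-no : ∀ {P : Set} (d : Dec P) → ¬ P → ind d ≡ 0ℤ
  ind-no (yes p) ¬p = contradiction p ¬p
  ind-no (no _)  ¬p = refl

  ind-⇔ : ∀ {P Q : Set} (d : Dec P) (e : Dec Q) → (P → Q) → (Q → P) → ind d ≡ ind e
  ind-⇔ (yes p) e f g = sym (ind-yes e (f p))
  ind-⇔ (no ¬p) e f g = sym (ind-no e (λ q → ¬p (g q)))

  ind≥0 : ∀ {P : Set} (d : Dec P) → 0ℤ ≤ ind d
  ind≥0 (yes _) = +≤+ z≤n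
  ind≥0 (no _)  = +≤+ z≤n

  ∑-*ˡ : ∀ (xs : List A) c (f : A → ℤ) → ∑ xs (λ x → c * f x) ≡ c * ∑ xs f
  ∑-*ˡ []       c f = sym (ℤₚ.*-zeroʳ c)
  ∑-*ˡ (x ∷ xs) c f = trans (cong (λ z → c * f x + z) (∑-*ˡ xs c f)) (sym (ℤₚ.*-distribˡ-+ c _ _))

  ∑-*ʳ : ∀ (xs : List A) c (f : A → ℤ) → ∑ xs (λ x → f x * c) ≡ ∑ xs f * c
  ∑-*ʳ xs c f = trans (∑-cong xs (λ x → ℤₚ.*-comm (f x) c)) (trans (∑-*ˡ xs c f) (ℤₚ.*-comm c _))

  ∑-neg : ∀ (xs : List A) (f : A → ℤ) → ∑ xs (λ x → - f x) ≡ - ∑ xs f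
  ∑-neg []       f = refl
  ∑-neg (x ∷ xs) f = trans (cong (λ z → - f x + z) (∑-neg xs f)) (sym (ℤₚ.neg-distrib-+ (f x) _))

  ∑-minus : ∀ (xs : List A) (f g : A → ℤ) → ∑ xs (λ x → f x - g x) ≡ ∑ xs f - ∑ xs g
  ∑-minus xs f g = trans (∑-∙ xs f (λ x → - g x)) (cong (λ z → ∑ xs f + z) (∑-neg xs g))

  ∑-const : ∀ (xs : List A) c → ∑ xs (λ _ → c) ≡ + length xs * c
  ∑-const []       c = refl
  ∑-const (x ∷ xs) c = trans (cong (λ z → c + z) (∑-const xs c)) (sym (ℤₚ.suc-* (+ length xs) c))

  ∑-mono : ∀ (xs : List A) {f g : A → ℤ} → (∀ x → f x ≤ g x) → ∑ xs f ≤ ∑ xs g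
  ∑-mono []       le = ℤₚ.≤-refl
  ∑-mono (x ∷ xs) le = ℤₚ.+-mono-≤ (le x) (∑-mono xs le)

  ∑≥0 : ∀ (xs : List A) {f : A → ℤ} → (∀ x → 0ℤ ≤ f x) → 0ℤ ≤ ∑ xs f
  ∑≥0 xs {f} le = subst (_≤ ∑ xs f) (∑-ε xs) (∑-mono xs le)

  ∑≥0-tight : ∀ (xs : List A) {f : A → ℤ} → (∀ x → 0ℤ ≤ f x) → ∑ xs f ≡ 0ℤ → ∀ {x} → x ∈ xs → f x ≡ 0ℤ
  ∑≥0-tight (y ∷ ys) {f} le eq (here refl) = ℤₚ.≤-antisym
    (ℤₚ.≤-trans (subst (_≤ f y + ∑ ys f) (ℤₚ.+-identityʳ _) (ℤₚ.+-monoʳ-≤ (f y) (∑≥0 ys le))) (ℤₚ.≤-reflexive eq)) (le y)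
  ∑≥0-tight (y ∷ ys) {f} le eq (there x∈) = ∑≥0-tight ys le (ℤₚ.≤-antisym
    (ℤₚ.≤-trans (subst (_≤ f y + ∑ ys f) (ℤₚ.+-identityˡ _) (ℤₚ.+-monoˡ-≤ (∑ ys f) (le y))) (ℤₚ.≤-reflexive eq)) (∑≥0 ys le)) x∈

  ∑-∑* : ∀ (xs : List A) (ys : List B) (f : A → ℤ) (g : B → ℤ) →
         ∑ xs (λ x → ∑ ys (λ y → f x * g y)) ≡ ∑ xs f * ∑ ys g
  ∑-∑* xs ys f g = trans (∑-cong xs (λ x → ∑-*ˡ ys (f x) g)) (∑-*ʳ xs (∑ ys g) f)

  module _ (FA : Finite A) where
    open Finite FA using (_≟_)

    ∑-ind : ∀ a (g : A → ℤ) → ∑ (elems FA) (λ x → ind (x ≟ a) * g x) ≡ g a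
    ∑-ind a g = trans (∑-δ FA a _ (λ x x≢a → cong (_* g x) (ind-no (x ≟ a) x≢a)))
      (trans (cong (_* g a) (ind-yes (a ≟ a) refl)) (ℤₚ.*-identityˡ (g a)))

    ∑-ind₁ : ∀ a → ∑ (elems FA) (λ x → ind (x ≟ a)) ≡ 1ℤ
    ∑-ind₁ a = trans (∑-cong (elems FA) (λ x → sym (ℤₚ.*-identityʳ _))) (∑-ind a (λ _ → 1ℤ))

  0≤i*i : ∀ i → 0ℤ ≤ i * i
  0≤i*i (+ n)          = subst (0ℤ ≤_) (ℤₚ.pos-* n n) (+≤+ z≤n)
  0≤i*i (-[1+ n ])  = +≤+ z≤n

module FieldLib where

  open import Defs
  open SumLib
  open import Algebra.Bundles using (CommutativeRing)
  open import Algebra.Solver.Ring.AlmostCommutativeRing using (fromCommutativeRing; _-Raw-AlmostCommutative⟶_)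
  open import Data.Fin as Fin using (fromℕ; inject₁)
  open import Data.Fin.Properties using (toℕ-inject₁; toℕ-fromℕ; toℕ<n)
  open import Data.Integer as ℤ using (ℤ; +_; -[1+_]; _⊖_)
  import Data.Integer.Properties as ℤₚ
  open import Data.List.Relation.Unary.All using ([]; _∷_)
  open import Data.List.Relation.Unary.AllPairs using ([]; _∷_)
  open import Data.Nat as ℕ using (ℕ; zero; suc)
  open import Data.Nat.Combinatorics using (_C_; nCn≡1; nC1≡n; nCk+nC[k+1]≡[n+1]C[k+1]; k>n⇒nCk≡0)
  open import Data.Nat.Divisibility using (_∣_; divides; ∣⇒≤; m∣m*n)
  open import Data.Nat.Primality using (Prime; euclidsLemma; prime⇒nonZero)
  import Data.Nat.Properties as ℕₚ

  nCk-absorb : ∀ n k → suc k ℕ.* (suc n C suc k) ≡ suc n ℕ.* (n C k)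
  nCk-absorb n zero = trans (ℕₚ.*-identityˡ _) (trans (nC1≡n (suc n)) (sym (ℕₚ.*-identityʳ _)))
  nCk-absorb zero (suc k) = trans (cong (suc (suc k) ℕ.*_) (k>n⇒nCk≡0 {1} {suc (suc k)} (ℕ.s≤s (ℕ.s≤s (ℕ.z≤n {k})))))
    (trans (ℕₚ.*-zeroʳ (suc (suc k))) (cong (1 ℕ.*_) (sym (k>n⇒nCk≡0 {0} {suc k} (ℕ.s≤s (ℕ.z≤n {k}))))))
  nCk-absorb (suc n) (suc k) = begin
    suc (suc k) ℕ.* (suc (suc n) C suc (suc k))
      ≡⟨ cong (suc (suc k) ℕ.*_) (sym (nCk+nC[k+1]≡[n+1]C[k+1] (suc n) (suc k))) ⟩
    suc (suc k) ℕ.* (a ℕ.+ (suc n C suc (suc k)))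
      ≡⟨ ℕₚ.*-distribˡ-+ (suc (suc k)) a _ ⟩
    suc (suc k) ℕ.* a ℕ.+ suc (suc k) ℕ.* (suc n C suc (suc k))
      ≡⟨ cong₂ ℕ._+_ (cong (a ℕ.+_) (nCk-absorb n k)) (nCk-absorb n (suc k)) ⟩
    a ℕ.+ suc n ℕ.* (n C k) ℕ.+ suc n ℕ.* (n C suc k)
      ≡⟨ ℕₚ.+-assoc a _ _ ⟩
    a ℕ.+ (suc n ℕ.* (n C k) ℕ.+ suc n ℕ.* (n C suc k))
      ≡⟨ cong (a ℕ.+_) (trans (sym (ℕₚ.*-distribˡ-+ (suc n) (n C k) _)) (cong (suc n ℕ.*_) (nCk+nC[k+1]≡[n+1]C[k+1] n k))) ⟩
    suc (suc n) ℕ.* a ∎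
    where open ≡-Reasoning
          a = suc n C suc k

  prime∣pCk : ∀ p → Prime p → ∀ k → 0 ℕ.< k → k ℕ.< p → p ∣ p C k
  prime∣pCk (suc p) pr (suc k) _ k<p with euclidsLemma (suc k) (suc p C suc k) pr
      (subst (suc p ∣_) (sym (nCk-absorb p k)) (m∣m*n (p C k)))
  ... | inj₂ d = d
  ... | inj₁ d = contradiction (∣⇒≤ d) (ℕₚ.<⇒≱ k<p)

  module Field (𝔽 : FiniteField) where
    open FiniteField 𝔽 public renaming (_+_ to infixl 6 _⊕_; _*_ to infixl 7 _⊗_; -_ to infix 8 ⊖_; 0# to 0F; 1# to 1F; _≟_ to infix 4 _≟F_; order to q)

    commutativeRing : CommutativeRing _ _
    commutativeRing = record { isCommutativeRing = isCommRing }

    open CommutativeRing commutativeRing public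
      using (semiring; commutativeSemiring; +-monoid; +-group; ring; *-isCommutativeMonoid; +-isCommutativeMonoid)
      renaming ( +-assoc to ⊕-assoc; +-comm to ⊕-comm; +-identityˡ to ⊕-identityˡ; +-identityʳ to ⊕-identityʳ
               ; -‿inverseˡ to ⊖-inverseˡ; -‿inverseʳ to ⊖-inverseʳ; *-assoc to ⊗-assoc; *-comm to ⊗-comm
               ; *-identityˡ to ⊗-identityˡ; *-identityʳ to ⊗-identityʳ; zeroˡ to ⊗-zeroˡ; zeroʳ to ⊗-zeroʳ
               ; distribˡ to ⊗-distribˡ; distribʳ to ⊗-distribʳ)
    open import Algebra.Properties.Semiring.Mult semiring public using (×-homo-+; ×1-homo-*; ×-assoc-*; ×-assocˡ) renaming (_×_ to _·_)
    open import Algebra.Properties.Semiring.Exp semiring public using (_^_; ^-homo-*; ^-assocʳ)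
    open import Algebra.Properties.CommutativeSemiring.Exp commutativeSemiring public using (^-distrib-*)
    open import Algebra.Properties.Ring ring public using (-‿distribˡ-*; -‿distribʳ-*; -‿involutive; -0#≈0#)
    import Algebra.Properties.CommutativeSemiring.Binomial commutativeSemiring as Binomial
    open import Algebra.Properties.Monoid.Sum +-monoid using (sum; sum-init-last; sum-cong-≗; sum-replicate-zero)

    private
      fromℤ : ℤ → F
      fromℤ (+ n)    = n · 1F
      fromℤ -[1+ n ] = ⊖ (suc n · 1F)

      ⊖-cancel : ∀ a b → (1F ⊕ a) ⊕ ⊖ (1F ⊕ b) ≡ a ⊕ ⊖ b
      ⊖-cancel a b = begin
        (1F ⊕ a) ⊕ ⊖ (1F ⊕ b)      ≡⟨ cong₂ _⊕_ (⊕-comm 1F a) (sym (⁻¹-∙-comm 1F b)) ⟩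
        (a ⊕ 1F) ⊕ (⊖ 1F ⊕ ⊖ b)    ≡⟨ ⊕-assoc a 1F _ ⟩
        a ⊕ (1F ⊕ (⊖ 1F ⊕ ⊖ b))    ≡⟨ cong (a ⊕_) (trans (sym (⊕-assoc 1F _ _)) (trans (cong (_⊕ ⊖ b) (⊖-inverseʳ 1F)) (⊕-identityˡ _))) ⟩
        a ⊕ ⊖ b ∎
        where open ≡-Reasoning
              open import Algebra.Properties.AbelianGroup (CommutativeRing.+-abelianGroup commutativeRing) using (⁻¹-∙-comm)

      ⊖-homo : ∀ m n → fromℤ (m ⊖ n) ≡ (m · 1F) ⊕ ⊖ (n · 1F)
      ⊖-homo zero    zero    = sym (trans (⊕-identityˡ _) -0#≈0#)
      ⊖-homo zero    (suc n) = sym (⊕-identityˡ _)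
      ⊖-homo (suc m) zero    = sym (trans (cong ((suc m · 1F) ⊕_) -0#≈0#) (⊕-identityʳ _))
      ⊖-homo (suc m) (suc n) = trans (cong fromℤ (ℤₚ.[1+m]⊖[1+n]≡m⊖n m n))
        (trans (⊖-homo m n) (sym (⊖-cancel (m · 1F) (n · 1F))))

      fromℤ-+ : ∀ i j → fromℤ (i ℤ.+ j) ≡ fromℤ i ⊕ fromℤ j
      fromℤ-+ (+ m)    (+ n)    = ×-homo-+ 1F m n
      fromℤ-+ (+ m)    -[1+ n ] = ⊖-homo m (suc n)
      fromℤ-+ -[1+ m ] (+ n)    = trans (⊖-homo n (suc m)) (⊕-comm _ _)
      fromℤ-+ -[1+ m ] -[1+ n ] = trans (cong ⊖_ (trans (cong (λ x → suc x · 1F) (sym (ℕₚ.+-suc m n))) (×-homo-+ 1F (suc m) (suc n)))) (sym (⁻¹-∙-comm _ _))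
        where open import Algebra.Properties.AbelianGroup (CommutativeRing.+-abelianGroup commutativeRing) using (⁻¹-∙-comm)

      fromℤ-neg : ∀ i → fromℤ (ℤ.- i) ≡ ⊖ fromℤ i
      fromℤ-neg (+ zero)  = sym -0#≈0#
      fromℤ-neg (+ suc n) = refl
      fromℤ-neg -[1+ n ]  = sym (-‿involutive _)

      fromℤ-*⁺ : ∀ m j → fromℤ (+ m ℤ.* j) ≡ fromℤ (+ m) ⊗ fromℤ j
      fromℤ-*⁺ m (+ n) = trans (cong fromℤ (sym (ℤₚ.pos-* m n))) (×1-homo-* m n)
      fromℤ-*⁺ m -[1+ n ] = trans (cong fromℤ (sym (ℤₚ.neg-distribʳ-* (+ m) (+ suc n))))
        (trans (fromℤ-neg (+ m ℤ.* + suc n)) (trans (cong ⊖_ (fromℤ-*⁺ m (+ suc n))) (-‿distribʳ-* _ _)))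

      fromℤ-* : ∀ i j → fromℤ (i ℤ.* j) ≡ fromℤ i ⊗ fromℤ j
      fromℤ-* (+ m) j = fromℤ-*⁺ m j
      fromℤ-* -[1+ m ] j = trans (cong fromℤ (sym (ℤₚ.neg-distribˡ-* (+ suc m) j)))
        (trans (fromℤ-neg (+ suc m ℤ.* j)) (trans (cong ⊖_ (fromℤ-*⁺ (suc m) j)) (-‿distribˡ-* _ _)))

      -- The ring solver needs the constant 1 to evaluate to 1F on the nose, while 1 · 1F is 1F ⊕ 0F.
      fromℕ′ : ℕ → F
      fromℕ′ zero          = 0F
      fromℕ′ (suc zero)    = 1F
      fromℕ′ (suc (suc n)) = 1F ⊕ fromℕ′ (suc n)

      fromℤ′ : ℤ → F
      fromℤ′ (+ n)    = fromℕ′ n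
      fromℤ′ -[1+ n ] = ⊖ fromℕ′ (suc n)

      fromℕ′≡ : ∀ n → fromℕ′ n ≡ n · 1F
      fromℕ′≡ zero          = refl
      fromℕ′≡ (suc zero)    = sym (⊕-identityʳ 1F)
      fromℕ′≡ (suc (suc n)) = cong (1F ⊕_) (fromℕ′≡ (suc n))

      fromℤ′≡ : ∀ i → fromℤ′ i ≡ fromℤ i
      fromℤ′≡ (+ n)    = fromℕ′≡ n
      fromℤ′≡ -[1+ n ] = cong ⊖_ (fromℕ′≡ (suc n))

      morphism : CommutativeRing.rawRing ℤₚ.+-*-commutativeRing -Raw-AlmostCommutative⟶ fromCommutativeRing commutativeRing
      morphism = record
        { ⟦_⟧ = fromℤ′
        ; +-homo = λ i j → trans (fromℤ′≡ (i ℤ.+ j)) (trans (fromℤ-+ i j) (sym (cong₂ _⊕_ (fromℤ′≡ i) (fromℤ′≡ j))))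
        ; *-homo = λ i j → trans (fromℤ′≡ (i ℤ.* j)) (trans (fromℤ-* i j) (sym (cong₂ _⊗_ (fromℤ′≡ i) (fromℤ′≡ j))))
        ; -‿homo = λ i → trans (fromℤ′≡ (ℤ.- i)) (trans (fromℤ-neg i) (sym (cong ⊖_ (fromℤ′≡ i))))
        ; 0-homo = refl ; 1-homo = refl }

      coeff≟ : ∀ i j → Maybe (fromℤ′ i ≡ fromℤ′ j)
      coeff≟ i j with i ℤ.≟ j
      ... | yes eq = just (cong fromℤ′ eq)
      ... | no _   = nothing

    open import Algebra.Solver.Ring (CommutativeRing.rawRing ℤₚ.+-*-commutativeRing) (fromCommutativeRing commutativeRing) morphism coeff≟ public
      using (solve; _:=_; _:+_; _:*_; _:-_; :-_; con)

    finite : Finite F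
    finite = record { elems = elements ; complete = complete ; distinct = distinct ; _≟_ = _≟F_ }

    Fs : List F
    Fs = elements

    zero? : ∀ x → x ≡ 0F ⊎ x ≢ 0F
    zero? x with x ≟F 0F
    ... | yes x≡0 = inj₁ x≡0
    ... | no x≢0  = inj₂ x≢0

    inv : F → F
    inv x with x ≟F 0F
    ... | yes _  = 0F
    ... | no x≢0 = proj₁ (inverse x x≢0)

    inv-0 : inv 0F ≡ 0F
    inv-0 with 0F ≟F 0F
    ... | yes _ = refl
    ... | no ne = contradiction refl ne

    inv-r : ∀ {x} → x ≢ 0F → x ⊗ inv x ≡ 1F
    inv-r {x} x≢0 with x ≟F 0F
    ... | yes x≡0 = contradiction x≡0 x≢0
    ... | no x≢0′ = proj₂ (inverse x x≢0′)

    inv-l : ∀ {x} → x ≢ 0F → inv x ⊗ x ≡ 1F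
    inv-l {x} x≢0 = trans (⊗-comm _ _) (inv-r x≢0)

    x⊗inv-x⊗y : ∀ {x} y → x ≢ 0F → x ⊗ (inv x ⊗ y) ≡ y
    x⊗inv-x⊗y {x} y x≢0 = trans (sym (⊗-assoc _ _ _)) (trans (cong (_⊗ y) (inv-r x≢0)) (⊗-identityˡ y))

    inv-x⊗x⊗y : ∀ {x} y → x ≢ 0F → inv x ⊗ (x ⊗ y) ≡ y
    inv-x⊗x⊗y {x} y x≢0 = trans (sym (⊗-assoc _ _ _)) (trans (cong (_⊗ y) (inv-l x≢0)) (⊗-identityˡ y))

    ⊗-cancelˡ : ∀ {x y z} → x ≢ 0F → x ⊗ y ≡ x ⊗ z → y ≡ z
    ⊗-cancelˡ {x} {y} {z} x≢0 eq = trans (sym (inv-x⊗x⊗y y x≢0)) (trans (cong (inv x ⊗_) eq) (inv-x⊗x⊗y z x≢0))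

    ⊗-≢0 : ∀ {x y} → x ≢ 0F → y ≢ 0F → x ⊗ y ≢ 0F
    ⊗-≢0 {x} x≢0 y≢0 eq = y≢0 (⊗-cancelˡ x≢0 (trans eq (sym (⊗-zeroʳ x))))

    ⊗≡0 : ∀ x {y} → x ⊗ y ≡ 0F → x ≡ 0F ⊎ y ≡ 0F
    ⊗≡0 x {y} eq with x ≟F 0F
    ... | yes x≡0 = inj₁ x≡0
    ... | no x≢0  = inj₂ (⊗-cancelˡ x≢0 (trans eq (sym (⊗-zeroʳ x))))

    1≢0 : 1F ≢ 0F
    1≢0 = 0≢1 ∘ sym

    inv-≢0 : ∀ {x} → x ≢ 0F → inv x ≢ 0F
    inv-≢0 {x} x≢0 eq = 1≢0 (trans (sym (inv-r x≢0)) (trans (cong (x ⊗_) eq) (⊗-zeroʳ x)))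

    inv-unique : ∀ {x y} → x ⊗ y ≡ 1F → inv x ≡ y
    inv-unique {x} {y} eq = ⊗-cancelˡ x≢0 (trans (inv-r x≢0) (sym eq))
      where x≢0 : x ≢ 0F
            x≢0 refl = 1≢0 (trans (sym eq) (⊗-zeroˡ y))

    inv-inv : ∀ x → inv (inv x) ≡ x
    inv-inv x with zero? x
    ... | inj₁ refl = trans (cong inv inv-0) inv-0
    ... | inj₂ x≢0 = inv-unique (inv-l x≢0)

    inv-⊗ : ∀ x y → inv (x ⊗ y) ≡ inv x ⊗ inv y
    inv-⊗ x y with zero? x | zero? y
    ... | inj₁ refl | _ = trans (cong inv (⊗-zeroˡ y)) (trans inv-0 (sym (trans (cong (_⊗ inv y) inv-0) (⊗-zeroˡ _))))
    ... | inj₂ _ | inj₁ refl = trans (cong inv (⊗-zeroʳ x)) (trans inv-0 (sym (trans (cong (inv x ⊗_) inv-0) (⊗-zeroʳ _))))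
    ... | inj₂ x≢0 | inj₂ y≢0 = inv-unique (trans (solve 4 (λ a b c d → (a :* b) :* (c :* d) := (a :* c) :* (b :* d)) refl x y (inv x) (inv y))
          (trans (cong₂ _⊗_ (inv-r x≢0) (inv-r y≢0)) (⊗-identityˡ 1F)))

    x⊖y≡0 : ∀ {x y} → x ⊕ ⊖ y ≡ 0F → x ≡ y
    x⊖y≡0 {x} {y} eq = trans (solve 2 (λ a b → a := (a :- b) :+ b) refl x y) (trans (cong (_⊕ y) eq) (⊕-identityˡ y))

    ⊖≢0 : ∀ {x} → x ≢ 0F → ⊖ x ≢ 0F
    ⊖≢0 {x} x≢0 eq = x≢0 (trans (sym (-‿involutive x)) (trans (cong ⊖_ eq) -0#≈0#))

    ^-≢0 : ∀ {x} n → x ≢ 0F → x ^ n ≢ 0F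
    ^-≢0 zero    x≢0 = 1≢0
    ^-≢0 (suc n) x≢0 = ⊗-≢0 x≢0 (^-≢0 n x≢0)

    1^ : ∀ n → 1F ^ n ≡ 1F
    1^ zero = refl
    1^ (suc n) = trans (⊗-identityˡ _) (1^ n)

    private
      module ΣF = Sum +-isCommutativeMonoid
      module ΠF = Sum *-isCommutativeMonoid
      ∑-const : ∀ {A : Set} (xs : List A) c → ΣF.∑ xs (λ _ → c) ≡ length xs · c
      ∑-const []       c = refl
      ∑-const (x ∷ xs) c = cong (c ⊕_) (∑-const xs c)
      ∏-const : ∀ {A : Set} (xs : List A) c → ΠF.∑ xs (λ _ → c) ≡ c ^ length xs
      ∏-const []       c = refl
      ∏-const (x ∷ xs) c = cong (c ⊗_) (∏-const xs c)

    q·1≡0 : q · 1F ≡ 0F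
    q·1≡0 = begin
      q · 1F                   ≡⟨ solve 2 (λ a b → a := (b :+ a) :- b) refl _ S ⟩
      (S ⊕ q · 1F) ⊕ ⊖ S       ≡⟨ cong (λ z → (S ⊕ z) ⊕ ⊖ S) (sym (∑-const Fs 1F)) ⟩
      (S ⊕ ΣF.∑ Fs (λ _ → 1F)) ⊕ ⊖ S ≡⟨ cong (_⊕ ⊖ S) (sym (ΣF.∑-∙ Fs (λ x → x) (λ _ → 1F))) ⟩
      ΣF.∑ Fs (λ x → x ⊕ 1F) ⊕ ⊖ S ≡⟨ cong (_⊕ ⊖ S) (ΣF.∑-reindex finite finite (_⊕ 1F) (λ x → x ⊕ ⊖ 1F)
          (λ x → solve 2 (λ a b → (a :- b) :+ b := a) refl x 1F) (λ x → solve 2 (λ a b → (a :+ b) :- b := a) refl x 1F) (λ x → x)) ⟩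
      S ⊕ ⊖ S ≡⟨ ⊖-inverseʳ S ⟩
      0F ∎
      where open ≡-Reasoning
            S = ΣF.∑ Fs (λ x → x)

    fermat : ∀ x → x ^ q ≡ x
    fermat x with x ≟F 0F
    ... | yes refl = 0^ q λ q≡0 → absurd q≡0 (complete 0F)
      where
      open import Data.List.Membership.Propositional using (_∈_)
      absurd : length Fs ≡ 0 → 0F ∈ Fs → _
      absurd eq m with Fs
      absurd () m | _ ∷ _
      absurd eq () | []
      0^ : ∀ n → n ≢ 0 → 0F ^ n ≡ 0F
      0^ zero ne = contradiction refl ne
      0^ (suc n) _ = ⊗-zeroˡ _
    ... | no x≢0 = ⊗-cancelˡ P≢0 (begin
      P ⊗ (x ^ q) ≡⟨ ⊗-comm _ _ ⟩
      (x ^ q) ⊗ P ≡⟨ cong (_⊗ P) (sym (∏-const Fs x)) ⟩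
      ΠF.∑ Fs (λ _ → x) ⊗ P ≡⟨ sym (ΠF.∑-∙ Fs (λ _ → x) g) ⟩
      ΠF.∑ Fs (λ y → x ⊗ g y) ≡⟨ ΠF.∑-cong Fs step ⟩
      ΠF.∑ Fs (λ y → g (x ⊗ y) ⊗ h y) ≡⟨ ΠF.∑-∙ Fs _ h ⟩
      ΠF.∑ Fs (λ y → g (x ⊗ y)) ⊗ ΠF.∑ Fs h ≡⟨ cong₂ _⊗_
         (ΠF.∑-reindex finite finite (x ⊗_) (inv x ⊗_) (λ y → x⊗inv-x⊗y y x≢0) (λ y → inv-x⊗x⊗y y x≢0) g)
         (trans (ΠF.∑-δ finite 0F h h1) h0) ⟩
      P ⊗ x ∎)
      where
      open ≡-Reasoning
      g h : F → F
      g y with y ≟F 0F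
      ... | yes _ = 1F
      ... | no _  = y
      h y with y ≟F 0F
      ... | yes _ = x
      ... | no _  = 1F
      h0 : h 0F ≡ x
      h0 with 0F ≟F 0F
      ... | yes _ = refl
      ... | no ne = contradiction refl ne
      h1 : ∀ y → y ≢ 0F → h y ≡ 1F
      h1 y ne with y ≟F 0F
      ... | yes e = contradiction e ne
      ... | no _  = refl
      step : ∀ y → x ⊗ g y ≡ g (x ⊗ y) ⊗ h y
      step y with y ≟F 0F | (x ⊗ y) ≟F 0F
      ... | yes _ | yes _ = ⊗-comm _ _
      ... | yes refl | no ne = contradiction (⊗-zeroʳ x) ne
      ... | no ne | yes e = contradiction e (⊗-≢0 x≢0 ne)
      ... | no _ | no _ = sym (⊗-identityʳ _)
      g≢0 : ∀ y → g y ≢ 0F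
      g≢0 y with y ≟F 0F
      ... | yes _ = 1≢0
      ... | no ne = ne
      ∏≢0 : ∀ (xs : List F) → ΠF.∑ xs g ≢ 0F
      ∏≢0 [] = 1≢0
      ∏≢0 (y ∷ ys) = ⊗-≢0 (g≢0 y) (∏≢0 ys)
      P = ΠF.∑ Fs g
      P≢0 = ∏≢0 Fs

    module PrimePower (p k : ℕ) (pr : Prime p) (q≡p^k : q ≡ p ℕ.^ k) where

      p·1≡0 : p · 1F ≡ 0F
      p·1≡0 = go k (trans (cong (_· 1F) (sym q≡p^k)) q·1≡0)
        where
        go : ∀ j → (p ℕ.^ j) · 1F ≡ 0F → p · 1F ≡ 0F
        go zero eq = contradiction (trans (sym (⊕-identityʳ 1F)) eq) 1≢0
        go (suc j) eq with ⊗≡0 (p · 1F) (trans (sym (×1-homo-* p (p ℕ.^ j))) eq)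
        ... | inj₁ e = e
        ... | inj₂ e = go j e

      p∣⇒·≡0 : ∀ {n} → p ∣ n → ∀ x → n · x ≡ 0F
      p∣⇒·≡0 {n} (divides c refl) x = begin
        (c ℕ.* p) · x           ≡⟨ cong ((c ℕ.* p) ·_) (sym (⊗-identityˡ x)) ⟩
        (c ℕ.* p) · (1F ⊗ x)    ≡⟨ sym (×-assoc-* (c ℕ.* p) 1F x) ⟩
        ((c ℕ.* p) · 1F) ⊗ x    ≡⟨ cong (_⊗ x) (trans (×1-homo-* c p) (trans (cong ((c · 1F) ⊗_) p·1≡0) (⊗-zeroʳ _))) ⟩
        0F ⊗ x                  ≡⟨ ⊗-zeroˡ x ⟩
        0F ∎
        where open ≡-Reasoning

      frobenius : ∀ x y → (x ⊕ y) ^ p ≡ x ^ p ⊕ y ^ p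
      frobenius x y = go p refl
        where
        go : ∀ n → n ≡ p → (x ⊕ y) ^ n ≡ x ^ n ⊕ y ^ n
        go zero refl = contradiction p·1≡0 (λ _ → ℕ.NonZero.nonZero (prime⇒nonZero pr))
        go (suc n) refl = begin
          (x ⊕ y) ^ suc n ≡⟨ Binomial.theorem (suc n) x y ⟩
          t Fin.zero ⊕ sum (t ∘ Fin.suc) ≡⟨ cong₂ _⊕_ bottom (trans (sum-init-last (t ∘ Fin.suc)) (cong₂ _⊕_ mid top)) ⟩
          y ^ suc n ⊕ (0F ⊕ x ^ suc n) ≡⟨ cong (y ^ suc n ⊕_) (⊕-identityˡ _) ⟩
          y ^ suc n ⊕ x ^ suc n ≡⟨ ⊕-comm _ _ ⟩
          x ^ suc n ⊕ y ^ suc n ∎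
          where
          open ≡-Reasoning
          open import Algebra.Properties.Semiring.Binomial semiring x y using (binomialTerm)
          t = binomialTerm (suc n)
          bottom : t Fin.zero ≡ y ^ suc n
          bottom = trans (⊕-identityʳ _) (⊗-identityˡ _)
          top : t (Fin.suc (fromℕ n)) ≡ x ^ suc n
          top rewrite toℕ-fromℕ n | nCn≡1 (suc n) | ℕₚ.n∸n≡0 n = trans (⊕-identityʳ _) (⊗-identityʳ _)
          mid : sum (λ i → t (Fin.suc (inject₁ i))) ≡ 0F
          mid = trans (sum-cong-≗ λ i → p∣⇒·≡0 (prime∣pCk (suc n) pr _ (ℕ.s≤s ℕ.z≤n)
                 (ℕ.s≤s (subst (ℕ._< n) (sym (toℕ-inject₁ i)) (toℕ<n i)))) _)
                (sum-replicate-zero n)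

      frobenius^ : ∀ j x y → (x ⊕ y) ^ (p ℕ.^ j) ≡ x ^ (p ℕ.^ j) ⊕ y ^ (p ℕ.^ j)
      frobenius^ zero x y = trans (⊗-identityʳ _) (sym (cong₂ _⊕_ (⊗-identityʳ _) (⊗-identityʳ _)))
      frobenius^ (suc j) x y = begin
        (x ⊕ y) ^ (p ℕ.* p ℕ.^ j)              ≡⟨ sym (^-assocʳ (x ⊕ y) p (p ℕ.^ j)) ⟩
        ((x ⊕ y) ^ p) ^ (p ℕ.^ j)              ≡⟨ cong (_^ (p ℕ.^ j)) (frobenius x y) ⟩
        (x ^ p ⊕ y ^ p) ^ (p ℕ.^ j)            ≡⟨ frobenius^ j _ _ ⟩
        (x ^ p) ^ (p ℕ.^ j) ⊕ (y ^ p) ^ (p ℕ.^ j) ≡⟨ cong₂ _⊕_ (^-assocʳ x p _) (^-assocʳ y p _) ⟩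
        x ^ (p ℕ.* p ℕ.^ j) ⊕ y ^ (p ℕ.* p ℕ.^ j) ∎
        where open ≡-Reasoning

      1⊕1≢0 : p ≢ 2 → 1F ⊕ 1F ≢ 0F
      1⊕1≢0 p≢2 2≡0 = go p refl
        where
        pair : ∀ n → suc (suc n) · 1F ≡ n · 1F
        pair n = trans (sym (⊕-assoc _ _ _)) (trans (cong (_⊕ (n · 1F)) 2≡0) (⊕-identityˡ _))
        odd⊎even : ∀ n → (n · 1F ≡ 0F × 2 ∣ n) ⊎ (n · 1F ≡ 1F)
        odd⊎even zero = inj₁ (refl , divides 0 refl)
        odd⊎even (suc zero) = inj₂ (⊕-identityʳ _)
        odd⊎even (suc (suc n)) with odd⊎even n
        ... | inj₁ (e , divides c eq) = inj₁ (trans (pair n) e , divides (suc c) (cong (suc ∘ suc) eq))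
        ... | inj₂ e = inj₂ (trans (pair n) e)
        go : ∀ n → n ≡ p → _
        go n refl with odd⊎even p
        ... | inj₂ e = contradiction (trans (sym e) p·1≡0) 1≢0
        ... | inj₁ (_ , 2∣p) with Data.Nat.Primality.prime⇒irreducible pr 2∣p
        ... | inj₁ ()
        ... | inj₂ 2≡p = p≢2 (sym 2≡p)

module Squares where

  open import Defs
  open SumLib
  open IntSum
  open FieldLib
  open import Data.Integer using (ℤ; +_; 0ℤ; 1ℤ; _+_; _*_; -_; _-_; _≤_; +≤+; +<+)
  import Data.Integer.Properties as ℤₚ
  open import Data.Integer.Tactic.RingSolver using (solve-∀)
  import Data.List.Relation.Unary.All as All
  import Data.List.Relation.Unary.Any as Any
  open import Data.Nat using (z≤n)
  import Data.List.Membership.Propositional as M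
  import Data.Nat as ℕ
  import Data.Nat.Properties as ℕₚ
  open import Relation.Nullary using (¬?)

  module NullSum (𝔽 : FiniteField) where
    open Field 𝔽

    Null : (F → ℤ) → Set
    Null λ′ = ∑ Fs λ′ ≡ 0ℤ

    ∑-shift : ∀ b (f : F → ℤ) → ∑ Fs (λ s → f (s ⊕ b)) ≡ ∑ Fs f
    ∑-shift b f = ∑-reindex finite finite (_⊕ b) (λ x → x ⊕ ⊖ b)
      (λ x → solve 2 (λ x b → (x :- b) :+ b := x) refl x b) (λ x → solve 2 (λ x b → (x :+ b) :- b := x) refl x b) f

    ∑-scale : ∀ {c} → c ≢ 0F → (f : F → ℤ) → ∑ Fs (λ s → f (c ⊗ s)) ≡ ∑ Fs f
    ∑-scale {c} c≢0 f = ∑-reindex finite finite (c ⊗_) (inv c ⊗_) (λ x → x⊗inv-x⊗y x c≢0) (λ x → inv-x⊗x⊗y x c≢0) f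

    ∑-⊖ : ∀ (f : F → ℤ) → ∑ Fs (f ∘ ⊖_) ≡ ∑ Fs f
    ∑-⊖ f = ∑-reindex finite finite ⊖_ ⊖_ -‿involutive -‿involutive f

    null-affine : ∀ {f} → Null f → ∀ {c} → c ≢ 0F → ∀ b → ∑ Fs (λ s → f (c ⊗ s ⊕ b)) ≡ 0ℤ
    null-affine {f} nf c≢0 b = trans (∑-scale c≢0 (λ s → f (s ⊕ b))) (trans (∑-shift b f) nf)

    orthogonality : ∀ {f} → Null f → ∀ c b → ∑ Fs (λ s → f (c ⊗ s ⊕ b)) ≡ ind (c ≟F 0F) * (+ q * f b)
    orthogonality {f} nf c b with c ≟F 0F
    ... | no c≢0   = null-affine nf c≢0 b
    ... | yes refl = trans (∑-cong Fs (λ s → cong f (trans (cong (_⊕ b) (⊗-zeroˡ s)) (⊕-identityˡ b))))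
                       (trans (∑-const Fs (f b)) (sym (ℤₚ.*-identityˡ _)))

    nz : F → ℤ
    nz x with x ≟F 0F
    ... | yes _ = 0ℤ
    ... | no _  = 1ℤ

    nz-0 : nz 0F ≡ 0ℤ
    nz-0 with 0F ≟F 0F
    ... | yes _ = refl
    ... | no ne = contradiction refl ne

    nz-≢0 : ∀ {x} → x ≢ 0F → nz x ≡ 1ℤ
    nz-≢0 {x} x≢0 with x ≟F 0F
    ... | yes x≡0 = contradiction x≡0 x≢0
    ... | no _    = refl

    nz-cong : ∀ x {f g : ℤ} → (x ≢ 0F → f ≡ g) → nz x * f ≡ nz x * g
    nz-cong x h with x ≟F 0F
    ... | yes _   = refl
    ... | no x≢0  = cong (1ℤ *_) (h x≢0)

    nz-⊗ : ∀ x y → nz x * nz y ≡ nz (x ⊗ y)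
    nz-⊗ x y with zero? x | zero? y
    ... | inj₁ refl | _ = trans (cong (_* nz y) nz-0) (sym (trans (cong nz (⊗-zeroˡ y)) nz-0))
    ... | inj₂ _ | inj₁ refl = trans (cong (nz x *_) nz-0) (trans (ℤₚ.*-zeroʳ (nz x)) (sym (trans (cong nz (⊗-zeroʳ x)) nz-0)))
    ... | inj₂ x≢0 | inj₂ y≢0 = trans (cong₂ _*_ (nz-≢0 x≢0) (nz-≢0 y≢0)) (sym (nz-≢0 (⊗-≢0 x≢0 y≢0)))

    nz-⇔ : ∀ {x y} → (x ≡ 0F → y ≡ 0F) → (y ≡ 0F → x ≡ 0F) → nz x ≡ nz y
    nz-⇔ {x} {y} f g with zero? x
    ... | inj₁ refl = trans nz-0 (sym (trans (cong nz (f refl)) nz-0))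
    ... | inj₂ x≢0  = trans (nz-≢0 x≢0) (sym (nz-≢0 (x≢0 ∘ g)))

    nz-as-ind : ∀ x → nz x ≡ 1ℤ - ind (x ≟F 0F)
    nz-as-ind x with x ≟F 0F
    ... | yes _ = refl
    ... | no _  = refl

    ∑-nz : ∀ (f : F → ℤ) → ∑ Fs (λ s → nz s * f s) ≡ ∑ Fs f - f 0F
    ∑-nz f = trans (∑-cong Fs (λ s → trans (cong (_* f s) (nz-as-ind s)) (expand (ind (s ≟F 0F)) (f s))))
      (trans (∑-minus Fs f _) (cong (λ z → ∑ Fs f - z) (∑-ind finite 0F f)))
      where
      expand : ∀ i x → (1ℤ - i) * x ≡ x - i * x
      expand = solve-∀

    ∑-nz-orthogonality : ∀ {f} → Null f → ∀ c b →
      ∑ Fs (λ s → nz s * f (c ⊗ s ⊕ b)) ≡ (+ q * ind (c ≟F 0F) - 1ℤ) * f b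
    ∑-nz-orthogonality {f} nf c b = trans (∑-nz _)
      (trans (cong₂ _-_ (orthogonality nf c b) (cong f (trans (cong (_⊕ b) (⊗-zeroʳ c)) (⊕-identityˡ b))))
       (rearrange (ind (c ≟F 0F)) (+ q) (f b)))
      where
      rearrange : ∀ i n x → i * (n * x) - x ≡ (n * i - 1ℤ) * x
      rearrange = solve-∀

  module OddField (𝔽 : FiniteField) (2≢0 : ¬ (FiniteField._+_ 𝔽 (FiniteField.1# 𝔽) (FiniteField.1# 𝔽) ≡ FiniteField.0# 𝔽)) where
    open Field 𝔽
    open NullSum 𝔽 public

    Nonsquare : F → Set
    Nonsquare δ = ∀ x → x ⊗ x ≢ δ

    ½ : F
    ½ = inv (1F ⊕ 1F)

    dbl≡ : ∀ x → (1F ⊕ 1F) ⊗ x ≡ x ⊕ x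
    dbl≡ x = solve 1 (λ x → (con 1ℤ :+ con 1ℤ) :* x := x :+ x) refl x

    ½⊕½ : ∀ x → ½ ⊗ x ⊕ ½ ⊗ x ≡ x
    ½⊕½ x = trans (sym (dbl≡ (½ ⊗ x))) (x⊗inv-x⊗y x 2≢0)

    ½-dbl : ∀ x → ½ ⊗ (x ⊕ x) ≡ x
    ½-dbl x = trans (cong (½ ⊗_) (sym (dbl≡ x))) (inv-x⊗x⊗y x 2≢0)

    1≢⊖1 : 1F ≢ ⊖ 1F
    1≢⊖1 eq = 2≢0 (trans (cong (1F ⊕_) eq) (⊖-inverseʳ 1F))

    square-roots : ∀ {x y} → x ⊗ x ≡ y ⊗ y → x ≡ y ⊎ x ≡ ⊖ y
    square-roots {x} {y} eq with ⊗≡0 (x ⊕ ⊖ y) {x ⊕ y}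
        (trans (solve 2 (λ x y → (x :- y) :* (x :+ y) := x :* x :- y :* y) refl x y) (trans (cong (_⊕ ⊖ (y ⊗ y)) eq) (⊖-inverseʳ _)))
    ... | inj₁ e = inj₁ (x⊖y≡0 e)
    ... | inj₂ e = inj₂ (x⊖y≡0 (trans (cong (x ⊕_) (-‿involutive y)) e))

    ∑-sum-difference : ∀ (f : F → F → ℤ) → ∑ Fs (λ x → ∑ Fs (f x)) ≡ ∑ Fs (λ t → ∑ Fs (λ w → f (t ⊕ w) (t ⊕ ⊖ w)))
    ∑-sum-difference f = trans (sym (∑-× Fs Fs _)) (trans (sym (∑-reindex F² F² σ τ στ τσ (λ (x , y) → f x y))) (∑-× Fs Fs _))
      where
      F² = ×-finite finite finite
      σ τ : F × F → F × F
      σ (t , w) = t ⊕ w , t ⊕ ⊖ w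
      τ (x , y) = ½ ⊗ (x ⊕ y) , ½ ⊗ (x ⊕ ⊖ y)
      στ : ∀ y → σ (τ y) ≡ y
      στ (x , y) = cong₂ _,_
        (trans (solve 3 (λ h x y → h :* (x :+ y) :+ h :* (x :- y) := h :* x :+ h :* x) refl ½ x y) (½⊕½ x))
        (trans (solve 3 (λ h x y → h :* (x :+ y) :- h :* (x :- y) := h :* y :+ h :* y) refl ½ x y) (½⊕½ y))
      τσ : ∀ x → τ (σ x) ≡ x
      τσ (t , w) = cong₂ _,_
        (trans (cong (½ ⊗_) (solve 2 (λ t w → (t :+ w) :+ (t :- w) := t :+ t) refl t w)) (½-dbl t))
        (trans (cong (½ ⊗_) (solve 2 (λ t w → (t :+ w) :- (t :- w) := w :+ w) refl t w)) (½-dbl w))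

    roots-≤2 : ∀ c → c ≢ 0F → ∀ D → ∑ Fs (λ x → ind (c ⊗ (x ⊗ x) ≟F D)) ≤ + 2
    roots-≤2 c c≢0 D with Any.any? (λ r → c ⊗ (r ⊗ r) ≟F D) Fs
    ... | no ¬∃ = subst (_≤ + 2) (sym (trans (∑-cong Fs (λ x → ind-no (c ⊗ (x ⊗ x) ≟F D) (λ e → ¬∃ (M.lose (complete x) e)))) (∑-ε Fs))) (+≤+ z≤n)
    ... | yes ∃r with M.find ∃r
    ... | r , _ , refl = subst (∑ Fs (λ x → ind (c ⊗ (x ⊗ x) ≟F (c ⊗ (r ⊗ r)))) ≤_)
        (trans (∑-∙ Fs _ _) (cong₂ _+_ (∑-ind₁ finite r) (∑-ind₁ finite (⊖ r)))) (∑-mono Fs le)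
      where
      le : ∀ x → ind (c ⊗ (x ⊗ x) ≟F (c ⊗ (r ⊗ r))) ≤ ind (x ≟F r) + ind (x ≟F (⊖ r))
      le x with c ⊗ (x ⊗ x) ≟F (c ⊗ (r ⊗ r))
      ... | no _ = ℤₚ.+-mono-≤ (ind≥0 (x ≟F r)) (ind≥0 (x ≟F (⊖ r)))
      ... | yes e with square-roots {x} {r} (⊗-cancelˡ c≢0 e)
      ... | inj₁ x≡r = subst (λ z → 1ℤ ≤ z + ind (x ≟F (⊖ r))) (sym (ind-yes (x ≟F r) x≡r)) (ℤₚ.+-monoʳ-≤ 1ℤ (ind≥0 (x ≟F (⊖ r))))
      ... | inj₂ x≡-r = subst (λ z → 1ℤ ≤ ind (x ≟F r) + z) (sym (ind-yes (x ≟F (⊖ r)) x≡-r)) (ℤₚ.+-monoˡ-≤ 1ℤ (ind≥0 (x ≟F r)))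

    ∑-roots : ∀ c → ∑ Fs (λ D → ∑ Fs (λ x → ind (c ⊗ (x ⊗ x) ≟F D))) ≡ + q
    ∑-roots c = trans (∑-swap Fs Fs _) (trans (∑-cong Fs (λ x → trans (∑-cong Fs (λ D → ind-⇔ (c ⊗ (x ⊗ x) ≟F D) (D ≟F (c ⊗ (x ⊗ x))) sym sym)) (∑-ind₁ finite _))) (trans (∑-const Fs 1ℤ) (ℤₚ.*-identityʳ _)))

    nonsquare : ∃ Nonsquare
    nonsquare with Any.any? (λ y → All.all? (λ x → ¬? (x ⊗ x ≟F y)) Fs) Fs
    ... | yes ∃y with M.find ∃y
    ... | δ , _ , ns = δ , λ x → All.lookup ns (complete x)
    nonsquare | no ¬∃ = contradiction (ℤₚ.≤-trans (ℤₚ.≤-reflexive {+ ℕ.suc q} {1ℤ + ∑ Fs (λ _ → 1ℤ)} (cong (λ z → 1ℤ + z) (sym (trans (∑-const Fs 1ℤ) (ℤₚ.*-identityʳ (+ q))))))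
         (ℤₚ.≤-trans (ℤₚ.≤-reflexive (trans (cong (_+ ∑ Fs (λ _ → 1ℤ)) (sym (∑-ind₁ finite 1F))) (sym (∑-∙ Fs _ _)))) (ℤₚ.≤-trans (∑-mono Fs many) (ℤₚ.≤-reflexive (∑-roots 1F)))))
         (ℤₚ.<⇒≱ (+<+ (ℕₚ.n<1+n q)))
      where
      root : ∀ y → ∃ λ x → x ⊗ x ≡ y
      root y with Any.any? (λ x → x ⊗ x ≟F y) Fs
      ... | yes ∃x = proj₁ (M.find ∃x) , proj₂ (proj₂ (M.find ∃x))
      ... | no ¬x = contradiction (M.lose (complete y) (All.tabulate (λ {x} x∈ e → ¬x (M.lose x∈ e)))) ¬∃
      many : ∀ y → ind (y ≟F 1F) + 1ℤ ≤ ∑ Fs (λ x → ind (1F ⊗ (x ⊗ x) ≟F y))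
      many y with y ≟F 1F
      ... | yes refl = subst (_≤ ∑ Fs (λ x → ind (1F ⊗ (x ⊗ x) ≟F 1F)))
            (trans (∑-∙ Fs _ _) (cong₂ _+_ (∑-ind₁ finite 1F) (∑-ind₁ finite (⊖ 1F)))) (∑-mono Fs le)
        where
        le : ∀ x → ind (x ≟F 1F) + ind (x ≟F (⊖ 1F)) ≤ ind (1F ⊗ (x ⊗ x) ≟F 1F)
        le x with x ≟F 1F | x ≟F (⊖ 1F)
        ... | yes refl | yes e = contradiction e 1≢⊖1
        ... | yes refl | no _ = ℤₚ.≤-reflexive (sym (ind-yes (1F ⊗ (1F ⊗ 1F) ≟F 1F) (solve 0 (con 1ℤ :* (con 1ℤ :* con 1ℤ) := con 1ℤ) refl)))
        ... | no _ | yes refl = ℤₚ.≤-reflexive (sym (ind-yes (1F ⊗ (⊖ 1F ⊗ ⊖ 1F) ≟F 1F) (solve 0 (con 1ℤ :* ((:- con 1ℤ) :* (:- con 1ℤ)) := con 1ℤ) refl)))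
        ... | no _ | no _ = ind≥0 (1F ⊗ (x ⊗ x) ≟F 1F)
      ... | no _ with root y
      ... | r , refl = subst (_≤ ∑ Fs (λ x → ind (1F ⊗ (x ⊗ x) ≟F (r ⊗ r)))) (∑-ind₁ finite r) (∑-mono Fs le)
        where
        le : ∀ x → ind (x ≟F r) ≤ ind (1F ⊗ (x ⊗ x) ≟F (r ⊗ r))
        le x with x ≟F r
        ... | yes refl = ℤₚ.≤-reflexive (sym (ind-yes (1F ⊗ (x ⊗ x) ≟F (x ⊗ x)) (⊗-identityˡ _)))
        ... | no _ = ind≥0 (1F ⊗ (x ⊗ x) ≟F (r ⊗ r))

    module _ {δ : F} (ns : Nonsquare δ) where

      δ≢0 : δ ≢ 0F
      δ≢0 refl = ns 0F (⊗-zeroˡ 0F)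

      private
        N : F → F → ℤ
        N c D = ∑ Fs (λ x → ind (c ⊗ (x ⊗ x) ≟F D))

        root-0 : ∀ c → c ≢ 0F → N c 0F ≡ 1ℤ
        root-0 c c≢0 = trans (∑-cong Fs (λ x → ind-⇔ (c ⊗ (x ⊗ x) ≟F 0F) (x ≟F 0F)
           (λ e → x≡0 x (⊗≡0 c e)) (λ { refl → trans (cong (c ⊗_) (⊗-zeroˡ 0F)) (⊗-zeroʳ c) }))) (∑-ind₁ finite 0F)
          where
          x≡0 : ∀ x → c ≡ 0F ⊎ x ⊗ x ≡ 0F → x ≡ 0F
          x≡0 x (inj₁ e) = contradiction e c≢0
          x≡0 x (inj₂ e) with ⊗≡0 x e
          ... | inj₁ e′ = e′
          ... | inj₂ e′ = e′

        no-root : ∀ c D → (∀ x → c ⊗ (x ⊗ x) ≢ D) → N c D ≡ 0ℤ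
        no-root c D h = trans (∑-cong Fs (λ x → ind-no (c ⊗ (x ⊗ x) ≟F D) (h x))) (∑-ε Fs)

        N+N≤2 : ∀ D → N 1F D + N δ D ≤ + 2
        N+N≤2 D with zero? D
        ... | inj₁ refl = ℤₚ.≤-reflexive (cong₂ _+_ (root-0 1F 1≢0) (root-0 δ δ≢0))
        ... | inj₂ D≢0 with Any.any? (λ r → 1F ⊗ (r ⊗ r) ≟F D) Fs
        ... | no ¬r = subst (λ z → z + N δ D ≤ + 2) (sym (no-root 1F D (λ x e → ¬r (M.lose (complete x) e))))
                (subst (_≤ + 2) (sym (ℤₚ.+-identityˡ _)) (roots-≤2 δ δ≢0 D))
        ... | yes ∃r = subst (λ z → N 1F D + z ≤ + 2) (sym (no-root δ D none))
                (subst (_≤ + 2) (sym (ℤₚ.+-identityʳ _)) (roots-≤2 1F 1≢0 D))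
          where
          none : ∀ v → δ ⊗ (v ⊗ v) ≢ D
          none v e with M.find ∃r | zero? v
          ... | r , _ , er | inj₁ refl = D≢0 (trans (sym e) (trans (cong (δ ⊗_) (⊗-zeroˡ 0F)) (⊗-zeroʳ δ)))
          ... | r , _ , er | inj₂ v≢0 = ns (r ⊗ inv v) (begin
            (r ⊗ inv v) ⊗ (r ⊗ inv v) ≡⟨ solve 2 (λ r w → (r :* w) :* (r :* w) := (con 1ℤ :* (r :* r)) :* (w :* w)) refl r (inv v) ⟩
            (1F ⊗ (r ⊗ r)) ⊗ (inv v ⊗ inv v) ≡⟨ cong (_⊗ (inv v ⊗ inv v)) (trans er (sym e)) ⟩
            (δ ⊗ (v ⊗ v)) ⊗ (inv v ⊗ inv v) ≡⟨ solve 3 (λ d v w → (d :* (v :* v)) :* (w :* w) := d :* ((v :* w) :* (v :* w))) refl δ v (inv v) ⟩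
            δ ⊗ ((v ⊗ inv v) ⊗ (v ⊗ inv v)) ≡⟨ cong (λ z → δ ⊗ (z ⊗ z)) (inv-r v≢0) ⟩
            δ ⊗ (1F ⊗ 1F) ≡⟨ solve 1 (λ d → d :* (con 1ℤ :* con 1ℤ) := d) refl δ ⟩
            δ ∎)
            where open ≡-Reasoning

        N+N≡2 : ∀ D → N 1F D + N δ D ≡ + 2
        N+N≡2 D = sym (ℤₚ.i-j≡0⇒i≡j (+ 2) (N 1F D + N δ D) (∑≥0-tight Fs {λ D → + 2 - (N 1F D + N δ D)} (λ D → ℤₚ.i≤j⇒0≤j-i (N+N≤2 D)) total (complete D)))
          where
          twice : ∀ x → x * + 2 - (x + x) ≡ 0ℤ
          twice = solve-∀
          total : ∑ Fs (λ D → + 2 - (N 1F D + N δ D)) ≡ 0ℤ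
          total = trans (∑-minus Fs _ _) (trans (cong₂ _-_ (∑-const Fs (+ 2)) (trans (∑-∙ Fs (N 1F) (N δ)) (cong₂ _+_ (∑-roots 1F) (∑-roots δ)))) (twice (+ q)))

        via-roots : ∀ c (g : F → ℤ) → ∑ Fs (λ w → g (c ⊗ (w ⊗ w))) ≡ ∑ Fs (λ D → N c D * g D)
        via-roots c g = begin
          ∑ Fs (λ w → g (c ⊗ (w ⊗ w))) ≡⟨ ∑-cong Fs (λ w → sym (∑-ind finite (c ⊗ (w ⊗ w)) g)) ⟩
          ∑ Fs (λ w → ∑ Fs (λ D → ind (D ≟F (c ⊗ (w ⊗ w))) * g D)) ≡⟨ ∑-swap Fs Fs _ ⟩
          ∑ Fs (λ D → ∑ Fs (λ w → ind (D ≟F (c ⊗ (w ⊗ w))) * g D)) ≡⟨ ∑-cong Fs (λ D → trans (∑-*ʳ Fs (g D) _) (cong (_* g D) (∑-cong Fs (λ w → ind-⇔ (D ≟F _) (_ ≟F D) sym sym)))) ⟩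
          ∑ Fs (λ D → N c D * g D) ∎
          where open ≡-Reasoning

      squares+nonsquares : ∀ (g : F → ℤ) →
        ∑ Fs (λ w → g (w ⊗ w)) + ∑ Fs (λ w → g (δ ⊗ (w ⊗ w))) ≡ + 2 * ∑ Fs g
      squares+nonsquares g = begin
        ∑ Fs (λ w → g (w ⊗ w)) + ∑ Fs (λ w → g (δ ⊗ (w ⊗ w)))
          ≡⟨ cong₂ _+_ (trans (∑-cong Fs (λ w → cong g (sym (⊗-identityˡ _)))) (via-roots 1F g)) (via-roots δ g) ⟩
        ∑ Fs (λ D → N 1F D * g D) + ∑ Fs (λ D → N δ D * g D) ≡⟨ sym (∑-∙ Fs _ _) ⟩
        ∑ Fs (λ D → N 1F D * g D + N δ D * g D) ≡⟨ ∑-cong Fs (λ D → trans (sym (ℤₚ.*-distribʳ-+ (g D) (N 1F D) (N δ D))) (cong (_* g D) (N+N≡2 D))) ⟩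
        ∑ Fs (λ D → + 2 * g D) ≡⟨ ∑-*ˡ Fs (+ 2) g ⟩
        + 2 * ∑ Fs g ∎
        where open ≡-Reasoning

module QuadExt where

  open import Defs
  open SumLib
  open IntSum
  open FieldLib
  open Squares
  open import Algebra.Structures using (IsCommutativeRing)
  open import Data.Integer using (ℤ; +_; 0ℤ; 1ℤ; _+_; _*_; -_; _-_)
  import Data.Integer.Properties as ℤₚ
  open import Data.Integer.Tactic.RingSolver using (solve-∀)
  import Data.Nat as ℕ

  module Quadratic (𝔽 : FiniteField)
    (2≢0 : ¬ (FiniteField._+_ 𝔽 (FiniteField.1# 𝔽) (FiniteField.1# 𝔽) ≡ FiniteField.0# 𝔽))
    (δ : FiniteField.F 𝔽) (ns : OddField.Nonsquare 𝔽 2≢0 δ) where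
    open Field 𝔽
    open OddField 𝔽 2≢0

    E : Set
    E = F × F

    _⊕ᴱ_ _⊗ᴱ_ : E → E → E
    (u , v) ⊕ᴱ (u′ , v′) = u ⊕ u′ , v ⊕ v′
    (u , v) ⊗ᴱ (u′ , v′) = u ⊗ u′ ⊕ δ ⊗ (v ⊗ v′) , u ⊗ v′ ⊕ v ⊗ u′

    ⊖ᴱ_ : E → E
    ⊖ᴱ (u , v) = ⊖ u , ⊖ v

    norm : E → F
    norm (u , v) = u ⊗ u ⊕ ⊖ (δ ⊗ (v ⊗ v))

    norm≡0 : ∀ z → norm z ≡ 0F → z ≡ (0F , 0F)
    norm≡0 (u , v) eq with zero? v
    ... | inj₁ refl = cong (_, 0F) u≡0
      where
      uu≡0 : u ⊗ u ≡ 0F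
      uu≡0 = trans (solve 2 (λ u d → u :* u := u :* u :- d :* (con 0ℤ :* con 0ℤ)) refl u δ) eq
      u≡0 : u ≡ 0F
      u≡0 with ⊗≡0 u uu≡0
      ... | inj₁ e = e
      ... | inj₂ e = e
    ... | inj₂ v≢0 = contradiction (begin
        (u ⊗ inv v) ⊗ (u ⊗ inv v) ≡⟨ solve 2 (λ u w → (u :* w) :* (u :* w) := (u :* u) :* (w :* w)) refl u (inv v) ⟩
        (u ⊗ u) ⊗ (inv v ⊗ inv v) ≡⟨ cong (_⊗ (inv v ⊗ inv v)) (x⊖y≡0 eq) ⟩
        (δ ⊗ (v ⊗ v)) ⊗ (inv v ⊗ inv v) ≡⟨ solve 3 (λ d v w → (d :* (v :* v)) :* (w :* w) := d :* ((v :* w) :* (v :* w))) refl δ v (inv v) ⟩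
        δ ⊗ ((v ⊗ inv v) ⊗ (v ⊗ inv v)) ≡⟨ cong (λ z → δ ⊗ (z ⊗ z)) (inv-r v≢0) ⟩
        δ ⊗ (1F ⊗ 1F) ≡⟨ solve 1 (λ d → d :* (con 1ℤ :* con 1ℤ) := d) refl δ ⟩
        δ ∎) (ns (u ⊗ inv v))
      where open ≡-Reasoning

    conj-inv : E → E
    conj-inv (u , v) = u ⊗ inv (norm (u , v)) , ⊖ v ⊗ inv (norm (u , v))

    isCommRingᴱ : IsCommutativeRing _≡_ _⊕ᴱ_ _⊗ᴱ_ ⊖ᴱ_ (0F , 0F) (1F , 0F)
    isCommRingᴱ = record
      { isRing = record
        { +-isAbelianGroup = record
          { isGroup = record
            { isMonoid = record
              { isSemigroup = record
                { isMagma = record { isEquivalence = isEquivalence ; ∙-cong = cong₂ _⊕ᴱ_ }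
                ; assoc = λ (a , b) (c , d) (e , f) → cong₂ _,_ (⊕-assoc a c e) (⊕-assoc b d f) }
              ; identity = (λ (a , b) → cong₂ _,_ (⊕-identityˡ a) (⊕-identityˡ b)) , (λ (a , b) → cong₂ _,_ (⊕-identityʳ a) (⊕-identityʳ b)) }
            ; inverse = (λ (a , b) → cong₂ _,_ (⊖-inverseˡ a) (⊖-inverseˡ b)) , (λ (a , b) → cong₂ _,_ (⊖-inverseʳ a) (⊖-inverseʳ b))
            ; ⁻¹-cong = cong ⊖ᴱ_ }
          ; comm = λ (a , b) (c , d) → cong₂ _,_ (⊕-comm a c) (⊕-comm b d) }
        ; *-cong = cong₂ _⊗ᴱ_
        ; *-assoc = λ (a , b) (c , d) (e , f) → cong₂ _,_
            (solve 7 (λ a b c d e f δ → (a :* c :+ δ :* (b :* d)) :* e :+ δ :* ((a :* d :+ b :* c) :* f) := a :* (c :* e :+ δ :* (d :* f)) :+ δ :* (b :* (c :* f :+ d :* e))) refl a b c d e f δ)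
            (solve 7 (λ a b c d e f δ → (a :* c :+ δ :* (b :* d)) :* f :+ (a :* d :+ b :* c) :* e := a :* (c :* f :+ d :* e) :+ b :* (c :* e :+ δ :* (d :* f))) refl a b c d e f δ)
        ; *-identity = (λ (a , b) → cong₂ _,_
               (solve 3 (λ a b δ → con 1ℤ :* a :+ δ :* (con 0ℤ :* b) := a) refl a b δ) (solve 2 (λ a b → con 1ℤ :* b :+ con 0ℤ :* a := b) refl a b))
            , (λ (a , b) → cong₂ _,_
               (solve 3 (λ a b δ → a :* con 1ℤ :+ δ :* (b :* con 0ℤ) := a) refl a b δ) (solve 2 (λ a b → a :* con 0ℤ :+ b :* con 1ℤ := b) refl a b))
        ; distrib = (λ (a , b) (c , d) (e , f) → cong₂ _,_
               (solve 7 (λ a b c d e f δ → a :* (c :+ e) :+ δ :* (b :* (d :+ f)) := (a :* c :+ δ :* (b :* d)) :+ (a :* e :+ δ :* (b :* f))) refl a b c d e f δ)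
               (solve 6 (λ a b c d e f → a :* (d :+ f) :+ b :* (c :+ e) := (a :* d :+ b :* c) :+ (a :* f :+ b :* e)) refl a b c d e f))
            , (λ (a , b) (c , d) (e , f) → cong₂ _,_
               (solve 7 (λ a b c d e f δ → (c :+ e) :* a :+ δ :* ((d :+ f) :* b) := (c :* a :+ δ :* (d :* b)) :+ (e :* a :+ δ :* (f :* b))) refl a b c d e f δ)
               (solve 6 (λ a b c d e f → (c :+ e) :* b :+ (d :+ f) :* a := (c :* b :+ d :* a) :+ (e :* b :+ f :* a)) refl a b c d e f)) }
      ; *-comm = λ (a , b) (c , d) → cong₂ _,_
           (solve 5 (λ a b c d δ → a :* c :+ δ :* (b :* d) := c :* a :+ δ :* (d :* b)) refl a b c d δ)
           (solve 4 (λ a b c d → a :* d :+ b :* c := c :* b :+ d :* a) refl a b c d) }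

    ⊗-conj-inv : ∀ z → ¬ (z ≡ (0F , 0F)) → z ⊗ᴱ conj-inv z ≡ (1F , 0F)
    ⊗-conj-inv (u , v) z≢0 = cong₂ _,_
      (trans (solve 4 (λ u v d i → u :* (u :* i) :+ d :* (v :* ((:- v) :* i)) := (u :* u :- d :* (v :* v)) :* i) refl u v δ (inv (norm (u , v))))
        (inv-r (z≢0 ∘ norm≡0 (u , v))))
      (solve 3 (λ u v i → u :* ((:- v) :* i) :+ v :* (u :* i) := con 0ℤ) refl u v (inv (norm (u , v))))

    extension : FiniteField
    extension = record
      { F = E ; _≟_ = Finite._≟_ FE ; _+_ = _⊕ᴱ_ ; _*_ = _⊗ᴱ_ ; -_ = ⊖ᴱ_ ; 0# = 0F , 0F ; 1# = 1F , 0F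
      ; isCommRing = isCommRingᴱ ; 0≢1 = 0≢1 ∘ cong proj₁
      ; inverse = λ z z≢0 → conj-inv z , ⊗-conj-inv z z≢0
      ; elements = elems FE ; complete = Finite.complete FE ; distinct = Finite.distinct FE }
      where FE = ×-finite finite finite

    module 𝔼 = Field extension
    module N𝔼 = NullSum extension

    order-extension : 𝔼.q ≡ q ℕ.* q
    order-extension = length-cartesianProduct Fs Fs

    2≢0ᴱ : ¬ ((1F , 0F) ⊕ᴱ (1F , 0F) ≡ (0F , 0F))
    2≢0ᴱ eq = 2≢0 (cong proj₁ eq)

    inv-pair : ∀ u v → 𝔼.inv (u , v) ≡ conj-inv (u , v)
    inv-pair u v with 𝔼.zero? (u , v)
    ... | inj₁ refl = trans 𝔼.inv-0 (sym (cong₂ _,_ (⊗-zeroˡ (inv (norm (0F , 0F)))) (trans (cong (_⊗ inv (norm (0F , 0F))) -0#≈0#) (⊗-zeroˡ _))))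
    ... | inj₂ z≢0 = 𝔼.inv-unique (⊗-conj-inv (u , v) z≢0)

    half-trace : E → F
    half-trace (u , v) = u ⊕ u

    null-extension : ∀ {f : F → ℤ} → Null f → N𝔼.Null (f ∘ half-trace)
    null-extension {f} nf = trans (∑-× Fs Fs _) (trans (∑-swap Fs Fs _) (trans (∑-cong Fs (λ v →
        trans (∑-cong Fs (λ u → cong f (trans (sym (dbl≡ u)) (sym (⊕-identityʳ _))))) (null-affine nf 2≢0 0F))) (∑-ε Fs)))

    -- Substituting x = t + w, y = t − w on the left and z = t + w√δ on the right, both sums run over
    -- the same function of t and w², respectively t and δw²; w² and δw² together cover F twice.
    kloosterman-doubling : ∀ (f : F → ℤ) → Null f → ∀ a → a ≢ 0F →
      ∑ Fs (λ x → ∑ Fs (λ y → nz x * nz y * f ((x ⊕ a ⊗ inv x) ⊕ (y ⊕ a ⊗ inv y))))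
        + ∑ 𝔼.Fs (λ z → N𝔼.nz z * f (half-trace (z ⊕ᴱ ((a , 0F) ⊗ᴱ 𝔼.inv z))))
      ≡ + 2 * (+ q * f 0F)
    kloosterman-doubling f nf a a≢0 = begin
      ∑ Fs (λ x → ∑ Fs (λ y → S x y)) + ∑ 𝔼.Fs T
        ≡⟨ cong₂ _+_ (∑-sum-difference S) (∑-× Fs Fs T) ⟩
      ∑ Fs (λ t → ∑ Fs (λ w → S (t ⊕ w) (t ⊕ ⊖ w))) + ∑ Fs (λ u → ∑ Fs (λ v → T (u , v)))
        ≡⟨ cong₂ _+_ (∑-cong Fs (λ t → ∑-cong Fs (λ w → S≡G t w))) (∑-cong Fs (λ u → ∑-cong Fs (λ v → T≡G u v))) ⟩
      ∑ Fs (λ t → ∑ Fs (λ w → G t (w ⊗ w))) + ∑ Fs (λ t → ∑ Fs (λ v → G t (δ ⊗ (v ⊗ v))))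
        ≡⟨ sym (∑-∙ Fs _ _) ⟩
      ∑ Fs (λ t → ∑ Fs (λ w → G t (w ⊗ w)) + ∑ Fs (λ v → G t (δ ⊗ (v ⊗ v))))
        ≡⟨ ∑-cong Fs (λ t → trans (squares+nonsquares ns (G t)) (cong (+ 2 *_) (reindexD t))) ⟩
      ∑ Fs (λ t → + 2 * ∑ Fs (λ p → nz p * f (phase t p)))
        ≡⟨ ∑-*ˡ Fs (+ 2) _ ⟩
      + 2 * ∑ Fs (λ t → ∑ Fs (λ p → nz p * f (phase t p)))
        ≡⟨ cong (+ 2 *_) (trans (∑-swap Fs Fs _) (∑-cong Fs inner)) ⟩
      + 2 * ∑ Fs (λ p → ind (p ≟F ⊖ a) * (nz p * (+ q * f 0F)))
        ≡⟨ cong (+ 2 *_) (trans (∑-ind finite (⊖ a) _) (trans (cong (_* (+ q * f 0F)) (nz-≢0 (⊖≢0 a≢0))) (ℤₚ.*-identityˡ _))) ⟩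
      + 2 * (+ q * f 0F) ∎
      where
      open ≡-Reasoning
      S : F → F → ℤ
      S x y = nz x * nz y * f ((x ⊕ a ⊗ inv x) ⊕ (y ⊕ a ⊗ inv y))
      T : E → ℤ
      T z = N𝔼.nz z * f (half-trace (z ⊕ᴱ ((a , 0F) ⊗ᴱ 𝔼.inv z)))
      phase : F → F → F
      phase t p = (t ⊕ t) ⊗ (1F ⊕ a ⊗ inv p)
      G : F → F → ℤ
      G t D = nz (t ⊗ t ⊕ ⊖ D) * f (phase t (t ⊗ t ⊕ ⊖ D))
      S-as-product : ∀ x y → S x y ≡ nz (x ⊗ y) * f ((x ⊕ y) ⊗ (1F ⊕ a ⊗ inv (x ⊗ y)))
      S-as-product x y = trans (cong (_* f ((x ⊕ a ⊗ inv x) ⊕ (y ⊕ a ⊗ inv y))) (nz-⊗ x y)) (nz-cong (x ⊗ y) (λ ne → cong f (begin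
        (x ⊕ a ⊗ inv x) ⊕ (y ⊕ a ⊗ inv y)
          ≡⟨ cong₂ (λ X Y → (x ⊕ a ⊗ X) ⊕ (y ⊕ a ⊗ Y)) (sym (other (λ { refl → ne (⊗-zeroʳ x) }))) (sym (other (λ { refl → ne (⊗-zeroˡ y) }))) ⟩
        (x ⊕ a ⊗ (inv x ⊗ (y ⊗ inv y))) ⊕ (y ⊕ a ⊗ (inv y ⊗ (x ⊗ inv x)))
          ≡⟨ solve 5 (λ x y a i j → (x :+ a :* (i :* (y :* j))) :+ (y :+ a :* (j :* (x :* i))) := (x :+ y) :* (con 1ℤ :+ a :* (i :* j))) refl x y a (inv x) (inv y) ⟩
        (x ⊕ y) ⊗ (1F ⊕ a ⊗ (inv x ⊗ inv y)) ≡⟨ cong (λ z → (x ⊕ y) ⊗ (1F ⊕ a ⊗ z)) (sym (inv-⊗ x y)) ⟩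
        (x ⊕ y) ⊗ (1F ⊕ a ⊗ inv (x ⊗ y)) ∎)))
        where
        other : ∀ {i y} → y ≢ 0F → i ⊗ (y ⊗ inv y) ≡ i
        other {i} y≢0 = trans (cong (i ⊗_) (inv-r y≢0)) (⊗-identityʳ i)
      S≡G : ∀ t w → S (t ⊕ w) (t ⊕ ⊖ w) ≡ G t (w ⊗ w)
      S≡G t w = trans (S-as-product (t ⊕ w) (t ⊕ ⊖ w)) (cong₂ (λ s p → nz p * f (s ⊗ (1F ⊕ a ⊗ inv p)))
        (solve 2 (λ t w → (t :+ w) :+ (t :- w) := t :+ t) refl t w) (solve 2 (λ t w → (t :+ w) :* (t :- w) := t :* t :- w :* w) refl t w))
      T≡G : ∀ u v → T (u , v) ≡ G u (δ ⊗ (v ⊗ v))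
      T≡G u v = cong₂ _*_ nz-norm (cong f (trans (cong (λ z → half-trace ((u , v) ⊕ᴱ ((a , 0F) ⊗ᴱ z))) (inv-pair u v))
        (solve 5 (λ u v a i d → (u :+ (a :* (u :* i) :+ d :* (con 0ℤ :* ((:- v) :* i)))) :+ (u :+ (a :* (u :* i) :+ d :* (con 0ℤ :* ((:- v) :* i)))) := (u :+ u) :* (con 1ℤ :+ a :* i)) refl u v a (inv (norm (u , v))) δ)))
        where
        nz-norm : N𝔼.nz (u , v) ≡ nz (norm (u , v))
        nz-norm with 𝔼.zero? (u , v)
        ... | inj₁ refl = trans N𝔼.nz-0 (sym (trans (cong nz (solve 1 (λ d → con 0ℤ :* con 0ℤ :- d :* (con 0ℤ :* con 0ℤ) := con 0ℤ) refl δ)) nz-0))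
        ... | inj₂ z≢0 = trans (N𝔼.nz-≢0 z≢0) (sym (nz-≢0 (z≢0 ∘ norm≡0 (u , v))))
      reindexD : ∀ t → ∑ Fs (G t) ≡ ∑ Fs (λ p → nz p * f (phase t p))
      reindexD t = ∑-reindex finite finite (λ D → t ⊗ t ⊕ ⊖ D) (λ p → t ⊗ t ⊕ ⊖ p)
        (λ p → solve 2 (λ s p → s :- (s :- p) := p) refl (t ⊗ t) p) (λ p → solve 2 (λ s p → s :- (s :- p) := p) refl (t ⊗ t) p) (λ p → nz p * f (phase t p))
      inner : ∀ p → ∑ Fs (λ t → nz p * f (phase t p)) ≡ ind (p ≟F ⊖ a) * (nz p * (+ q * f 0F))
      inner p = begin
        ∑ Fs (λ t → nz p * f (phase t p)) ≡⟨ ∑-*ˡ Fs (nz p) _ ⟩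
        nz p * ∑ Fs (λ t → f (phase t p))
          ≡⟨ cong (nz p *_) (trans (∑-cong Fs (λ t → cong f (solve 2 (λ t c → (t :+ t) :* c := ((con 1ℤ :+ con 1ℤ) :* c) :* t :+ con 0ℤ) refl t c))) (orthogonality nf ((1F ⊕ 1F) ⊗ c) 0F)) ⟩
        nz p * (ind ((1F ⊕ 1F) ⊗ c ≟F 0F) * (+ q * f 0F))
          ≡⟨ nz-cong p (λ p≢0 → cong (_* (+ q * f 0F)) (ind-⇔ ((1F ⊕ 1F) ⊗ c ≟F 0F) (p ≟F ⊖ a) (to p≢0) (from p≢0))) ⟩
        nz p * (ind (p ≟F ⊖ a) * (+ q * f 0F)) ≡⟨ swap (nz p) (ind (p ≟F ⊖ a)) _ ⟩
        ind (p ≟F ⊖ a) * (nz p * (+ q * f 0F)) ∎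
        where
        c = 1F ⊕ a ⊗ inv p
        swap : ∀ x y z → x * (y * z) ≡ y * (x * z)
        swap = solve-∀
        from : p ≢ 0F → p ≡ ⊖ a → (1F ⊕ 1F) ⊗ c ≡ 0F
        from p≢0 refl = trans (cong ((1F ⊕ 1F) ⊗_) (trans (cong (_⊕ a ⊗ inv (⊖ a)) (sym (inv-r p≢0)))
          (solve 2 (λ a i → (:- a) :* i :+ a :* i := con 0ℤ) refl a (inv (⊖ a))))) (⊗-zeroʳ _)
        to : p ≢ 0F → (1F ⊕ 1F) ⊗ c ≡ 0F → p ≡ ⊖ a
        to p≢0 eq with ⊗≡0 (1F ⊕ 1F) eq
        ... | inj₁ e = contradiction e 2≢0
        ... | inj₂ e = x⊖y≡0 (trans (cong (p ⊕_) (-‿involutive a)) (trans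
            (trans (cong (p ⊕_) (trans (sym (⊗-identityʳ a)) (cong (a ⊗_) (sym (inv-r p≢0))))) (solve 3 (λ p a i → p :+ a :* (p :* i) := p :* (con 1ℤ :+ a :* i)) refl p a (inv p))) (trans (cong (p ⊗_) e) (⊗-zeroʳ p))))

module Poly where

  open import Defs
  open SumLib
  open FieldLib
  import Data.Fin as Fin
  import Data.Fin.Properties as Finₚ
  open import Data.Integer using (1ℤ; 0ℤ)
  open import Data.List using (lookup)
  open import Data.List.Relation.Unary.All as All using ([]; _∷_)
  open import Data.List.Relation.Unary.AllPairs using ([]; _∷_)
  open import Data.List.Relation.Unary.Any using (index)
  open import Data.List.Relation.Unary.Any.Properties using (lookup-index)
  import Data.List.Relation.Unary.Unique.Propositional.Properties as Uniq
  open import Data.Nat as ℕ using (ℕ; zero; suc; _≤_; _<_; z≤n; s≤s)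
  import Data.Nat.Properties as ℕₚ
  open import Data.Nat.Tactic.RingSolver using ()
  open import Data.Product using (Σ)
  open import Data.Vec as Vec using ([]; _∷_)
  import Data.Vec.Properties as Vecₚ

  Vec-finite : ∀ {A} → Finite A → ∀ n → Finite (Vec A n)
  Vec-finite FA zero = record { elems = [] ∷ [] ; complete = λ { [] → here refl } ; distinct = [] ∷ [] ; _≟_ = λ { [] [] → yes refl } }
  Vec-finite {A} FA (suc n) = record
    { elems    = map cons (elems FP)
    ; complete = λ { (x ∷ xs) → ∈-map⁺ cons (Finite.complete FP (x , xs)) }
    ; distinct = Uniq.map⁺ (λ { {x , xs} {y , ys} refl → refl }) (Finite.distinct FP)
    ; _≟_      = Vecₚ.≡-dec (Finite._≟_ FA) }
    where
    FP = ×-finite FA (Vec-finite FA n)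
    cons : A × Vec A n → Vec A (suc n)
    cons (x , xs) = x ∷ xs

  size-Vec : ∀ {A} (FA : Finite A) n → Finite.size (Vec-finite FA n) ≡ Finite.size FA ℕ.^ n
  size-Vec FA zero    = refl
  size-Vec FA (suc n) = trans (length-map _ (elems (×-finite FA (Vec-finite FA n)))) (trans (length-cartesianProduct (elems FA) _) (cong (Finite.size FA ℕ.*_) (size-Vec FA n)))

  collision : ∀ {A B} (FA : Finite A) (FB : Finite B) → Finite.size FB < Finite.size FA → (f : A → B) →
              ∃ λ x → ∃ λ y → x ≢ y × f x ≡ f y
  collision {A} {B} FA FB lt f with Finₚ.pigeonhole lt (λ i → index (Finite.complete FB (f (lookup (elems FA) i))))
  ... | i , j , i<j , eq = at i , at j , (λ e → Finₚ.<⇒≢ i<j (inj (Finite.distinct FA) i j e)) ,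
        trans (lookup-index (Finite.complete FB (f (at i)))) (trans (cong (lookup (elems FB)) eq) (sym (lookup-index (Finite.complete FB (f (at j))))))
    where
    at = lookup (elems FA)
    open import Data.List.Membership.Propositional.Properties using (∈-lookup)
    inj : ∀ {xs : List A} → Unique xs → ∀ i j → lookup xs i ≡ lookup xs j → i ≡ j
    inj (_ ∷ _) Fin.zero Fin.zero _ = refl
    inj {_ ∷ xs} (x∉ ∷ _) Fin.zero (Fin.suc j) e = contradiction e (All.lookup x∉ (∈-lookup j))
    inj {_ ∷ xs} (x∉ ∷ _) (Fin.suc i) Fin.zero e = contradiction (sym e) (All.lookup x∉ (∈-lookup i))
    inj (_ ∷ u) (Fin.suc i) (Fin.suc j) e = cong Fin.suc (inj u i j e)

  module Polynomial (𝔽 : FiniteField) where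
    open Field 𝔽

    eval : ∀ {n} → Vec F n → F → F
    eval []       z = 0F
    eval (c ∷ cs) z = c ⊕ z ⊗ eval cs z

    -- a monic polynomial of degree n, given by its n lower coefficients
    evalM : ∀ {n} → Vec F n → F → F
    evalM []       z = 1F
    evalM (c ∷ cs) z = c ⊕ z ⊗ evalM cs z

    IsPoly IsMonic : ℕ → (F → F) → Set
    IsPoly  n f = Σ (Vec F n) λ c → ∀ z → f z ≡ eval c z
    IsMonic n f = Σ (Vec F n) λ c → ∀ z → f z ≡ evalM c z

    poly-cong : ∀ {n f g} → (∀ z → g z ≡ f z) → IsPoly n f → IsPoly n g
    poly-cong e (c , h) = c , λ z → trans (e z) (h z)

    monic-cong : ∀ {n f g} → (∀ z → g z ≡ f z) → IsMonic n f → IsMonic n g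
    monic-cong e (c , h) = c , λ z → trans (e z) (h z)

    eval-0 : ∀ n z → eval (replicate n 0F) z ≡ 0F
    eval-0 zero    z = refl
    eval-0 (suc n) z = trans (⊕-identityˡ _) (trans (cong (z ⊗_) (eval-0 n z)) (⊗-zeroʳ z))

    poly-0 : ∀ n → IsPoly n (λ _ → 0F)
    poly-0 n = replicate n 0F , λ z → sym (eval-0 n z)

    poly-const : ∀ n c → IsPoly (suc n) (λ _ → c)
    poly-const n c = c ∷ replicate n 0F , λ z → sym (trans (cong (λ w → c ⊕ z ⊗ w) (eval-0 n z)) (solve 2 (λ c z → c :+ z :* con 0ℤ := c) refl c z))

    poly-+ : ∀ {n f g} → IsPoly n f → IsPoly n g → IsPoly n (λ z → f z ⊕ g z)
    poly-+ (c , hc) (d , hd) = Vec.zipWith _⊕_ c d , λ z → trans (cong₂ _⊕_ (hc z) (hd z)) (go c d z)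
      where
      go : ∀ {n} (c d : Vec F n) z → eval c z ⊕ eval d z ≡ eval (Vec.zipWith _⊕_ c d) z
      go [] [] z = ⊕-identityˡ _
      go (x ∷ c) (y ∷ d) z = trans (solve 5 (λ x y z a b → (x :+ z :* a) :+ (y :+ z :* b) := (x :+ y) :+ z :* (a :+ b)) refl x y z (eval c z) (eval d z))
        (cong (λ w → (x ⊕ y) ⊕ z ⊗ w) (go c d z))

    poly-scale : ∀ {n f} a → IsPoly n f → IsPoly n (λ z → a ⊗ f z)
    poly-scale a (c , hc) = Vec.map (a ⊗_) c , λ z → trans (cong (a ⊗_) (hc z)) (go c z)
      where
      go : ∀ {n} (c : Vec F n) z → a ⊗ eval c z ≡ eval (Vec.map (a ⊗_) c) z
      go [] z = ⊗-zeroʳ a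
      go (x ∷ c) z = trans (solve 4 (λ a x z b → a :* (x :+ z :* b) := a :* x :+ z :* (a :* b)) refl a x z (eval c z)) (cong (λ w → a ⊗ x ⊕ z ⊗ w) (go c z))

    poly-shift : ∀ {n f} → IsPoly n f → IsPoly (suc n) (λ z → z ⊗ f z)
    poly-shift (c , hc) = 0F ∷ c , λ z → trans (cong (z ⊗_) (hc z)) (sym (⊕-identityˡ _))

    poly-≤ : ∀ {n m f} → n ≤ m → IsPoly n f → IsPoly m f
    poly-≤ {m = m} z≤n ([] , h) = poly-cong h (poly-0 m)
    poly-≤ (s≤s le) (c ∷ cs , h) with poly-≤ le (cs , λ z → refl)
    ... | ds , hd = c ∷ ds , λ z → trans (h z) (cong (λ w → c ⊕ z ⊗ w) (hd z))

    poly-* : ∀ {n m f g} → IsPoly (suc n) f → IsPoly (suc m) g → IsPoly (suc (n ℕ.+ m)) (λ z → f z ⊗ g z)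
    poly-* {zero} {m} {f} {g} (c ∷ [] , hc) pg = poly-cong (λ z → cong (_⊗ g z) (trans (hc z) (solve 2 (λ c z → c :+ z :* con 0ℤ := c) refl c z))) (poly-scale c pg)
    poly-* {suc n} {m} {f} {g} (c ∷ cs , hc) pg = poly-cong
      (λ z → trans (cong (_⊗ g z) (hc z)) (solve 4 (λ c z e g → (c :+ z :* e) :* g := c :* g :+ z :* (e :* g)) refl c z (eval cs z) (g z)))
      (poly-+ (poly-≤ (s≤s (ℕₚ.m≤n+m m (suc n))) (poly-scale c pg)) (poly-shift (poly-* {n} {m} (cs , λ z → refl) pg)))

    poly-^ : ∀ {n f} j → IsPoly (suc n) f → IsPoly (suc (j ℕ.* n)) (λ z → f z ^ j)
    poly-^ zero    pf = poly-const 0 1F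
    poly-^ (suc j) pf = poly-* pf (poly-^ j pf)

    poly-X^ : ∀ n → IsPoly (suc n) (_^ n)
    poly-X^ zero    = poly-const 0 1F
    poly-X^ (suc n) = poly-shift (poly-X^ n)

    monic-1 : IsMonic 0 (λ _ → 1F)
    monic-1 = [] , λ z → refl

    monic-shift : ∀ {n f} → IsMonic n f → IsMonic (suc n) (λ z → z ⊗ f z)
    monic-shift (c , hc) = 0F ∷ c , λ z → trans (cong (z ⊗_) (hc z)) (sym (⊕-identityˡ _))

    monic-X^ : ∀ n → IsMonic n (_^ n)
    monic-X^ zero    = monic-1
    monic-X^ (suc n) = monic-shift (monic-X^ n)

    monic⇒poly : ∀ {n f} → IsMonic n f → IsPoly (suc n) f
    monic⇒poly ([] , h) = poly-cong h (poly-const 0 1F)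
    monic⇒poly (c ∷ cs , h) with monic⇒poly (cs , λ z → refl)
    ... | ds , hd = c ∷ ds , λ z → trans (h z) (cong (λ w → c ⊕ z ⊗ w) (hd z))

    monic-+ : ∀ {n f g} → IsMonic n f → IsPoly n g → IsMonic n (λ z → f z ⊕ g z)
    monic-+ (c , hc) (d , hd) = Vec.zipWith _⊕_ c d , λ z → trans (cong₂ _⊕_ (hc z) (hd z)) (go c d z)
      where
      go : ∀ {n} (c d : Vec F n) z → evalM c z ⊕ eval d z ≡ evalM (Vec.zipWith _⊕_ c d) z
      go [] [] z = ⊕-identityʳ _
      go (x ∷ c) (y ∷ d) z = trans (solve 5 (λ x y z a b → (x :+ z :* a) :+ (y :+ z :* b) := (x :+ y) :+ z :* (a :+ b)) refl x y z (evalM c z) (eval d z))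
        (cong (λ w → (x ⊕ y) ⊕ z ⊗ w) (go c d z))

    monic-* : ∀ {n m f g} → IsMonic n f → IsMonic m g → IsMonic (n ℕ.+ m) (λ z → f z ⊗ g z)
    monic-* {zero} {m} {f} {g} ([] , hc) pg = monic-cong (λ z → trans (cong (_⊗ g z) (hc z)) (⊗-identityˡ _)) pg
    monic-* {suc n} {m} {f} {g} (c ∷ cs , hc) pg = monic-cong
      (λ z → trans (cong (_⊗ g z) (hc z)) (solve 4 (λ c z e g → (c :+ z :* e) :* g := z :* (e :* g) :+ c :* g) refl c z (evalM cs z) (g z)))
      (monic-+ (monic-shift (monic-* {n} {m} (cs , λ z → refl) pg)) (poly-≤ (s≤s (ℕₚ.m≤n+m m n)) (poly-scale c (monic⇒poly pg))))

    monic-^ : ∀ {n f} j → IsMonic n f → IsMonic (j ℕ.* n) (λ z → f z ^ j)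
    monic-^ zero    pf = monic-1
    monic-^ (suc j) pf = monic-* pf (monic-^ j pf)

    divide : ∀ {n} (c : Vec F (suc n)) r → Σ (Vec F n) λ d → ∀ z → evalM c z ⊕ ⊖ evalM c r ≡ (z ⊕ ⊖ r) ⊗ evalM d z
    divide (c ∷ []) r = [] , λ z → solve 3 (λ c z r → (c :+ z :* con 1ℤ) :- (c :+ r :* con 1ℤ) := (z :- r) :* con 1ℤ) refl c z r
    divide (c ∷ cs@(_ ∷ _)) r with divide cs r
    ... | d , hd with monic-+ {f = evalM cs} (cs , λ z → refl) (poly-scale r (monic⇒poly (d , λ z → refl)))
    ... | e , he = e , λ z → trans (solve 5 (λ c z r a b → (c :+ z :* a) :- (c :+ r :* b) := (z :- r) :* a :+ r :* (a :- b)) refl c z r (evalM cs z) (evalM cs r))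
          (trans (cong (λ w → (z ⊕ ⊖ r) ⊗ evalM cs z ⊕ r ⊗ w) (hd z))
          (trans (solve 4 (λ x a r e → x :* a :+ r :* (x :* e) := x :* (a :+ r :* e)) refl (z ⊕ ⊖ r) (evalM cs z) r (evalM d z)) (cong ((z ⊕ ⊖ r) ⊗_) (he z))))

    root-bound : ∀ {n f} → IsMonic n f → ∀ zs → Unique zs → All (λ z → f z ≡ 0F) zs → length zs ≤ n
    root-bound m [] _ _ = z≤n
    root-bound ([] , h) (z ∷ zs) _ (fz≡0 ∷ _) = contradiction (trans (sym (h z)) fz≡0) 1≢0
    root-bound {suc n} {f} (c@(_ ∷ _) , h) (r ∷ zs) (r∉ ∷ u) (fr≡0 ∷ fzs) with divide c r
    ... | d , hd = s≤s (root-bound (d , λ z → refl) zs u (All.zipWith step (r∉ , fzs)))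
      where
      step : ∀ {z} → r ≢ z × f z ≡ 0F → evalM d z ≡ 0F
      step {z} (r≢z , fz≡0) = ⊗-cancelˡ {z ⊕ ⊖ r} (λ e → r≢z (sym (x⊖y≡0 e)))
        (trans (sym (hd z)) (trans (cong₂ (λ x y → x ⊕ ⊖ y) (trans (sym (h z)) fz≡0) (trans (sym (h r)) fr≡0))
          (trans (⊖-inverseʳ 0F) (sym (⊗-zeroʳ _)))))

    comb : ∀ {N} → (ℕ → F) → Vec F N → F
    comb w []               = 0F
    comb {suc N} w (c ∷ cs) = comb w cs ⊕ c ⊗ w N

    comb-cong : ∀ {N} {w w′ : ℕ → F} (c : Vec F N) → (∀ ν → ν < N → w ν ≡ w′ ν) → comb w c ≡ comb w′ c
    comb-cong [] e = refl
    comb-cong {suc N} (c ∷ cs) e = cong₂ _⊕_ (comb-cong cs (λ ν lt → e ν (ℕₚ.m<n⇒m<1+n lt))) (cong (c ⊗_) (e N ℕₚ.≤-refl))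

    comb-scale : ∀ {N} u (w : ℕ → F) (c : Vec F N) → comb (λ ν → u ⊗ w ν) c ≡ u ⊗ comb w c
    comb-scale u w [] = sym (⊗-zeroʳ u)
    comb-scale {suc N} u w (c ∷ cs) = trans (cong (_⊕ c ⊗ (u ⊗ w N)) (comb-scale u w cs))
      (solve 4 (λ u a c w → u :* a :+ c :* (u :* w) := u :* (a :+ c :* w)) refl u (comb w cs) c (w N))

    comb-minus : ∀ {N} (w : ℕ → F) (c d : Vec F N) → comb w (Vec.zipWith (λ x y → x ⊕ ⊖ y) c d) ≡ comb w c ⊕ ⊖ comb w d
    comb-minus w [] [] = sym (⊖-inverseʳ 0F)
    comb-minus {suc N} w (c ∷ cs) (d ∷ ds) = trans (cong (_⊕ (c ⊕ ⊖ d) ⊗ w N) (comb-minus w cs ds))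
      (solve 5 (λ a b c d w → (a :- b) :+ (c :- d) :* w := (a :+ c :* w) :- (b :+ d :* w)) refl (comb w cs) (comb w ds) c d (w N))

    poly-comb : ∀ {N n} (b : ℕ → F → F) → (∀ ν → ν < N → IsPoly n (b ν)) → (c : Vec F N) → IsPoly n (λ z → comb (λ ν → b ν z) c)
    poly-comb {n = n} b hb [] = poly-0 n
    poly-comb {suc N} b hb (c ∷ cs) = poly-+ (poly-comb b (λ ν lt → hb ν (ℕₚ.m<n⇒m<1+n lt)) cs) (poly-scale c (hb N ℕₚ.≤-refl))

    monic-comb-roots : ∀ {N} o (b : ℕ → F → F) → (∀ ν → ν < N → IsMonic (ν ℕ.+ o) (b ν)) → (c : Vec F N) →
      ∀ zs → Unique zs → All (λ z → comb (λ ν → b ν z) c ≡ 0F) zs → N ℕ.+ o ≤ length zs → c ≡ replicate N 0F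
    monic-comb-roots o b hb [] zs u h le = refl
    monic-comb-roots {suc N} o b hb (c ∷ cs) zs u h le with zero? c
    ... | inj₁ refl = cong (0F ∷_) (monic-comb-roots o b (λ ν lt → hb ν (ℕₚ.m<n⇒m<1+n lt)) cs zs u
            (All.map (λ {z} e → trans (solve 2 (λ a w → a := a :+ con 0ℤ :* w) refl (comb (λ ν → b ν z) cs) (b N z)) e) h) (ℕₚ.<⇒≤ le))
    ... | inj₂ c≢0 = contradiction (root-bound top zs u (All.map (λ {z} e → vanish z e) h)) (ℕₚ.<⇒≱ le)
      where
      lower : ∀ z → F
      lower z = comb (λ ν → b ν z) cs
      top : IsMonic (N ℕ.+ o) (λ z → b N z ⊕ inv c ⊗ lower z)
      top = monic-+ (hb N ℕₚ.≤-refl) (poly-scale (inv c) (poly-comb b (λ ν lt → poly-≤ (ℕₚ.+-monoˡ-≤ o lt) (monic⇒poly (hb ν (ℕₚ.m<n⇒m<1+n lt)))) cs))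
      vanish : ∀ z → lower z ⊕ c ⊗ b N z ≡ 0F → b N z ⊕ inv c ⊗ lower z ≡ 0F
      vanish z e = trans (cong (_⊕ inv c ⊗ lower z) (sym (inv-x⊗x⊗y (b N z) c≢0)))
        (trans (solve 4 (λ i c b l → i :* (c :* b) :+ i :* l := i :* (l :+ c :* b)) refl (inv c) c (b N z) (lower z)) (trans (cong (inv c ⊗_) e) (⊗-zeroʳ _)))

    1<q : 1 < q
    1<q = go (complete 0F) (complete 1F)
      where
      go : ∀ {xs : List F} → 0F ∈ xs → 1F ∈ xs → 1 < length xs
      go (here refl) (here e) = contradiction e 1≢0
      go {_ ∷ _ ∷ _} _ _ = s≤s (s≤s z≤n)

    dependent : ∀ {N n} (b : ℕ → F → F) → (∀ ν → ν < N → IsPoly n (b ν)) → n < N →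
      ∃ λ (c : Vec F N) → c ≢ replicate N 0F × (∀ z → comb (λ ν → b ν z) c ≡ 0F)
    dependent {N} {n} b hb n<N with collision (Vec-finite finite N) (Vec-finite finite n)
        (subst₂ _<_ (sym (size-Vec finite n)) (sym (size-Vec finite N)) (ℕₚ.^-monoʳ-< q 1<q n<N)) (λ c → proj₁ (poly-comb b hb c))
    ... | c , d , c≢d , eq = Vec.zipWith (λ x y → x ⊕ ⊖ y) c d , (λ e → c≢d (equal c d e)) ,
          λ z → trans (comb-minus (λ ν → b ν z) c d) (trans (cong₂ (λ x y → x ⊕ ⊖ y) (proj₂ (poly-comb b hb c) z)
            (trans (proj₂ (poly-comb b hb d) z) (cong (λ v → eval v z) (sym eq)))) (⊖-inverseʳ _))
      where
      equal : ∀ {m} (c d : Vec F m) → Vec.zipWith (λ x y → x ⊕ ⊖ y) c d ≡ replicate m 0F → c ≡ d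
      equal [] [] _ = refl
      equal (x ∷ c) (y ∷ d) e = cong₂ _∷_ (x⊖y≡0 (Vecₚ.∷-injectiveˡ e)) (equal c d (Vecₚ.∷-injectiveʳ e))

module Stepanov where

  open import Defs
  open FieldLib
  open Poly
  open import Data.Integer using (1ℤ)
  import Data.List.Relation.Unary.All as All
  open import Data.Nat as ℕ using (ℕ; zero; suc; _≤_; _<_; z≤n; s≤s; _∸_; _+_; _*_; NonZero)
  open import Data.Nat.DivMod as DM using (_/_; _%_)
  import Data.Nat.Properties as ℕₚ
  open import Data.Nat.Tactic.RingSolver using (solve-∀)
  import Data.Sum as Sum
  open import Data.Vec as Vec using ([]; _∷_)

  module _ (𝔽 : FiniteField) (n : ℕ) where
    open Field 𝔽

    PowerAdditive : Set
    PowerAdditive = ∀ x y → (x ⊕ y) ^ n ≡ x ^ n ⊕ y ^ n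

    PowerFixed : F → Set
    PowerFixed x = x ^ n ≡ x

  module FrobeniusTrace (𝔽 : FiniteField) (q₀ : ℕ)
    (frob : PowerAdditive 𝔽 q₀) where
    open Field 𝔽

    frob^ : ∀ i x y → (x ⊕ y) ^ (q₀ ℕ.^ i) ≡ x ^ (q₀ ℕ.^ i) ⊕ y ^ (q₀ ℕ.^ i)
    frob^ zero x y = trans (⊗-identityʳ _) (sym (cong₂ _⊕_ (⊗-identityʳ _) (⊗-identityʳ _)))
    frob^ (suc i) x y = trans (sym (^-assocʳ (x ⊕ y) q₀ (q₀ ℕ.^ i))) (trans (cong (_^ (q₀ ℕ.^ i)) (frob x y))
      (trans (frob^ i _ _) (cong₂ _⊕_ (^-assocʳ x q₀ _) (^-assocʳ y q₀ _))))

    trace : ℕ → F → F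
    trace zero    w = 0F
    trace (suc n) w = trace n w ⊕ w ^ (q₀ ℕ.^ n)

    trace-⊕ : ∀ n x y → trace n (x ⊕ y) ≡ trace n x ⊕ trace n y
    trace-⊕ zero x y = sym (⊕-identityˡ 0F)
    trace-⊕ (suc n) x y = trans (cong₂ _⊕_ (trace-⊕ n x y) (frob^ n x y))
      (solve 4 (λ a b c d → (a :+ b) :+ (c :+ d) := (a :+ c) :+ (b :+ d)) refl (trace n x) (trace n y) (x ^ (q₀ ℕ.^ n)) (y ^ (q₀ ℕ.^ n)))

    trace-+ : ∀ n m w → trace (n + m) w ≡ trace n w ⊕ trace m (w ^ (q₀ ℕ.^ n))
    trace-+ n zero w rewrite ℕₚ.+-identityʳ n = sym (⊕-identityʳ _)
    trace-+ n (suc m) w rewrite ℕₚ.+-suc n m = trans (cong₂ _⊕_ (trace-+ n m w) (trans (cong (w ^_) (ℕₚ.^-distribˡ-+-* q₀ n m)) (sym (^-assocʳ w (q₀ ℕ.^ n) (q₀ ℕ.^ m)))))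
      (⊕-assoc _ _ _)

    trace-^ : ∀ j m w → trace m (w ^ (q₀ ℕ.^ j)) ≡ trace m w ^ (q₀ ℕ.^ j)
    trace-^ j zero w = sym (0^ j)
      where
      0^ : ∀ j → 0F ^ (q₀ ℕ.^ j) ≡ 0F
      0^ j = trans (sym (⊕-identityʳ _)) (trans (cong (0F ^ (q₀ ℕ.^ j) ⊕_) (sym (⊖-inverseʳ (0F ^ (q₀ ℕ.^ j)))))
         (trans (sym (⊕-assoc _ _ _)) (trans (cong (_⊕ ⊖ (0F ^ (q₀ ℕ.^ j))) (trans (sym (frob^ j 0F 0F)) (cong (_^ (q₀ ℕ.^ j)) (⊕-identityˡ 0F)))) (⊖-inverseʳ _))))
    trace-^ j (suc m) w = trans (cong₂ _⊕_ (trace-^ j m w) (trans (^-assocʳ w (q₀ ℕ.^ j) (q₀ ℕ.^ m)) (trans (cong (w ^_) (ℕₚ.*-comm (q₀ ℕ.^ j) (q₀ ℕ.^ m))) (sym (^-assocʳ w (q₀ ℕ.^ m) (q₀ ℕ.^ j)))))) (sym (frob^ j (trace m w) (w ^ (q₀ ℕ.^ m))))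

  module StepanovBound (𝔽 : FiniteField) (q₀ h : ℕ) (3≤q₀ : 3 ≤ q₀)
    (order≡ : FiniteField.order 𝔽 ≡ q₀ ℕ.^ (suc h + suc h))
    (frob : PowerAdditive 𝔽 q₀)
    (a β : FiniteField.F 𝔽) (a^q₀ : PowerFixed 𝔽 q₀ a) where
    open Field 𝔽
    open Polynomial 𝔽
    open FrobeniusTrace 𝔽 q₀ frob

    private
      A s I N o Eq : ℕ
      A = q₀ ℕ.^ h
      s = q₀ ℕ.^ suc h
      I = A + 4
      N = s * I
      o = A * (q₀ ∸ 1)
      Eq = A * s + I + (s + s)

      f : F → F
      f z = z ⊕ a ⊗ inv z

      T : F → F
      T z = trace (suc h) (f z)

      instance
        q₀≢0 : NonZero q₀
        q₀≢0 = ℕ.>-nonZero (ℕₚ.≤-trans (s≤s z≤n) 3≤q₀)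
        A≢0 : NonZero A
        A≢0 = ℕₚ.m^n≢0 q₀ h
        s≢0 : NonZero s
        s≢0 = ℕₚ.m^n≢0 q₀ (suc h)

      1≤A : 1 ≤ A
      1≤A = ℕ.>-nonZero⁻¹ A

      ^s^s : ∀ x → (x ^ s) ^ s ≡ x
      ^s^s x = trans (^-assocʳ x s s) (trans (cong (x ^_) (trans (sym (ℕₚ.^-distribˡ-+-* q₀ (suc h) (suc h))) (sym order≡))) (fermat x))

      ^s-twice : ∀ {n} (c : Vec F n) → Vec.map (_^ s) (Vec.map (_^ s) c) ≡ c
      ^s-twice []      = refl
      ^s-twice (x ∷ c) = cong₂ _∷_ (^s^s x) (^s-twice c)

      0^s : 0F ^ s ≡ 0F
      0^s with s | s≢0
      ... | suc n | _ = ⊗-zeroˡ _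

      a^ : ∀ i → a ^ (q₀ ℕ.^ i) ≡ a
      a^ zero = ⊗-identityʳ a
      a^ (suc i) = trans (sym (^-assocʳ a q₀ _)) (trans (cong (_^ (q₀ ℕ.^ i)) a^q₀) (a^ i))

      f^ : ∀ i z → f z ^ (q₀ ℕ.^ i) ≡ z ^ (q₀ ℕ.^ i) ⊕ a ⊗ inv z ^ (q₀ ℕ.^ i)
      f^ i z = trans (frob^ i z (a ⊗ inv z)) (cong (z ^ (q₀ ℕ.^ i) ⊕_) (trans (^-distrib-* a (inv z) (q₀ ℕ.^ i)) (cong (_⊗ inv z ^ (q₀ ℕ.^ i)) (a^ i))))

      clear : ∀ {z} → z ≢ 0F → ∀ n m → n ≤ m → z ^ m ⊗ inv z ^ n ≡ z ^ (m ∸ n)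
      clear {z} z≢0 n m n≤m = begin
        z ^ m ⊗ inv z ^ n ≡⟨ cong (λ k → z ^ k ⊗ inv z ^ n) (sym (ℕₚ.m∸n+n≡m n≤m)) ⟩
        z ^ (m ∸ n + n) ⊗ inv z ^ n ≡⟨ cong (_⊗ inv z ^ n) (^-homo-* z (m ∸ n) n) ⟩
        z ^ (m ∸ n) ⊗ z ^ n ⊗ inv z ^ n ≡⟨ ⊗-assoc _ _ _ ⟩
        z ^ (m ∸ n) ⊗ (z ^ n ⊗ inv z ^ n) ≡⟨ cong (z ^ (m ∸ n) ⊗_) (trans (sym (^-distrib-* z (inv z) n)) (trans (cong (_^ n) (inv-r z≢0)) (1^ n))) ⟩
        z ^ (m ∸ n) ⊗ 1F ≡⟨ ⊗-identityʳ _ ⟩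
        z ^ (m ∸ n) ∎
        where open ≡-Reasoning

      -- z ^ A ⊗ T z cleared of negative powers of z
      τ-part : ℕ → F → F
      τ-part zero    z = 0F
      τ-part (suc i) z = τ-part i z ⊕ (z ^ (A + q₀ ℕ.^ i) ⊕ a ⊗ z ^ (A ∸ q₀ ℕ.^ i))

      τ : F → F
      τ = τ-part (suc h)

      τ-part≡ : ∀ {z} → z ≢ 0F → ∀ i → i ≤ suc h → τ-part i z ≡ z ^ A ⊗ trace i (f z)
      τ-part≡ {z} z≢0 zero _ = sym (⊗-zeroʳ _)
      τ-part≡ {z} z≢0 (suc i) (s≤s i≤h) = begin
        τ-part i z ⊕ (z ^ (A + Q) ⊕ a ⊗ z ^ (A ∸ Q))
          ≡⟨ cong₂ _⊕_ (τ-part≡ z≢0 i (ℕₚ.m≤n⇒m≤1+n i≤h)) (cong₂ _⊕_ (^-homo-* z A Q) (cong (a ⊗_) (sym (clear z≢0 Q A (ℕₚ.^-monoʳ-≤ q₀ i≤h))))) ⟩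
        z ^ A ⊗ trace i (f z) ⊕ (z ^ A ⊗ z ^ Q ⊕ a ⊗ (z ^ A ⊗ inv z ^ Q))
          ≡⟨ solve 5 (λ y t x a w → y :* t :+ (y :* x :+ a :* (y :* w)) := y :* (t :+ (x :+ a :* w))) refl (z ^ A) (trace i (f z)) (z ^ Q) a (inv z ^ Q) ⟩
        z ^ A ⊗ (trace i (f z) ⊕ (z ^ Q ⊕ a ⊗ inv z ^ Q)) ≡⟨ cong (λ w → z ^ A ⊗ (trace i (f z) ⊕ w)) (sym (f^ i z)) ⟩
        z ^ A ⊗ (trace i (f z) ⊕ f z ^ Q) ∎
        where open ≡-Reasoning
              Q = q₀ ℕ.^ i

      τ-lower : ∀ i → i ≤ h → IsPoly (A + A) (τ-part i)
      τ-lower zero _ = poly-0 (A + A)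
      τ-lower (suc i) i<h = poly-+ (τ-lower i (ℕₚ.<⇒≤ i<h)) (poly-+
          (poly-≤ (ℕₚ.+-monoʳ-< A Q<A) (poly-X^ (A + Q)))
          (poly-scale a (poly-≤ (s≤s (ℕₚ.≤-trans (ℕₚ.m∸n≤m A Q) (ℕₚ.m≤m+n A _)) ∙ ℕₚ.+-monoʳ-< A 1≤A) (poly-X^ (A ∸ Q)))))
        where
        Q = q₀ ℕ.^ i
        Q<A : Q < A
        Q<A = ℕₚ.^-monoʳ-< q₀ (ℕₚ.≤-trans (s≤s (s≤s z≤n)) 3≤q₀) i<h
        _∙_ : suc (A ∸ Q) ≤ suc (A + 0) → suc (A + 0) ≤ A + A → suc (A ∸ Q) ≤ A + A
        p ∙ q = ℕₚ.≤-trans p q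

      τ-monic : IsMonic (A + A) τ
      τ-monic = monic-cong (λ z → solve 3 (λ l x y → l :+ (x :+ y) := x :+ (l :+ y)) refl (τ-part h z) _ _)
        (monic-+ (monic-X^ (A + A)) (poly-+ (τ-lower h ℕₚ.≤-refl) (poly-scale a (poly-≤ (ℕₚ.≤-trans (s≤s (ℕₚ.≤-reflexive (ℕₚ.n∸n≡0 A))) (ℕₚ.≤-trans 1≤A (ℕₚ.m≤m+n A A))) (poly-X^ (A ∸ A))))))

      -- ν = k + A j + s i with k < A and j < q₀
      i′ j′ k′ : ℕ → ℕ
      i′ ν = ν / s
      j′ ν = (ν % s) / A
      k′ ν = (ν % s) % A

      ν≡ : ∀ ν → ν ≡ k′ ν + j′ ν * A + i′ ν * s
      ν≡ ν = trans (DM.m≡m%n+[m/n]*n ν s) (cong (_+ i′ ν * s) (DM.m≡m%n+[m/n]*n (ν % s) A))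

      j<q₀ : ∀ ν → j′ ν < q₀
      j<q₀ ν = DM.m<n*o⇒m/o<n (DM.m%n<n ν s)

      k<A : ∀ ν → k′ ν < A
      k<A ν = DM.m%n<n (ν % s) A

      i<I : ∀ ν → ν < N → i′ ν < I
      i<I ν lt = DM.m<n*o⇒m/o<n (subst (ν <_) (ℕₚ.*-comm s I) lt)

      basis constraint : ℕ → F → F
      basis ν z = z ^ (k′ ν + i′ ν * s) ⊗ (τ z ^ j′ ν ⊗ z ^ ((q₀ ∸ 1 ∸ j′ ν) * A))
      constraint ν z = z ^ (k′ ν * s + i′ ν) ⊗ ((β ⊗ z ^ A ⊕ ⊖ τ z) ^ j′ ν ⊗ z ^ ((q₀ ∸ 1 ∸ j′ ν) * A))

      j+rest : ∀ ν → j′ ν + (q₀ ∸ 1 ∸ j′ ν) ≡ q₀ ∸ 1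
      j+rest ν = ℕₚ.m+[n∸m]≡n (ℕₚ.∸-monoˡ-≤ 1 (j<q₀ ν))

      basis-degree : ∀ ν → k′ ν + i′ ν * s + (j′ ν * (A + A) + (q₀ ∸ 1 ∸ j′ ν) * A) ≡ ν + o
      basis-degree ν = trans (arith (k′ ν) (i′ ν * s) (j′ ν) A (q₀ ∸ 1 ∸ j′ ν)) (cong₂ _+_ (sym (ν≡ ν)) (cong (A *_) (j+rest ν)))
        where
        arith : ∀ k is j A r → k + is + (j * (A + A) + r * A) ≡ k + j * A + is + A * (j + r)
        arith = solve-∀

      basis-monic : ∀ ν → IsMonic (ν + o) (basis ν)
      basis-monic ν = subst (λ n → IsMonic n (basis ν)) (basis-degree ν)
        (monic-* (monic-X^ (k′ ν + i′ ν * s)) (monic-* (monic-^ (j′ ν) τ-monic) (monic-X^ ((q₀ ∸ 1 ∸ j′ ν) * A))))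

      constraint-degree : ∀ ν → ν < N → suc (k′ ν * s + i′ ν + (j′ ν * (A + A) + (q₀ ∸ 1 ∸ j′ ν) * A)) ≤ Eq
      constraint-degree ν lt = begin
        suc (k′ ν * s + i′ ν + (j′ ν * (A + A) + (q₀ ∸ 1 ∸ j′ ν) * A)) ≡⟨ arith (k′ ν * s) (i′ ν) (j′ ν) A (q₀ ∸ 1 ∸ j′ ν) ⟩
        k′ ν * s + suc (i′ ν) + (j′ ν * A + (j′ ν + (q₀ ∸ 1 ∸ j′ ν)) * A) ≡⟨ cong (λ r → k′ ν * s + suc (i′ ν) + (j′ ν * A + r * A)) (j+rest ν) ⟩
        k′ ν * s + suc (i′ ν) + (j′ ν * A + (q₀ ∸ 1) * A) ≤⟨ ℕₚ.+-mono-≤ (ℕₚ.+-mono-≤ (ℕₚ.*-monoˡ-≤ s (ℕₚ.<⇒≤ (k<A ν))) (i<I ν lt))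
              (ℕₚ.+-mono-≤ (ℕₚ.*-monoˡ-≤ A (ℕₚ.<⇒≤ (j<q₀ ν))) (ℕₚ.*-monoˡ-≤ A (ℕₚ.m∸n≤m q₀ 1))) ⟩
        Eq ∎
        where
        open ℕₚ.≤-Reasoning
        arith : ∀ ks i j A r → suc (ks + i + (j * (A + A) + r * A)) ≡ ks + suc i + (j * A + (j + r) * A)
        arith = solve-∀

      constraint-poly : ∀ ν → ν < N → IsPoly Eq (constraint ν)
      constraint-poly ν lt = poly-≤ (constraint-degree ν lt)
        (poly-* (poly-X^ (k′ ν * s + i′ ν)) (poly-* (poly-^ (j′ ν) inner) (poly-X^ ((q₀ ∸ 1 ∸ j′ ν) * A))))
        where
        inner : IsPoly (suc (A + A)) (λ z → β ⊗ z ^ A ⊕ ⊖ τ z)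
        inner = poly-cong (λ z → solve 2 (λ x y → x :- y := x :+ (:- con 1ℤ) :* y) refl (β ⊗ z ^ A) (τ z))
          (poly-+ (poly-scale β (poly-≤ (s≤s (ℕₚ.m≤m+n A A)) (poly-X^ A))) (poly-scale (⊖ 1F) (monic⇒poly τ-monic)))

      Eq<N : Eq < N
      Eq<N = begin
        suc (A * s + (A + 4) + (s + s))           ≡⟨ a1 A s ⟩
        A * s + (s + s) + (A + 5 * 1)             ≤⟨ ℕₚ.+-monoʳ-≤ (A * s + (s + s)) (ℕₚ.+-monoʳ-≤ A (ℕₚ.*-monoʳ-≤ 5 1≤A)) ⟩
        A * s + (s + s) + (A + 5 * A)             ≡⟨ cong (A * s + (s + s) +_) (a2 A) ⟩
        A * s + (s + s) + (3 * A + 3 * A)         ≤⟨ ℕₚ.+-monoʳ-≤ (A * s + (s + s)) (ℕₚ.+-mono-≤ (ℕₚ.*-monoˡ-≤ A 3≤q₀) (ℕₚ.*-monoˡ-≤ A 3≤q₀)) ⟩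
        A * s + (s + s) + (s + s)                 ≡⟨ a3 A s ⟩
        s * (A + 4) ∎
        where
        open ℕₚ.≤-Reasoning
        a1 : ∀ A s → suc (A * s + (A + 4) + (s + s)) ≡ A * s + (s + s) + (A + 5 * 1)
        a1 = solve-∀
        a2 : ∀ A → A + 5 * A ≡ 3 * A + 3 * A
        a2 = solve-∀
        a3 : ∀ A s → A * s + (s + s) + (s + s) ≡ s * (A + 4)
        a3 = solve-∀

      term : F → ℕ → F
      term z ν = z ^ k′ ν ⊗ (T z ^ j′ ν ⊗ z ^ (i′ ν * s))

      clearing : F → F
      clearing z = z ^ ((q₀ ∸ 1) * A)

      -- both families are cleared of denominators by the factor z ^ (A (q₀ − 1)) : a power of z ^ A for each possible factor T
      cleared : ∀ {z} → z ≢ 0F → ∀ x t y ν → x ⊗ ((z ^ A ⊗ t) ^ j′ ν ⊗ z ^ ((q₀ ∸ 1 ∸ j′ ν) * A)) ⊗ y ≡ clearing z ⊗ (x ⊗ (t ^ j′ ν ⊗ y))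
      cleared {z} z≢0 x t y ν = begin
        x ⊗ ((z ^ A ⊗ t) ^ j ⊗ z ^ (r * A)) ⊗ y
          ≡⟨ cong (λ w → x ⊗ (w ⊗ z ^ (r * A)) ⊗ y) (trans (^-distrib-* (z ^ A) t j) (cong (_⊗ t ^ j) (trans (^-assocʳ z A j) (cong (z ^_) (ℕₚ.*-comm A j))))) ⟩
        x ⊗ (z ^ (j * A) ⊗ t ^ j ⊗ z ^ (r * A)) ⊗ y
          ≡⟨ solve 5 (λ x u t v y → x :* (u :* t :* v) :* y := (u :* v) :* (x :* (t :* y))) refl x (z ^ (j * A)) (t ^ j) (z ^ (r * A)) y ⟩
        z ^ (j * A) ⊗ z ^ (r * A) ⊗ (x ⊗ (t ^ j ⊗ y))
          ≡⟨ cong (_⊗ (x ⊗ (t ^ j ⊗ y))) (trans (sym (^-homo-* z (j * A) (r * A))) (cong (z ^_) (trans (sym (ℕₚ.*-distribʳ-+ A j r)) (cong (_* A) (j+rest ν))))) ⟩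
        clearing z ⊗ (x ⊗ (t ^ j ⊗ y)) ∎
        where open ≡-Reasoning
              j = j′ ν
              r = q₀ ∸ 1 ∸ j′ ν

      basis≡ : ∀ {z} → z ≢ 0F → ∀ ν → basis ν z ≡ clearing z ⊗ term z ν
      basis≡ {z} z≢0 ν = begin
        z ^ (k′ ν + i′ ν * s) ⊗ (τ z ^ j′ ν ⊗ R) ≡⟨ cong₂ (λ x t → x ⊗ (t ^ j′ ν ⊗ R)) (^-homo-* z (k′ ν) (i′ ν * s)) (τ-part≡ z≢0 (suc h) ℕₚ.≤-refl) ⟩
        z ^ k′ ν ⊗ z ^ (i′ ν * s) ⊗ ((z ^ A ⊗ T z) ^ j′ ν ⊗ R) ≡⟨ solve 3 (λ x y w → (x :* y) :* w := (x :* w) :* y) refl (z ^ k′ ν) (z ^ (i′ ν * s)) _ ⟩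
        z ^ k′ ν ⊗ ((z ^ A ⊗ T z) ^ j′ ν ⊗ R) ⊗ z ^ (i′ ν * s) ≡⟨ cleared z≢0 (z ^ k′ ν) (T z) (z ^ (i′ ν * s)) ν ⟩
        clearing z ⊗ term z ν ∎
        where open ≡-Reasoning
              R = z ^ ((q₀ ∸ 1 ∸ j′ ν) * A)

      monomial^s : ∀ z t b → t ^ s ≡ b → ∀ k j i → (z ^ k ⊗ (t ^ j ⊗ z ^ (i * s))) ^ s ≡ z ^ (k * s) ⊗ (b ^ j ⊗ z ^ i)
      monomial^s z t b t^s≡b k j i = begin
        (z ^ k ⊗ (t ^ j ⊗ z ^ (i * s))) ^ s             ≡⟨ ^-distrib-* (z ^ k) (t ^ j ⊗ z ^ (i * s)) s ⟩
        (z ^ k) ^ s ⊗ (t ^ j ⊗ z ^ (i * s)) ^ s         ≡⟨ cong₂ _⊗_ (^-assocʳ z k s) (^-distrib-* (t ^ j) (z ^ (i * s)) s) ⟩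
        z ^ (k * s) ⊗ ((t ^ j) ^ s ⊗ (z ^ (i * s)) ^ s) ≡⟨ cong (z ^ (k * s) ⊗_) (cong₂ _⊗_ (trans (^-comm t j s) (cong (_^ j) t^s≡b)) last) ⟩
        z ^ (k * s) ⊗ (b ^ j ⊗ z ^ i) ∎
        where
        open ≡-Reasoning
        ^-comm : ∀ x m n → (x ^ m) ^ n ≡ (x ^ n) ^ m
        ^-comm x m n = trans (^-assocʳ x m n) (trans (cong (x ^_) (ℕₚ.*-comm m n)) (sym (^-assocʳ x n m)))
        last : (z ^ (i * s)) ^ s ≡ z ^ i
        last = trans (cong (_^ s) (sym (^-assocʳ z i s))) (^s^s (z ^ i))

      module _ {z : F} (z≢0 : z ≢ 0F) (tr≡ : trace (suc h + suc h) (f z) ≡ β) where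

        T^s : T z ^ s ≡ β ⊕ ⊖ T z
        T^s = trans (solve 2 (λ x y → y := (x :+ y) :- x) refl (T z) (T z ^ s))
          (cong (_⊕ ⊖ T z) (trans (cong (T z ⊕_) (sym (trace-^ (suc h) (suc h) (f z)))) (trans (sym (trace-+ (suc h) (suc h) (f z))) tr≡)))

        constraint≡ : ∀ ν → constraint ν z ≡ clearing z ⊗ term z ν ^ s
        constraint≡ ν = begin
          z ^ (k′ ν * s + i′ ν) ⊗ ((β ⊗ z ^ A ⊕ ⊖ τ z) ^ j′ ν ⊗ R)
            ≡⟨ cong₂ (λ x t → x ⊗ (t ^ j′ ν ⊗ R)) (^-homo-* z (k′ ν * s) (i′ ν))
                 (trans (cong (λ t → β ⊗ z ^ A ⊕ ⊖ t) (τ-part≡ z≢0 (suc h) ℕₚ.≤-refl)) (solve 3 (λ b x t → b :* x :- x :* t := x :* (b :- t)) refl β (z ^ A) (T z))) ⟩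
          z ^ (k′ ν * s) ⊗ z ^ i′ ν ⊗ ((z ^ A ⊗ (β ⊕ ⊖ T z)) ^ j′ ν ⊗ R) ≡⟨ solve 3 (λ x y w → (x :* y) :* w := (x :* w) :* y) refl (z ^ (k′ ν * s)) (z ^ i′ ν) _ ⟩
          z ^ (k′ ν * s) ⊗ ((z ^ A ⊗ (β ⊕ ⊖ T z)) ^ j′ ν ⊗ R) ⊗ z ^ i′ ν ≡⟨ cleared z≢0 _ (β ⊕ ⊖ T z) (z ^ i′ ν) ν ⟩
          clearing z ⊗ (z ^ (k′ ν * s) ⊗ ((β ⊕ ⊖ T z) ^ j′ ν ⊗ z ^ i′ ν))
            ≡⟨ cong (clearing z ⊗_) (sym (monomial^s z (T z) (β ⊕ ⊖ T z) T^s (k′ ν) (j′ ν) (i′ ν))) ⟩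
          clearing z ⊗ term z ν ^ s ∎
          where open ≡-Reasoning
                R = z ^ ((q₀ ∸ 1 ∸ j′ ν) * A)

        comb-^s : ∀ {n} (w : ℕ → F) (c : Vec F n) → comb w c ^ s ≡ comb (λ ν → w ν ^ s) (Vec.map (_^ s) c)
        comb-^s w [] = 0^s
        comb-^s {suc n} w (c ∷ cs) = trans (frob^ (suc h) (comb w cs) (c ⊗ w n)) (cong₂ _⊕_ (comb-^s w cs) (^-distrib-* c (w n) s))

        vanishing : (c : Vec F N) → comb (λ ν → constraint ν z) c ≡ 0F → comb (λ ν → basis ν z) (Vec.map (_^ s) c) ≡ 0F
        vanishing c e with zero? (comb (term z) (Vec.map (_^ s) c))
        ... | inj₁ e0 = trans (trans (comb-cong (Vec.map (_^ s) c) (λ ν _ → basis≡ z≢0 ν)) (comb-scale (clearing z) (term z) (Vec.map (_^ s) c)))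
                          (trans (cong (clearing z ⊗_) e0) (⊗-zeroʳ _))
        ... | inj₂ ne = contradiction (begin
            clearing z ⊗ comb (term z) (Vec.map (_^ s) c) ^ s ≡⟨ cong (clearing z ⊗_) (comb-^s (term z) (Vec.map (_^ s) c)) ⟩
            clearing z ⊗ comb (λ ν → term z ν ^ s) (Vec.map (_^ s) (Vec.map (_^ s) c)) ≡⟨ cong (λ d → clearing z ⊗ comb (λ ν → term z ν ^ s) d) (^s-twice c) ⟩
            clearing z ⊗ comb (λ ν → term z ν ^ s) c ≡⟨ sym (comb-scale (clearing z) _ c) ⟩
            comb (λ ν → clearing z ⊗ term z ν ^ s) c ≡⟨ comb-cong c (λ ν _ → sym (constraint≡ ν)) ⟩
            comb (λ ν → constraint ν z) c ≡⟨ e ⟩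
            0F ∎) (⊗-≢0 (^-≢0 ((q₀ ∸ 1) * A) z≢0) (^-≢0 s ne))
          where open ≡-Reasoning

      map-0^s : ∀ n → Vec.map (_^ s) (replicate n 0F) ≡ replicate n 0F
      map-0^s zero    = refl
      map-0^s (suc n) = cong₂ _∷_ 0^s (map-0^s n)

      Zero : F → Set
      Zero z = z ≢ 0F × trace (suc h + suc h) (f z) ≡ β

      trivial : ∀ zs → Unique zs → All Zero zs → N + o ≤ length zs →
        (c : Vec F N) → (∀ z → comb (λ ν → constraint ν z) c ≡ 0F) → c ≡ replicate N 0F
      trivial zs u hyp le c ec = trans (sym (^s-twice c)) (trans (cong (Vec.map (_^ s)) zeroes) (map-0^s N))
        where
        zeroes : Vec.map (_^ s) c ≡ replicate N 0F
        zeroes = monic-comb-roots o basis (λ ν _ → basis-monic ν) (Vec.map (_^ s) c) zs u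
          (All.map (λ {z} hz → vanishing (proj₁ hz) (proj₂ hz) c (ec z)) hyp) le

      total : N + o ≤ s * (A + 5)
      total = begin
        s * (A + 4) + A * (q₀ ∸ 1) ≤⟨ ℕₚ.+-monoʳ-≤ (s * (A + 4)) (ℕₚ.*-monoʳ-≤ A (ℕₚ.m∸n≤m q₀ 1)) ⟩
        s * (A + 4) + A * q₀       ≡⟨ cong (s * (A + 4) +_) (ℕₚ.*-comm A q₀) ⟩
        s * (A + 4) + s            ≡⟨ arith A s ⟩
        s * (A + 5) ∎
        where
        open ℕₚ.≤-Reasoning
        arith : ∀ A s → s * (A + 4) + s ≡ s * (A + 5)
        arith = solve-∀

    stepanov : ∀ zs → Unique zs → All (λ z → z ≢ 0F × trace (suc h + suc h) (z ⊕ a ⊗ inv z) ≡ β) zs →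
               length zs ≤ q₀ ℕ.^ suc h * (q₀ ℕ.^ h + 5)
    stepanov zs u hyp = Sum.[ (λ le → contradiction (trivial zs u hyp le c ec) c≢0) , (λ lt → ℕₚ.≤-trans (ℕₚ.<⇒≤ lt) total) ]′
                          (ℕₚ.≤-<-connex (N + o) (length zs))
      where
      dep = dependent constraint constraint-poly Eq<N
      c = proj₁ dep
      c≢0 = proj₁ (proj₂ dep)
      ec = proj₂ (proj₂ dep)

module Weil where

  open import Defs
  open SumLib
  open IntSum
  open FieldLib
  open Squares
  open QuadExt
  open Poly
  open Stepanov
  open import Data.Integer as ℤ using (ℤ; +_; 0ℤ; 1ℤ; _+_; _*_; -_; _-_; _≤_; _<_; +≤+; +<+)
  import Data.Integer.Properties as ℤₚ
  open import Data.Integer.Tactic.RingSolver using (solve-∀)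
  import Data.List.Relation.Unary.All as All
  import Data.List.Relation.Unary.Unique.Propositional.Properties as Uniq
  open import Data.Nat as ℕ using (ℕ; zero; suc)
  open import Data.Nat.Primality using (Prime; prime⇒nonZero; prime⇒nonTrivial)
  import Data.Nat.Properties as ℕₚ
  import Data.Sum as Sum
  open import Relation.Nullary.Decidable using (¬?)

  ∑-filter : ∀ {A : Set} {P : A → Set} (P? : ∀ x → Dec (P x)) xs → ∑ xs (λ x → ind (P? x)) ≡ + length (filter P? xs)
  ∑-filter P? [] = refl
  ∑-filter P? (x ∷ xs) with P? x
  ... | yes _ = cong (λ z → 1ℤ + z) (∑-filter P? xs)
  ... | no _  = trans (ℤₚ.+-identityˡ _) (∑-filter P? xs)

  ≤-<-connexℤ : ∀ i j → i ≤ j ⊎ j < i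
  ≤-<-connexℤ i j with i ℤₚ.≤? j
  ... | yes le = inj₁ le
  ... | no nle = inj₂ (ℤₚ.≰⇒> nle)

  excess-growth : ∀ (n : ℕ) (s′ N x y S : ℤ) (c : ℕ) → 0ℤ < N → 1 ℕ.≤ c → s′ ≡ + n * + n →
    S + y ≡ + 2 * (s′ * N) → x * x ≤ S * N → (+ 2 + + c) * + n * N ≤ - x → (+ 2 + + suc c) * s′ * N ≤ - y
  excess-growth n s′ N x y S c N>0 1≤c refl S+y cs excess = ℤₚ.*-cancelˡ-≤-pos _ _ N {{ℤ.positive N>0}} (begin
    N * ((+ 2 + + suc c) * (s * s) * N) ≡⟨ cong (λ z → N * ((+ 2 + z) * (s * s) * N)) (ℤₚ.pos-+ 1 c) ⟩
    N * ((+ 2 + (1ℤ + + c)) * (s * s) * N) ≡⟨ e1 N s (+ c) ⟩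
    (+ 2 + (1ℤ + + c)) * ((s * N) * (s * N)) ≤⟨ ℤₚ.*-monoʳ-≤-nonNeg ((s * N) * (s * N)) {{ℤ.nonNegative (0≤i*i (s * N))}} coefficient ⟩
    (C * C - + 2) * ((s * N) * (s * N)) ≡⟨ e2 C s N ⟩
    (C * s * N) * (C * s * N) - + 2 * (s * s * N) * N ≤⟨ ℤₚ.+-monoˡ-≤ (- (+ 2 * (s * s * N) * N)) squares ⟩
    S * N - + 2 * (s * s * N) * N ≡⟨ cong (λ z → S * N - z * N) (sym S+y) ⟩
    S * N - (S + y) * N ≡⟨ e3 S N y ⟩
    N * - y ∎)
    where
    open ℤₚ.≤-Reasoning
    s C : ℤ
    s = + n
    C = + 2 + + c
    CsN≥0 : 0ℤ ≤ C * s * N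
    CsN≥0 = subst (0ℤ ≤_) (cong (_* N) (ℤₚ.pos-* (2 ℕ.+ c) n)) (subst (_≤ + ((2 ℕ.+ c) ℕ.* n) * N) (ℤₚ.*-zeroʳ (+ ((2 ℕ.+ c) ℕ.* n))) (ℤₚ.*-monoˡ-≤-nonNeg (+ ((2 ℕ.+ c) ℕ.* n)) (ℤₚ.<⇒≤ N>0)))
    neg² : ∀ x → (- x) * (- x) ≡ x * x
    neg² = solve-∀
    squares : (C * s * N) * (C * s * N) ≤ S * N
    squares = begin
      (C * s * N) * (C * s * N) ≤⟨ ℤₚ.*-monoʳ-≤-nonNeg (C * s * N) {{ℤ.nonNegative CsN≥0}} excess ⟩
      (- x) * (C * s * N)       ≤⟨ ℤₚ.*-monoˡ-≤-nonNeg (- x) {{ℤ.nonNegative (ℤₚ.≤-trans CsN≥0 excess)}} excess ⟩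
      (- x) * (- x)             ≡⟨ neg² x ⟩
      x * x                     ≤⟨ cs ⟩
      S * N ∎
    e1 : ∀ N s c → N * ((+ 2 + (1ℤ + c)) * (s * s) * N) ≡ (+ 2 + (1ℤ + c)) * ((s * N) * (s * N))
    e1 = solve-∀
    e2 : ∀ C s N → (C * C - + 2) * ((s * N) * (s * N)) ≡ (C * s * N) * (C * s * N) - + 2 * (s * s * N) * N
    e2 = solve-∀
    e3 : ∀ S N y → S * N - (S + y) * N ≡ N * - y
    e3 = solve-∀
    e4 : ∀ c → (+ 2 + c) * (+ 2 + c) - + 2 ≡ (+ 2 + (1ℤ + c)) + (c * c + + 2 * c + (c - 1ℤ))
    e4 = solve-∀
    coefficient : + 2 + (1ℤ + + c) ≤ C * C - + 2
    coefficient = subst (+ 2 + (1ℤ + + c) ≤_) (sym (e4 (+ c)))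
      (subst (_≤ + 2 + (1ℤ + + c) + (+ c * + c + + 2 * + c + (+ c - 1ℤ))) (ℤₚ.+-identityʳ _)
        (ℤₚ.+-monoʳ-≤ (+ 2 + (1ℤ + + c)) (ℤₚ.+-mono-≤ (ℤₚ.+-mono-≤ (0≤i*i (+ c)) (subst (0ℤ ≤_) (ℤₚ.pos-* 2 c) (+≤+ ℕ.z≤n))) (ℤₚ.i≤j⇒0≤j-i (+≤+ 1≤c)))))

  module PositiveDefinite (𝔽 : FiniteField) where
    open Field 𝔽
    open NullSum 𝔽

    record Autocorrelation (ℓ : F → ℤ) : Set₁ where
      field
        null     : Null ℓ
        even     : ∀ x → ℓ (⊖ x) ≡ ℓ x
        positive : ∀ {A : Set} (xs : List A) (c : A → ℤ) (φ : A → F) →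
                   0ℤ ≤ ∑ xs (λ i → ∑ xs (λ j → c i * c j * ℓ (φ i ⊕ ⊖ φ j)))

      private
        N = ℓ 0F

      at-difference : ∀ x y → ℓ (x ⊕ ⊖ y) ≡ ℓ (y ⊕ ⊖ x)
      at-difference x y = trans (sym (even (x ⊕ ⊖ y))) (cong ℓ (solve 2 (λ x y → :- (x :- y) := y :- x) refl x y))

      ℓ0≥0 : 0ℤ ≤ ℓ 0F
      ℓ0≥0 = subst (0ℤ ≤_) (trans (simplify (ℓ (0F ⊕ ⊖ 0F))) (cong ℓ (⊖-inverseʳ 0F))) (positive (0F ∷ []) (λ _ → 1ℤ) (λ x → x))
        where
        simplify : ∀ x → 1ℤ * 1ℤ * x + 0ℤ + 0ℤ ≡ x
        simplify = solve-∀

      expand : ∀ {A : Set} (xs : List A) (c : A → ℤ) (φ : A → F) (n m : ℤ) →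
        0ℤ ≤ n * n * ∑ xs (λ i → ∑ xs (λ j → c i * c j * ℓ (φ i ⊕ ⊖ φ j))) - + 2 * (n * m * ∑ xs (λ i → c i * ℓ (φ i))) + m * m * N
      expand {A} xs c φ n m = subst (0ℤ ≤_) eq (positive (nothing ∷ map just xs) c′ φ′)
        where
        c′ : Maybe A → ℤ
        c′ nothing  = - m
        c′ (just x) = n * c x
        φ′ : Maybe A → F
        φ′ nothing  = 0F
        φ′ (just x) = φ x
        X = ∑ xs (λ i → c i * ℓ (φ i))
        S = ∑ xs (λ i → ∑ xs (λ j → c i * c j * ℓ (φ i ⊕ ⊖ φ j)))
        ys = nothing ∷ map just xs
        term : Maybe A → Maybe A → ℤ
        term i j = c′ i * c′ j * ℓ (φ′ i ⊕ ⊖ φ′ j)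
        r1 : ∀ m n c l → (- m) * (n * c) * l ≡ - (n * m) * (c * l)
        r1 = solve-∀
        r2 : ∀ m n c l → (n * c) * (- m) * l ≡ - (n * m) * (c * l)
        r2 = solve-∀
        r3 : ∀ n c d l → (n * c) * (n * d) * l ≡ n * n * (c * d * l)
        r3 = solve-∀
        r4 : ∀ n m N S X → ((- m) * (- m) * N + - (n * m) * X) + (- (n * m) * X + n * n * S) ≡ n * n * S - + 2 * (n * m * X) + m * m * N
        r4 = solve-∀
        row0 : ∑ (map just xs) (term nothing) ≡ - (n * m) * X
        row0 = trans (∑-map just xs _) (trans (∑-cong xs (λ i → trans (cong (λ z → (- m) * (n * c i) * z) (trans (cong ℓ (⊕-identityˡ _)) (even (φ i)))) (r1 m n (c i) (ℓ (φ i))))) (∑-*ˡ xs (- (n * m)) _))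
        col0 : ∑ xs (λ i → term (just i) nothing) ≡ - (n * m) * X
        col0 = trans (∑-cong xs (λ i → trans (cong (λ z → (n * c i) * (- m) * ℓ z) (trans (cong (φ i ⊕_) -0#≈0#) (⊕-identityʳ _))) (r2 m n (c i) (ℓ (φ i))))) (∑-*ˡ xs (- (n * m)) _)
        rest : ∑ xs (λ i → ∑ (map just xs) (term (just i))) ≡ n * n * S
        rest = trans (∑-cong xs (λ i → trans (∑-map just xs _) (trans (∑-cong xs (λ j → r3 n (c i) (c j) _)) (∑-*ˡ xs (n * n) _)))) (∑-*ˡ xs (n * n) _)
        eq : ∑ ys (λ i → ∑ ys (term i)) ≡ n * n * S - + 2 * (n * m * X) + m * m * N
        eq = trans (cong₂ _+_ (cong₂ _+_ (cong (λ z → (- m) * (- m) * ℓ z) (⊖-inverseʳ 0F)) row0)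
               (trans (∑-map just xs _) (trans (∑-∙ xs _ _) (cong₂ _+_ col0 rest)))) (r4 n m N S X)

      ℓ≤ℓ0 : ∀ x → ℓ x ≤ ℓ 0F
      ℓ≤ℓ0 x = ℤₚ.*-cancelˡ-≤-pos (ℓ x) (ℓ 0F) (+ 2) (ℤₚ.0≤i-j⇒j≤i (subst (0ℤ ≤_)
          (trans (cong (λ z → 1ℤ * 1ℤ * (1ℤ * 1ℤ * ℓ z + 0ℤ + 0ℤ) - + 2 * (1ℤ * 1ℤ * (1ℤ * ℓ x + 0ℤ)) + 1ℤ * 1ℤ * N) (⊖-inverseʳ x)) (arith (ℓ x) N))
          (expand (x ∷ []) (λ _ → 1ℤ) (λ y → y) 1ℤ 1ℤ)))
        where
        arith : ∀ l N → 1ℤ * 1ℤ * (1ℤ * 1ℤ * N + 0ℤ + 0ℤ) - + 2 * (1ℤ * 1ℤ * (1ℤ * l + 0ℤ)) + 1ℤ * 1ℤ * N ≡ + 2 * N - + 2 * l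
        arith = solve-∀

      cauchy-schwarz : 0ℤ < ℓ 0F → ∀ {A : Set} (xs : List A) (c : A → ℤ) (φ : A → F) →
        ∑ xs (λ i → c i * ℓ (φ i)) * ∑ xs (λ i → c i * ℓ (φ i)) ≤ ∑ xs (λ i → ∑ xs (λ j → c i * c j * ℓ (φ i ⊕ ⊖ φ j))) * ℓ 0F
      cauchy-schwarz N>0 xs c φ = ℤₚ.*-cancelˡ-≤-pos _ _ N {{ℤ.positive N>0}}
        (ℤₚ.0≤i-j⇒j≤i (subst (0ℤ ≤_) (arith N _ _) (expand xs c φ N (∑ xs (λ i → c i * ℓ (φ i))))))
        where
        arith : ∀ N S X → N * N * S - + 2 * (N * X * X) + X * X * N ≡ N * (S * N) - N * (X * X)
        arith = solve-∀

  module Conjugation (𝔽 : FiniteField)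
    (2≢0 : ¬ (FiniteField._+_ 𝔽 (FiniteField.1# 𝔽) (FiniteField.1# 𝔽) ≡ FiniteField.0# 𝔽))
    (δ : FiniteField.F 𝔽) (ns : OddField.Nonsquare 𝔽 2≢0 δ) where
    open Field 𝔽
    open Quadratic 𝔽 2≢0 δ ns

    embed-^ : ∀ u n → (u , 0F) 𝔼.^ n ≡ (u ^ n , 0F)
    embed-^ u zero = refl
    embed-^ u (suc n) = trans (cong ((u , 0F) ⊗ᴱ_) (embed-^ u n)) (cong₂ _,_
      (solve 3 (λ u x d → u :* x :+ d :* (con 0ℤ :* con 0ℤ) := u :* x) refl u (u ^ n) δ) (solve 2 (λ u x → u :* con 0ℤ :+ con 0ℤ :* x := con 0ℤ) refl u (u ^ n)))

    module _ (frobᴱ : ∀ x y → (x ⊕ᴱ y) 𝔼.^ q ≡ (x 𝔼.^ q) ⊕ᴱ (y 𝔼.^ q)) where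
      private
        ρ : E
        ρ = 0F , 1F

        decompose : ∀ u v → (u , v) ≡ (u , 0F) ⊕ᴱ ((v , 0F) ⊗ᴱ ρ)
        decompose u v = cong₂ _,_ (solve 3 (λ u v d → u := u :+ (v :* con 0ℤ :+ d :* (con 0ℤ :* con 1ℤ))) refl u v δ)
          (solve 1 (λ v → v := con 0ℤ :+ (v :* con 1ℤ :+ con 0ℤ :* con 0ℤ)) refl v)

        ^q : ∀ u v → (u , v) 𝔼.^ q ≡ (u , 0F) ⊕ᴱ ((v , 0F) ⊗ᴱ (ρ 𝔼.^ q))
        ^q u v = trans (cong (𝔼._^ q) (decompose u v)) (trans (frobᴱ (u , 0F) ((v , 0F) ⊗ᴱ ρ))
          (cong₂ _⊕ᴱ_ (fixed u) (trans (𝔼.^-distrib-* (v , 0F) ρ q) (cong (_⊗ᴱ (ρ 𝔼.^ q)) (fixed v)))))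
          where
          fixed : ∀ u → (u , 0F) 𝔼.^ q ≡ (u , 0F)
          fixed u = trans (embed-^ u q) (cong (_, 0F) (fermat u))

        ρ² : ρ ⊗ᴱ ρ ≡ (δ , 0F)
        ρ² = cong₂ _,_ (solve 1 (λ d → con 0ℤ :* con 0ℤ :+ d :* (con 1ℤ :* con 1ℤ) := d) refl δ) (solve 0 (con 0ℤ :* con 1ℤ :+ con 1ℤ :* con 0ℤ := con 0ℤ) refl)

        ρ^q : ρ 𝔼.^ q ≡ ρ ⊎ ρ 𝔼.^ q ≡ ⊖ᴱ ρ
        ρ^q = OddField.square-roots extension 2≢0ᴱ {ρ 𝔼.^ q} {ρ} (trans (sym (𝔼.^-distrib-* ρ ρ q))
          (trans (cong (𝔼._^ q) ρ²) (trans (embed-^ δ q) (trans (cong (_, 0F) (fermat δ)) (sym ρ²)))))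

        not-fixed : ρ 𝔼.^ q ≢ ρ
        not-fixed e = contradiction (P𝔼.root-bound monic 𝔼.elements 𝔼.distinct (All.tabulate (λ {z} _ → root z)))
          (ℕₚ.<⇒≱ (subst (q ℕ.<_) (sym order-extension) (ℕₚ.m<m*n q q {{ℕ.>-nonZero (ℕₚ.<⇒≤ 1<q)}} 1<q)))
          where
          module P𝔼 = Polynomial extension
          open Polynomial 𝔽 using (1<q)
          monic : P𝔼.IsMonic q (λ z → (z 𝔼.^ q) ⊕ᴱ ((⊖ᴱ (1F , 0F)) ⊗ᴱ (z 𝔼.^ 1)))
          monic = P𝔼.monic-+ (P𝔼.monic-X^ q) (P𝔼.poly-scale (⊖ᴱ (1F , 0F)) (P𝔼.poly-≤ 1<q (P𝔼.poly-X^ 1)))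
          root : ∀ z → (z 𝔼.^ q) ⊕ᴱ ((⊖ᴱ (1F , 0F)) ⊗ᴱ (z 𝔼.^ 1)) ≡ (0F , 0F)
          root (u , v) = trans (cong (_⊕ᴱ ((⊖ᴱ (1F , 0F)) ⊗ᴱ ((u , v) 𝔼.^ 1))) (trans (^q u v) (trans (cong (λ r → (u , 0F) ⊕ᴱ ((v , 0F) ⊗ᴱ r)) e) (sym (decompose u v)))))
            (trans (cong ((u , v) ⊕ᴱ_) (trans (sym (𝔼.-‿distribˡ-* (1F , 0F) ((u , v) 𝔼.^ 1))) (cong ⊖ᴱ_ (trans (𝔼.⊗-identityˡ ((u , v) 𝔼.^ 1)) (𝔼.⊗-identityʳ (u , v)))))) (𝔼.⊖-inverseʳ (u , v)))

      conjugation : ∀ u v → (u , v) 𝔼.^ q ≡ (u , ⊖ v)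
      conjugation u v = Sum.[ (λ e → contradiction e not-fixed) , negated ]′ ρ^q
        where
        negated : ρ 𝔼.^ q ≡ ⊖ᴱ ρ → (u , v) 𝔼.^ q ≡ (u , ⊖ v)
        negated e = trans (^q u v) (trans (cong (λ r → (u , 0F) ⊕ᴱ ((v , 0F) ⊗ᴱ r)) e) (cong₂ _,_
          (solve 3 (λ u v d → u :+ (v :* (:- con 0ℤ) :+ d :* (con 0ℤ :* (:- con 1ℤ))) := u) refl u v δ)
          (solve 1 (λ v → con 0ℤ :+ (v :* (:- con 1ℤ) :+ con 0ℤ :* (:- con 0ℤ)) := :- v) refl v)))

  module WeilBound (𝔽 : FiniteField) (p k : ℕ) (pr : Prime p) (p≢2 : p ≢ 2) (1≤k : 1 ℕ.≤ k) (q≡p^k : FiniteField.order 𝔽 ≡ p ℕ.^ k) where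
    open Field 𝔽
    open NullSum 𝔽
    open PositiveDefinite 𝔽

    3≤q : 3 ℕ.≤ q
    3≤q = subst (3 ℕ.≤_) (sym q≡p^k) (ℕₚ.≤-trans 3≤p (subst (ℕ._≤ p ℕ.^ k) (ℕₚ.*-identityʳ p) (ℕₚ.^-monoʳ-≤ p {{prime⇒nonZero pr}} 1≤k)))
      where
      3≤p : 3 ℕ.≤ p
      3≤p = ℕₚ.≤∧≢⇒< (ℕ.nonTrivial⇒n>1 p {{prime⇒nonTrivial pr}}) (p≢2 ∘ sym)

    record Level : Set₁ where
      field
        K      : FiniteField
        h      : ℕ
        order≡ : FiniteField.order K ≡ q ℕ.^ suc h
      module 𝕂 = Field K
      order-p : 𝕂.q ≡ p ℕ.^ (k ℕ.* suc h)
      order-p = trans order≡ (trans (cong (ℕ._^ suc h) q≡p^k) (ℕₚ.^-*-assoc p k (suc h)))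
      module ℙ = 𝕂.PrimePower p (k ℕ.* suc h) pr order-p
      2≢0 : ¬ (𝕂.1F 𝕂.⊕ 𝕂.1F ≡ 𝕂.0F)
      2≢0 = ℙ.1⊕1≢0 p≢2
      frob : ∀ x y → (x 𝕂.⊕ y) 𝕂.^ q ≡ (x 𝕂.^ q) 𝕂.⊕ (y 𝕂.^ q)
      frob x y = subst (λ n → (x 𝕂.⊕ y) 𝕂.^ n ≡ (x 𝕂.^ n) 𝕂.⊕ (y 𝕂.^ n)) (sym q≡p^k) (ℙ.frobenius^ k x y)
      module 𝕋 = FrobeniusTrace K q frob
      field
        tr      : 𝕂.F → F
        tr-⊕    : ∀ x y → tr (x 𝕂.⊕ y) ≡ tr x ⊕ tr y
        tr-null : ∀ {ℓ} → Null ℓ → NullSum.Null K (ℓ ∘ tr)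
        ι       : F → 𝕂.F
        ι-tr    : ∀ z → ι (tr z) ≡ 𝕋.trace (suc h) z
        α       : 𝕂.F
        α≢0     : α ≢ 𝕂.0F
        α^q     : α 𝕂.^ q ≡ α

      phase : 𝕂.F → F
      phase z = tr (z 𝕂.⊕ (α 𝕂.⊗ 𝕂.inv z))

      open NullSum K using () renaming (nz to nzᴷ)

      kloosterman kloosterman² : (F → ℤ) → ℤ
      kloosterman  ℓ = ∑ 𝕂.Fs (λ z → nzᴷ z * ℓ (phase z))
      kloosterman² ℓ = ∑ 𝕂.Fs (λ x → ∑ 𝕂.Fs (λ y → nzᴷ x * nzᴷ y * ℓ (phase x ⊕ phase y)))

      tr-0 : tr 𝕂.0F ≡ 0F
      tr-0 = trans (solve 1 (λ x → x := (x :+ x) :- x) refl (tr 𝕂.0F))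
        (trans (cong (_⊕ ⊖ tr 𝕂.0F) (trans (sym (tr-⊕ 𝕂.0F 𝕂.0F)) (cong tr (𝕂.⊕-identityˡ 𝕂.0F)))) (⊖-inverseʳ _))

      tr-⊖ : ∀ x → tr (𝕂.⊖ x) ≡ ⊖ tr x
      tr-⊖ x = trans (solve 2 (λ x y → y := (x :+ y) :- x) refl (tr x) (tr (𝕂.⊖ x)))
        (trans (cong (_⊕ ⊖ tr x) (trans (sym (tr-⊕ x (𝕂.⊖ x))) (trans (cong tr (𝕂.⊖-inverseʳ x)) tr-0))) (⊕-identityˡ _))

      phase-⊖ : ∀ z → phase (𝕂.⊖ z) ≡ ⊖ phase z
      phase-⊖ z = trans (cong tr (trans (cong (λ w → 𝕂.⊖ z 𝕂.⊕ (α 𝕂.⊗ w)) inv-⊖)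
        (𝕂.solve 3 (λ z a w → (𝕂.:- z) 𝕂.:+ a 𝕂.:* (𝕂.:- w) 𝕂.:= 𝕂.:- (z 𝕂.:+ a 𝕂.:* w)) refl z α (𝕂.inv z)))) (tr-⊖ _)
        where
        inv-⊖ : 𝕂.inv (𝕂.⊖ z) ≡ 𝕂.⊖ 𝕂.inv z
        inv-⊖ with 𝕂.zero? z
        ... | inj₁ refl = trans (cong 𝕂.inv 𝕂.-0#≈0#) (trans 𝕂.inv-0 (sym (trans (cong 𝕂.⊖_ 𝕂.inv-0) 𝕂.-0#≈0#)))
        ... | inj₂ z≢0 = 𝕂.inv-unique (trans (𝕂.solve 2 (λ z w → (𝕂.:- z) 𝕂.:* (𝕂.:- w) 𝕂.:= z 𝕂.:* w) refl z (𝕂.inv z)) (𝕂.inv-r z≢0))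

      kloosterman²-difference : ∀ ℓ → kloosterman² ℓ ≡ ∑ 𝕂.Fs (λ x → ∑ 𝕂.Fs (λ y → nzᴷ x * nzᴷ y * ℓ (phase x ⊕ ⊖ phase y)))
      kloosterman²-difference ℓ = ∑-cong 𝕂.Fs (λ x → trans (sym (NullSum.∑-⊖ K _)) (∑-cong 𝕂.Fs (λ y →
        cong₂ (λ m l → nzᴷ x * m * ℓ (phase x ⊕ l)) (NullSum.nz-⇔ K (λ e → trans (sym (𝕂.-‿involutive y)) (trans (cong 𝕂.⊖_ e) 𝕂.-0#≈0#)) (λ e → trans (cong 𝕂.⊖_ e) 𝕂.-0#≈0#)) (phase-⊖ y))))

      cauchy-schwarz-kloosterman : ∀ {ℓ} → Autocorrelation ℓ → 0ℤ < ℓ 0F → kloosterman ℓ * kloosterman ℓ ≤ kloosterman² ℓ * ℓ 0F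
      cauchy-schwarz-kloosterman {ℓ} auto N>0 = subst (λ S → kloosterman ℓ * kloosterman ℓ ≤ S * ℓ 0F) (sym (kloosterman²-difference ℓ))
        (Autocorrelation.cauchy-schwarz auto N>0 𝕂.Fs nzᴷ phase)

    base : ∀ a → a ≢ 0F → Level
    base a a≢0 = record { K = 𝔽 ; h = 0 ; order≡ = sym (ℕₚ.*-identityʳ q) ; tr = λ x → x ; tr-⊕ = λ _ _ → refl ; tr-null = λ n → n
      ; ι = λ x → x ; ι-tr = λ z → sym (trans (⊕-identityˡ _) (⊗-identityʳ z)) ; α = a ; α≢0 = a≢0 ; α^q = fermat a }

    module Next (L : Level) where
      open Level L
      open OddField K 2≢0 using (nonsquare)
      open Quadratic K 2≢0 (proj₁ nonsquare) (proj₂ nonsquare) public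
      open Conjugation K 2≢0 (proj₁ nonsquare) (proj₂ nonsquare)

      order≡′ : 𝔼.q ≡ q ℕ.^ (suc h ℕ.+ suc h)
      order≡′ = trans order-extension (trans (cong₂ ℕ._*_ order≡ order≡) (sym (ℕₚ.^-distribˡ-+-* q (suc h) (suc h))))

      order-p′ : 𝔼.q ≡ p ℕ.^ (k ℕ.* (suc h ℕ.+ suc h))
      order-p′ = trans order≡′ (trans (cong (ℕ._^ (suc h ℕ.+ suc h)) q≡p^k) (ℕₚ.^-*-assoc p k (suc h ℕ.+ suc h)))

      frob′ : ∀ x y → (x ⊕ᴱ y) 𝔼.^ q ≡ (x 𝔼.^ q) ⊕ᴱ (y 𝔼.^ q)
      frob′ x y = subst (λ n → (x ⊕ᴱ y) 𝔼.^ n ≡ (x 𝔼.^ n) ⊕ᴱ (y 𝔼.^ n)) (sym q≡p^k)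
        (𝔼.PrimePower.frobenius^ p (k ℕ.* (suc h ℕ.+ suc h)) pr order-p′ k x y)

      module 𝕋′ = FrobeniusTrace extension q frob′

      ι′ : F → E
      ι′ c = ι c , 𝕂.0F

      tr′ : E → F
      tr′ z = tr (half-trace z)

      trace-embed : ∀ n u → 𝕋′.trace n (u , 𝕂.0F) ≡ (𝕋.trace n u , 𝕂.0F)
      trace-embed zero u = refl
      trace-embed (suc n) u = trans (cong₂ _⊕ᴱ_ (trace-embed n u) (embed-^ u (q ℕ.^ n))) (cong (λ v → 𝕋.trace (suc n) u , v) (𝕂.⊕-identityˡ 𝕂.0F))

      ι-tr′ : ∀ z → ι′ (tr′ z) ≡ 𝕋′.trace (suc h ℕ.+ suc h) z
      ι-tr′ z@(u , v) = begin
        (ι (tr (u 𝕂.⊕ u)) , 𝕂.0F) ≡⟨ cong (_, 𝕂.0F) (ι-tr (u 𝕂.⊕ u)) ⟩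
        (𝕋.trace (suc h) (u 𝕂.⊕ u) , 𝕂.0F) ≡⟨ sym (trace-embed (suc h) (u 𝕂.⊕ u)) ⟩
        𝕋′.trace (suc h) (u 𝕂.⊕ u , 𝕂.0F) ≡⟨ cong (𝕋′.trace (suc h)) (trans (cong ((u 𝕂.⊕ u) ,_) (sym (𝕂.⊖-inverseʳ v))) (cong (z ⊕ᴱ_) (sym conj))) ⟩
        𝕋′.trace (suc h) (z ⊕ᴱ (z 𝔼.^ (q ℕ.^ suc h))) ≡⟨ 𝕋′.trace-⊕ (suc h) z (z 𝔼.^ (q ℕ.^ suc h)) ⟩
        𝕋′.trace (suc h) z ⊕ᴱ 𝕋′.trace (suc h) (z 𝔼.^ (q ℕ.^ suc h)) ≡⟨ sym (𝕋′.trace-+ (suc h) (suc h) z) ⟩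
        𝕋′.trace (suc h ℕ.+ suc h) z ∎
        where
        open ≡-Reasoning
        conj : z 𝔼.^ (q ℕ.^ suc h) ≡ (u , 𝕂.⊖ v)
        conj = trans (cong (z 𝔼.^_) (sym order≡)) (conjugation (λ x y → subst (λ n → (x ⊕ᴱ y) 𝔼.^ n ≡ (x 𝔼.^ n) ⊕ᴱ (y 𝔼.^ n)) (sym order≡) (𝕋′.frob^ (suc h) x y)) u v)

      α′^q : (α , 𝕂.0F) 𝔼.^ q ≡ (α , 𝕂.0F)
      α′^q = trans (embed-^ α q) (cong (_, 𝕂.0F) α^q)

      next : Level
      next = record { K = extension ; h = h ℕ.+ suc h ; order≡ = order≡′ ; tr = tr′
        ; tr-⊕ = λ (x , _) (y , _) → trans (cong tr (𝕂.solve 2 (λ x y → (x 𝕂.:+ y) 𝕂.:+ (x 𝕂.:+ y) 𝕂.:= (x 𝕂.:+ x) 𝕂.:+ (y 𝕂.:+ y)) refl x y)) (tr-⊕ _ _)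
        ; tr-null = λ n → null-extension (tr-null n)
        ; ι = ι′ ; ι-tr = ι-tr′ ; α = α , 𝕂.0F ; α≢0 = α≢0 ∘ cong proj₁ ; α^q = α′^q }

      module 𝕃 = Level next

      doubling : ∀ {ℓ} → Null ℓ → kloosterman² ℓ + 𝕃.kloosterman ℓ ≡ + 2 * (+ 𝕂.q * ℓ 0F)
      doubling {ℓ} nl = trans (cong (_+ 𝕃.kloosterman ℓ) (∑-cong 𝕂.Fs (λ x → ∑-cong 𝕂.Fs (λ y → cong (λ w → NullSum.nz K x * NullSum.nz K y * ℓ w) (sym (tr-⊕ _ _))))))
        (trans (kloosterman-doubling (ℓ ∘ tr) (tr-null nl) α α≢0) (cong (λ w → + 2 * (+ 𝕂.q * ℓ w)) tr-0))

      fibre : F → List E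
      fibre b = filter (λ z → ¬? (z 𝔼.≟F 𝔼.0F) ×-dec (𝕃.phase z ≟F b)) 𝔼.Fs

      fibre-bound : ∀ b → length (fibre b) ℕ.≤ q ℕ.^ suc h ℕ.* (q ℕ.^ h ℕ.+ 5)
      fibre-bound b = StepanovBound.stepanov extension q h 3≤q order≡′ frob′ (α , 𝕂.0F) (ι′ b) α′^q (fibre b) (Uniq.filter⁺ _ 𝔼.distinct)
        (All.tabulate (λ {z} z∈ → zero-of z (proj₂ (∈-filter⁻ _ {v = z} {xs = 𝔼.Fs} z∈))))
        where
        zero-of : ∀ z → ¬ (z ≡ 𝔼.0F) × 𝕃.phase z ≡ b → ¬ (z ≡ 𝔼.0F) × 𝕋′.trace (suc h ℕ.+ suc h) (z ⊕ᴱ ((α , 𝕂.0F) ⊗ᴱ 𝔼.inv z)) ≡ ι′ b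
        zero-of z (z≢0 , e) = z≢0 , trans (sym (ι-tr′ (z ⊕ᴱ ((α , 𝕂.0F) ⊗ᴱ 𝔼.inv z)))) (cong ι′ e)

      kloosterman-by-fibres : ∀ ℓ → 𝕃.kloosterman ℓ ≡ ∑ Fs (λ b → + length (fibre b) * ℓ b)
      kloosterman-by-fibres ℓ = begin
        ∑ 𝔼.Fs (λ z → N𝔼.nz z * ℓ (𝕃.phase z))
          ≡⟨ ∑-cong 𝔼.Fs (λ z → sym (trans (∑-cong Fs (λ b → split z b)) (∑-ind finite (𝕃.phase z) (λ b → N𝔼.nz z * ℓ b)))) ⟩
        ∑ 𝔼.Fs (λ z → ∑ Fs (λ b → ind (dec z b) * ℓ b)) ≡⟨ ∑-swap 𝔼.Fs Fs _ ⟩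
        ∑ Fs (λ b → ∑ 𝔼.Fs (λ z → ind (dec z b) * ℓ b)) ≡⟨ ∑-cong Fs (λ b → trans (∑-*ʳ 𝔼.Fs (ℓ b) _) (cong (_* ℓ b) (∑-filter (λ z → dec z b) 𝔼.Fs))) ⟩
        ∑ Fs (λ b → + length (fibre b) * ℓ b) ∎
        where
        open ≡-Reasoning
        dec : ∀ z b → Dec (¬ (z ≡ 𝔼.0F) × 𝕃.phase z ≡ b)
        dec z b = ¬? (z 𝔼.≟F 𝔼.0F) ×-dec (𝕃.phase z ≟F b)
        split : ∀ z b → ind (dec z b) * ℓ b ≡ ind (b ≟F 𝕃.phase z) * (N𝔼.nz z * ℓ b)
        split z b = lemma (z 𝔼.≟F 𝔼.0F) (𝕃.phase z ≟F b) (b ≟F 𝕃.phase z) (N𝔼.nz-as-ind z)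
          where
          lemma : ∀ {P : Set} (d : Dec P) (e : Dec (𝕃.phase z ≡ b)) (e′ : Dec (b ≡ 𝕃.phase z)) → N𝔼.nz z ≡ 1ℤ - ind d →
                  ind (¬? d ×-dec e) * ℓ b ≡ ind e′ * (N𝔼.nz z * ℓ b)
          lemma d e (no ne) _ = cong (_* ℓ b) (ind-no (¬? d ×-dec e) (λ (_ , x) → ne (sym x)))
          lemma (yes d) e (yes _) nz≡ = trans (cong (_* ℓ b) (ind-no (¬? (yes d) ×-dec e) (λ (nd , _) → nd d))) (sym (trans (ℤₚ.*-identityˡ _) (cong (_* ℓ b) nz≡)))
          lemma (no d) (no ne) (yes x) _ = contradiction (sym x) ne
          lemma (no d) (yes _) (yes _) nz≡ = sym (trans (ℤₚ.*-identityˡ _) (cong (_* ℓ b) nz≡))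

      ∑-fibres : ∑ Fs (λ b → + length (fibre b)) ≡ + 𝔼.q - 1ℤ
      ∑-fibres = begin
        ∑ Fs (λ b → + length (fibre b)) ≡⟨ ∑-cong Fs (λ b → sym (ℤₚ.*-identityʳ _)) ⟩
        ∑ Fs (λ b → + length (fibre b) * 1ℤ) ≡⟨ sym (kloosterman-by-fibres (λ _ → 1ℤ)) ⟩
        ∑ 𝔼.Fs (λ z → N𝔼.nz z * 1ℤ) ≡⟨ N𝔼.∑-nz (λ _ → 1ℤ) ⟩
        ∑ 𝔼.Fs (λ _ → 1ℤ) - 1ℤ ≡⟨ cong (λ z → z - 1ℤ) (trans (∑-const 𝔼.Fs 1ℤ) (ℤₚ.*-identityʳ (+ 𝔼.q))) ⟩
        + 𝔼.q - 1ℤ ∎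
        where open ≡-Reasoning

      kloosterman-lower : ∀ {ℓ} → Autocorrelation ℓ → - 𝕃.kloosterman ℓ ≤ + (6 ℕ.* q) * + 𝕂.q * ℓ 0F
      kloosterman-lower {ℓ} auto = begin
        - 𝕃.kloosterman ℓ ≡⟨ cong -_ (kloosterman-by-fibres ℓ) ⟩
        - ∑ Fs (λ b → n b * ℓ b) ≡⟨ trans (sym (ℤₚ.+-identityˡ _)) (cong (_+ - ∑ Fs (λ b → n b * ℓ b)) (sym (trans (∑-*ˡ Fs t ℓ) (trans (cong (t *_) null) (ℤₚ.*-zeroʳ t))))) ⟩
        ∑ Fs (λ b → t * ℓ b) - ∑ Fs (λ b → n b * ℓ b) ≡⟨ sym (∑-minus Fs _ _) ⟩
        ∑ Fs (λ b → t * ℓ b - n b * ℓ b) ≤⟨ ∑-mono Fs (λ b → subst (_≤ (t - n b) * ℓ 0F) (distr t (n b) (ℓ b)) (ℤₚ.*-monoˡ-≤-nonNeg (t - n b) {{ℤ.nonNegative (ℤₚ.i≤j⇒0≤j-i (+≤+ (fibre-bound b)))}} (ℓ≤ℓ0 b))) ⟩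
        ∑ Fs (λ b → (t - n b) * ℓ 0F) ≡⟨ trans (∑-*ʳ Fs (ℓ 0F) _) (cong (_* ℓ 0F) (trans (∑-minus Fs _ _) (cong₂ _-_ (∑-const Fs t) ∑-fibres))) ⟩
        (+ q * t - (+ 𝔼.q - 1ℤ)) * ℓ 0F ≤⟨ ℤₚ.*-monoʳ-≤-nonNeg (ℓ 0F) {{ℤ.nonNegative ℓ0≥0}} count ⟩
        + (6 ℕ.* q) * + 𝕂.q * ℓ 0F ∎
        where
        open Autocorrelation auto
        open ℤₚ.≤-Reasoning
        n : F → ℤ
        n b = + length (fibre b)
        T = q ℕ.^ suc h ℕ.* (q ℕ.^ h ℕ.+ 5)
        t = + T
        distr : ∀ t n l → (t - n) * l ≡ t * l - n * l
        distr = solve-∀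
        s = 𝕂.q
        qT : q ℕ.* T ≡ 𝔼.q ℕ.+ 5 ℕ.* q ℕ.* s
        qT = trans (arith q (q ℕ.^ suc h) (q ℕ.^ h)) (cong₂ ℕ._+_ (sym (trans order≡′ (ℕₚ.^-distribˡ-+-* q (suc h) (suc h)))) (cong (5 ℕ.* q ℕ.*_) (sym order≡)))
          where
          open import Data.Nat.Tactic.RingSolver using () renaming (solve-∀ to solveℕ)
          arith : ∀ q s A → q ℕ.* (s ℕ.* (A ℕ.+ 5)) ≡ q ℕ.* A ℕ.* s ℕ.+ 5 ℕ.* q ℕ.* s
          arith = solveℕ
        count : + q * t - (+ 𝔼.q - 1ℤ) ≤ + (6 ℕ.* q) * + 𝕂.q
        count = ℤₚ.≤-trans (ℤₚ.≤-reflexive (trans (cong (λ z → z - (+ 𝔼.q - 1ℤ)) (trans (sym (ℤₚ.pos-* q T)) (trans (cong +_ qT) (ℤₚ.pos-+ 𝔼.q (5 ℕ.* q ℕ.* s))))) (cancel (+ 𝔼.q) (+ (5 ℕ.* q ℕ.* s)))))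
          (subst₂ _≤_ refl (trans (cong +_ final) (ℤₚ.pos-* (6 ℕ.* q) s)) (+≤+ (ℕₚ.+-monoʳ-≤ (5 ℕ.* q ℕ.* s) 1≤qs)))
          where
          open import Data.Nat.Tactic.RingSolver using () renaming (solve-∀ to solveℕ)
          cancel : ∀ x y → x + y - (x - 1ℤ) ≡ y + 1ℤ
          cancel = solve-∀
          arith : ∀ q s → 5 ℕ.* q ℕ.* s ℕ.+ q ℕ.* s ≡ 6 ℕ.* q ℕ.* s
          arith = solveℕ
          final : 5 ℕ.* q ℕ.* s ℕ.+ q ℕ.* s ≡ 6 ℕ.* q ℕ.* s
          final = arith q s
          1≤qs : 1 ℕ.≤ q ℕ.* s
          1≤qs = ℕₚ.*-mono-≤ (ℕₚ.≤-trans (ℕ.s≤s ℕ.z≤n) 3≤q) (ℕₚ.<⇒≤ (Polynomial.1<q K))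

    open Next using (next)

    -- With x = − (Kloosterman sum) / (√|K| ℓ(0)), doubling and Cauchy–Schwarz give x′ ≥ x² − 2 at the next level,
    -- so an excess x ≥ 2 + c over the Weil bound keeps growing up the tower and violates the Stepanov bound.
    no-excess : ∀ {ℓ} → Autocorrelation ℓ → 0ℤ < ℓ 0F → ∀ j (L : Level) (c : ℕ) → 1 ℕ.≤ c → 6 ℕ.* q ℕ.≤ c ℕ.+ j →
      ¬ ((+ 2 + + c) * + Level.𝕂.q L * ℓ 0F ≤ - Level.kloosterman (next L) ℓ)
    no-excess {ℓ} auto N>0 zero L c 1≤c 6q≤ excess = ℤₚ.<⇒≱ too-much (Next.kloosterman-lower L auto)
      where
      s = Level.𝕂.q L
      s>0 : 0ℤ < + s
      s>0 = +<+ (ℕₚ.<⇒≤ (Polynomial.1<q (Level.K L)))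
      too-much : + (6 ℕ.* q) * + s * ℓ 0F < - Level.kloosterman (next L) ℓ
      too-much = ℤₚ.<-≤-trans (ℤₚ.*-monoʳ-<-pos (ℓ 0F) {{ℤ.positive N>0}} (ℤₚ.*-monoʳ-<-pos (+ s) {{ℤ.positive s>0}}
        (+<+ (ℕ.s≤s (ℕₚ.≤-trans 6q≤ (ℕₚ.≤-trans (ℕₚ.≤-reflexive (ℕₚ.+-identityʳ c)) (ℕₚ.n≤1+n c))))))) excess
    no-excess {ℓ} auto N>0 (suc j) L c 1≤c 6q≤ excess =
      no-excess auto N>0 j (next L) (suc c) (ℕ.s≤s ℕ.z≤n) (ℕₚ.≤-trans 6q≤ (ℕₚ.≤-reflexive (ℕₚ.+-suc c j)))
        (excess-growth (Level.𝕂.q L) (+ Level.𝕂.q (next L)) (ℓ 0F) (Level.kloosterman (next L) ℓ) (Level.kloosterman (next (next L)) ℓ) (Level.kloosterman² (next L) ℓ) c N>0 1≤c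
          (trans (cong +_ (Next.order-extension L)) (ℤₚ.pos-* (Level.𝕂.q L) (Level.𝕂.q L)))
          (Next.doubling (next L) (Autocorrelation.null auto))
          (Level.cauchy-schwarz-kloosterman (next L) auto N>0) excess)

    weil : ∀ {ℓ} → Autocorrelation ℓ → ∀ a → a ≢ 0F →
      ∑ Fs (λ x → ∑ Fs (λ y → nz x * nz y * ℓ ((x ⊕ a ⊗ inv x) ⊕ (y ⊕ a ⊗ inv y)))) ≤ + 5 * + q * ℓ 0F
    weil {ℓ} auto a a≢0 = Sum.[ positive-case , (λ N≤0 → zero-case (ℤₚ.≤-antisym N≤0 ℓ0≥0)) ]′ (Sum.swap (≤-<-connexℤ (ℓ 0F) 0ℤ))
      where
      open Autocorrelation auto
      L = base a a≢0
      N = ℓ 0F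
      S = Level.kloosterman² L ℓ
      x = Level.kloosterman (next L) ℓ
      nz≥0 : ∀ x → 0ℤ ≤ nz x
      nz≥0 x with x ≟F 0F
      ... | yes _ = +≤+ ℕ.z≤n
      ... | no _  = +≤+ ℕ.z≤n
      zero-case : N ≡ 0ℤ → S ≤ + 5 * + q * N
      zero-case N≡0 = ℤₚ.≤-trans (∑-mono Fs (λ x → ∑-mono Fs (λ y → term x y)))
        (ℤₚ.≤-reflexive (trans (∑-cong Fs (λ _ → ∑-ε Fs)) (trans (∑-ε Fs) (sym (trans (cong (+ 5 * + q *_) N≡0) (ℤₚ.*-zeroʳ (+ 5 * + q)))))))
        where
        term : ∀ x y → nz x * nz y * ℓ (Level.phase L x ⊕ Level.phase L y) ≤ 0ℤ
        term x y = subst (nz x * nz y * ℓ (Level.phase L x ⊕ Level.phase L y) ≤_) (ℤₚ.*-zeroʳ (nz x * nz y))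
          (ℤₚ.*-monoˡ-≤-nonNeg (nz x * nz y) {{ℤ.nonNegative (subst (0ℤ ≤_) (sym (nz-⊗ x y)) (nz≥0 (x ⊗ y)))}} (subst (ℓ (Level.phase L x ⊕ Level.phase L y) ≤_) N≡0 (ℓ≤ℓ0 _)))
      positive-case : 0ℤ < N → S ≤ + 5 * + q * N
      positive-case N>0 = Sum.[ (λ le → le) , (λ gt → contradiction (excess (ℤₚ.<⇒≤ gt)) (no-excess auto N>0 (6 ℕ.* q) L 1 ℕₚ.≤-refl (ℕₚ.n≤1+n _))) ]′ (≤-<-connexℤ S (+ 5 * + q * N))
        where
        excess : + 5 * + q * N ≤ S → (+ 2 + 1ℤ) * + q * N ≤ - x
        excess le = subst₂ _≤_ (e1 (+ q) N) (trans (cong (λ z → S - z) (sym (Next.doubling L null))) (e2 S x)) (ℤₚ.+-monoˡ-≤ (- (+ 2 * (+ q * N))) le)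
          where
          e1 : ∀ q N → + 5 * q * N - + 2 * (q * N) ≡ (+ 2 + 1ℤ) * q * N
          e1 = solve-∀
          e2 : ∀ S x → S - (S + x) ≡ - x
          e2 = solve-∀

    kloosterman-bound : ∀ {ℓ} → Autocorrelation ℓ → ∀ a → a ≢ 0F →
      ∑ Fs (λ x → ∑ Fs (λ y → nz x * nz y * ℓ ((x ⊕ a ⊗ inv x) ⊕ ⊖ (y ⊕ a ⊗ inv y)))) ≤ + 5 * + q * ℓ 0F
    kloosterman-bound {ℓ} auto a a≢0 = subst (_≤ + 5 * + q * ℓ 0F) (Level.kloosterman²-difference (base a a≢0) ℓ) (weil auto a a≢0)

module Spectral where

  open import Defs using (FiniteField)
  import Defs
  open SumLib
  open IntSum
  open FieldLib
  open Squares
  open Poly using (Vec-finite; size-Vec)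
  open Weil using (module PositiveDefinite; module WeilBound; ≤-<-connexℤ)
  open import Data.Integer as ℤ using (ℤ; +_; 0ℤ; 1ℤ; _+_; _*_; -_; _-_; _≤_; _<_; +≤+; +<+)
  import Data.Integer.Properties as ℤₚ
  open import Data.Integer.Tactic.RingSolver using (solve-∀)
  import Data.List.Membership.Propositional as M
  import Data.List.Relation.Unary.Any as Any
  open import Data.Nat as ℕ using (ℕ; zero; suc)
  open import Data.Nat.Primality using (Prime)
  import Data.Nat.Properties as ℕₚ
  import Data.Sum as Sum
  open import Data.Vec as Vec using ([]; _∷_)
  import Data.Vec.Properties

  ∑-swap⁴ : ∀ {A B : Set} (xs : List A) (ys : List B) (f : A → A → B → B → ℤ) →
    ∑ xs (λ x → ∑ xs (λ x′ → ∑ ys (λ y → ∑ ys (λ y′ → f x x′ y y′)))) ≡ ∑ ys (λ y → ∑ ys (λ y′ → ∑ xs (λ x → ∑ xs (λ x′ → f x x′ y y′))))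
  ∑-swap⁴ xs ys f = begin
    ∑ xs (λ x → ∑ xs (λ x′ → ∑ ys (λ y → ∑ ys (λ y′ → f x x′ y y′)))) ≡⟨ ∑-cong xs (λ x → ∑-swap xs ys _) ⟩
    ∑ xs (λ x → ∑ ys (λ y → ∑ xs (λ x′ → ∑ ys (λ y′ → f x x′ y y′)))) ≡⟨ ∑-swap xs ys _ ⟩
    ∑ ys (λ y → ∑ xs (λ x → ∑ xs (λ x′ → ∑ ys (λ y′ → f x x′ y y′)))) ≡⟨ ∑-cong ys (λ y → trans (∑-cong xs (λ x → ∑-swap xs ys _)) (∑-swap xs ys _)) ⟩
    ∑ ys (λ y → ∑ ys (λ y′ → ∑ xs (λ x → ∑ xs (λ x′ → f x x′ y y′)))) ∎
    where open ≡-Reasoning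

  square-mono : ∀ {a b} → 0ℤ ≤ a → a ≤ b → a * a ≤ b * b
  square-mono {a} {b} 0≤a a≤b = ℤₚ.≤-trans (ℤₚ.*-monoˡ-≤-nonNeg a {{ℤ.nonNegative 0≤a}} a≤b) (ℤₚ.*-monoʳ-≤-nonNeg b {{ℤ.nonNegative (ℤₚ.≤-trans 0≤a a≤b)}} a≤b)

  module SpectralBound (𝔽 : FiniteField) (p k : ℕ) (pr : Prime p) (p≢2 : p ≢ 2) (1≤k : 1 ℕ.≤ k) (q≡p^k : FiniteField.order 𝔽 ≡ p ℕ.^ k) where
    open Field 𝔽
    open PrimePower p k pr q≡p^k using (1⊕1≢0)

    2≢0 : ¬ (1F ⊕ 1F ≡ 0F)
    2≢0 = 1⊕1≢0 p≢2

    open OddField 𝔽 2≢0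
    open PositiveDefinite 𝔽

    δ : F
    δ = proj₁ nonsquare

    δ-nonsquare : Nonsquare δ
    δ-nonsquare = proj₂ nonsquare

    V : ℕ → Set
    V = Vec F

    Vs : ∀ d → List (V d)
    Vs d = elems (Vec-finite finite d)

    _≟V_ : ∀ {d} (x y : V d) → Dec (x ≡ y)
    _≟V_ {d} = Finite._≟_ (Vec-finite finite d)

    ‖_‖ : ∀ {d} → V d → F
    ‖ x ‖ = Defs.‖_‖ 𝔽 x

    _⊝_ : ∀ {d} → V d → V d → V d
    _⊝_ = Defs._-ᵥ_ 𝔽

    dot : ∀ {d} → V d → V d → F
    dot []      []      = 0F
    dot (a ∷ m) (x ∷ v) = a ⊗ x ⊕ dot m v

    ∑V-suc : ∀ d (f : V (suc d) → ℤ) → ∑ (Vs (suc d)) f ≡ ∑ Fs (λ x → ∑ (Vs d) (λ v → f (x ∷ v)))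
    ∑V-suc d f = trans (∑-map _ (cartesianProduct Fs (Vs d)) f) (∑-× Fs (Vs d) _)

    -- q times the indicator of 0, minus 1 : the sum of all nontrivial additive characters
    e : F → ℤ
    e x = + q * ind (x ≟F 0F) - 1ℤ

    e-null : Null e
    e-null = trans (∑-minus Fs _ _) (trans (cong₂ _-_ (trans (∑-*ˡ Fs (+ q) _) (cong (+ q *_) (∑-ind₁ finite 0F))) (∑-const Fs 1ℤ)) (ℤₚ.+-inverseʳ (+ q * 1ℤ)))

    e-even : ∀ x → e (⊖ x) ≡ e x
    e-even x = cong (λ z → + q * z - 1ℤ) (ind-⇔ (⊖ x ≟F 0F) (x ≟F 0F)
      (λ e → trans (sym (-‿involutive x)) (trans (cong ⊖_ e) -0#≈0#)) (λ e → trans (cong ⊖_ e) -0#≈0#))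

    e-convolution : ∀ {f} → Null f → ∀ c b → e c * f b ≡ ∑ Fs (λ s → nz s * f (c ⊗ s ⊕ b))
    e-convolution nf c b = sym (∑-nz-orthogonality nf c b)

    ∑²≤q∑ : ∀ (h : F → ℤ) → 0ℤ ≤ + q * ∑ Fs (λ x → h x * h x) - ∑ Fs h * ∑ Fs h
    ∑²≤q∑ h = ℤₚ.*-cancelˡ-≤-pos 0ℤ _ (+ 2) (subst (0ℤ ≤_) (begin
      ∑ Fs (λ x → ∑ Fs (λ y → (h x - h y) * (h x - h y)))
        ≡⟨ ∑-cong Fs (λ x → trans (∑-cong Fs (λ y → e1 (h x) (h y))) (trans (∑-∙ Fs _ _) (cong₂ _+_ (trans (∑-∙ Fs _ _) (cong₂ _+_ (∑-const Fs _) refl)) (∑-*ˡ Fs (- (+ 2) * h x) h)))) ⟩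
      ∑ Fs (λ x → (+ q * (h x * h x) + H²) + - (+ 2) * h x * H)
        ≡⟨ trans (∑-∙ Fs _ _) (cong₂ _+_ (trans (∑-∙ Fs _ _) (cong₂ _+_ (∑-*ˡ Fs (+ q) _) (∑-const Fs H²))) (trans (∑-*ʳ Fs H _) (cong (_* H) (∑-*ˡ Fs (- (+ 2)) h)))) ⟩
      (+ q * H² + + q * H²) + - (+ 2) * H * H ≡⟨ e2 (+ q) H² H ⟩
      + 2 * (+ q * H² - H * H) ∎) (∑≥0 Fs (λ x → ∑≥0 Fs (λ y → 0≤i*i (h x - h y)))))
      where
      open ≡-Reasoning
      H = ∑ Fs h
      H² = ∑ Fs (λ x → h x * h x)
      e1 : ∀ a b → (a - b) * (a - b) ≡ (a * a + b * b) + - (+ 2) * a * b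
      e1 = solve-∀
      e2 : ∀ q s h → (q * s + q * s) + - (+ 2) * h * h ≡ + 2 * (q * s - h * h)
      e2 = solve-∀

    e-positive : ∀ {A : Set} (xs : List A) (c : A → ℤ) (φ : A → F) → 0ℤ ≤ ∑ xs (λ i → ∑ xs (λ j → c i * c j * e (φ i ⊕ ⊖ φ j)))
    e-positive xs c φ = subst (0ℤ ≤_) (sym (begin
      ∑ xs (λ i → ∑ xs (λ j → c i * c j * e (φ i ⊕ ⊖ φ j)))
        ≡⟨ ∑-cong xs (λ i → trans (∑-cong xs (λ j → trans (cong (λ z → c i * c j * (+ q * z - 1ℤ)) (ind-⇔ (φ i ⊕ ⊖ φ j ≟F 0F) (φ i ≟F φ j) x⊖y≡0 (λ e → trans (cong (λ z → z ⊕ ⊖ φ j) e) (⊖-inverseʳ _)))) (e1 (c i) (c j) (+ q) (ind (φ i ≟F φ j))))) (∑-minus xs _ _)) ⟩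
      ∑ xs (λ i → ∑ xs (λ j → + q * (c i * c j * ind (φ i ≟F φ j))) - ∑ xs (λ j → c i * c j))
        ≡⟨ trans (∑-minus xs _ _) (cong₂ _-_ (trans (∑-cong xs (λ i → ∑-*ˡ xs (+ q) _)) (∑-*ˡ xs (+ q) _)) (∑-∑* xs xs c c)) ⟩
      + q * ∑ xs (λ i → ∑ xs (λ j → c i * c j * ind (φ i ≟F φ j))) - ∑ xs c * ∑ xs c
        ≡⟨ cong₂ (λ a b → + q * a - b * b) (sym h²) (sym ∑h) ⟩
      + q * ∑ Fs (λ x → h x * h x) - ∑ Fs h * ∑ Fs h ∎)) (∑²≤q∑ h)
      where
      open ≡-Reasoning
      h : F → ℤ
      h x = ∑ xs (λ i → ind (x ≟F φ i) * c i)
      e1 : ∀ a b q i → a * b * (q * i - 1ℤ) ≡ q * (a * b * i) - a * b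
      e1 = solve-∀
      e2 : ∀ i a j b → i * a * (j * b) ≡ i * (a * b * j)
      e2 = solve-∀
      ∑h : ∑ Fs h ≡ ∑ xs c
      ∑h = trans (∑-swap Fs xs _) (∑-cong xs (λ i → ∑-ind finite (φ i) (λ _ → c i)))
      h² : ∑ Fs (λ x → h x * h x) ≡ ∑ xs (λ i → ∑ xs (λ j → c i * c j * ind (φ i ≟F φ j)))
      h² = begin
        ∑ Fs (λ x → h x * h x) ≡⟨ ∑-cong Fs (λ x → sym (∑-∑* xs xs _ _)) ⟩
        ∑ Fs (λ x → ∑ xs (λ i → ∑ xs (λ j → ind (x ≟F φ i) * c i * (ind (x ≟F φ j) * c j)))) ≡⟨ trans (∑-swap Fs xs _) (∑-cong xs (λ i → ∑-swap Fs xs _)) ⟩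
        ∑ xs (λ i → ∑ xs (λ j → ∑ Fs (λ x → ind (x ≟F φ i) * c i * (ind (x ≟F φ j) * c j)))) ≡⟨ ∑-cong xs (λ i → ∑-cong xs (λ j →
            trans (∑-cong Fs (λ x → e2 (ind (x ≟F φ i)) (c i) (ind (x ≟F φ j)) (c j))) (∑-ind finite (φ i) (λ x → c i * c j * ind (x ≟F φ j))))) ⟩
        ∑ xs (λ i → ∑ xs (λ j → c i * c j * ind (φ i ≟F φ j))) ∎

    -- The autocorrelation of the Fourier coefficient of g at m.
    module Twisted {d} (g : V d → ℤ) (m : V d) where
      ℓ : F → ℤ
      ℓ c = ∑ (Vs d) (λ y → ∑ (Vs d) (λ y′ → g y * g y′ * e (c ⊕ (dot m y ⊕ ⊖ dot m y′))))

      autocorrelation : Autocorrelation ℓ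
      autocorrelation = record { null = null ; even = even ; positive = positive }
        where
        null : Null ℓ
        null = trans (∑-swap Fs (Vs d) _) (trans (∑-cong (Vs d) (λ y → trans (∑-swap Fs (Vs d) _) (trans (∑-cong (Vs d) (λ y′ →
          trans (∑-*ˡ Fs (g y * g y′) _) (trans (cong (g y * g y′ *_) (trans (∑-shift _ e) e-null)) (ℤₚ.*-zeroʳ (g y * g y′))))) (∑-ε (Vs d))))) (∑-ε (Vs d)))
        even : ∀ x → ℓ (⊖ x) ≡ ℓ x
        even x = trans (∑-swap (Vs d) (Vs d) _) (∑-cong (Vs d) (λ y → ∑-cong (Vs d) (λ y′ → cong₂ _*_ (ℤₚ.*-comm (g y′) (g y))
          (trans (cong e (solve 3 (λ x a b → (:- x) :+ (b :- a) := :- (x :+ (a :- b))) refl x (dot m y) (dot m y′))) (e-even _)))))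
        positive : ∀ {A : Set} (xs : List A) (c : A → ℤ) (φ : A → F) → 0ℤ ≤ ∑ xs (λ i → ∑ xs (λ j → c i * c j * ℓ (φ i ⊕ ⊖ φ j)))
        positive xs c φ = subst (0ℤ ≤_) (begin
          ∑ prod (λ a → ∑ prod (λ b → C a * C b * e (ψ a ⊕ ⊖ ψ b)))
            ≡⟨ trans (∑-cong prod (λ a → ∑-× xs (Vs d) _)) (∑-× xs (Vs d) _) ⟩
          ∑ xs (λ i → ∑ (Vs d) (λ y → ∑ xs (λ j → ∑ (Vs d) (λ y′ → C (i , y) * C (j , y′) * e (ψ (i , y) ⊕ ⊖ ψ (j , y′))))))
            ≡⟨ ∑-cong xs (λ i → ∑-swap (Vs d) xs _) ⟩
          ∑ xs (λ i → ∑ xs (λ j → ∑ (Vs d) (λ y → ∑ (Vs d) (λ y′ → C (i , y) * C (j , y′) * e (ψ (i , y) ⊕ ⊖ ψ (j , y′))))))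
            ≡⟨ ∑-cong xs (λ i → ∑-cong xs (λ j → trans (∑-cong (Vs d) (λ y → trans (∑-cong (Vs d) (λ y′ → term i j y y′)) (∑-*ˡ (Vs d) (c i * c j) _))) (∑-*ˡ (Vs d) (c i * c j) _))) ⟩
          ∑ xs (λ i → ∑ xs (λ j → c i * c j * ℓ (φ i ⊕ ⊖ φ j))) ∎) (e-positive prod C ψ)
          where
          open ≡-Reasoning
          prod = cartesianProduct xs (Vs d)
          C : _ × V d → ℤ
          C (i , y) = c i * g y
          ψ : _ × V d → F
          ψ (i , y) = φ i ⊕ dot m y
          e1 : ∀ a x b y z → a * x * (b * y) * z ≡ a * b * (x * y * z)
          e1 = solve-∀
          term : ∀ i j y y′ → c i * g y * (c j * g y′) * e ((φ i ⊕ dot m y) ⊕ ⊖ (φ j ⊕ dot m y′)) ≡ c i * c j * (g y * g y′ * e ((φ i ⊕ ⊖ φ j) ⊕ (dot m y ⊕ ⊖ dot m y′)))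
          term i j y y′ = trans (e1 (c i) (g y) (c j) (g y′) _) (cong (λ z → c i * c j * (g y * g y′ * e z))
            (solve 4 (λ a b c d → (a :+ b) :- (c :+ d) := (a :- c) :+ (b :- d)) refl (φ i) (dot m y) (φ j) (dot m y′)))

    δ-twist : ∀ {f} → Null f → ∀ {s} → s ≢ 0F → ∀ b → ∑ Fs (λ u → f (δ ⊗ s ⊗ (u ⊗ u) ⊕ b)) ≡ - ∑ Fs (λ u → f (s ⊗ (u ⊗ u) ⊕ b))
    δ-twist {f} nf {s} s≢0 b = trans (∑-cong Fs (λ u → cong (λ z → f (z ⊕ b)) (solve 3 (λ d s u → d :* s :* u := s :* (d :* u)) refl δ s (u ⊗ u))))
      (negate (trans (squares+nonsquares δ-nonsquare (λ D → f (s ⊗ D ⊕ b))) (cong (+ 2 *_) (null-affine nf s≢0 b))))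
      where
      negate : ∀ {x y} → x + y ≡ 0ℤ → y ≡ - x
      negate {x} {y} eq = trans (e1 x y) (trans (cong (λ z → z - x) eq) (ℤₚ.+-identityˡ _))
        where
        e1 : ∀ x y → y ≡ x + y - x
        e1 = solve-∀

    hyperbolic : ∀ {f} → Null f → ∀ {s} → s ≢ 0F → ∀ c → ∑ Fs (λ u → ∑ Fs (λ v → f (s ⊗ (u ⊗ u ⊕ ⊖ (v ⊗ v)) ⊕ c))) ≡ + q * f c
    hyperbolic {f} nf {s} s≢0 c = begin
      ∑ Fs (λ u → ∑ Fs (λ v → f (s ⊗ (u ⊗ u ⊕ ⊖ (v ⊗ v)) ⊕ c)))
        ≡⟨ ∑-cong Fs (λ u → ∑-cong Fs (λ v → cong (λ z → f (z ⊕ c)) (solve 3 (λ s u v → s :* (u :* u :- v :* v) := (s :* (u :+ v)) :* (u :- v)) refl s u v))) ⟩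
      ∑ Fs (λ u → ∑ Fs (λ v → f ((s ⊗ (u ⊕ v)) ⊗ (u ⊕ ⊖ v) ⊕ c))) ≡⟨ sym (∑-sum-difference (λ x y → f ((s ⊗ x) ⊗ y ⊕ c))) ⟩
      ∑ Fs (λ x → ∑ Fs (λ y → f ((s ⊗ x) ⊗ y ⊕ c))) ≡⟨ ∑-cong Fs (λ x → trans (orthogonality nf (s ⊗ x) c) (cong (_* (+ q * f c)) (ind-⇔ (s ⊗ x ≟F 0F) (x ≟F 0F) (x≡0 x) (λ { refl → ⊗-zeroʳ s })))) ⟩
      ∑ Fs (λ x → ind (x ≟F 0F) * (+ q * f c)) ≡⟨ ∑-ind finite 0F _ ⟩
      + q * f c ∎
      where
      open ≡-Reasoning
      x≡0 : ∀ x → s ⊗ x ≡ 0F → x ≡ 0F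
      x≡0 x eq = ⊗-cancelˡ s≢0 (trans eq (sym (⊗-zeroʳ s)))

    -- the quadratic character of −1
    sign : ∃ λ ε → ε * ε ≡ 1ℤ × (∀ {f} → Null f → ∀ {s} → s ≢ 0F → ∀ b → ∑ Fs (λ v → f (s ⊗ (v ⊗ v) ⊕ b)) ≡ ε * ∑ Fs (λ v → f (s ⊗ ⊖ (v ⊗ v) ⊕ b)))
    sign with Any.any? (λ i → i ⊗ i ≟F ⊖ 1F) Fs
    ... | yes ∃i with M.find ∃i
    ... | i , _ , i²≡-1 = 1ℤ , refl , λ {f} nf {s} s≢0 b → trans (sym (∑-scale i≢0 (λ v → f (s ⊗ (v ⊗ v) ⊕ b))))
          (trans (∑-cong Fs (λ v → cong (λ z → f (s ⊗ z ⊕ b)) (trans (solve 2 (λ i v → (i :* v) :* (i :* v) := (i :* i) :* (v :* v)) refl i v)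
            (trans (cong (_⊗ (v ⊗ v)) i²≡-1) (solve 1 (λ v → (:- con 1ℤ) :* v := :- v) refl (v ⊗ v)))))) (sym (ℤₚ.*-identityˡ _)))
      where
      i≢0 : i ≢ 0F
      i≢0 refl = ⊖≢0 1≢0 (trans (sym i²≡-1) (⊗-zeroˡ 0F))
    sign | no ¬i = - 1ℤ , refl , λ {f} nf {s} s≢0 b → negate (trans (cong (λ z → ∑ Fs (λ v → f (s ⊗ (v ⊗ v) ⊕ b)) + z) (∑-cong Fs (λ v → cong (λ z → f (s ⊗ z ⊕ b)) (solve 1 (λ v → :- v := (:- con 1ℤ) :* v) refl (v ⊗ v)))))
         (trans (squares+nonsquares (λ x e → ¬i (M.lose (complete x) e)) (λ D → f (s ⊗ D ⊕ b))) (cong (+ 2 *_) (null-affine nf s≢0 b))))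
      where
      negate : ∀ {x y} → x + y ≡ 0ℤ → x ≡ - 1ℤ * y
      negate {x} {y} eq = trans (e1 x y) (trans (cong (λ z → z + - 1ℤ * y) eq) (ℤₚ.+-identityˡ _))
        where
        e1 : ∀ x y → x ≡ x + y + - 1ℤ * y
        e1 = solve-∀

    ε : ℤ
    ε = proj₁ sign

    two-squares : ∀ {f} → Null f → ∀ {s} → s ≢ 0F → ∀ c → ∑ Fs (λ u → ∑ Fs (λ v → f (s ⊗ (u ⊗ u ⊕ v ⊗ v) ⊕ c))) ≡ ε * (+ q * f c)
    two-squares {f} nf {s} s≢0 c = trans (∑-cong Fs (λ u → trans (∑-cong Fs (λ v → cong f (e1 s u v c))) (trans (proj₂ (proj₂ sign) nf s≢0 (s ⊗ (u ⊗ u) ⊕ c)) (cong (ε *_) (∑-cong Fs (λ v → cong f (e2 s u v c)))))))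
      (trans (∑-*ˡ Fs ε _) (cong (ε *_) (hyperbolic nf s≢0 c)))
      where
      e1 : ∀ s u v c → s ⊗ (u ⊗ u ⊕ v ⊗ v) ⊕ c ≡ s ⊗ (v ⊗ v) ⊕ (s ⊗ (u ⊗ u) ⊕ c)
      e1 = solve 4 (λ s u v c → s :* (u :* u :+ v :* v) :+ c := s :* (v :* v) :+ (s :* (u :* u) :+ c)) refl
      e2 : ∀ s u v c → s ⊗ ⊖ (v ⊗ v) ⊕ (s ⊗ (u ⊗ u) ⊕ c) ≡ s ⊗ (u ⊗ u ⊕ ⊖ (v ⊗ v)) ⊕ c
      e2 = solve 4 (λ s u v c → s :* (:- (v :* v)) :+ (s :* (u :* u) :+ c) := s :* (u :* u :- v :* v) :+ c) refl

    ¼ : F → F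
    ¼ s = ½ ⊗ ½ ⊗ inv s

    complete-square₁ : ∀ (f : F → ℤ) {s} → s ≢ 0F → ∀ m b → ∑ Fs (λ u → f (s ⊗ (u ⊗ u) ⊕ m ⊗ u ⊕ b)) ≡ ∑ Fs (λ u → f (s ⊗ (u ⊗ u) ⊕ (⊖ (m ⊗ m ⊗ ¼ s) ⊕ b)))
    complete-square₁ f {s} s≢0 m b = trans (∑-cong Fs (λ u → cong f (eq u))) (∑-shift (½ ⊗ (m ⊗ inv s)) (λ u → f (s ⊗ (u ⊗ u) ⊕ (⊖ (m ⊗ m ⊗ ¼ s) ⊕ b))))
      where
      eq : ∀ u → s ⊗ (u ⊗ u) ⊕ m ⊗ u ⊕ b ≡ s ⊗ ((u ⊕ ½ ⊗ (m ⊗ inv s)) ⊗ (u ⊕ ½ ⊗ (m ⊗ inv s))) ⊕ (⊖ (m ⊗ m ⊗ ¼ s) ⊕ b)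
      eq u = sym (begin
        s ⊗ ((u ⊕ ½ ⊗ (m ⊗ i)) ⊗ (u ⊕ ½ ⊗ (m ⊗ i))) ⊕ (⊖ (m ⊗ m ⊗ (½ ⊗ ½ ⊗ i)) ⊕ b)
          ≡⟨ solve 6 (λ s u h m i b → s :* ((u :+ h :* (m :* i)) :* (u :+ h :* (m :* i))) :+ ((:- (m :* m :* (h :* h :* i))) :+ b)
               := s :* (u :* u) :+ (h :* ((s :* i) :* (m :* u)) :+ h :* ((s :* i) :* (m :* u))) :+ ((s :* i) :* (m :* m :* (h :* h :* i)) :- m :* m :* (h :* h :* i)) :+ b) refl s u ½ m i b ⟩
        s ⊗ (u ⊗ u) ⊕ (½ ⊗ ((s ⊗ i) ⊗ (m ⊗ u)) ⊕ ½ ⊗ ((s ⊗ i) ⊗ (m ⊗ u))) ⊕ ((s ⊗ i) ⊗ (m ⊗ m ⊗ (½ ⊗ ½ ⊗ i)) ⊕ ⊖ (m ⊗ m ⊗ (½ ⊗ ½ ⊗ i))) ⊕ b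
          ≡⟨ cong₂ (λ x y → s ⊗ (u ⊗ u) ⊕ x ⊕ (y ⊕ ⊖ (m ⊗ m ⊗ (½ ⊗ ½ ⊗ i))) ⊕ b) (trans (½⊕½ _) (one (m ⊗ u))) (one _) ⟩
        s ⊗ (u ⊗ u) ⊕ m ⊗ u ⊕ (m ⊗ m ⊗ (½ ⊗ ½ ⊗ i) ⊕ ⊖ (m ⊗ m ⊗ (½ ⊗ ½ ⊗ i))) ⊕ b
          ≡⟨ solve 4 (λ x y z b → x :+ y :+ (z :- z) :+ b := x :+ y :+ b) refl (s ⊗ (u ⊗ u)) (m ⊗ u) (m ⊗ m ⊗ (½ ⊗ ½ ⊗ i)) b ⟩
        s ⊗ (u ⊗ u) ⊕ m ⊗ u ⊕ b ∎)
        where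
        open ≡-Reasoning
        i = inv s
        one : ∀ x → (s ⊗ i) ⊗ x ≡ x
        one x = trans (cong (_⊗ x) (inv-r s≢0)) (⊗-identityˡ x)

    complete-square : ∀ d (f : F → ℤ) {s} → s ≢ 0F → ∀ (m : V d) b →
      ∑ (Vs d) (λ x → f (s ⊗ ‖ x ‖ ⊕ dot m x ⊕ b)) ≡ ∑ (Vs d) (λ x → f (s ⊗ ‖ x ‖ ⊕ (⊖ (‖ m ‖ ⊗ ¼ s) ⊕ b)))
    complete-square zero f {s} s≢0 [] b = cong (λ z → f z + 0ℤ) (solve 3 (λ s b w → s :* con 0ℤ :+ con 0ℤ :+ b := s :* con 0ℤ :+ ((:- (con 0ℤ :* w)) :+ b)) refl s b (¼ s))
    complete-square (suc d) f {s} s≢0 (a ∷ m) b = begin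
      ∑ (Vs (suc d)) (λ x → f (s ⊗ ‖ x ‖ ⊕ dot (a ∷ m) x ⊕ b)) ≡⟨ ∑V-suc d _ ⟩
      ∑ Fs (λ u → ∑ (Vs d) (λ x → f (s ⊗ (u ⊗ u ⊕ ‖ x ‖) ⊕ (a ⊗ u ⊕ dot m x) ⊕ b)))
        ≡⟨ ∑-cong Fs (λ u → trans (∑-cong (Vs d) (λ x → cong f (e1 s (u ⊗ u) (‖ x ‖) (a ⊗ u) (dot m x) b))) (trans (complete-square d f s≢0 m (s ⊗ (u ⊗ u) ⊕ a ⊗ u ⊕ b)) (∑-cong (Vs d) (λ x → cong f (e2 (s ⊗ ‖ x ‖) (‖ m ‖ ⊗ ¼ s) (s ⊗ (u ⊗ u)) (a ⊗ u) b))))) ⟩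
      ∑ Fs (λ u → ∑ (Vs d) (λ x → f (s ⊗ (u ⊗ u) ⊕ a ⊗ u ⊕ (s ⊗ ‖ x ‖ ⊕ ⊖ (‖ m ‖ ⊗ ¼ s) ⊕ b)))) ≡⟨ ∑-swap Fs (Vs d) _ ⟩
      ∑ (Vs d) (λ x → ∑ Fs (λ u → f (s ⊗ (u ⊗ u) ⊕ a ⊗ u ⊕ (s ⊗ ‖ x ‖ ⊕ ⊖ (‖ m ‖ ⊗ ¼ s) ⊕ b))))
        ≡⟨ ∑-cong (Vs d) (λ x → trans (complete-square₁ f s≢0 a _) (∑-cong Fs (λ u → cong f (e3 s (u ⊗ u) (‖ x ‖) (a ⊗ a) (‖ m ‖) (¼ s) b)))) ⟩
      ∑ (Vs d) (λ x → ∑ Fs (λ u → f (s ⊗ (u ⊗ u ⊕ ‖ x ‖) ⊕ (⊖ ((a ⊗ a ⊕ ‖ m ‖) ⊗ ¼ s) ⊕ b)))) ≡⟨ ∑-swap (Vs d) Fs _ ⟩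
      ∑ Fs (λ u → ∑ (Vs d) (λ x → f (s ⊗ (u ⊗ u ⊕ ‖ x ‖) ⊕ (⊖ ((a ⊗ a ⊕ ‖ m ‖) ⊗ ¼ s) ⊕ b)))) ≡⟨ sym (∑V-suc d _) ⟩
      ∑ (Vs (suc d)) (λ x → f (s ⊗ ‖ x ‖ ⊕ (⊖ (‖ a ∷ m ‖ ⊗ ¼ s) ⊕ b))) ∎
      where
      open ≡-Reasoning
      e1 : ∀ s u x a m b → s ⊗ (u ⊕ x) ⊕ (a ⊕ m) ⊕ b ≡ s ⊗ x ⊕ m ⊕ (s ⊗ u ⊕ a ⊕ b)
      e1 = solve 6 (λ s u x a m b → s :* (u :+ x) :+ (a :+ m) :+ b := s :* x :+ m :+ (s :* u :+ a :+ b)) refl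
      e2 : ∀ x m u a b → x ⊕ (⊖ m ⊕ (u ⊕ a ⊕ b)) ≡ u ⊕ a ⊕ (x ⊕ ⊖ m ⊕ b)
      e2 = solve 5 (λ x m u a b → x :+ ((:- m) :+ (u :+ a :+ b)) := u :+ a :+ (x :- m :+ b)) refl
      e3 : ∀ s u x a m w b → s ⊗ u ⊕ (⊖ (a ⊗ w) ⊕ (s ⊗ x ⊕ ⊖ (m ⊗ w) ⊕ b)) ≡ s ⊗ (u ⊕ x) ⊕ (⊖ ((a ⊕ m) ⊗ w) ⊕ b)
      e3 = solve 7 (λ s u x a m w b → s :* u :+ ((:- (a :* w)) :+ (s :* x :- m :* w :+ b)) := s :* (u :+ x) :+ ((:- ((a :+ m) :* w)) :+ b)) refl

    gauss-step : ∀ d {f} → Null f → ∀ {s} → s ≢ 0F → ∀ b → ∑ (Vs (suc (suc d))) (λ x → f (s ⊗ ‖ x ‖ ⊕ b)) ≡ (ε * + q) * ∑ (Vs d) (λ x → f (s ⊗ ‖ x ‖ ⊕ b))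
    gauss-step d {f} nf {s} s≢0 b = begin
      ∑ (Vs (suc (suc d))) (λ x → f (s ⊗ ‖ x ‖ ⊕ b)) ≡⟨ trans (∑V-suc (suc d) _) (∑-cong Fs (λ u → ∑V-suc d _)) ⟩
      ∑ Fs (λ u → ∑ Fs (λ v → ∑ (Vs d) (λ x → f (s ⊗ (u ⊗ u ⊕ (v ⊗ v ⊕ ‖ x ‖)) ⊕ b)))) ≡⟨ trans (∑-cong Fs (λ u → ∑-swap Fs (Vs d) _)) (∑-swap Fs (Vs d) _) ⟩
      ∑ (Vs d) (λ x → ∑ Fs (λ u → ∑ Fs (λ v → f (s ⊗ (u ⊗ u ⊕ (v ⊗ v ⊕ ‖ x ‖)) ⊕ b))))
        ≡⟨ ∑-cong (Vs d) (λ x → trans (∑-cong Fs (λ u → ∑-cong Fs (λ v → cong f (e1 s (u ⊗ u) (v ⊗ v) (‖ x ‖) b)))) (trans (two-squares nf s≢0 _) (sym (ℤₚ.*-assoc ε (+ q) _)))) ⟩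
      ∑ (Vs d) (λ x → (ε * + q) * f (s ⊗ ‖ x ‖ ⊕ b)) ≡⟨ ∑-*ˡ (Vs d) (ε * + q) _ ⟩
      (ε * + q) * ∑ (Vs d) (λ x → f (s ⊗ ‖ x ‖ ⊕ b)) ∎
      where
      open ≡-Reasoning
      e1 : ∀ s u v x b → s ⊗ (u ⊕ (v ⊕ x)) ⊕ b ≡ s ⊗ (u ⊕ v) ⊕ (s ⊗ x ⊕ b)
      e1 = solve 5 (λ s u v x b → s :* (u :+ (v :+ x)) :+ b := s :* (u :+ v) :+ (s :* x :+ b)) refl

    -- sums of quadratic phases over F^d reduce to dimension d mod 2
    data Reduction (d : ℕ) : Set where
      even : ∀ c → c * c ≡ + (q ℕ.^ d) → (∀ {f} → Null f → ∀ {s} → s ≢ 0F → ∀ b → ∑ (Vs d) (λ x → f (s ⊗ ‖ x ‖ ⊕ b)) ≡ c * f b) → Reduction d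
      odd  : ∀ c → + q * (c * c) ≡ + (q ℕ.^ d) → (∀ {f} → Null f → ∀ {s} → s ≢ 0F → ∀ b → ∑ (Vs d) (λ x → f (s ⊗ ‖ x ‖ ⊕ b)) ≡ c * ∑ Fs (λ u → f (s ⊗ (u ⊗ u) ⊕ b))) → Reduction d

    reduction : ∀ d → Reduction d
    reduction zero = even 1ℤ refl (λ {f} nf {s} s≢0 b → trans (ℤₚ.+-identityʳ _) (trans (cong f (trans (cong (_⊕ b) (⊗-zeroʳ s)) (⊕-identityˡ b))) (sym (ℤₚ.*-identityˡ _))))
    reduction (suc zero) = odd 1ℤ (trans (ℤₚ.*-identityʳ (+ q)) (cong +_ (sym (ℕₚ.*-identityʳ q)))) (λ {f} nf {s} s≢0 b → trans (∑V-suc 0 _) (trans (∑-cong Fs (λ u → trans (ℤₚ.+-identityʳ _) (cong (λ z → f (s ⊗ z ⊕ b)) (⊕-identityʳ (u ⊗ u))))) (sym (ℤₚ.*-identityˡ _))))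
    reduction (suc (suc d)) with reduction d
    ... | even c cc h = even (ε * + q * c) (trans (square ε (+ q) c) (trans (cong₂ (λ x y → x * (+ q * (+ q * y))) (proj₁ (proj₂ sign)) cc) (powers q (q ℕ.^ d))))
          (λ nf s≢0 b → trans (gauss-step d nf s≢0 b) (trans (cong (ε * + q *_) (h nf s≢0 b)) (sym (ℤₚ.*-assoc (ε * + q) c _))))
      where
      square : ∀ e q c → e * q * c * (e * q * c) ≡ (e * e) * (q * (q * (c * c)))
      square = solve-∀
      powers : ∀ q n → 1ℤ * (+ q * (+ q * + n)) ≡ + (q ℕ.* (q ℕ.* n))
      powers q n = trans (ℤₚ.*-identityˡ _) (trans (cong (+ q *_) (sym (ℤₚ.pos-* q n))) (sym (ℤₚ.pos-* q (q ℕ.* n))))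
    ... | odd c cc h = odd (ε * + q * c) (trans (square ε (+ q) c) (trans (cong₂ (λ x y → x * (+ q * (+ q * y))) (proj₁ (proj₂ sign)) cc) (powers q (q ℕ.^ d))))
          (λ nf s≢0 b → trans (gauss-step d nf s≢0 b) (trans (cong (ε * + q *_) (h nf s≢0 b)) (sym (ℤₚ.*-assoc (ε * + q) c _))))
      where
      square : ∀ e q c → q * (e * q * c * (e * q * c)) ≡ (e * e) * (q * (q * (q * (c * c))))
      square = solve-∀
      powers : ∀ q n → 1ℤ * (+ q * (+ q * + n)) ≡ + (q ℕ.* (q ℕ.* n))
      powers q n = trans (ℤₚ.*-identityˡ _) (trans (cong (+ q *_) (sym (ℤₚ.pos-* q n))) (sym (ℤₚ.pos-* q (q ℕ.* n))))

    -- a weighted sum of additive characters, seen through its action on null functions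
    record Wave : Set₁ where
      constructor wave
      field
        {Index} : Set
        indices : List Index
        weight  : Index → ℤ
        phase   : Index → F

    open Wave

    apply : Wave → (F → ℤ) → F → ℤ
    apply W f b = ∑ (indices W) (λ i → weight W i * f (phase W i ⊕ b))

    infix 4 _≈_
    record _≈_ (W W′ : Wave) : Set where
      field
        act : ∀ {f} → Null f → ∀ b → apply W f b ≡ apply W′ f b

    open _≈_

    energy : Wave → (F → ℤ) → ℤ
    energy W ℓ = ∑ (indices W) (λ i → ∑ (indices W) (λ j → weight W i * weight W j * ℓ (phase W i ⊕ ⊖ phase W j)))

    energy-cong : ∀ {ℓ} → Autocorrelation ℓ → ∀ {W W′} → W ≈ W′ → energy W ℓ ≡ energy W′ ℓ
    energy-cong {ℓ} auto {W} {W′} W≈W′ = begin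
      energy W ℓ ≡⟨ as-apply W W ⟩
      ∑ (indices W) (λ i → weight W i * apply W ℓ (⊖ phase W i)) ≡⟨ ∑-cong (indices W) (λ i → cong (weight W i *_) (act W≈W′ null (⊖ phase W i))) ⟩
      ∑ (indices W) (λ i → weight W i * apply W′ ℓ (⊖ phase W i)) ≡⟨ sym (as-apply W W′) ⟩
      ∑ (indices W) (λ i → ∑ (indices W′) (λ j → weight W i * weight W′ j * ℓ (phase W i ⊕ ⊖ phase W′ j))) ≡⟨ ∑-swap (indices W) (indices W′) _ ⟩
      ∑ (indices W′) (λ j → ∑ (indices W) (λ i → weight W i * weight W′ j * ℓ (phase W i ⊕ ⊖ phase W′ j)))
        ≡⟨ ∑-cong (indices W′) (λ j → ∑-cong (indices W) (λ i → cong₂ _*_ (ℤₚ.*-comm (weight W i) (weight W′ j)) (at-difference (phase W i) (phase W′ j)))) ⟩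
      ∑ (indices W′) (λ j → ∑ (indices W) (λ i → weight W′ j * weight W i * ℓ (phase W′ j ⊕ ⊖ phase W i))) ≡⟨ as-apply W′ W ⟩
      ∑ (indices W′) (λ j → weight W′ j * apply W ℓ (⊖ phase W′ j)) ≡⟨ ∑-cong (indices W′) (λ j → cong (weight W′ j *_) (act W≈W′ null (⊖ phase W′ j))) ⟩
      ∑ (indices W′) (λ j → weight W′ j * apply W′ ℓ (⊖ phase W′ j)) ≡⟨ sym (as-apply W′ W′) ⟩
      energy W′ ℓ ∎
      where
      open ≡-Reasoning
      open Autocorrelation auto
      as-apply : ∀ X Y → ∑ (indices X) (λ i → ∑ (indices Y) (λ j → weight X i * weight Y j * ℓ (phase X i ⊕ ⊖ phase Y j)))
                       ≡ ∑ (indices X) (λ i → weight X i * apply Y ℓ (⊖ phase X i))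
      as-apply X Y = ∑-cong (indices X) (λ i → trans (∑-cong (indices Y) (λ j → trans (ℤₚ.*-assoc (weight X i) (weight Y j) _)
        (cong (λ z → weight X i * (weight Y j * z)) (trans (at-difference (phase X i) (phase Y j)) refl)))) (∑-*ˡ (indices Y) (weight X i) _))

    ≈-trans : ∀ {X Y Z} → X ≈ Y → Y ≈ Z → X ≈ Z
    ≈-trans X≈Y Y≈Z .act nf b = trans (act X≈Y nf b) (act Y≈Z nf b)

    energy-point : ∀ c ℓ → energy (wave (0F ∷ []) (λ _ → c) (λ x → x)) ℓ ≡ c * c * ℓ 0F
    energy-point c ℓ = trans (trans (ℤₚ.+-identityʳ _) (ℤₚ.+-identityʳ _)) (cong (λ z → c * c * ℓ z) (⊖-inverseʳ 0F))

    roots : F → ℤ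
    roots ρ = ∑ Fs (λ u → ind (u ⊗ u ≟F ρ))

    0≤roots : ∀ ρ → 0ℤ ≤ roots ρ
    0≤roots ρ = ∑≥0 Fs (λ u → ind≥0 (u ⊗ u ≟F ρ))

    roots≤2 : ∀ ρ → roots ρ ≤ + 2
    roots≤2 ρ = ℤₚ.≤-trans (ℤₚ.≤-reflexive (∑-cong Fs (λ u → ind-⇔ (u ⊗ u ≟F ρ) (1F ⊗ (u ⊗ u) ≟F ρ) (trans (⊗-identityˡ _)) (trans (sym (⊗-identityˡ _)))))) (roots-≤2 1F 1≢0 ρ)

    e-difference : ∀ u ρ → e (u ⊗ u ⊕ ⊖ ρ) ≡ + q * ind (u ⊗ u ≟F ρ) - 1ℤ
    e-difference u ρ = cong (λ z → + q * z - 1ℤ) (ind-⇔ (u ⊗ u ⊕ ⊖ ρ ≟F 0F) (u ⊗ u ≟F ρ) x⊖y≡0 (λ eq → trans (cong (_⊕ ⊖ ρ) eq) (⊖-inverseʳ ρ)))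

    salié-bound : ∀ {ℓ} → Autocorrelation ℓ → ∀ c w ρ → energy (wave Fs (λ u → c * e (u ⊗ u ⊕ ⊖ ρ)) (w ⊗_)) ℓ ≤ c * c * (+ 4 * (+ q * + q)) * ℓ 0F
    salié-bound {ℓ} auto c w ρ = Sum.[ w≡0 , w≢0 ]′ (zero? w)
      where
      open Autocorrelation auto
      N = roots ρ
      cc≥0 : 0ℤ ≤ c * c * (+ q * + q)
      cc≥0 = subst (0ℤ ≤_) (e1 c (+ q)) (0≤i*i (c * + q))
        where
        e1 : ∀ c q → (c * q) * (c * q) ≡ c * c * (q * q)
        e1 = solve-∀
      scale : ∀ {x} → x ≤ + 4 → c * c * (+ q * + q) * x * ℓ 0F ≤ c * c * (+ 4 * (+ q * + q)) * ℓ 0F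
      scale {x} le = ℤₚ.≤-trans (ℤₚ.*-monoʳ-≤-nonNeg (ℓ 0F) {{ℤ.nonNegative ℓ0≥0}} (ℤₚ.*-monoˡ-≤-nonNeg (c * c * (+ q * + q)) {{ℤ.nonNegative cc≥0}} le))
        (ℤₚ.≤-reflexive (cong (_* ℓ 0F) (e2 (c * c) (+ q * + q))))
        where
        e2 : ∀ c q → c * q * + 4 ≡ c * (+ 4 * q)
        e2 = solve-∀
      w≡0 : w ≡ 0F → energy (wave Fs (λ u → c * e (u ⊗ u ⊕ ⊖ ρ)) (w ⊗_)) ℓ ≤ c * c * (+ 4 * (+ q * + q)) * ℓ 0F
      w≡0 refl = ℤₚ.≤-trans (ℤₚ.≤-reflexive (trans (energy-cong auto collapse) (trans (energy-point total ℓ) (cong (_* ℓ 0F) (e2 c (+ q) N))))) (scale small)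
        where
        total : ℤ
        total = c * (+ q * (N - 1ℤ))
        e1 : ∀ q n → q * n - q * 1ℤ ≡ q * (n - 1ℤ)
        e1 = solve-∀
        e2 : ∀ c q n → c * (q * (n - 1ℤ)) * (c * (q * (n - 1ℤ))) ≡ c * c * (q * q) * ((n - 1ℤ) * (n - 1ℤ))
        e2 = solve-∀
        e3 : ∀ n → 1ℤ - (n - 1ℤ) * (n - 1ℤ) ≡ n * (+ 2 - n)
        e3 = solve-∀
        collapse : wave Fs (λ u → c * e (u ⊗ u ⊕ ⊖ ρ)) (0F ⊗_) ≈ wave (0F ∷ []) (λ _ → total) (λ x → x)
        collapse .act {f} nf b = begin
          ∑ Fs (λ u → c * e (u ⊗ u ⊕ ⊖ ρ) * f (0F ⊗ u ⊕ b)) ≡⟨ ∑-cong Fs (λ u → cong (λ z → c * e (u ⊗ u ⊕ ⊖ ρ) * f (z ⊕ b)) (⊗-zeroˡ u)) ⟩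
          ∑ Fs (λ u → c * e (u ⊗ u ⊕ ⊖ ρ) * f (0F ⊕ b)) ≡⟨ trans (∑-*ʳ Fs (f (0F ⊕ b)) _) (cong (_* f (0F ⊕ b)) (trans (∑-*ˡ Fs c _) (cong (c *_) sum-e))) ⟩
          total * f (0F ⊕ b) ≡⟨ sym (ℤₚ.+-identityʳ _) ⟩
          total * f (0F ⊕ b) + 0ℤ ∎
          where
          open ≡-Reasoning
          sum-e : ∑ Fs (λ u → e (u ⊗ u ⊕ ⊖ ρ)) ≡ + q * (N - 1ℤ)
          sum-e = trans (∑-cong Fs (λ u → e-difference u ρ)) (trans (∑-minus Fs _ _) (trans (cong₂ _-_ (∑-*ˡ Fs (+ q) _) (∑-const Fs 1ℤ)) (e1 (+ q) N)))
        small : (N - 1ℤ) * (N - 1ℤ) ≤ + 4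
        small = ℤₚ.≤-trans (ℤₚ.0≤i-j⇒j≤i (subst (0ℤ ≤_) (sym (e3 N)) (subst (_≤ N * (+ 2 - N)) (ℤₚ.*-zeroʳ N)
          (ℤₚ.*-monoˡ-≤-nonNeg N {{ℤ.nonNegative (0≤roots ρ)}} (ℤₚ.i≤j⇒0≤j-i (roots≤2 ρ)))))) (+≤+ (ℕ.s≤s ℕ.z≤n))
      w≢0 : w ≢ 0F → energy (wave Fs (λ u → c * e (u ⊗ u ⊕ ⊖ ρ)) (w ⊗_)) ℓ ≤ c * c * (+ 4 * (+ q * + q)) * ℓ 0F
      w≢0 w≢0 = begin
        energy (wave Fs (λ u → c * e (u ⊗ u ⊕ ⊖ ρ)) (w ⊗_)) ℓ ≡⟨ energy-cong auto concentrate ⟩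
        ∑ Fs (λ u → ∑ Fs (λ v → c * (+ q * i u) * (c * (+ q * i v)) * ℓ (w ⊗ u ⊕ ⊖ (w ⊗ v))))
          ≡⟨ ∑-cong Fs (λ u → trans (∑-cong Fs (λ v → e1 c (+ q) (i u) (i v) _)) (∑-*ˡ Fs (c * c * (+ q * + q)) _)) ⟩
        ∑ Fs (λ u → c * c * (+ q * + q) * ∑ Fs (λ v → i u * i v * ℓ (w ⊗ u ⊕ ⊖ (w ⊗ v)))) ≡⟨ ∑-*ˡ Fs (c * c * (+ q * + q)) _ ⟩
        c * c * (+ q * + q) * ∑ Fs (λ u → ∑ Fs (λ v → i u * i v * ℓ (w ⊗ u ⊕ ⊖ (w ⊗ v))))
          ≤⟨ ℤₚ.*-monoˡ-≤-nonNeg (c * c * (+ q * + q)) {{ℤ.nonNegative cc≥0}} (∑-mono Fs (λ u → ∑-mono Fs (λ v → le u v))) ⟩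
        c * c * (+ q * + q) * ∑ Fs (λ u → ∑ Fs (λ v → i u * (i v * ℓ 0F))) ≡⟨ cong (c * c * (+ q * + q) *_) (trans (∑-∑* Fs Fs i _) (trans (cong (N *_) (∑-*ʳ Fs (ℓ 0F) i)) (sym (ℤₚ.*-assoc N N _)))) ⟩
        c * c * (+ q * + q) * (N * N * ℓ 0F) ≡⟨ sym (ℤₚ.*-assoc (c * c * (+ q * + q)) (N * N) (ℓ 0F)) ⟩
        c * c * (+ q * + q) * (N * N) * ℓ 0F ≤⟨ scale (square-mono (0≤roots ρ) (roots≤2 ρ)) ⟩
        c * c * (+ 4 * (+ q * + q)) * ℓ 0F ∎
        where
        open ℤₚ.≤-Reasoning
        i : F → ℤ
        i u = ind (u ⊗ u ≟F ρ)
        e1 : ∀ c q a b l → c * (q * a) * (c * (q * b)) * l ≡ c * c * (q * q) * (a * b * l)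
        e1 = solve-∀
        e2 : ∀ c q i z → c * (q * i - 1ℤ) * z ≡ c * (q * i) * z - c * z
        e2 = solve-∀
        le : ∀ u v → i u * i v * ℓ (w ⊗ u ⊕ ⊖ (w ⊗ v)) ≤ i u * (i v * ℓ 0F)
        le u v = subst (i u * i v * ℓ (w ⊗ u ⊕ ⊖ (w ⊗ v)) ≤_) (ℤₚ.*-assoc (i u) (i v) _)
          (ℤₚ.*-monoˡ-≤-nonNeg (i u * i v) {{ℤ.nonNegative ind*ind≥0}} (ℓ≤ℓ0 _))
          where
          ind*ind≥0 : 0ℤ ≤ i u * i v
          ind*ind≥0 = subst (_≤ i u * i v) (ℤₚ.*-zeroʳ (i u)) (ℤₚ.*-monoˡ-≤-nonNeg (i u) {{ℤ.nonNegative (ind≥0 (u ⊗ u ≟F ρ))}} (ind≥0 (v ⊗ v ≟F ρ)))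
        concentrate : wave Fs (λ u → c * e (u ⊗ u ⊕ ⊖ ρ)) (w ⊗_) ≈ wave Fs (λ u → c * (+ q * i u)) (w ⊗_)
        concentrate .act {f} nf b = trans (∑-cong Fs (λ u → trans (cong (λ z → c * z * f (w ⊗ u ⊕ b)) (e-difference u ρ)) (e2 c (+ q) (i u) _)))
          (trans (∑-minus Fs _ _) (trans (cong (λ z → ∑ Fs (λ u → c * (+ q * i u) * f (w ⊗ u ⊕ b)) - z) (trans (∑-*ˡ Fs c _) (trans (cong (c *_) (null-affine nf w≢0 b)) (ℤₚ.*-zeroʳ c)))) (ℤₚ.+-identityʳ _)))

    module _ (r : F) (r≢0 : r ≢ 0F) {d : ℕ} where

      θ : F → F → F
      θ t s = ⊖ (t ⊗ ¼ s) ⊕ ⊖ (r ⊗ s)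

      sphere : V d → Wave
      sphere m = wave (Vs d) (λ x → e (‖ x ‖ ⊕ ⊖ r)) (dot m)

      sphere≈ : ∀ m → sphere m ≈ wave (cartesianProduct Fs (Vs d)) (λ (s , x) → nz s) (λ (s , x) → s ⊗ ‖ x ‖ ⊕ θ ‖ m ‖ s)
      sphere≈ m .act {f} nf b = begin
        ∑ (Vs d) (λ x → e (‖ x ‖ ⊕ ⊖ r) * f (dot m x ⊕ b)) ≡⟨ ∑-cong (Vs d) (λ x → e-convolution nf _ _) ⟩
        ∑ (Vs d) (λ x → ∑ Fs (λ s → nz s * f ((‖ x ‖ ⊕ ⊖ r) ⊗ s ⊕ (dot m x ⊕ b)))) ≡⟨ ∑-swap (Vs d) Fs _ ⟩
        ∑ Fs (λ s → ∑ (Vs d) (λ x → nz s * f ((‖ x ‖ ⊕ ⊖ r) ⊗ s ⊕ (dot m x ⊕ b)))) ≡⟨ ∑-cong Fs (λ s → trans (∑-*ˡ (Vs d) (nz s) _) (trans (nz-cong s (inner s)) (sym (∑-*ˡ (Vs d) (nz s) _)))) ⟩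
        ∑ Fs (λ s → ∑ (Vs d) (λ x → nz s * f (s ⊗ ‖ x ‖ ⊕ θ ‖ m ‖ s ⊕ b))) ≡⟨ sym (∑-× Fs (Vs d) _) ⟩
        ∑ (cartesianProduct Fs (Vs d)) (λ (s , x) → nz s * f (s ⊗ ‖ x ‖ ⊕ θ ‖ m ‖ s ⊕ b)) ∎
        where
        open ≡-Reasoning
        e1 : ∀ x s y b → (x ⊕ ⊖ r) ⊗ s ⊕ (y ⊕ b) ≡ s ⊗ x ⊕ y ⊕ (⊖ (r ⊗ s) ⊕ b)
        e1 x s y b = solve 5 (λ x r s y b → (x :- r) :* s :+ (y :+ b) := s :* x :+ y :+ ((:- (r :* s)) :+ b)) refl x r s y b
        inner : ∀ s → s ≢ 0F → ∑ (Vs d) (λ x → f ((‖ x ‖ ⊕ ⊖ r) ⊗ s ⊕ (dot m x ⊕ b))) ≡ ∑ (Vs d) (λ x → f (s ⊗ ‖ x ‖ ⊕ θ ‖ m ‖ s ⊕ b))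
        inner s s≢0 = trans (∑-cong (Vs d) (λ x → cong f (e1 (‖ x ‖) s (dot m x) b))) (trans (complete-square d f s≢0 m (⊖ (r ⊗ s) ⊕ b))
          (∑-cong (Vs d) (λ x → cong f (solve 4 (λ x t r b → x :+ (t :+ (r :+ b)) := x :+ (t :+ r) :+ b) refl (s ⊗ ‖ x ‖) (⊖ (‖ m ‖ ⊗ ¼ s)) (⊖ (r ⊗ s)) b))))

      even-case : ∀ {ℓ} → Autocorrelation ℓ → ∀ c t → energy (wave Fs (λ s → c * nz s) (θ t)) ℓ ≤ c * c * (+ 5 * + q) * ℓ 0F
      even-case {ℓ} auto c t = Sum.[ t≡0 , t≢0 ]′ (zero? t)
        where
        open Autocorrelation auto
        t≡0 : t ≡ 0F → energy (wave Fs (λ s → c * nz s) (θ t)) ℓ ≤ c * c * (+ 5 * + q) * ℓ 0F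
        t≡0 refl = ℤₚ.≤-trans (ℤₚ.≤-reflexive (trans (energy-cong auto collapse) (trans (energy-point (- c) ℓ) (cong (_* ℓ 0F) (e1 c)))))
          (ℤₚ.*-monoʳ-≤-nonNeg (ℓ 0F) {{ℤ.nonNegative ℓ0≥0}} (subst (_≤ c * c * (+ 5 * + q)) (ℤₚ.*-identityʳ (c * c)) (ℤₚ.*-monoˡ-≤-nonNeg (c * c) {{ℤ.nonNegative (0≤i*i c)}}
            (subst (1ℤ ≤_) (ℤₚ.pos-* 5 q) (+≤+ (ℕₚ.≤-trans (ℕₚ.<⇒≤ 1<q) (ℕₚ.m≤n*m q 5)))))))
          where
          1<q = Poly.Polynomial.1<q 𝔽
          e1 : ∀ c → - c * - c ≡ c * c
          e1 = solve-∀
          e2 : ∀ i x → (i - 1ℤ) * x ≡ i * x - x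
          e2 = solve-∀
          collapse : wave Fs (λ s → c * nz s) (θ 0F) ≈ wave (0F ∷ []) (λ _ → - c) (λ x → x)
          collapse .act {f} nf b = begin
            ∑ Fs (λ s → c * nz s * f (θ 0F s ⊕ b)) ≡⟨ ∑-cong Fs (λ s → trans (ℤₚ.*-assoc c (nz s) _) (cong (λ z → c * (nz s * f z)) (solve 4 (λ w r s b → (:- (con 0ℤ :* w)) :- r :* s :+ b := (:- r) :* s :+ b) refl (¼ s) r s b))) ⟩
            ∑ Fs (λ s → c * (nz s * f (⊖ r ⊗ s ⊕ b))) ≡⟨ trans (∑-*ˡ Fs c _) (cong (c *_) (trans (∑-nz-orthogonality nf (⊖ r) b) (cong (λ z → (+ q * z - 1ℤ) * f b) (ind-no (⊖ r ≟F 0F) (⊖≢0 r≢0))))) ⟩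
            c * ((+ q * 0ℤ - 1ℤ) * f b) ≡⟨ e3 c (+ q) (f b) ⟩
            - c * f b ≡⟨ cong (λ z → - c * f z) (sym (⊕-identityˡ b)) ⟩
            - c * f (0F ⊕ b) ≡⟨ sym (ℤₚ.+-identityʳ _) ⟩
            - c * f (0F ⊕ b) + 0ℤ ∎
            where
            open ≡-Reasoning
            e3 : ∀ c q x → c * ((q * 0ℤ - 1ℤ) * x) ≡ - c * x
            e3 = solve-∀
        t≢0 : t ≢ 0F → energy (wave Fs (λ s → c * nz s) (θ t)) ℓ ≤ c * c * (+ 5 * + q) * ℓ 0F
        t≢0 t≢0 = begin
          energy (wave Fs (λ s → c * nz s) (θ t)) ℓ ≡⟨ energy-cong auto substitute ⟩
          ∑ Fs (λ x → ∑ Fs (λ y → c * nz x * (c * nz y) * ℓ ((x ⊕ a ⊗ inv x) ⊕ ⊖ (y ⊕ a ⊗ inv y))))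
            ≡⟨ trans (∑-cong Fs (λ x → trans (∑-cong Fs (λ y → e1 c (nz x) (nz y) _)) (∑-*ˡ Fs (c * c) _))) (∑-*ˡ Fs (c * c) _) ⟩
          c * c * ∑ Fs (λ x → ∑ Fs (λ y → nz x * nz y * ℓ ((x ⊕ a ⊗ inv x) ⊕ ⊖ (y ⊕ a ⊗ inv y))))
            ≤⟨ ℤₚ.*-monoˡ-≤-nonNeg (c * c) {{ℤ.nonNegative (0≤i*i c)}} (WeilBound.kloosterman-bound 𝔽 p k pr p≢2 1≤k q≡p^k auto a a≢0) ⟩
          c * c * (+ 5 * + q * ℓ 0F) ≡⟨ sym (ℤₚ.*-assoc (c * c) (+ 5 * + q) (ℓ 0F)) ⟩
          c * c * (+ 5 * + q) * ℓ 0F ∎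
          where
          open ℤₚ.≤-Reasoning
          a = r ⊗ t ⊗ (½ ⊗ ½)
          ½≢0 : ½ ≢ 0F
          ½≢0 = inv-≢0 2≢0
          a≢0 : a ≢ 0F
          a≢0 = ⊗-≢0 (⊗-≢0 r≢0 t≢0) (⊗-≢0 ½≢0 ½≢0)
          e1 : ∀ c x y l → c * x * (c * y) * l ≡ c * c * (x * y * l)
          e1 = solve-∀
          substitute : wave Fs (λ s → c * nz s) (θ t) ≈ wave Fs (λ x → c * nz x) (λ x → x ⊕ a ⊗ inv x)
          substitute .act {f} nf b = trans (∑-cong Fs (λ s → cong₂ (λ z y → c * z * f (y ⊕ b)) (nz-⇔ (λ { refl → ⊗-zeroʳ (⊖ r) }) (λ eq → ⊗-cancelˡ (⊖≢0 r≢0) (trans eq (sym (⊗-zeroʳ (⊖ r)))))) (same s)))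
            (∑-scale (⊖≢0 r≢0) (λ x → c * nz x * f (x ⊕ a ⊗ inv x ⊕ b)))
            where
            same : ∀ s → θ t s ≡ ⊖ r ⊗ s ⊕ a ⊗ inv (⊖ r ⊗ s)
            same s = sym (trans (cong (λ z → ⊖ r ⊗ s ⊕ a ⊗ z) (trans (inv-⊗ (⊖ r) s) (cong (_⊗ inv s) inv-⊖r)))
              (trans (solve 6 (λ r s t h i j → (:- r) :* s :+ r :* t :* (h :* h) :* ((:- j) :* i) := (:- ((r :* j) :* (t :* (h :* h :* i)))) :- r :* s) refl r s t ½ (inv s) (inv r))
                (cong (λ z → ⊖ z ⊕ ⊖ (r ⊗ s)) (trans (cong (_⊗ (t ⊗ ¼ s)) (inv-r r≢0)) (⊗-identityˡ _)))))
              where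
              inv-⊖r : inv (⊖ r) ≡ ⊖ inv r
              inv-⊖r = inv-unique (trans (solve 2 (λ r j → (:- r) :* (:- j) := r :* j) refl r (inv r)) (inv-r r≢0))

      odd-case : ∀ {ℓ} → Autocorrelation ℓ → ∀ c t → energy (wave (cartesianProduct Fs Fs) (λ (s , u) → c * nz s) (λ (s , u) → s ⊗ (u ⊗ u) ⊕ θ t s)) ℓ ≤ c * c * (+ 4 * (+ q * + q)) * ℓ 0F
      odd-case {ℓ} auto c t = Sum.[ square , (λ (w , eq) → nonsquare-case w eq) ]′ (square-class t)
        where
        W = wave (cartesianProduct Fs Fs) (λ (s , u) → c * nz s) (λ (s , u) → s ⊗ (u ⊗ u) ⊕ θ t s)
        square-class : ∀ t → (∃ λ w → w ⊗ w ≡ t) ⊎ (∃ λ w → δ ⊗ (w ⊗ w) ≡ t)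
        square-class t with Any.any? (λ w → w ⊗ w ≟F t) Fs | Any.any? (λ w → δ ⊗ (w ⊗ w) ≟F t) Fs
        ... | yes ∃w | _ = inj₁ (proj₁ (M.find ∃w) , proj₂ (proj₂ (M.find ∃w)))
        ... | no _ | yes ∃w = inj₂ (proj₁ (M.find ∃w) , proj₂ (proj₂ (M.find ∃w)))
        ... | no ¬w | no ¬w′ = contradiction (trans (sym count) (trans (squares+nonsquares δ-nonsquare (λ D → ind (D ≟F t))) (cong (+ 2 *_) (∑-ind₁ finite t)))) (λ ())
          where
          count : ∑ Fs (λ w → ind (w ⊗ w ≟F t)) + ∑ Fs (λ w → ind (δ ⊗ (w ⊗ w) ≟F t)) ≡ 0ℤ
          count = cong₂ _+_ (∑-zero∈ Fs (λ w w∈ → ind-no (w ⊗ w ≟F t) (λ eq → ¬w (M.lose w∈ eq)))) (∑-zero∈ Fs (λ w w∈ → ind-no (δ ⊗ (w ⊗ w) ≟F t) (λ eq → ¬w′ (M.lose w∈ eq))))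
        resum : ∀ {f} → Null f → ∀ w ρ b → ∑ Fs (λ s → nz s * ∑ Fs (λ u → f (s ⊗ (u ⊗ u) ⊕ (⊖ (w ⊗ w ⊗ ¼ s) ⊕ (⊖ (ρ ⊗ s) ⊕ b))))) ≡ ∑ Fs (λ u → e (u ⊗ u ⊕ ⊖ ρ) * f (w ⊗ u ⊕ b))
        resum {f} nf w ρ b = begin
          ∑ Fs (λ s → nz s * ∑ Fs (λ u → f (s ⊗ (u ⊗ u) ⊕ (⊖ (w ⊗ w ⊗ ¼ s) ⊕ (⊖ (ρ ⊗ s) ⊕ b))))) ≡⟨ ∑-cong Fs (λ s → nz-cong s (λ s≢0 → sym (complete-square₁ f s≢0 w (⊖ (ρ ⊗ s) ⊕ b)))) ⟩
          ∑ Fs (λ s → nz s * ∑ Fs (λ u → f (s ⊗ (u ⊗ u) ⊕ w ⊗ u ⊕ (⊖ (ρ ⊗ s) ⊕ b)))) ≡⟨ ∑-cong Fs (λ s → trans (sym (∑-*ˡ Fs (nz s) _)) (∑-cong Fs (λ u → cong (λ z → nz s * f z) (e1 s (u ⊗ u) (w ⊗ u) ρ b)))) ⟩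
          ∑ Fs (λ s → ∑ Fs (λ u → nz s * f ((u ⊗ u ⊕ ⊖ ρ) ⊗ s ⊕ (w ⊗ u ⊕ b)))) ≡⟨ ∑-swap Fs Fs _ ⟩
          ∑ Fs (λ u → ∑ Fs (λ s → nz s * f ((u ⊗ u ⊕ ⊖ ρ) ⊗ s ⊕ (w ⊗ u ⊕ b)))) ≡⟨ ∑-cong Fs (λ u → sym (e-convolution nf _ _)) ⟩
          ∑ Fs (λ u → e (u ⊗ u ⊕ ⊖ ρ) * f (w ⊗ u ⊕ b)) ∎
          where
          open ≡-Reasoning
          e1 : ∀ s u w ρ b → s ⊗ u ⊕ w ⊕ (⊖ (ρ ⊗ s) ⊕ b) ≡ (u ⊕ ⊖ ρ) ⊗ s ⊕ (w ⊕ b)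
          e1 = solve 5 (λ s u w ρ b → s :* u :+ w :+ ((:- (ρ :* s)) :+ b) := (u :- ρ) :* s :+ (w :+ b)) refl
        unfold : ∀ f b → apply W f b ≡ c * ∑ Fs (λ s → nz s * ∑ Fs (λ u → f (s ⊗ (u ⊗ u) ⊕ (⊖ (t ⊗ ¼ s) ⊕ (⊖ (r ⊗ s) ⊕ b)))))
        unfold f b = trans (∑-× Fs Fs _) (trans (∑-cong Fs (λ s → trans (∑-cong Fs (λ u → trans (ℤₚ.*-assoc c (nz s) _) (cong (λ z → c * (nz s * f z)) (e1 _ _ _ b)))) (trans (∑-*ˡ Fs c _) (cong (c *_) (∑-*ˡ Fs (nz s) _))))) (∑-*ˡ Fs c _))
          where
          e1 : ∀ x t r b → x ⊕ (t ⊕ r) ⊕ b ≡ x ⊕ (t ⊕ (r ⊕ b))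
          e1 = solve 4 (λ x t r b → x :+ (t :+ r) :+ b := x :+ (t :+ (r :+ b))) refl
        square : (∃ λ w → w ⊗ w ≡ t) → energy W ℓ ≤ c * c * (+ 4 * (+ q * + q)) * ℓ 0F
        square (w , refl) = ℤₚ.≤-trans (ℤₚ.≤-reflexive (energy-cong auto rewritten)) (salié-bound auto c w r)
          where
          rewritten : W ≈ wave Fs (λ u → c * e (u ⊗ u ⊕ ⊖ r)) (w ⊗_)
          rewritten .act {f} nf b = trans (unfold f b) (trans (cong (c *_) (resum nf w r b)) (trans (sym (∑-*ˡ Fs c _)) (∑-cong Fs (λ u → sym (ℤₚ.*-assoc c _ _)))))
        nonsquare-case : ∀ w → δ ⊗ (w ⊗ w) ≡ t → energy W ℓ ≤ c * c * (+ 4 * (+ q * + q)) * ℓ 0F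
        nonsquare-case w refl = ℤₚ.≤-trans (ℤₚ.≤-reflexive (energy-cong auto rewritten)) (subst (λ z → energy (wave Fs (λ u → - c * e (u ⊗ u ⊕ ⊖ (r ⊗ δ))) (w ⊗_)) ℓ ≤ z * (+ 4 * (+ q * + q)) * ℓ 0F) (e1 c) (salié-bound auto (- c) w (r ⊗ δ)))
          where
          e1 : ∀ c → - c * - c ≡ c * c
          e1 = solve-∀
          e2 : ∀ c x → c * (- x) ≡ - c * x
          e2 = solve-∀
          δ≢0′ : δ ≢ 0F
          δ≢0′ = δ≢0 δ-nonsquare
          rewritten : W ≈ wave Fs (λ u → - c * e (u ⊗ u ⊕ ⊖ (r ⊗ δ))) (w ⊗_)
          rewritten .act {f} nf b = begin
            apply W f b ≡⟨ unfold f b ⟩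
            c * ∑ Fs (λ s → nz s * ∑ Fs (λ u → f (s ⊗ (u ⊗ u) ⊕ (⊖ (δ ⊗ (w ⊗ w) ⊗ ¼ s) ⊕ (⊖ (r ⊗ s) ⊕ b))))) ≡⟨ cong (c *_) (sym (∑-scale δ≢0′ _)) ⟩
            c * ∑ Fs (λ s → nz (δ ⊗ s) * ∑ Fs (λ u → f (δ ⊗ s ⊗ (u ⊗ u) ⊕ (⊖ (δ ⊗ (w ⊗ w) ⊗ ¼ (δ ⊗ s)) ⊕ (⊖ (r ⊗ (δ ⊗ s)) ⊕ b)))))
              ≡⟨ cong (c *_) (∑-cong Fs (λ s → trans (cong₂ _*_ (nz-δ s) refl) (trans (nz-cong s (λ s≢0 → trans (δ-twist nf s≢0 _) (cong -_ (∑-cong Fs (λ u → cong (λ z → f (s ⊗ (u ⊗ u) ⊕ z)) (simplify s)))))) (sym (ℤₚ.neg-distribʳ-* (nz s) _))))) ⟩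
            c * ∑ Fs (λ s → - (nz s * ∑ Fs (λ u → f (s ⊗ (u ⊗ u) ⊕ (⊖ (w ⊗ w ⊗ ¼ s) ⊕ (⊖ (r ⊗ δ ⊗ s) ⊕ b)))))) ≡⟨ cong (c *_) (trans (∑-neg Fs _) (cong -_ (resum nf w (r ⊗ δ) b))) ⟩
            c * (- ∑ Fs (λ u → e (u ⊗ u ⊕ ⊖ (r ⊗ δ)) * f (w ⊗ u ⊕ b))) ≡⟨ e2 c _ ⟩
            - c * ∑ Fs (λ u → e (u ⊗ u ⊕ ⊖ (r ⊗ δ)) * f (w ⊗ u ⊕ b)) ≡⟨ trans (sym (∑-*ˡ Fs (- c) _)) (∑-cong Fs (λ u → sym (ℤₚ.*-assoc (- c) _ _))) ⟩
            ∑ Fs (λ u → - c * e (u ⊗ u ⊕ ⊖ (r ⊗ δ)) * f (w ⊗ u ⊕ b)) ∎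
            where
            open ≡-Reasoning
            nz-δ : ∀ s → nz (δ ⊗ s) ≡ nz s
            nz-δ s = nz-⇔ (λ eq → ⊗-cancelˡ δ≢0′ (trans eq (sym (⊗-zeroʳ δ)))) (λ { refl → ⊗-zeroʳ δ })
            simplify : ∀ s → ⊖ (δ ⊗ (w ⊗ w) ⊗ ¼ (δ ⊗ s)) ⊕ (⊖ (r ⊗ (δ ⊗ s)) ⊕ b) ≡ ⊖ (w ⊗ w ⊗ ¼ s) ⊕ (⊖ (r ⊗ δ ⊗ s) ⊕ b)
            simplify s = cong₂ (λ x y → ⊖ x ⊕ (⊖ y ⊕ b)) (trans (cong (λ z → δ ⊗ (w ⊗ w) ⊗ (½ ⊗ ½ ⊗ z)) (inv-⊗ δ s))
              (trans (solve 5 (λ d j w h i → d :* w :* (h :* h :* (j :* i)) := (d :* j) :* (w :* (h :* h :* i))) refl δ (inv δ) (w ⊗ w) ½ (inv s)) (trans (cong (_⊗ (w ⊗ w ⊗ ¼ s)) (inv-r δ≢0′)) (⊗-identityˡ _))))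
              (sym (⊗-assoc r δ s))

      sphere-energy : ∀ {ℓ} → Autocorrelation ℓ → ∀ m → energy (sphere m) ℓ ≤ + 5 * + (q ℕ.^ suc d) * ℓ 0F
      sphere-energy {ℓ} auto m = go (reduction d)
        where
        open Autocorrelation auto
        go : Reduction d → energy (sphere m) ℓ ≤ + 5 * + (q ℕ.^ suc d) * ℓ 0F
        go (even c cc h) = ℤₚ.≤-trans (ℤₚ.≤-reflexive (energy-cong auto (≈-trans (sphere≈ m) collapse)))
          (ℤₚ.≤-trans (even-case auto c ‖ m ‖) (ℤₚ.≤-reflexive (cong (_* ℓ 0F) (trans (cong (_* (+ 5 * + q)) cc) (trans (e1 (+ (q ℕ.^ d)) (+ q)) (cong (+ 5 *_) (sym (ℤₚ.pos-* q (q ℕ.^ d)))))))))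
          where
          e1 : ∀ n q → n * (+ 5 * q) ≡ + 5 * (q * n)
          e1 = solve-∀
          collapse : wave (cartesianProduct Fs (Vs d)) (λ (s , x) → nz s) (λ (s , x) → s ⊗ ‖ x ‖ ⊕ θ ‖ m ‖ s) ≈ wave Fs (λ s → c * nz s) (θ ‖ m ‖)
          collapse .act {f} nf b = trans (∑-× Fs (Vs d) _) (∑-cong Fs (λ s → trans (∑-*ˡ (Vs d) (nz s) _) (trans (nz-cong s (λ s≢0 → trans (∑-cong (Vs d) (λ x → cong f (⊕-assoc _ _ b))) (h nf s≢0 (θ ‖ m ‖ s ⊕ b)))) (e2 (nz s) c _))))
            where
            e2 : ∀ n c x → n * (c * x) ≡ c * n * x
            e2 = solve-∀
        go (odd c cc h) = ℤₚ.≤-trans (ℤₚ.≤-reflexive (energy-cong auto (≈-trans (sphere≈ m) collapse)))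
          (ℤₚ.≤-trans (odd-case auto c ‖ m ‖) (ℤₚ.*-monoʳ-≤-nonNeg (ℓ 0F) {{ℤ.nonNegative ℓ0≥0}} (ℤₚ.≤-trans (ℤₚ.≤-reflexive (trans (e1 c (+ q)) (cong (+ 4 *_) (trans (cong (+ q *_) cc) (sym (ℤₚ.pos-* q (q ℕ.^ d)))))))
            (ℤₚ.*-monoʳ-≤-nonNeg (+ (q ℕ.^ suc d)) {+ 4} {+ 5} (+≤+ (ℕₚ.n≤1+n 4))))))
          where
          e1 : ∀ c q → c * c * (+ 4 * (q * q)) ≡ + 4 * (q * (q * (c * c)))
          e1 = solve-∀
          collapse : wave (cartesianProduct Fs (Vs d)) (λ (s , x) → nz s) (λ (s , x) → s ⊗ ‖ x ‖ ⊕ θ ‖ m ‖ s) ≈ wave (cartesianProduct Fs Fs) (λ (s , u) → c * nz s) (λ (s , u) → s ⊗ (u ⊗ u) ⊕ θ ‖ m ‖ s)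
          collapse .act {f} nf b = trans (∑-× Fs (Vs d) _) (trans (∑-cong Fs (λ s → trans (∑-*ˡ (Vs d) (nz s) _) (trans (nz-cong s (λ s≢0 → trans (∑-cong (Vs d) (λ x → cong f (⊕-assoc _ _ b))) (trans (h nf s≢0 (θ ‖ m ‖ s ⊕ b)) (cong (c *_) (∑-cong Fs (λ u → cong f (sym (⊕-assoc _ _ b))))))))
              (trans (e2 (nz s) c _) (sym (∑-*ˡ Fs (c * nz s) _)))))) (sym (∑-× Fs Fs _)))
            where
            e2 : ∀ n c x → n * (c * x) ≡ c * n * x
            e2 = solve-∀

    _⊞_ : ∀ {d} → V d → V d → V d
    _⊞_ = Vec.zipWith _⊕_

    ⊞-⊝ : ∀ {d} (x y : V d) → (x ⊞ y) ⊝ y ≡ x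
    ⊞-⊝ []      []      = refl
    ⊞-⊝ (x ∷ v) (y ∷ w) = cong₂ _∷_ (solve 2 (λ x y → (x :+ y) :- y := x) refl x y) (⊞-⊝ v w)

    ⊝-⊞ : ∀ {d} (x y : V d) → (x ⊝ y) ⊞ y ≡ x
    ⊝-⊞ []      []      = refl
    ⊝-⊞ (x ∷ v) (y ∷ w) = cong₂ _∷_ (solve 2 (λ x y → (x :- y) :+ y := x) refl x y) (⊝-⊞ v w)

    dot-⊞ : ∀ {d} (m x y : V d) → dot m (x ⊞ y) ≡ dot m x ⊕ dot m y
    dot-⊞ []      []      []      = sym (⊕-identityˡ 0F)
    dot-⊞ (a ∷ m) (x ∷ v) (y ∷ w) = trans (cong (a ⊗ (x ⊕ y) ⊕_) (dot-⊞ m v w))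
      (solve 5 (λ a x y p q → a :* (x :+ y) :+ (p :+ q) := (a :* x :+ p) :+ (a :* y :+ q)) refl a x y (dot m v) (dot m w))

    ∑V-shift : ∀ {d} (y : V d) (f : V d → ℤ) → ∑ (Vs d) (λ x → f (x ⊞ y)) ≡ ∑ (Vs d) f
    ∑V-shift {d} y f = ∑-reindex FV FV (_⊞ y) (_⊝ y) (λ x → ⊝-⊞ x y) (λ x → ⊞-⊝ x y) f
      where FV = Vec-finite finite d

    dual-orthogonality : ∀ d {f} → Null f → ∀ (x y : V d) b →
      ∑ (Vs d) (λ m → f ((dot m x ⊕ ⊖ dot m y) ⊕ b)) ≡ + (q ℕ.^ d) * (ind (x ≟V y) * f b)
    dual-orthogonality zero {f} nf [] [] b = trans (ℤₚ.+-identityʳ _) (trans (cong f (solve 1 (λ b → (con 0ℤ :- con 0ℤ) :+ b := b) refl b))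
      (sym (trans (ℤₚ.*-identityˡ _) (trans (cong (_* f b) (ind-yes ([] ≟V []) refl)) (ℤₚ.*-identityˡ _)))))
    dual-orthogonality (suc d) {f} nf (x ∷ v) (y ∷ w) b = begin
      ∑ (Vs (suc d)) (λ m → f ((dot m (x ∷ v) ⊕ ⊖ dot m (y ∷ w)) ⊕ b)) ≡⟨ ∑V-suc d _ ⟩
      ∑ Fs (λ a → ∑ (Vs d) (λ m → f (((a ⊗ x ⊕ dot m v) ⊕ ⊖ (a ⊗ y ⊕ dot m w)) ⊕ b)))
        ≡⟨ ∑-cong Fs (λ a → trans (∑-cong (Vs d) (λ m → cong f (solve 6 (λ a x y p q b → ((a :* x :+ p) :- (a :* y :+ q)) :+ b := (p :- q) :+ ((x :- y) :* a :+ b)) refl a x y (dot m v) (dot m w) b))) (dual-orthogonality d nf v w ((x ⊕ ⊖ y) ⊗ a ⊕ b))) ⟩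
      ∑ Fs (λ a → + (q ℕ.^ d) * (ind (v ≟V w) * f ((x ⊕ ⊖ y) ⊗ a ⊕ b))) ≡⟨ trans (∑-*ˡ Fs (+ (q ℕ.^ d)) _) (cong (+ (q ℕ.^ d) *_) (trans (∑-*ˡ Fs (ind (v ≟V w)) _) (cong (ind (v ≟V w) *_) (orthogonality nf (x ⊕ ⊖ y) b)))) ⟩
      + (q ℕ.^ d) * (ind (v ≟V w) * (ind (x ⊕ ⊖ y ≟F 0F) * (+ q * f b))) ≡⟨ e1 (+ (q ℕ.^ d)) (ind (v ≟V w)) (ind (x ⊕ ⊖ y ≟F 0F)) (+ q) (f b) ⟩
      + q * + (q ℕ.^ d) * (ind (x ⊕ ⊖ y ≟F 0F) * ind (v ≟V w) * f b) ≡⟨ cong₂ (λ i n → n * (i * f b)) ind-∷ (sym (ℤₚ.pos-* q (q ℕ.^ d))) ⟩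
      + (q ℕ.^ suc d) * (ind ((x ∷ v) ≟V (y ∷ w)) * f b) ∎
      where
      open ≡-Reasoning
      e1 : ∀ n i j q f → n * (i * (j * (q * f))) ≡ q * n * (j * i * f)
      e1 = solve-∀
      ind-∷ : ind (x ⊕ ⊖ y ≟F 0F) * ind (v ≟V w) ≡ ind ((x ∷ v) ≟V (y ∷ w))
      ind-∷ with x ⊕ ⊖ y ≟F 0F
      ... | no ne = sym (ind-no ((x ∷ v) ≟V (y ∷ w)) (λ eq → ne (trans (cong (_⊕ ⊖ y) (Data.Vec.Properties.∷-injectiveˡ eq)) (⊖-inverseʳ y))))
      ... | yes eq = trans (ℤₚ.*-identityˡ _) (ind-⇔ (v ≟V w) ((x ∷ v) ≟V (y ∷ w)) (cong₂ _∷_ (x⊖y≡0 eq)) Data.Vec.Properties.∷-injectiveʳ)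

    plancherel : ∀ {d} (h : V d → ℤ) →
      ∑ (Vs d) (λ m → ∑ (Vs d) (λ x → ∑ (Vs d) (λ y → h x * h y * e (0F ⊕ (dot m x ⊕ ⊖ dot m y))))) ≡ + (q ℕ.^ d) * e 0F * ∑ (Vs d) (λ x → h x * h x)
    plancherel {d} h = begin
      ∑ (Vs d) (λ m → ∑ (Vs d) (λ x → ∑ (Vs d) (λ y → h x * h y * e (0F ⊕ (dot m x ⊕ ⊖ dot m y)))))
        ≡⟨ trans (∑-swap (Vs d) (Vs d) _) (∑-cong (Vs d) (λ x → ∑-swap (Vs d) (Vs d) _)) ⟩
      ∑ (Vs d) (λ x → ∑ (Vs d) (λ y → ∑ (Vs d) (λ m → h x * h y * e (0F ⊕ (dot m x ⊕ ⊖ dot m y)))))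
        ≡⟨ ∑-cong (Vs d) (λ x → ∑-cong (Vs d) (λ y → trans (∑-*ˡ (Vs d) (h x * h y) _) (trans (cong (h x * h y *_) (trans (∑-cong (Vs d) (λ m → cong e (⊕-comm 0F _))) (dual-orthogonality d e-null x y 0F)))
              (trans (cong (λ i → h x * h y * (+ (q ℕ.^ d) * (i * e 0F))) (ind-⇔ (x ≟V y) (y ≟V x) sym sym)) (e1 (h x) (h y) (+ (q ℕ.^ d)) (ind (y ≟V x)) (e 0F)))))) ⟩
      ∑ (Vs d) (λ x → ∑ (Vs d) (λ y → ind (y ≟V x) * (+ (q ℕ.^ d) * e 0F * (h x * h y)))) ≡⟨ ∑-cong (Vs d) (λ x → ∑-ind (Vec-finite finite d) x _) ⟩
      ∑ (Vs d) (λ x → + (q ℕ.^ d) * e 0F * (h x * h x)) ≡⟨ ∑-*ˡ (Vs d) (+ (q ℕ.^ d) * e 0F) _ ⟩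
      + (q ℕ.^ d) * e 0F * ∑ (Vs d) (λ x → h x * h x) ∎
      where
      open ≡-Reasoning
      e1 : ∀ a b n i z → a * b * (n * (i * z)) ≡ i * (n * z * (a * b))
      e1 = solve-∀

    module _ (r : F) (r≢0 : r ≢ 0F) {d : ℕ} (g : V d → ℤ) where

      discrepancy : V d → ℤ
      discrepancy x = ∑ (Vs d) (λ y → g y * e (‖ x ⊝ y ‖ ⊕ ⊖ r))

      private
        D = discrepancy

        spectral : ∀ m → ∑ (Vs d) (λ x → ∑ (Vs d) (λ x′ → D x * D x′ * e (0F ⊕ (dot m x ⊕ ⊖ dot m x′)))) ≡ energy (sphere r r≢0 m) (Twisted.ℓ g m)
        spectral m = begin
          ∑ (Vs d) (λ x → ∑ (Vs d) (λ x′ → D x * D x′ * e (0F ⊕ (dot m x ⊕ ⊖ dot m x′))))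
            ≡⟨ ∑-cong (Vs d) (λ x → ∑-cong (Vs d) (λ x′ → trans (cong (_* e (0F ⊕ (dot m x ⊕ ⊖ dot m x′))) (sym (∑-∑* (Vs d) (Vs d) _ _)))
                 (trans (sym (∑-*ʳ (Vs d) _ _)) (∑-cong (Vs d) (λ y → sym (∑-*ʳ (Vs d) _ _)))))) ⟩
          ∑ (Vs d) (λ x → ∑ (Vs d) (λ x′ → ∑ (Vs d) (λ y → ∑ (Vs d) (λ y′ → g y * S (x ⊝ y) * (g y′ * S (x′ ⊝ y′)) * e (0F ⊕ (dot m x ⊕ ⊖ dot m x′))))))
            ≡⟨ ∑-swap⁴ (Vs d) (Vs d) _ ⟩
          ∑ (Vs d) (λ y → ∑ (Vs d) (λ y′ → ∑ (Vs d) (λ x → ∑ (Vs d) (λ x′ → g y * S (x ⊝ y) * (g y′ * S (x′ ⊝ y′)) * e (0F ⊕ (dot m x ⊕ ⊖ dot m x′))))))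
            ≡⟨ ∑-cong (Vs d) (λ y → ∑-cong (Vs d) (λ y′ → trans (sym (∑V-shift y _)) (∑-cong (Vs d) (λ x → trans (sym (∑V-shift y′ _)) (∑-cong (Vs d) (λ x′ → shifted y y′ x x′)))))) ⟩
          ∑ (Vs d) (λ y → ∑ (Vs d) (λ y′ → ∑ (Vs d) (λ x → ∑ (Vs d) (λ x′ → S x * S x′ * (g y * g y′ * e ((dot m x ⊕ ⊖ dot m x′) ⊕ (dot m y ⊕ ⊖ dot m y′)))))))
            ≡⟨ sym (∑-swap⁴ (Vs d) (Vs d) _) ⟩
          ∑ (Vs d) (λ x → ∑ (Vs d) (λ x′ → ∑ (Vs d) (λ y → ∑ (Vs d) (λ y′ → S x * S x′ * (g y * g y′ * e ((dot m x ⊕ ⊖ dot m x′) ⊕ (dot m y ⊕ ⊖ dot m y′)))))))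
            ≡⟨ ∑-cong (Vs d) (λ x → ∑-cong (Vs d) (λ x′ → trans (∑-cong (Vs d) (λ y → ∑-*ˡ (Vs d) (S x * S x′) _)) (∑-*ˡ (Vs d) (S x * S x′) _))) ⟩
          energy (sphere r r≢0 m) (Twisted.ℓ g m) ∎
          where
          open ≡-Reasoning
          S : V d → ℤ
          S x = e (‖ x ‖ ⊕ ⊖ r)
          e1 : ∀ a s b t z → a * s * (b * t) * z ≡ s * t * (a * b * z)
          e1 = solve-∀
          shifted : ∀ y y′ x x′ → g y * S ((x ⊞ y) ⊝ y) * (g y′ * S ((x′ ⊞ y′) ⊝ y′)) * e (0F ⊕ (dot m (x ⊞ y) ⊕ ⊖ dot m (x′ ⊞ y′)))
                                ≡ S x * S x′ * (g y * g y′ * e ((dot m x ⊕ ⊖ dot m x′) ⊕ (dot m y ⊕ ⊖ dot m y′)))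
          shifted y y′ x x′ = trans (cong₂ (λ a b → g y * S a * (g y′ * S b) * e (0F ⊕ (dot m (x ⊞ y) ⊕ ⊖ dot m (x′ ⊞ y′)))) (⊞-⊝ x y) (⊞-⊝ x′ y′))
            (trans (e1 (g y) (S x) (g y′) (S x′) _) (cong (λ z → S x * S x′ * (g y * g y′ * e z)) (trans (cong₂ (λ a b → 0F ⊕ (a ⊕ ⊖ b)) (dot-⊞ m x y) (dot-⊞ m x′ y′))
              (solve 4 (λ x y x′ y′ → con 0ℤ :+ ((x :+ y) :- (x′ :+ y′)) := (x :- x′) :+ (y :- y′)) refl (dot m x) (dot m y) (dot m x′) (dot m y′)))))

      discrepancy-bound : ∑ (Vs d) (λ x → D x * D x) ≤ + 5 * + (q ℕ.^ suc d) * ∑ (Vs d) (λ x → g x * g x)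
      discrepancy-bound = ℤₚ.*-cancelˡ-≤-pos _ _ (+ (q ℕ.^ d) * e 0F) {{ℤ.positive scale>0}} (begin
        + (q ℕ.^ d) * e 0F * ∑ (Vs d) (λ x → D x * D x) ≡⟨ sym (plancherel D) ⟩
        ∑ (Vs d) (λ m → ∑ (Vs d) (λ x → ∑ (Vs d) (λ y → D x * D y * e (0F ⊕ (dot m x ⊕ ⊖ dot m y))))) ≤⟨ ∑-mono (Vs d) (λ m → ℤₚ.≤-trans (ℤₚ.≤-reflexive (spectral m)) (sphere-energy r r≢0 (Twisted.autocorrelation g m) m)) ⟩
        ∑ (Vs d) (λ m → + 5 * + (q ℕ.^ suc d) * Twisted.ℓ g m 0F) ≡⟨ trans (∑-*ˡ (Vs d) (+ 5 * + (q ℕ.^ suc d)) _) (cong (+ 5 * + (q ℕ.^ suc d) *_) (plancherel g)) ⟩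
        + 5 * + (q ℕ.^ suc d) * (+ (q ℕ.^ d) * e 0F * ∑ (Vs d) (λ x → g x * g x)) ≡⟨ e1 (+ 5 * + (q ℕ.^ suc d)) (+ (q ℕ.^ d) * e 0F) _ ⟩
        + (q ℕ.^ d) * e 0F * (+ 5 * + (q ℕ.^ suc d) * ∑ (Vs d) (λ x → g x * g x)) ∎)
        where
        open ℤₚ.≤-Reasoning
        1<q = Poly.Polynomial.1<q 𝔽
        e1 : ∀ a b c → a * (b * c) ≡ b * (a * c)
        e1 = solve-∀
        e0>0 : 0ℤ < e 0F
        e0>0 = subst (0ℤ <_) (sym (trans (cong (λ i → + q * i - 1ℤ) (ind-yes (0F ≟F 0F) refl)) (cong (λ z → z - 1ℤ) (ℤₚ.*-identityʳ (+ q))))) (ℤₚ.+-monoˡ-< (- 1ℤ) (+<+ 1<q))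
        scale>0 : 0ℤ < + (q ℕ.^ d) * e 0F
        scale>0 = subst (_< + (q ℕ.^ d) * e 0F) (ℤₚ.*-zeroʳ (+ (q ℕ.^ d))) (ℤₚ.*-monoˡ-<-pos (+ (q ℕ.^ d)) {{ℤ.positive (+<+ (ℕₚ.m^n>0 q {{ℕ.>-nonZero (ℕₚ.<⇒≤ 1<q)}} d))}} e0>0)

module NatSum where

  open SumLib
  open import Data.Bool using (not)
  open import Data.Nat using (ℕ; suc; _+_; _*_; _≤_; _<_; z≤n; s≤s)
  import Data.Nat.Properties as ℕₚ
  import Data.List.Membership.DecPropositional as DecM
  import Data.List.Relation.Unary.All as All
  open import Data.List.Relation.Unary.AllPairs using ([]; _∷_)

  open Sum ℕₚ.+-0-isCommutativeMonoid public

  private variable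
    A B : Set

  [_]ᵇ : Bool → ℕ
  [ true ]ᵇ  = 1
  [ false ]ᵇ = 0

  bool-cases : ∀ b → b ≡ true ⊎ b ≡ false
  bool-cases true  = inj₁ refl
  bool-cases false = inj₂ refl

  true≢false : ∀ {b} → b ≡ true → b ≡ false → ∀ {X : Set} → X
  true≢false refl ()

  []ᵇ-mono : ∀ {a b} → (a ≡ true → b ≡ true) → [ a ]ᵇ ≤ [ b ]ᵇ
  []ᵇ-mono {false} h = z≤n
  []ᵇ-mono {true} {b} h = subst (λ z → 1 ≤ [ z ]ᵇ) (sym (h refl)) ℕₚ.≤-refl

  []ᵇ≤1 : ∀ a → [ a ]ᵇ ≤ 1
  []ᵇ≤1 true  = ℕₚ.≤-refl
  []ᵇ≤1 false = z≤n

  ∧-true : ∀ {a b} → a ∧ b ≡ true → a ≡ true × b ≡ true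
  ∧-true {true} e = refl , e

  ∨-trueˡ : ∀ {a b} → a ≡ true → a ∨ b ≡ true
  ∨-trueˡ refl = refl

  ∨-trueʳ : ∀ {a b} → b ≡ true → a ∨ b ≡ true
  ∨-trueʳ {true}  refl = refl
  ∨-trueʳ {false} refl = refl

  ∨-true : ∀ {a b} → a ∨ b ≡ true → a ≡ true ⊎ b ≡ true
  ∨-true {true}  e = inj₁ refl
  ∨-true {false} e = inj₂ e

  count : List A → (A → Bool) → ℕ
  count xs f = ∑ xs (λ x → [ f x ]ᵇ)

  ∑-mono∈ : ∀ (xs : List A) {f g : A → ℕ} → (∀ x → x ∈ xs → f x ≤ g x) → ∑ xs f ≤ ∑ xs g
  ∑-mono∈ []       le = z≤n
  ∑-mono∈ (x ∷ xs) le = ℕₚ.+-mono-≤ (le x (here refl)) (∑-mono∈ xs (λ y y∈ → le y (there y∈)))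

  ∑-mono : ∀ (xs : List A) {f g : A → ℕ} → (∀ x → f x ≤ g x) → ∑ xs f ≤ ∑ xs g
  ∑-mono xs le = ∑-mono∈ xs (λ x _ → le x)

  ∑-*ʳ : ∀ (xs : List A) c (f : A → ℕ) → ∑ xs (λ x → f x * c) ≡ ∑ xs f * c
  ∑-*ʳ []       c f = refl
  ∑-*ʳ (x ∷ xs) c f = trans (cong (f x * c +_) (∑-*ʳ xs c f)) (sym (ℕₚ.*-distribʳ-+ c (f x) _))

  ∑-*ˡ : ∀ (xs : List A) c (f : A → ℕ) → ∑ xs (λ x → c * f x) ≡ c * ∑ xs f
  ∑-*ˡ xs c f = trans (∑-cong xs (λ x → ℕₚ.*-comm c (f x))) (trans (∑-*ʳ xs c f) (ℕₚ.*-comm _ c))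

  ∑-const : ∀ (xs : List A) c → ∑ xs (λ _ → c) ≡ length xs * c
  ∑-const []       c = refl
  ∑-const (x ∷ xs) c = cong (c +_) (∑-const xs c)

  ∑-term-≤ : ∀ (xs : List A) (f : A → ℕ) {x} → x ∈ xs → f x ≤ ∑ xs f
  ∑-term-≤ (x ∷ xs) f (here refl) = ℕₚ.m≤m+n _ _
  ∑-term-≤ (x ∷ xs) f (there x∈)  = ℕₚ.≤-trans (∑-term-≤ xs f x∈) (ℕₚ.m≤n+m _ _)

  any-elim : ∀ (f : A → Bool) xs → any f xs ≡ true → ∃ λ x → x ∈ xs × f x ≡ true
  any-elim f (x ∷ xs) e with f x in eq
  ... | true  = x , here refl , eq
  ... | false with any-elim f xs e
  ... | y , y∈ , fy = y , there y∈ , fy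

  any-intro : ∀ (f : A → Bool) {xs x} → x ∈ xs → f x ≡ true → any f xs ≡ true
  any-intro f {y ∷ ys} (here refl) e = ∨-trueˡ e
  any-intro f {y ∷ ys} (there x∈)  e = ∨-trueʳ (any-intro f x∈ e)

  count-any : ∀ (xs : List A) (f : A → Bool) → 0 < count xs f → ∃ λ x → x ∈ xs × f x ≡ true
  count-any (x ∷ xs) f lt with f x in eq
  ... | true  = x , here refl , eq
  ... | false with count-any xs f lt
  ... | y , y∈ , fy = y , there y∈ , fy

  count-filter : ∀ (f : A → Bool) xs → length (filterᵇ f xs) ≡ count xs f
  count-filter f [] = refl
  count-filter f (x ∷ xs) with f x
  ... | true  = cong suc (count-filter f xs)
  ... | false = count-filter f xs

  count-split : ∀ (xs : List A) (f g : A → Bool) → count xs f ≡ count xs (λ x → f x ∧ g x) + count xs (λ x → f x ∧ not (g x))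
  count-split xs f g = trans (∑-cong xs (λ x → split (f x) (g x))) (∑-∙ xs _ _)
    where
    split : ∀ a b → [ a ]ᵇ ≡ [ a ∧ b ]ᵇ + [ a ∧ not b ]ᵇ
    split false b     = refl
    split true  true  = refl
    split true  false = refl

  count-mono : ∀ (xs : List A) {f g : A → Bool} → (∀ x → f x ≡ true → g x ≡ true) → count xs f ≤ count xs g
  count-mono xs h = ∑-mono xs (λ x → []ᵇ-mono (h x))

  sublists : List A → List (List A)
  sublists []       = [] ∷ []
  sublists (x ∷ xs) = map (x ∷_) (sublists xs) ++ sublists xs

  module _ {V : Set} (FV : Finite V) where
    open Finite FV using (_≟_)
    private Vs = elems FV

    count-≟ : ∀ z → ∑ Vs (λ y → [ ⌊ y ≟ z ⌋ ]ᵇ) ≡ 1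
    count-≟ z = trans (∑-δ FV z _ (λ y ne → off y ne)) on
      where
      off : ∀ y → y ≢ z → [ ⌊ y ≟ z ⌋ ]ᵇ ≡ 0
      off y ne with y ≟ z
      ... | yes e = contradiction e ne
      ... | no _  = refl
      on : [ ⌊ z ≟ z ⌋ ]ᵇ ≡ 1
      on with z ≟ z
      ... | yes _ = refl
      ... | no ne = contradiction refl ne

    count-member : ∀ (zs : List V) → count Vs (λ y → ⌊ DecM._∈?_ _≟_ y zs ⌋) ≤ length zs
    count-member [] = ℕₚ.≤-reflexive (∑-ε Vs)
    count-member (z ∷ zs) = ℕₚ.≤-trans (∑-mono Vs split) (ℕₚ.≤-trans (ℕₚ.≤-reflexive (trans (∑-∙ Vs _ _) (cong (_+ count Vs (λ y → ⌊ DecM._∈?_ _≟_ y zs ⌋)) (count-≟ z)))) (s≤s (count-member zs)))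
      where
      split : ∀ y → [ ⌊ DecM._∈?_ _≟_ y (z ∷ zs) ⌋ ]ᵇ ≤ [ ⌊ y ≟ z ⌋ ]ᵇ + [ ⌊ DecM._∈?_ _≟_ y zs ⌋ ]ᵇ
      split y with y ≟ z | DecM._∈?_ _≟_ y zs
      ... | yes _ | _     = s≤s z≤n
      ... | no _  | yes _ = s≤s z≤n
      ... | no _  | no _  = z≤n

    count-unique : ∀ {xs} → Unique xs → length xs ≤ count Vs (λ y → ⌊ DecM._∈?_ _≟_ y xs ⌋)
    count-unique {xs} u = subst (_≤ count Vs (λ y → ⌊ DecM._∈?_ _≟_ y xs ⌋)) (trans (trans (∑-swap Vs xs _) (∑-cong xs count-≟)) (trans (∑-const xs 1) (ℕₚ.*-identityʳ _)))
        (∑-mono Vs (λ v → below v u))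
      where
      below : ∀ v {xs} → Unique xs → ∑ xs (λ x → [ ⌊ v ≟ x ⌋ ]ᵇ) ≤ [ ⌊ DecM._∈?_ _≟_ v xs ⌋ ]ᵇ
      below v {[]} _ = z≤n
      below v {x ∷ xs} (x∉ ∷ u) with v ≟ x | DecM._∈?_ _≟_ v xs | below v u
      ... | no _ | yes _ | le = le
      ... | no _ | no _ | le = le
      ... | yes refl | yes v∈ | le = contradiction refl (All.lookup x∉ v∈)
      ... | yes refl | no _ | le = s≤s le

    length-unique : ∀ {xs} → Unique xs → length xs ≤ Finite.size FV
    length-unique u = ℕₚ.≤-trans (count-unique u) (ℕₚ.≤-trans (∑-mono Vs (λ v → []ᵇ≤1 _)) (ℕₚ.≤-reflexive (trans (∑-const Vs 1) (ℕₚ.*-identityʳ _))))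

module Extension where

  open SumLib
  open NatSum
  open import Data.Bool using (not)
  import Data.List.Membership.Propositional as M
  import Data.List.Membership.DecPropositional as DecM
  open import Data.List.Relation.Unary.All as All using ([]; _∷_)
  import Data.List.Relation.Unary.All.Properties as Allₚ
  open import Data.Nat using (ℕ; suc; _+_; _*_; _≤_; _<_; z≤n; s≤s; NonZero)
  import Data.Nat as ℕ
  import Data.Nat.Properties as ℕₚ
  open import Data.Nat.Tactic.RingSolver using (solve-∀)
  import Data.Sum as Sum
  open import Relation.Nullary.Decidable using (_→-dec_)

  data Status (P : Set) : Set where
    outside free : Status P
    child        : P → Status P

  child-injective : ∀ {P : Set} {p p′ : P} → child p ≡ child p′ → p ≡ p′
  child-injective refl = refl

  -- P indexes the possible parents; a vertex y can be attached below p when nbr p y.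
  module Extendable {V P : Set} (FV : Finite V) (_≟P_ : DecidableEquality P) (Ps : List P) (Ps! : Unique Ps)
                    (nbr : P → V → Bool) (κ : ℕ) .{{_ : NonZero κ}} where

    Vs = elems FV
    open Finite FV using (_≟_; complete)

    State : Set
    State = V → Status P

    PSet : Set
    PSet = P → Bool

    Γ : PSet → V → Bool
    Γ S y = any (λ p → S p ∧ nbr p y) Ps

    Γ-intro : ∀ {S y p} → p ∈ Ps → S p ≡ true → nbr p y ≡ true → Γ S y ≡ true
    Γ-intro p∈ Sp nb = any-intro _ p∈ (cong₂ _∧_ Sp nb)

    Γ-elim : ∀ {S y} → Γ S y ≡ true → ∃ λ p → p ∈ Ps × S p ≡ true × nbr p y ≡ true
    Γ-elim {S} {y} e with any-elim (λ p → S p ∧ nbr p y) Ps e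
    ... | p , p∈ , Sp∧nb = p , p∈ , ∧-true Sp∧nb

    Γ-mono : ∀ {S S′} → (∀ p → p ∈ Ps → S p ≡ true → S′ p ≡ true) → ∀ {y} → Γ S y ≡ true → Γ S′ y ≡ true
    Γ-mono h e with Γ-elim e
    ... | p , p∈ , Sp , nb = Γ-intro p∈ (h p p∈ Sp) nb

    gain : PSet → V → Status P → ℕ
    gain S y outside   = 0
    gain S y free      = [ Γ S y ]ᵇ
    gain S y (child p) = [ S p ]ᵇ

    φ : State → PSet → ℕ
    φ st S = ∑ Vs (λ y → gain S y (st y))

    ∣_∣ : PSet → ℕ
    ∣ S ∣ = count Ps S

    Extendable : State → Set
    Extendable st = ∀ S → ∣ S ∣ ≤ 2 * κ → 2 * ∣ S ∣ ≤ φ st S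

    WellFormed : State → Set
    WellFormed st = ∀ {y p} → st y ≡ child p → p ∈ Ps × nbr p y ≡ true

    freeᵇ : Status P → Bool
    freeᵇ free      = true
    freeᵇ outside   = false
    freeᵇ (child _) = false

    isFree : State → V → Bool
    isFree st y = freeᵇ (st y)

    isFree-true : ∀ {st y} → isFree st y ≡ true → st y ≡ free
    isFree-true {st} {y} e with st y
    ... | free = refl

    isFree-intro : ∀ {st y} → st y ≡ free → isFree st y ≡ true
    isFree-intro e = cong freeᵇ e

    #free : State → ℕ
    #free st = count Vs (isFree st)

    childOfᵇ : P → Status P → Bool
    childOfᵇ p (child p′) = ⌊ p′ ≟P p ⌋
    childOfᵇ p outside    = false
    childOfᵇ p free       = false

    isChildOf : State → P → V → Bool
    isChildOf st p y = childOfᵇ p (st y)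

    #children : State → P → ℕ
    #children st p = count Vs (isChildOf st p)

    attach : State → V → P → State
    attach st y p z = if ⌊ z ≟ y ⌋ then child p else st z

    attach-same : ∀ st y p → attach st y p y ≡ child p
    attach-same st y p with y ≟ y
    ... | yes _ = refl
    ... | no ne = contradiction refl ne

    attach-other : ∀ st {y} p {z} → z ≢ y → attach st y p z ≡ st z
    attach-other st {y} p {z} z≢y with z ≟ y
    ... | yes e = contradiction e z≢y
    ... | no _  = refl

    module Finitary where
      open DecM _≟P_ using (_∈?_)

      member : List P → PSet
      member L p = ⌊ p ∈? L ⌋

      member-true : ∀ {L p} → member L p ≡ true → p ∈ L
      member-true {L} {p} e with p ∈? L
      ... | yes p∈ = p∈

      member-intro : ∀ {L p} → p ∈ L → member L p ≡ true
      member-intro {L} {p} p∈ with p ∈? L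
      ... | yes _ = refl
      ... | no n  = contradiction p∈ n

      filter∈sublists : ∀ (S : PSet) (xs : List P) → filterᵇ S xs ∈ sublists xs
      filter∈sublists S []       = here refl
      filter∈sublists S (x ∷ xs) with S x
      ... | true  = ∈-++⁺ˡ (∈-map⁺ (x ∷_) (filter∈sublists S xs))
      ... | false = ∈-++⁺ʳ (map (x ∷_) (sublists xs)) (filter∈sublists S xs)

      ∈-filter-intro : ∀ (S : PSet) {xs p} → p ∈ xs → S p ≡ true → p ∈ filterᵇ S xs
      ∈-filter-intro S {x ∷ xs} (here refl) e with S x
      ∈-filter-intro S (here refl) refl | true = here refl
      ∈-filter-intro S {x ∷ xs} (there p∈) e with S x
      ... | true  = there (∈-filter-intro S p∈ e)
      ... | false = ∈-filter-intro S p∈ e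

      ∈-filter-elim : ∀ (S : PSet) xs {p} → p ∈ filterᵇ S xs → S p ≡ true
      ∈-filter-elim S (x ∷ xs) p∈ with S x in eq
      ∈-filter-elim S (x ∷ xs) (here refl) | true = eq
      ∈-filter-elim S (x ∷ xs) (there p∈)  | true = ∈-filter-elim S xs p∈
      ... | false = ∈-filter-elim S xs p∈

      agree : ∀ (S : PSet) p → p ∈ Ps → member (filterᵇ S Ps) p ≡ S p
      agree S p p∈ with S p in eq
      ... | true  = member-intro (∈-filter-intro S p∈ eq)
      ... | false = Sum.[ (λ e → true≢false (∈-filter-elim S Ps (member-true {filterᵇ S Ps} {p} e)) eq) , (λ e → e) ]′ (bool-cases (member (filterᵇ S Ps) p))

      φ-cong : ∀ st → WellFormed st → ∀ {S S′} → (∀ p → p ∈ Ps → S p ≡ S′ p) → φ st S ≡ φ st S′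
      φ-cong st wf {S} {S′} h = ∑-cong Vs (λ y → same y (st y) refl)
        where
        same : ∀ y s → st y ≡ s → gain S y s ≡ gain S′ y s
        same y outside e = refl
        same y free e = ℕₚ.≤-antisym ([]ᵇ-mono (Γ-mono (λ p p∈ Sp → trans (sym (h p p∈)) Sp))) ([]ᵇ-mono (Γ-mono (λ p p∈ Sp → trans (h p p∈) Sp)))
        same y (child p) e = cong [_]ᵇ (h p (proj₁ (wf e)))

      OK : State → List P → Set
      OK st L = ∣ member L ∣ ≤ 2 * κ → 2 * ∣ member L ∣ ≤ φ st (member L)

      extendable? : ∀ st → WellFormed st → Extendable st ⊎ ∃ λ S → ∣ S ∣ ≤ 2 * κ × φ st S < 2 * ∣ S ∣
      extendable? st wf with All.all? (λ L → (∣ member L ∣ ℕ.≤? 2 * κ) →-dec (2 * ∣ member L ∣ ℕ.≤? φ st (member L))) (sublists Ps)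
      ... | yes ok = inj₁ (λ S le → subst₂ (λ a b → 2 * a ≤ b) (∑-cong∈ Ps (λ p p∈ → cong [_]ᵇ (agree S p p∈))) (φ-cong st wf (agree S))
              (All.lookup ok (filter∈sublists S Ps) (subst (_≤ 2 * κ) (sym (∑-cong∈ Ps (λ p p∈ → cong [_]ᵇ (agree S p p∈)))) le)))
      ... | no ¬ok with M.find (Allₚ.¬All⇒Any¬ (λ L → (∣ member L ∣ ℕ.≤? 2 * κ) →-dec (2 * ∣ member L ∣ ℕ.≤? φ st (member L))) (sublists Ps) ¬ok)
      ... | L , _ , ¬okL with ∣ member L ∣ ℕ.≤? 2 * κ | 2 * ∣ member L ∣ ℕ.≤? φ st (member L)
      ... | no ¬le | _ = contradiction (λ le → contradiction le ¬le) ¬okL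
      ... | yes _ | yes le = contradiction (λ _ → le) ¬okL
      ... | yes le | no ¬le = inj₂ (member L , le , ℕₚ.≰⇒> ¬le)

    open Finitary using (extendable?)

    rollback : ∀ {st st′} → WellFormed st → (∀ y → st′ y ≡ st y ⊎ (st′ y ≡ free × ∃ λ p → st y ≡ child p)) → Extendable st → Extendable st′
    rollback {st} {st′} wf rel ext S le = ℕₚ.≤-trans (ext S le) (∑-mono Vs step)
      where
      step : ∀ y → gain S y (st y) ≤ gain S y (st′ y)
      step y with rel y
      ... | inj₁ e = ℕₚ.≤-reflexive (cong (gain S y) (sym e))
      ... | inj₂ (e , p , e′) rewrite e | e′ = []ᵇ-mono (λ Sp → Γ-intro (proj₁ (wf e′)) Sp (proj₂ (wf e′)))

    attach-wf : ∀ {st y p} → WellFormed st → p ∈ Ps → nbr p y ≡ true → WellFormed (attach st y p)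
    attach-wf {st} {y} {p} wf p∈ nb {z} e with z ≟ y
    attach-wf wf p∈ nb refl | yes refl = p∈ , nb
    attach-wf wf p∈ nb e    | no _     = wf e

    attach-φ : ∀ st {y} p → st y ≡ free → ∀ S → φ (attach st y p) S + [ Γ S y ]ᵇ ≡ φ st S + [ S p ]ᵇ
    attach-φ st {y} p fr S = begin
      φ (attach st y p) S + [ Γ S y ]ᵇ ≡⟨ cong (φ (attach st y p) S +_) (sym (trans (∑-δ FV y _ (λ z z≢y → δ-off z z≢y)) (δ-on [ Γ S y ]ᵇ))) ⟩
      φ (attach st y p) S + ∑ Vs (λ z → δ z [ Γ S y ]ᵇ) ≡⟨ sym (∑-∙ Vs _ _) ⟩
      ∑ Vs (λ z → gain S z (attach st y p z) + δ z [ Γ S y ]ᵇ) ≡⟨ ∑-cong Vs pointwise ⟩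
      ∑ Vs (λ z → gain S z (st z) + δ z [ S p ]ᵇ) ≡⟨ ∑-∙ Vs _ _ ⟩
      φ st S + ∑ Vs (λ z → δ z [ S p ]ᵇ) ≡⟨ cong (φ st S +_) (trans (∑-δ FV y _ (λ z z≢y → δ-off z z≢y)) (δ-on [ S p ]ᵇ)) ⟩
      φ st S + [ S p ]ᵇ ∎
      where
      open ≡-Reasoning
      δ : V → ℕ → ℕ
      δ z n = if ⌊ z ≟ y ⌋ then n else 0
      δ-on : ∀ n → δ y n ≡ n
      δ-on n with y ≟ y
      ... | yes _ = refl
      ... | no ne = contradiction refl ne
      δ-off : ∀ z → z ≢ y → ∀ {n} → δ z n ≡ 0
      δ-off z ne with z ≟ y
      ... | yes e = contradiction e ne
      ... | no _  = refl
      pointwise : ∀ z → gain S z (attach st y p z) + δ z [ Γ S y ]ᵇ ≡ gain S z (st z) + δ z [ S p ]ᵇ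
      pointwise z with z ≟ y
      ... | yes refl rewrite fr = ℕₚ.+-comm [ S p ]ᵇ [ Γ S y ]ᵇ
      ... | no _ = refl

    _∪_ _∩_ : PSet → PSet → PSet
    (S ∪ S′) p = S p ∨ S′ p
    (S ∩ S′) p = S p ∧ S′ p

    ∪∩-count : ∀ S S′ → ∣ S ∪ S′ ∣ + ∣ S ∩ S′ ∣ ≡ ∣ S ∣ + ∣ S′ ∣
    ∪∩-count S S′ = trans (sym (∑-∙ Ps _ _)) (trans (∑-cong Ps (λ p → bits (S p) (S′ p))) (∑-∙ Ps _ _))
      where
      bits : ∀ a b → [ a ∨ b ]ᵇ + [ a ∧ b ]ᵇ ≡ [ a ]ᵇ + [ b ]ᵇ
      bits true  true  = refl
      bits true  false = refl
      bits false true  = refl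
      bits false false = refl

    submodular : ∀ st S S′ → φ st (S ∪ S′) + φ st (S ∩ S′) ≤ φ st S + φ st S′
    submodular st S S′ = subst₂ _≤_ (∑-∙ Vs _ _) (∑-∙ Vs _ _) (∑-mono Vs (λ y → pointwise y (st y)))
      where
      bits : ∀ {a b c d} → (a ≡ true → c ≡ true ⊎ d ≡ true) → (b ≡ true → c ≡ true × d ≡ true) → [ a ]ᵇ + [ b ]ᵇ ≤ [ c ]ᵇ + [ d ]ᵇ
      bits {a} {true} f g with g refl
      ... | refl , refl = ℕₚ.+-monoˡ-≤ 1 ([]ᵇ≤1 a)
      bits {false} {false} f g = z≤n
      bits {true} {false} f g with f refl
      ... | inj₁ refl = s≤s z≤n
      ... | inj₂ refl = ℕₚ.m≤n+m 1 _
      pointwise : ∀ y s → gain (S ∪ S′) y s + gain (S ∩ S′) y s ≤ gain S y s + gain S′ y s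
      pointwise y outside = z≤n
      pointwise y (child p) = bits (∨-true {S p}) (∧-true {S p})
      pointwise y free = bits split (λ e → Γ-mono (λ p _ e′ → proj₁ (∧-true e′)) e , Γ-mono (λ p _ e′ → proj₂ (∧-true {S p} e′)) e)
        where
        split : Γ (S ∪ S′) y ≡ true → Γ S y ≡ true ⊎ Γ S′ y ≡ true
        split e with Γ-elim e
        ... | p , p∈ , Sp , nb with ∨-true {S p} Sp
        ... | inj₁ s = inj₁ (Γ-intro p∈ s nb)
        ... | inj₂ s = inj₂ (Γ-intro p∈ s nb)

    Joined : Set
    Joined = ∀ (S : PSet) (X : V → Bool) → (∀ p → p ∈ Ps → S p ≡ true → ∀ y → X y ≡ true → nbr p y ≡ false) → ∣ S ∣ * count Vs X ≤ κ * κ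

    module _ (joined : Joined) where

      Tight : State → PSet → Set
      Tight st S = ∣ S ∣ ≤ 2 * κ × φ st S ≤ 2 * ∣ S ∣

      tight-small : ∀ {st S} → 5 * κ < #free st → Tight st S → ∣ S ∣ < κ
      tight-small {st} {S} many (S≤2κ , tight) = ℕₚ.≰⇒> λ κ≤S → ℕₚ.<⇒≱ many (begin
        #free st ≡⟨ count-split Vs (isFree st) (Γ S) ⟩
        count Vs (λ y → isFree st y ∧ Γ S y) + count Vs X ≤⟨ ℕₚ.+-mono-≤ seen (missed κ≤S) ⟩
        φ st S + κ ≤⟨ ℕₚ.+-monoˡ-≤ κ (ℕₚ.≤-trans tight (ℕₚ.*-monoʳ-≤ 2 S≤2κ)) ⟩
        2 * (2 * κ) + κ ≡⟨ arith κ ⟩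
        5 * κ ∎)
        where
        open ℕₚ.≤-Reasoning
        arith : ∀ κ → 2 * (2 * κ) + κ ≡ 5 * κ
        arith = solve-∀
        X : V → Bool
        X y = isFree st y ∧ not (Γ S y)
        seen : count Vs (λ y → isFree st y ∧ Γ S y) ≤ φ st S
        seen = ∑-mono Vs pointwise
          where
          pointwise : ∀ y → [ isFree st y ∧ Γ S y ]ᵇ ≤ gain S y (st y)
          pointwise y with st y
          ... | free    = ℕₚ.≤-refl
          ... | outside = z≤n
          ... | child _ = z≤n
        missed : κ ≤ ∣ S ∣ → count Vs X ≤ κ
        missed κ≤S = ℕₚ.*-cancelˡ-≤ κ (ℕₚ.≤-trans (ℕₚ.*-monoˡ-≤ (count Vs X) κ≤S) (joined S X (λ p p∈ Sp y Xy → unseen p p∈ Sp y (proj₂ (∧-true {isFree st y} Xy)))))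
          where
          unseen : ∀ p → p ∈ Ps → S p ≡ true → ∀ y → not (Γ S y) ≡ true → nbr p y ≡ false
          unseen p p∈ Sp y nΓ = Sum.[ (λ nb → true≢false nΓ (cong not (Γ-intro p∈ Sp nb))) , (λ e → e) ]′ (bool-cases (nbr p y))

      tight-∪ : ∀ {st S S′} → Extendable st → 5 * κ < #free st → Tight st S → Tight st S′ → Tight st (S ∪ S′)
      tight-∪ {st} {S} {S′} ext many t t′ = small , ℕₚ.+-cancelʳ-≤ (2 * ∣ S ∩ S′ ∣) _ _ (begin
        φ st (S ∪ S′) + 2 * ∣ S ∩ S′ ∣ ≤⟨ ℕₚ.+-monoʳ-≤ (φ st (S ∪ S′)) (ext (S ∩ S′) (ℕₚ.≤-trans (∑-mono Ps (λ p → []ᵇ-mono (proj₁ ∘ ∧-true {S p}))) (proj₁ t))) ⟩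
        φ st (S ∪ S′) + φ st (S ∩ S′) ≤⟨ submodular st S S′ ⟩
        φ st S + φ st S′ ≤⟨ ℕₚ.+-mono-≤ (proj₂ t) (proj₂ t′) ⟩
        2 * ∣ S ∣ + 2 * ∣ S′ ∣ ≡⟨ sym (ℕₚ.*-distribˡ-+ 2 ∣ S ∣ _) ⟩
        2 * (∣ S ∣ + ∣ S′ ∣) ≡⟨ cong (2 *_) (sym (∪∩-count S S′)) ⟩
        2 * (∣ S ∪ S′ ∣ + ∣ S ∩ S′ ∣) ≡⟨ ℕₚ.*-distribˡ-+ 2 ∣ S ∪ S′ ∣ _ ⟩
        2 * ∣ S ∪ S′ ∣ + 2 * ∣ S ∩ S′ ∣ ∎)
        where
        open ℕₚ.≤-Reasoning
        small : ∣ S ∪ S′ ∣ ≤ 2 * κ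
        small = begin
          ∣ S ∪ S′ ∣ ≤⟨ ℕₚ.m≤m+n _ _ ⟩
          ∣ S ∪ S′ ∣ + ∣ S ∩ S′ ∣ ≡⟨ ∪∩-count S S′ ⟩
          ∣ S ∣ + ∣ S′ ∣ ≤⟨ ℕₚ.+-mono-≤ (ℕₚ.<⇒≤ (tight-small many t)) (ℕₚ.<⇒≤ (tight-small many t′)) ⟩
          κ + κ ≡⟨ cong (κ +_) (sym (ℕₚ.+-identityʳ κ)) ⟩
          2 * κ ∎

      extend : ∀ {st} → WellFormed st → Extendable st → 5 * κ < #free st → ∀ p → p ∈ Ps → #children st p ≤ 1 →
               ∃ λ y → st y ≡ free × nbr p y ≡ true × Extendable (attach st y p)
      extend {st} wf ext many p p∈ few = decide Vs (∅ , (∣∅∣≤ , φ∅≤) , refl , λ y y∉ → contradiction (complete y) y∉)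
        where
        ∅ : PSet
        ∅ _ = false
        ∣∅∣≤ : ∣ ∅ ∣ ≤ 2 * κ
        ∣∅∣≤ = ℕₚ.≤-trans (ℕₚ.≤-reflexive (∑-ε Ps)) z≤n
        φ∅≤ : φ st ∅ ≤ 2 * ∣ ∅ ∣
        φ∅≤ = ℕₚ.≤-trans (ℕₚ.≤-reflexive (∑-zero∈ Vs (λ y _ → none y (st y)))) z≤n
          where
          none : ∀ y s → gain ∅ y s ≡ 0
          none y outside = refl
          none y (child _) = refl
          none y free = cong [_]ᵇ (Sum.[ (λ e → true≢false (proj₁ (proj₂ (proj₂ (Γ-elim {∅} {y} e)))) refl) , (λ e → e) ]′ (bool-cases (Γ ∅ y)))
        Covers : List V → PSet → Set
        Covers ys S = Tight st S × S p ≡ false × (∀ y → ¬ (y ∈ ys) → st y ≡ free → nbr p y ≡ true → Γ S y ≡ true)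
        Goal = ∃ λ y → st y ≡ free × nbr p y ≡ true × Extendable (attach st y p)
        -- a tight set that sees every free neighbour of p but does not contain p : adding p breaks extendability
        impossible : ∀ S → Covers [] S → Goal
        impossible S (tight , Sp≡f , sees) = contradiction (ext S⁺ (ℕₚ.≤-trans (ℕₚ.≤-reflexive ∣S⁺∣) (ℕₚ.≤-trans (tight-small many tight) (ℕₚ.m≤m+n κ _)))) (ℕₚ.<⇒≱ (begin-strict
            φ st S⁺ ≤⟨ φS⁺ ⟩
            φ st S + #children st p ≤⟨ ℕₚ.+-mono-≤ (proj₂ tight) few ⟩
            2 * ∣ S ∣ + 1 <⟨ ℕₚ.≤-reflexive (arith ∣ S ∣) ⟩
            2 * suc ∣ S ∣ ≡⟨ cong (2 *_) (sym ∣S⁺∣) ⟩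
            2 * ∣ S⁺ ∣ ∎))
          where
          open ℕₚ.≤-Reasoning
          arith : ∀ n → suc (2 * n + 1) ≡ 2 * suc n
          arith = solve-∀
          S⁺ : PSet
          S⁺ p′ = S p′ ∨ ⌊ p′ ≟P p ⌋
          single : ∑ Ps (λ p′ → [ ⌊ p′ ≟P p ⌋ ]ᵇ) ≡ 1
          single = trans (∑-δ∈ Ps Ps! p p∈ _ (λ p′ _ ne → off p′ ne)) on
            where
            off : ∀ p′ → p′ ≢ p → [ ⌊ p′ ≟P p ⌋ ]ᵇ ≡ 0
            off p′ ne with p′ ≟P p
            ... | yes e = contradiction e ne
            ... | no _  = refl
            on : [ ⌊ p ≟P p ⌋ ]ᵇ ≡ 1
            on with p ≟P p
            ... | yes _ = refl
            ... | no ne = contradiction refl ne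
          ∣S⁺∣ : ∣ S⁺ ∣ ≡ suc ∣ S ∣
          ∣S⁺∣ = trans (∑-cong Ps bits) (trans (∑-∙ Ps _ _) (trans (cong (∣ S ∣ +_) single) (ℕₚ.+-comm ∣ S ∣ 1)))
            where
            bits : ∀ p′ → [ S⁺ p′ ]ᵇ ≡ [ S p′ ]ᵇ + [ ⌊ p′ ≟P p ⌋ ]ᵇ
            bits p′ with p′ ≟P p
            ... | yes refl rewrite Sp≡f = refl
            ... | no _ with S p′
            ... | true  = refl
            ... | false = refl
          φS⁺ : φ st S⁺ ≤ φ st S + #children st p
          φS⁺ = subst (φ st S⁺ ≤_) (∑-∙ Vs _ _) (∑-mono Vs pointwise)
            where
            at-free : ∀ y → st y ≡ free → Γ S⁺ y ≡ true → Γ S y ≡ true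
            at-free y fr e with Γ-elim {S⁺} e
            ... | p′ , p′∈ , Sp′ , nb with ∨-true {S p′} Sp′
            ... | inj₁ s = Γ-intro p′∈ s nb
            ... | inj₂ s with p′ ≟P p
            ... | yes refl = sees y (λ ()) fr nb
            pointwise : ∀ y → gain S⁺ y (st y) ≤ gain S y (st y) + [ isChildOf st p y ]ᵇ
            pointwise y with st y in eq
            ... | outside = z≤n
            ... | free = ℕₚ.≤-trans ([]ᵇ-mono (at-free y eq)) (ℕₚ.m≤m+n _ _)
            ... | child p′ with S p′
            ... | true  = s≤s z≤n
            ... | false = ℕₚ.≤-refl
        decide : ∀ ys → (∃ λ S → Covers ys S) → Goal
        decide [] (S , covers) = impossible S covers
        decide (y ∷ ys) (S , tight , Sp , sees) with st y in eq | nbr p y in nb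
        ... | free | true = Sum.[ (λ ext′ → y , eq , nb , ext′) , blocked ]′ (extendable? (attach st y p) (attach-wf wf p∈ nb))
          where
          blocked : (∃ λ S′ → ∣ S′ ∣ ≤ 2 * κ × φ (attach st y p) S′ < 2 * ∣ S′ ∣) → Goal
          blocked (S′ , le , lt) = decide ys (S ∪ S′ , tight-∪ ext many tight tight′ , cong₂ _∨_ Sp S′p , sees′)
            where
            φ≡ = attach-φ st p eq S′
            ext′ = ext S′ le
            S′p : S′ p ≡ false
            S′p with S′ p | φ≡
            ... | false | _ = refl
            ... | true | e = contradiction lt (ℕₚ.≤⇒≯ (ℕₚ.≤-trans ext′ (ℕₚ.+-cancelʳ-≤ 1 _ _ (ℕₚ.≤-trans (ℕₚ.≤-reflexive (sym e)) (ℕₚ.+-monoʳ-≤ _ ([]ᵇ≤1 (Γ S′ y)))))))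
            Γy : Γ S′ y ≡ true
            Γy with Γ S′ y | φ≡
            ... | true | _ = refl
            ... | false | e = contradiction lt (ℕₚ.≤⇒≯ (ℕₚ.≤-trans ext′ (ℕₚ.≤-trans (ℕₚ.m≤m+n _ _) (ℕₚ.≤-reflexive (trans (sym e) (ℕₚ.+-identityʳ _))))))
            tight′ : Tight st S′
            tight′ = le , ℕₚ.≤-trans (ℕₚ.≤-reflexive (sym (trans (cong (λ b → φ (attach st y p) S′ + [ b ]ᵇ) (sym Γy)) (trans φ≡ (trans (cong (λ b → φ st S′ + [ b ]ᵇ) S′p) (ℕₚ.+-identityʳ _)))))) (ℕₚ.≤-trans (ℕₚ.≤-reflexive (ℕₚ.+-comm _ 1)) lt)
            sees′ : ∀ z → ¬ (z ∈ ys) → st z ≡ free → nbr p z ≡ true → Γ (S ∪ S′) z ≡ true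
            sees′ z z∉ fr nbz with z ≟ y
            ... | yes refl = Γ-mono (λ p′ _ e → ∨-trueʳ {S p′} e) Γy
            ... | no z≢y = Γ-mono {S} (λ p′ _ e → ∨-trueˡ {S p′} {S′ p′} e) (sees z (λ { (here e) → z≢y e ; (there z∈ys) → z∉ z∈ys }) fr nbz)
        ... | free | false = decide ys (S , tight , Sp , λ z z∉ fr nbz → sees z (λ { (here refl) → true≢false nbz nb ; (there z∈ys) → z∉ z∈ys }) fr nbz)
        ... | outside | _ = decide ys (S , tight , Sp , λ z z∉ fr nbz → sees z (λ { (here refl) → contradiction (trans (sym fr) eq) (λ ()) ; (there z∈ys) → z∉ z∈ys }) fr nbz)
        ... | child _ | _ = decide ys (S , tight , Sp , λ z z∉ fr nbz → sees z (λ { (here refl) → contradiction (trans (sym fr) eq) (λ ()) ; (there z∈ys) → z∉ z∈ys }) fr nbz)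

module Connect where

  open SumLib
  open NatSum
  open Extension
  open import Data.Bool using (not)
  open import Data.Empty using (⊥)
  open import Data.List using (_ʳ++_; reverse)
  open import Data.List.Properties using (length-reverse; ʳ++-ʳ++; reverse-involutive)
  import Data.List.Membership.DecPropositional as DecM
  open import Data.List.Relation.Binary.Permutation.Propositional using (↭-sym)
  open import Data.List.Relation.Binary.Permutation.Propositional.Properties using (∈-resp-↭; ++↭ʳ++)
  import Data.List.Relation.Unary.Any.Properties as Anyₚ
  open import Data.List.Relation.Unary.All as All using ([]; _∷_)
  import Data.List.Relation.Unary.All.Properties as Allₚ
  open import Data.List.Relation.Unary.AllPairs using ([]; _∷_)
  import Data.List.Relation.Unary.Any as Any
  open import Data.Nat using (ℕ; zero; suc; _+_; _*_; _^_; _≤_; _<_; z≤n; s≤s; NonZero)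
  import Data.Nat.Properties as ℕₚ
  open import Data.Nat.Tactic.RingSolver using (solve-∀)
  import Data.Sum as Sum

  ʳ++-assoc : ∀ {A : Set} (xs : List A) {ys zs} → xs ʳ++ (ys ++ zs) ≡ (xs ʳ++ ys) ++ zs
  ʳ++-assoc []       = refl
  ʳ++-assoc (x ∷ xs) = ʳ++-assoc xs

  module Connection {V C : Set} (FV : Finite V) (_≟C_ : DecidableEquality C) (R : List C)
                    (adj : C → V → V → Bool) (adj-sym : ∀ c x y → adj c x y ≡ true → adj c y x ≡ true)
                    (U : V → Bool) (Ps : List (C × V)) (Ps! : Unique Ps)
                    (∈Ps : ∀ {c x} → c ∈ R → U x ≡ true → (c , x) ∈ Ps)
                    (κ : ℕ) .{{_ : NonZero κ}} where

    open Finite FV using (_≟_; complete)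
    open Extendable FV (≡-dec _≟C_ _≟_) Ps Ps! (λ (c , x) y → adj c x y) κ public

    free? : ∀ (st : State) y → st y ≡ free ⊎ st y ≢ free
    free? st y with st y
    ... | free = inj₁ refl
    ... | outside = inj₂ (λ ())
    ... | child _ = inj₂ (λ ())

    Childless : State → V → Set
    Childless st u = ∀ z c → st z ≢ child (c , u)

    record Inv (st : State) : Set where
      field
        wf    : WellFormed st
        ext   : Extendable st
        inU   : ∀ y → st y ≢ outside → U y ≡ true
        fresh : ∀ y → st y ≡ free → Childless st y

    -- st′ arises from st by attaching at most n free vertices below the vertices in A or below newly attached ones
    record Step (A : V → Set) (st st′ : State) (n : ℕ) : Set where
      field
        keep  : ∀ y → st y ≢ free → st′ y ≡ st y
        alive : ∀ y → st y ≡ free → st′ y ≢ outside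
        cost  : #free st ≤ #free st′ + n
        quiet : ∀ w → st w ≢ free → ¬ A w → Childless st w → Childless st′ w

      nonfree : ∀ {y} → st y ≢ free → st′ y ≢ free
      nonfree {y} ne e = ne (trans (sym (keep y ne)) e)

    open Step

    step-refl : ∀ {A st} → Step A st st 0
    step-refl = record { keep = λ _ _ → refl ; alive = λ y e e′ → contradiction (trans (sym e) e′) (λ ()) ; cost = ℕₚ.≤-reflexive (sym (ℕₚ.+-identityʳ _)) ; quiet = λ _ _ _ h → h }

    step-trans : ∀ {A B st st′ st″ n m} → (∀ w → B w → A w ⊎ st w ≡ free) → Step A st st′ n → Step B st′ st″ m → Step A st st″ (n + m)
    step-trans {A} {B} {st} {st′} {st″} {n} {m} B⊆ s t = record
      { keep = λ y ne → trans (keep t y (nonfree s ne)) (keep s y ne)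
      ; alive = λ y e e″ → Sum.[ (λ e′ → alive t y e′ e″) , (λ ne → alive s y e (trans (sym (keep t y ne)) e″)) ]′ (free? st′ y)
      ; cost = ℕₚ.≤-trans (cost s) (ℕₚ.≤-trans (ℕₚ.+-monoˡ-≤ n (cost t)) (ℕₚ.≤-reflexive (arith (#free st″) m n)))
      ; quiet = λ w ne ¬A h → quiet t w (nonfree s ne) (λ b → Sum.[ ¬A , ne ]′ (B⊆ w b)) (quiet s w ne ¬A h) }
      where
      arith : ∀ f m n → f + m + n ≡ f + (n + m)
      arith = solve-∀

    module _ (joined : Joined) where

      childless⇒#0 : ∀ {st u} c → Childless st u → #children st (c , u) ≡ 0
      childless⇒#0 {st} {u} c h = ∑-zero∈ Vs (λ z _ → none z)
        where
        none : ∀ z → [ isChildOf st (c , u) z ]ᵇ ≡ 0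
        none z with st z in eq
        ... | outside = refl
        ... | free    = refl
        ... | child p with ≡-dec _≟C_ _≟_ p (c , u)
        ... | yes refl = contradiction eq (h z c)
        ... | no _     = refl

      attach-#children : ∀ st y p → #children (attach st y p) p ≤ suc (#children st p)
      attach-#children st y p = ℕₚ.≤-trans (∑-mono Vs split) (ℕₚ.≤-trans (ℕₚ.≤-reflexive (∑-∙ Vs _ _)) (ℕₚ.≤-trans (ℕₚ.+-monoʳ-≤ (#children st p) (ℕₚ.≤-trans (∑-mono Vs one) (count-member FV (y ∷ [])))) (ℕₚ.≤-reflexive (ℕₚ.+-comm _ 1))))
        where
        one : ∀ z → [ ⌊ z ≟ y ⌋ ]ᵇ ≤ [ ⌊ DecM._∈?_ _≟_ z (y ∷ []) ⌋ ]ᵇ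
        one z with z ≟ y
        ... | no _  = z≤n
        ... | yes _ = s≤s z≤n
        split : ∀ z → [ isChildOf (attach st y p) p z ]ᵇ ≤ [ isChildOf st p z ]ᵇ + [ ⌊ z ≟ y ⌋ ]ᵇ
        split z with z ≟ y
        ... | yes refl = ℕₚ.≤-trans ([]ᵇ≤1 _) (ℕₚ.m≤n+m 1 _)
        ... | no ne = ℕₚ.m≤m+n _ 0

      record Attached (st : State) (c : C) (u : V) : Set where
        field
          vertex    : V
          was-free  : st vertex ≡ free
          adjacent  : adj c u vertex ≡ true
        after = attach st vertex (c , u)
        field
          inv       : Inv after
          step      : Step (_≡ u) st after 1
          childless : Childless after vertex

      attach-below : ∀ {st c u} → Inv st → c ∈ R → U u ≡ true → st u ≢ free → #children st (c , u) ≤ 1 → 5 * κ < #free st → Attached st c u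
      attach-below {st} {c} {u} I c∈ Uu u-used few many = go (extend joined wf ext many (c , u) (∈Ps c∈ Uu) few)
        where
        open Inv I
        go : (∃ λ y → st y ≡ free × adj c u y ≡ true × Extendable (attach st y (c , u))) → Attached st c u
        go (y , fr , ad , ext′) = record { vertex = y ; was-free = fr ; adjacent = ad
          ; inv = record { wf = attach-wf wf (∈Ps c∈ Uu) ad ; ext = ext′ ; inU = inU′ ; fresh = fresh′ }
          ; step = record { keep = λ z ne → attach-other st (c , u) (λ { refl → ne fr }) ; alive = alive′ ; cost = cost′ ; quiet = λ w ne w≢u h → childless′ w (λ e → w≢u e) h }
          ; childless = childless′ y (λ { refl → u-used fr }) (fresh y fr) }
          where
          st′ = attach st y (c , u)
          inU′ : ∀ z → st′ z ≢ outside → U z ≡ true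
          inU′ z ne with z ≟ y
          ... | yes refl = inU y (λ e → contradiction (trans (sym fr) e) (λ ()))
          ... | no _     = inU z ne
          childless′ : ∀ w → w ≢ u → Childless st w → Childless st′ w
          childless′ w w≢u h z d e with z ≟ y
          ... | yes refl = w≢u (sym (cong proj₂ (child-injective e)))
          ... | no _     = h z d e
          fresh′ : ∀ z → st′ z ≡ free → Childless st′ z
          fresh′ z e = childless′ z (λ { refl → u-used free-before }) (fresh z free-before)
            where
            free-before : st z ≡ free
            free-before with z ≟ y
            free-before | no _ = e
          alive′ : ∀ z → st z ≡ free → st′ z ≢ outside
          alive′ z e e′ with z ≟ y
          alive′ z e () | yes _
          ... | no _ = contradiction (trans (sym e) e′) (λ ())
          cost′ : #free st ≤ #free st′ + 1
          cost′ = ℕₚ.≤-trans (∑-mono Vs split) (ℕₚ.≤-trans (ℕₚ.≤-reflexive (∑-∙ Vs _ _)) (ℕₚ.+-monoʳ-≤ (#free st′) (count-member FV (y ∷ []))))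
            where
            split : ∀ z → [ isFree st z ]ᵇ ≤ [ isFree st′ z ]ᵇ + [ ⌊ DecM._∈?_ _≟_ z (y ∷ []) ⌋ ]ᵇ
            split z with z ≟ y
            ... | yes _ = []ᵇ≤1 (isFree st z)
            ... | no _  = ℕₚ.m≤m+n [ isFree st z ]ᵇ 0

      -- colours and vertices of a branch are listed from its end back to the root
      data Branch (st₀ st : State) (x : V) : List C → V → List V → Set where
        root : Branch st₀ st x [] x []
        grow : ∀ {c cs u v zs} → Branch st₀ st x cs u zs → st₀ v ≡ free → ¬ (v ∈ zs) → st v ≡ child (c , u) → Branch st₀ st x (c ∷ cs) v (v ∷ zs)

      branch-free : ∀ {st₀ st x cs u zs} → Branch st₀ st x cs u zs → ∀ {z} → z ∈ zs → st₀ z ≡ free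
      branch-free (grow b fr _ _) (here refl) = fr
      branch-free (grow b fr _ _) (there z∈)  = branch-free b z∈

      branch-used : ∀ {st₀ st x cs u zs} → Branch st₀ st x cs u zs → ∀ {z} → z ∈ zs → ∃ λ p → st z ≡ child p × (proj₂ p ≡ x ⊎ proj₂ p ∈ zs)
      branch-used (grow root _ _ ch) (here refl) = _ , ch , inj₁ refl
      branch-used (grow (grow b _ _ _) _ _ ch) (here refl) = _ , ch , inj₂ (there (here refl))
      branch-used (grow b _ _ _) (there z∈) with branch-used b z∈
      ... | p , ch , where′ = p , ch , Sum.map₂ there where′

      branch-unique : ∀ {st₀ st x cs u zs} → Branch st₀ st x cs u zs → Unique zs
      branch-unique root = []
      branch-unique (grow b _ v∉ _) = All.tabulate (λ z∈ e → v∉ (subst (_∈ _) (sym e) z∈)) ∷ branch-unique b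

      branch-end : ∀ {st₀ st x cs u zs} → Branch st₀ st x cs u zs → u ≡ x ⊎ st₀ u ≡ free
      branch-end root = inj₁ refl
      branch-end (grow _ fr _ _) = inj₂ fr

      branch-length : ∀ {st₀ st x cs u zs} → Branch st₀ st x cs u zs → length zs ≡ length cs
      branch-length root = refl
      branch-length (grow b _ _ _) = cong suc (branch-length b)

      branch-keep : ∀ {st₀ st st′ x cs u zs} → (∀ y → st y ≢ free → st′ y ≡ st y) → Branch st₀ st x cs u zs → Branch st₀ st′ x cs u zs
      branch-keep k root = root
      branch-keep k (grow b fr v∉ ch) = grow (branch-keep k b) fr v∉ (trans (k _ (λ e → contradiction (trans (sym ch) e) (λ ()))) ch)

      nonfree-end : ∀ {st₀ st x cs u zs} → st x ≢ free → Branch st₀ st x cs u zs → st u ≢ free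
      nonfree-end ne root = ne
      nonfree-end ne (grow _ _ _ ch) e = contradiction (trans (sym ch) e) (λ ())

      in-U-end : ∀ {st₀ st x cs u zs} → Inv st → U x ≡ true → Branch st₀ st x cs u zs → U u ≡ true
      in-U-end I Ux root = Ux
      in-U-end I Ux (grow _ _ _ ch) = Inv.inU I _ (λ e → contradiction (trans (sym ch) e) (λ ()))

      grow-branch : ∀ {st₀ st x cs u zs c} → Branch st₀ st x cs u zs → (∀ y → st₀ y ≢ free → st y ≡ st₀ y) → (A : Attached st c u) →
                    Branch st₀ (Attached.after A) x (c ∷ cs) (Attached.vertex A) (Attached.vertex A ∷ zs)
      grow-branch {st₀} {st} b k A = grow (branch-keep (keep step) b) (Sum.[ (λ e → e) , (λ ne → contradiction was-free (λ e → ne (trans (sym (k vertex ne)) e))) ]′ (free? st₀ vertex))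
          (λ v∈ → contradiction (trans (sym was-free) (proj₁ (proj₂ (branch-used b v∈)))) (λ ())) (attach-same st vertex _)
        where open Attached A

      Node : Set
      Node = V × List V

      record Frontier (st₀ st : State) (x : V) (cs : List C) (ns : List Node) : Set where
        field
          branches  : All (λ (u , zs) → Branch st₀ st x cs u zs) ns
          childless : All (λ (u , _) → Childless st u) ns
          distinct  : Unique (map proj₁ ns)

      record Grown (st₀ st : State) (x : V) (cs : List C) (m : ℕ) (n : ℕ) : Set where
        field
          final     : State
          inv       : Inv final
          step      : Step (_≡ x) st₀ final n
          nodes     : List Node
          frontier  : Frontier st₀ final x cs nodes
          size      : length nodes ≡ m

      module _ {st₀ : State} {x : V} (Ux : U x ≡ true) (x-used : st₀ x ≢ free) where

        grow-path : ∀ ds {st cs u zs n} → All (_∈ R) ds → Inv st → Step (_≡ x) st₀ st n → Branch st₀ st x cs u zs → Childless st u →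
                    5 * κ + length ds ≤ #free st → Grown st₀ st x (ds ʳ++ cs) 1 (n + length ds)
        grow-path [] {st} {zs = zs} {n} _ I s b h _ = record { final = _ ; inv = I ; step = subst (Step (_≡ x) st₀ st) (sym (ℕₚ.+-identityʳ n)) s ; nodes = (_ , zs) ∷ []
          ; frontier = record { branches = b ∷ [] ; childless = h ∷ [] ; distinct = [] ∷ [] } ; size = refl }
        grow-path (d ∷ ds) {st} {cs} {u} {zs} {n} (d∈ ∷ ds∈) I s b h budget = record { Grown rest ; step = subst (Step (_≡ x) st₀ (Grown.final rest)) (ℕₚ.+-assoc n 1 (length ds)) (Grown.step rest) }
          where
          A : Attached st d u
          A = attach-below I d∈ (in-U-end I Ux b) (nonfree-end (nonfree s x-used) b) (ℕₚ.≤-trans (ℕₚ.≤-reflexive (childless⇒#0 d h)) z≤n)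
                (ℕₚ.<-≤-trans (ℕₚ.m<m+n (5 * κ) (s≤s z≤n)) budget)
          module A = Attached A
          budget′ : 5 * κ + length ds ≤ #free A.after
          budget′ = ℕₚ.+-cancelʳ-≤ 1 _ _ (ℕₚ.≤-trans (ℕₚ.≤-reflexive (trans (ℕₚ.+-assoc (5 * κ) (length ds) 1) (cong (5 * κ +_) (ℕₚ.+-comm (length ds) 1)))) (ℕₚ.≤-trans budget (cost A.step)))
          rest : Grown st₀ A.after x (ds ʳ++ (d ∷ cs)) 1 (n + 1 + length ds)
          rest = grow-path ds ds∈ A.inv (step-trans (λ w → λ { refl → branch-end b }) s A.step) (grow-branch b (keep s) A) A.childless budget′

        -- one more level of the binary tree, processing the nodes one after another
        record Doubled (st : State) (cs : List C) (ns : List Node) : Set where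
          field
            final    : State
            inv      : Inv final
            step     : Step (_∈ map proj₁ ns) st final (2 * length ns)
            nodes    : List Node
            frontier : Frontier st₀ final x cs nodes
            size     : length nodes ≡ 2 * length ns
            new      : All (λ (u , _) → st u ≡ free) nodes

        double : ∀ {c} → c ∈ R → ∀ ns {st cs} → Inv st → (∀ y → st₀ y ≢ free → st y ≡ st₀ y) → Frontier st₀ st x cs ns →
                 5 * κ + 2 * length ns ≤ #free st → Doubled st (c ∷ cs) ns
        double c∈ [] {st} I k F _ = record { final = st ; inv = I ; step = step-refl ; nodes = [] ; frontier = record { branches = [] ; childless = [] ; distinct = [] } ; size = refl ; new = [] }
        double {c} c∈ ((u , zs) ∷ ns) {st} {cs} I k record { branches = b ∷ bs ; childless = h ∷ hs ; distinct = u∉ ∷ ns! } budget = record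
          { final = D.final ; inv = D.inv
          ; step = subst (Step (_∈ u ∷ map proj₁ ns) st D.final) (arith (length ns)) (step-trans (λ w w∈ → inj₁ (there w∈)) two D.step)
          ; nodes = (A.vertex , A.vertex ∷ zs) ∷ (B.vertex , B.vertex ∷ zs) ∷ D.nodes
          ; frontier = record
            { branches = branch-keep (keep D.step) (branch-keep (keep B.step) (grow-branch b k A)) ∷ branch-keep (keep D.step) (grow-branch bᴬ kᴬ B) ∷ Frontier.branches D.frontier
            ; childless = quiet D.step A.vertex (nonfree B.step A-used) (λ v∈ → not-old A.was-free v∈) (quiet B.step A.vertex A-used A≢u A.childless)
                        ∷ quiet D.step B.vertex B-used (λ v∈ → not-old B-free v∈) B.childless ∷ Frontier.childless D.frontier
            ; distinct = (A≢B ∷ fresh-in-D (nonfree B.step A-used)) ∷ (fresh-in-D B-used ∷ Frontier.distinct D.frontier) }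
          ; size = trans (cong (2 +_) D.size) (arith′ (length ns))
          ; new = A.was-free ∷ B-free ∷ All.map (λ {(v , _)} fr → back v fr) D.new }
          where
          arith : ∀ n → 1 + 1 + 2 * n ≡ 2 * suc n
          arith = solve-∀
          arith′ : ∀ n → 2 + 2 * n ≡ 2 * suc n
          arith′ = solve-∀
          x-used′ : st x ≢ free
          x-used′ e = x-used (trans (sym (k x x-used)) e)
          u-used : st u ≢ free
          u-used = nonfree-end x-used′ b
          Uu = in-U-end I Ux b
          many : ∀ {f g} → 5 * κ + 2 * suc (length ns) ≤ f → f ≤ g + 1 → 5 * κ < g × 5 * κ + (1 + 2 * length ns) ≤ g
          many {f} {g} le le′ = ℕₚ.<-≤-trans (ℕₚ.m<m+n (5 * κ) (s≤s z≤n)) enough , enough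
            where
            arith″ : ∀ k n → k + (1 + 2 * n) + 1 ≡ k + 2 * suc n
            arith″ = solve-∀
            enough : 5 * κ + (1 + 2 * length ns) ≤ g
            enough = ℕₚ.+-cancelʳ-≤ 1 _ _ (ℕₚ.≤-trans (ℕₚ.≤-reflexive (arith″ (5 * κ) (length ns))) (ℕₚ.≤-trans le le′))
          A : Attached st c u
          A = attach-below I c∈ Uu u-used (ℕₚ.≤-trans (ℕₚ.≤-reflexive (childless⇒#0 c h)) z≤n) (ℕₚ.<-≤-trans (ℕₚ.m<m+n (5 * κ) (s≤s z≤n)) budget)
          module A = Attached A
          B : Attached A.after c u
          B = attach-below A.inv c∈ Uu (nonfree A.step u-used) (ℕₚ.≤-trans (attach-#children st A.vertex (c , u)) (s≤s (ℕₚ.≤-reflexive (childless⇒#0 c h)))) (proj₁ (many budget (cost A.step)))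
          module B = Attached B
          two : Step (_∈ u ∷ map proj₁ ns) st B.after (1 + 1)
          two = step-trans (λ { w refl → inj₁ (here refl) }) (weaken A.step) B.step
            where
            weaken : Step (_≡ u) st A.after 1 → Step (_∈ u ∷ map proj₁ ns) st A.after 1
            weaken s = record { keep = keep s ; alive = alive s ; cost = cost s ; quiet = λ w ne w∉ → quiet s w ne (λ { refl → w∉ (here refl) }) }
          kᴬ : ∀ y → st₀ y ≢ free → A.after y ≡ st₀ y
          kᴬ y ne = trans (keep A.step y (λ e → ne (trans (sym (k y ne)) e))) (k y ne)
          bᴬ : Branch st₀ A.after x cs u zs
          bᴬ = branch-keep (keep A.step) b
          A-used : A.after A.vertex ≢ free
          A-used e = contradiction (trans (sym (attach-same st A.vertex (c , u))) e) (λ ())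
          B-used : B.after B.vertex ≢ free
          B-used e = contradiction (trans (sym (attach-same A.after B.vertex (c , u))) e) (λ ())
          A≢u : A.vertex ≢ u
          A≢u e = u-used (trans (cong st (sym e)) A.was-free)
          back′ : ∀ v → B.after v ≡ free → A.after v ≡ free
          back′ v e = Sum.[ (λ e′ → e′) , (λ ne → contradiction e (nonfree B.step ne)) ]′ (free? A.after v)
          backᴬ : ∀ v → A.after v ≡ free → st v ≡ free
          backᴬ v e = Sum.[ (λ e′ → e′) , (λ ne → contradiction e (nonfree A.step ne)) ]′ (free? st v)
          back : ∀ v → B.after v ≡ free → st v ≡ free
          back v e = backᴬ v (back′ v e)
          B-free : st B.vertex ≡ free
          B-free = backᴬ B.vertex B.was-free
          A≢B : A.vertex ≢ B.vertex
          A≢B e = A-used (trans (cong A.after e) B.was-free)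
          ends-used : ∀ {v} → v ∈ map proj₁ ns → st v ≢ free
          ends-used v∈ with Any.map (λ z → z) v∈
          ... | v∈′ = go ns bs v∈′
            where
            go : ∀ ns → All (λ (u , zs) → Branch st₀ st x cs u zs) ns → ∀ {v} → v ∈ map proj₁ ns → st v ≢ free
            go (_ ∷ ns) (b ∷ bs) (here refl) = nonfree-end x-used′ b
            go (_ ∷ ns) (b ∷ bs) (there v∈) = go ns bs v∈
          not-old : ∀ {v} → st v ≡ free → ¬ (v ∈ map proj₁ ns)
          not-old fr v∈ = ends-used v∈ fr
          rest-frontier : Frontier st₀ B.after x cs ns
          rest-frontier = record { branches = All.map (λ b′ → branch-keep (keep B.step) (branch-keep (keep A.step) b′)) bs
            ; childless = quiet-all ns hs (λ w∈ → ends-used w∈) (λ w∈ e → All.lookup u∉ w∈ (sym e)) ; distinct = ns! }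
            where
            quiet-all : ∀ ns → All (λ (u , _) → Childless st u) ns → (∀ {w} → w ∈ map proj₁ ns → st w ≢ free) → (∀ {w} → w ∈ map proj₁ ns → w ≢ u) → All (λ (u , _) → Childless B.after u) ns
            quiet-all [] [] _ _ = []
            quiet-all ((w , _) ∷ ns) (h ∷ hs) used ne = quiet B.step w (nonfree A.step (used (here refl))) (ne (here refl)) (quiet A.step w (used (here refl)) (ne (here refl)) h)
              ∷ quiet-all ns hs (λ w∈ → used (there w∈)) (λ w∈ → ne (there w∈))
          D : Doubled B.after (c ∷ cs) ns
          D = double c∈ ns B.inv (λ y ne → trans (keep B.step y (λ e → ne (trans (sym (kᴬ y ne)) e))) (kᴬ y ne)) rest-frontier
                (ℕₚ.+-cancelʳ-≤ 1 _ _ (ℕₚ.≤-trans (ℕₚ.≤-reflexive (trans (ℕₚ.+-assoc (5 * κ) _ 1) (cong (5 * κ +_) (ℕₚ.+-comm _ 1)))) (ℕₚ.≤-trans (proj₂ (many budget (cost A.step))) (cost B.step))))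
          module D = Doubled D
          fresh-in-D : ∀ {v} → B.after v ≢ free → All (v ≢_) (map proj₁ D.nodes)
          fresh-in-D {v} ne = Allₚ.map⁺ (All.map {P = λ n → B.after (proj₁ n) ≡ free} {Q = λ n → v ≢ proj₁ n} (λ fr e → ne (trans (cong B.after e) fr)) D.new)

        tree-cost : ℕ → ℕ → ℕ
        tree-cost zero    m = 0
        tree-cost (suc h) m = 2 * m + tree-cost h (2 * m)

        grow-tree : ∀ ds {st cs m n} → All (_∈ R) ds → (G : Grown st₀ st x cs m n) → 5 * κ + tree-cost (length ds) m ≤ #free (Grown.final G) →
                    Grown st₀ st x (ds ʳ++ cs) (2 ^ length ds * m) (n + tree-cost (length ds) m)
        grow-tree [] {m = m} {n} _ G _ = record { Grown G ; step = subst (Step (_≡ x) st₀ (Grown.final G)) (sym (ℕₚ.+-identityʳ n)) (Grown.step G) ; size = trans (Grown.size G) (sym (ℕₚ.+-identityʳ m)) }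
        grow-tree (d ∷ ds) {st} {cs} {m} {n} (d∈ ∷ ds∈) G budget = record { Grown rest
            ; step = subst (Step (_≡ x) st₀ (Grown.final rest)) (ℕₚ.+-assoc n (2 * m) _) (Grown.step rest) ; size = trans (Grown.size rest) (arith (2 ^ length ds) m) }
          where
          arith : ∀ p m → p * (2 * m) ≡ 2 * p * m
          arith = solve-∀
          module G = Grown G
          size≡ : 2 * length G.nodes ≡ 2 * m
          size≡ = cong (2 *_) G.size
          D : Doubled G.final (d ∷ cs) G.nodes
          D = double d∈ G.nodes G.inv (keep G.step) G.frontier (ℕₚ.≤-trans (ℕₚ.+-monoʳ-≤ (5 * κ) (ℕₚ.≤-trans (ℕₚ.≤-reflexive size≡) (ℕₚ.m≤m+n _ _))) budget)
          module D = Doubled D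
          G′ : Grown st₀ st x (d ∷ cs) (2 * m) (n + 2 * m)
          G′ = record { final = D.final ; inv = D.inv ; step = subst (λ k → Step (_≡ x) st₀ D.final (n + k)) size≡ (step-trans (λ w w∈ → ends G.nodes (Frontier.branches G.frontier) w∈) G.step D.step)
            ; nodes = D.nodes ; frontier = D.frontier ; size = trans D.size size≡ }
            where
            ends : ∀ ns → All (λ (u , zs) → Branch st₀ G.final x cs u zs) ns → ∀ {w} → w ∈ map proj₁ ns → w ≡ x ⊎ st₀ w ≡ free
            ends (_ ∷ ns) (b ∷ bs) (here refl) = branch-end b
            ends (_ ∷ ns) (b ∷ bs) (there w∈) = ends ns bs w∈
          rest = grow-tree ds ds∈ G′ (ℕₚ.+-cancelʳ-≤ (2 * m) _ _ (ℕₚ.≤-trans (ℕₚ.≤-reflexive (trans (ℕₚ.+-assoc (5 * κ) _ (2 * m)) (cong (5 * κ +_) (ℕₚ.+-comm _ (2 * m)))))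
                    (ℕₚ.≤-trans budget (ℕₚ.≤-trans (cost D.step) (ℕₚ.≤-reflexive (cong (#free D.final +_) size≡))))))

      tree-cost-≤ : ∀ {st₀ x} (Ux : U x ≡ true) (x-used : st₀ x ≢ free) h m → tree-cost {st₀} {x} Ux x-used h m ≤ 2 ^ h * (2 * m)
      tree-cost-≤ {st₀} {x} Ux x-used h m = ℕₚ.≤-trans (ℕₚ.m≤m+n _ (2 * m)) (ℕₚ.≤-reflexive (go h m))
        where
        arith : ∀ m t → 2 * m + t + 2 * m ≡ t + 2 * (2 * m)
        arith = solve-∀
        arith′ : ∀ p m → p * (2 * (2 * m)) ≡ 2 * p * (2 * m)
        arith′ = solve-∀
        go : ∀ h m → tree-cost {st₀} {x} Ux x-used h m + 2 * m ≡ 2 ^ h * (2 * m)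
        go zero m = sym (ℕₚ.+-identityʳ _)
        go (suc h) m = trans (arith m (tree-cost {st₀} {x} Ux x-used h (2 * m))) (trans (go h (2 * m)) (arith′ (2 ^ h) m))

      data Walk : List C → V → List V → Set where
        []  : ∀ {x} → Walk [] x []
        _∷_ : ∀ {c cs x z zs} → adj c x z ≡ true → Walk cs z zs → Walk (c ∷ cs) x (z ∷ zs)

      module _ {st₀ st : State} {x : V} (wf : WellFormed st) where

        branch-edge : ∀ {c u v} → st v ≡ child (c , u) → adj c u v ≡ true
        branch-edge ch = proj₂ (wf ch)

        walk-from-root : ∀ {cs u zs ds ws} → Branch st₀ st x cs u zs → Walk ds u ws → Walk (cs ʳ++ ds) x (zs ʳ++ ws)
        walk-from-root root w = w
        walk-from-root (grow b _ _ ch) w = walk-from-root b (branch-edge ch ∷ w)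

        walk-to-root : ∀ {cs u zs c v} → adj c v u ≡ true → Branch st₀ st x cs u zs → Walk (c ∷ cs) v (zs ++ [ x ])
        walk-to-root e root = e ∷ []
        walk-to-root e (grow {c} {u = u} {v} b _ _ ch) = e ∷ walk-to-root (adj-sym c u v (branch-edge ch)) b

      record Connected (st : State) (x y : V) (ds : List C) : Set where
        field
          inner : List V
          walk  : Walk ds x (inner ++ [ y ])
          final : State
          inv   : Inv final
          keep  : ∀ z → st z ≢ free → final z ≡ st z
          inner-free : ∀ {z} → z ∈ inner → st z ≡ free
          inner-used : ∀ {z} → z ∈ inner → final z ≢ free
          inner!     : Unique inner
          cost  : #free st ≤ #free final + length inner
          quiet : ∀ w → st w ≢ free → w ≢ x → w ≢ y → Childless st w → Childless final w

      join : ∀ {st₀ st₁ st₂ x y n m cx cy c u v zx zy} → Inv st₀ → Inv st₁ → Inv st₂ → st₀ x ≢ free → st₀ y ≢ free →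
             Step (_≡ x) st₀ st₁ n → Step (_≡ y) st₁ st₂ m → Branch st₀ st₁ x cx u zx → Branch st₁ st₂ y cy v zy → adj c u v ≡ true →
             Connected st₀ x y (cx ʳ++ (c ∷ cy))
      join {st₀} {st₁} {st₂} {x} {y} {cx = cx} {cy} {c} {zx = zx} {zy} I I₁ I₂ x-used y-used S₁ S₂ bx by ad = record
        { inner = inner ; walk = walk ; final = st₃ ; inv = inv₃ ; keep = keep₃
        ; inner-free = inner-free ; inner-used = inner-used ; inner! = inner! ; cost = cost₃ ; quiet = quiet₃ }
        where
        keep₂ : ∀ z → st₀ z ≢ free → st₂ z ≡ st₀ z
        keep₂ z ne = trans (keep S₂ z (nonfree S₁ ne)) (keep S₁ z ne)
        free₀ : ∀ {z} → st₁ z ≡ free → st₀ z ≡ free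
        free₀ {z} e = Sum.[ (λ e′ → e′) , (λ ne → contradiction e (nonfree S₁ ne)) ]′ (free? st₀ z)
        inner = zx ʳ++ zy
        ∈-inner : ∀ {z} → z ∈ inner → z ∈ zx ⊎ z ∈ zy
        ∈-inner z∈ = ∈-++⁻ zx (∈-resp-↭ (↭-sym (++↭ʳ++ zx zy)) z∈)
        ∈-innerˡ : ∀ {z} → z ∈ zx → z ∈ inner
        ∈-innerˡ z∈ = ∈-resp-↭ (++↭ʳ++ zx zy) (∈-++⁺ˡ z∈)
        ∈-innerʳ : ∀ {z} → z ∈ zy → z ∈ inner
        ∈-innerʳ z∈ = ∈-resp-↭ (++↭ʳ++ zx zy) (∈-++⁺ʳ zx z∈)
        walk : Walk (cx ʳ++ (c ∷ cy)) x (inner ++ [ y ])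
        walk = subst (Walk (cx ʳ++ (c ∷ cy)) x) (ʳ++-assoc zx) (walk-from-root (Inv.wf I₁) bx (walk-to-root (Inv.wf I₂) ad by))
        inner-free : ∀ {z} → z ∈ inner → st₀ z ≡ free
        inner-free z∈ = Sum.[ branch-free bx , (λ z∈y → free₀ (branch-free by z∈y)) ]′ (∈-inner z∈)
        x-branch-used : ∀ {z} → z ∈ zx → st₁ z ≢ free
        x-branch-used z∈ e = contradiction (trans (sym (proj₁ (proj₂ (branch-used bx z∈)))) e) (λ ())
        child₂ : ∀ {z} → z ∈ inner → ∃ λ p → st₂ z ≡ child p × (st₀ (proj₂ p) ≢ free ⊎ proj₂ p ∈ inner)
        child₂ {z} z∈ = Sum.[ (λ z∈x → let (p , ch , w) = branch-used bx z∈x in p , trans (keep S₂ z (x-branch-used z∈x)) ch , Sum.map (λ e f → x-used (trans (cong st₀ (sym e)) f)) ∈-innerˡ w)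
                            , (λ z∈y → let (p , ch , w) = branch-used by z∈y in p , ch , Sum.map (λ e f → y-used (trans (cong st₀ (sym e)) f)) ∈-innerʳ w) ]′ (∈-inner z∈)
        st₃ : State
        st₃ z = if isFree st₀ z ∧ not ⌊ DecM._∈?_ _≟_ z inner ⌋ then free else st₂ z
        data Case (z : V) : Set where
          kept    : st₃ z ≡ st₂ z → st₀ z ≢ free ⊎ z ∈ inner → Case z
          dropped : st₃ z ≡ free → st₀ z ≡ free → ¬ (z ∈ inner) → Case z
        case : ∀ z → Case z
        case z with free? st₀ z | DecM._∈?_ _≟_ z inner in eq
        ... | inj₂ ne | _ = kept (cong (λ b → if b ∧ not ⌊ DecM._∈?_ _≟_ z inner ⌋ then free else st₂ z) (Sum.[ (λ t → contradiction (isFree-true {st₀} t) ne) , (λ f → f) ]′ (bool-cases (isFree st₀ z)))) (inj₁ ne)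
        ... | inj₁ e | yes z∈ = kept (trans (cong₂ (λ b d → if b ∧ not ⌊ d ⌋ then free else st₂ z) (isFree-intro {st₀} e) eq) refl) (inj₂ z∈)
        ... | inj₁ e | no z∉ = dropped (trans (cong₂ (λ b d → if b ∧ not ⌊ d ⌋ then free else st₂ z) (isFree-intro {st₀} e) eq) refl) e z∉
        keep₃ : ∀ z → st₀ z ≢ free → st₃ z ≡ st₀ z
        keep₃ z ne with case z
        ... | kept e _ = trans e (keep₂ z ne)
        ... | dropped _ e _ = contradiction e ne
        inner-used : ∀ {z} → z ∈ inner → st₃ z ≢ free
        inner-used {z} z∈ e with case z
        ... | kept e′ _ = contradiction (trans (sym (proj₁ (proj₂ (child₂ z∈)))) (trans (sym e′) e)) (λ ())
        ... | dropped _ _ z∉ = z∉ z∈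
        child₃ : ∀ {z p} → st₃ z ≡ child p → st₂ z ≡ child p × (st₀ z ≢ free ⊎ z ∈ inner)
        child₃ {z} e with case z
        ... | kept e′ w = trans (sym e′) e , w
        ... | dropped e′ _ _ = contradiction (trans (sym e′) e) (λ ())
        childless₃ : ∀ {w} → Childless st₂ w → Childless st₃ w
        childless₃ h z d e = h z d (proj₁ (child₃ e))
        inv₃ : Inv st₃
        inv₃ = record { wf = λ e → Inv.wf I₂ (proj₁ (child₃ e)) ; ext = rollback (Inv.wf I₂) related (Inv.ext I₂) ; inU = inU₃ ; fresh = fresh₃ }
          where
          related : ∀ z → st₃ z ≡ st₂ z ⊎ (st₃ z ≡ free × ∃ λ p → st₂ z ≡ child p)
          related z with case z
          ... | kept e _ = inj₁ e
          ... | dropped e e₀ _ = status (st₂ z) refl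
            where
            status : ∀ s → st₂ z ≡ s → st₃ z ≡ st₂ z ⊎ (st₃ z ≡ free × ∃ λ p → st₂ z ≡ child p)
            status free      e₂ = inj₁ (trans e (sym e₂))
            status (child p) e₂ = inj₂ (e , p , e₂)
            status outside   e₂ = contradiction e₂ (Sum.[ (λ e₁ → alive S₂ z e₁) , (λ ne e′ → alive S₁ z e₀ (trans (sym (keep S₂ z ne)) e′)) ]′ (free? st₁ z))
          inU₃ : ∀ z → st₃ z ≢ outside → U z ≡ true
          inU₃ z ne with case z
          ... | kept e _ = Inv.inU I₂ z (λ e′ → ne (trans e e′))
          ... | dropped _ e₀ _ = Inv.inU I z (λ e′ → contradiction (trans (sym e₀) e′) (λ ()))
          fresh₃ : ∀ z → st₃ z ≡ free → Childless st₃ z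
          fresh₃ z e with case z
          ... | kept e′ _ = childless₃ (Inv.fresh I₂ z (trans (sym e′) e))
          ... | dropped _ e₀ z∉ = λ w d e₃ → lemma w d (child₃ e₃)
            where
            lemma : ∀ w d → st₂ w ≡ child (d , z) × (st₀ w ≢ free ⊎ w ∈ inner) → ⊥
            lemma w d (e₂ , inj₁ ne) = Inv.fresh I z e₀ w d (trans (sym (keep₂ w ne)) e₂)
            lemma w d (e₂ , inj₂ w∈) with child₂ w∈
            ... | p , ch , parent with trans (sym ch) e₂
            lemma w d (e₂ , inj₂ w∈) | p , ch , inj₁ ne | refl = ne e₀
            lemma w d (e₂ , inj₂ w∈) | p , ch , inj₂ z∈ | refl = z∉ z∈
        quiet₃ : ∀ w → st₀ w ≢ free → w ≢ x → w ≢ y → Childless st₀ w → Childless st₃ w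
        quiet₃ w ne w≢x w≢y h = childless₃ (quiet S₂ w (nonfree S₁ ne) w≢y (quiet S₁ w ne w≢x h))
        unique-ʳ++ : ∀ xs {ys} → Unique xs → Unique ys → (∀ {z} → z ∈ xs → ¬ (z ∈ ys)) → Unique (xs ʳ++ ys)
        unique-ʳ++ [] _ u _ = u
        unique-ʳ++ (z ∷ xs) {ys} (z∉ ∷ u) u′ disjoint = unique-ʳ++ xs u (All.tabulate (λ w∈ e → disjoint (here refl) (subst (_∈ ys) (sym e) w∈)) ∷ u′)
          (λ { w∈ (here refl) → All.lookup z∉ w∈ refl ; w∈ (there w∈′) → disjoint (there w∈) w∈′ })
        inner! : Unique inner
        inner! = unique-ʳ++ zx (branch-unique bx) (branch-unique by) (λ z∈x z∈y → x-branch-used z∈x (branch-free by z∈y))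
        cost₃ : #free st₀ ≤ #free st₃ + length inner
        cost₃ = ℕₚ.≤-trans (∑-mono Vs split) (ℕₚ.≤-trans (ℕₚ.≤-reflexive (∑-∙ Vs _ _)) (ℕₚ.+-monoʳ-≤ (#free st₃) (count-member FV inner)))
          where
          split : ∀ z → [ isFree st₀ z ]ᵇ ≤ [ isFree st₃ z ]ᵇ + [ ⌊ DecM._∈?_ _≟_ z inner ⌋ ]ᵇ
          split z with isFree st₀ z | DecM._∈?_ _≟_ z inner
          ... | false | _ = z≤n
          ... | true | no _ = s≤s z≤n
          ... | true | yes _ = ℕₚ.m≤n+m 1 _

      module _ (M : ℕ) (dense : ∀ {c} → c ∈ R → ∀ Xs Ys → Unique Xs → Unique Ys → M < length Xs * length Ys → ∃₂ λ u v → u ∈ Xs × v ∈ Ys × adj c u v ≡ true) where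

        node-of : ∀ {ns : List Node} {u} → u ∈ map proj₁ ns → ∃ λ zs → (u , zs) ∈ ns
        node-of {_ ∷ ns} (here refl) = _ , here refl
        node-of {_ ∷ ns} (there u∈) with node-of u∈
        ... | zs , n∈ = zs , there n∈

        connect : ∀ {st x y} → Inv st → U x ≡ true → U y ≡ true → st x ≢ free → st y ≢ free → x ≢ y → Childless st x → Childless st y →
                  ∀ as bs c es → All (_∈ R) as → All (_∈ R) bs → c ∈ R → All (_∈ R) es → length bs ≡ length es → M < 2 ^ length es * 2 ^ length es →
                  5 * κ + (length as + 4 * 2 ^ length es) ≤ #free st → Connected st x y (as ++ bs ++ c ∷ es)
        connect {st₀} {x} {y} I Ux Uy x-used y-used x≢y hx hy as bs c es as∈ bs∈ c∈ es∈ ∣bs∣ M< budget =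
          assemble (dense c∈ (map proj₁ X.nodes) (map proj₁ Y.nodes) (Frontier.distinct X.frontier) (Frontier.distinct Y.frontier) (subst₂ (λ a b → M < a * b) (sym ∣X∣) (sym ∣Y∣) M<))
          where
          H = 2 ^ length es
          se = reverse es
          se∈ : All (_∈ R) se
          se∈ = All.tabulate (λ e∈ → All.lookup es∈ (Anyₚ.reverse⁻ e∈))
          ∣se∣ : length se ≡ length es
          ∣se∣ = length-reverse es
          tx≤ : tree-cost {st₀} {x} Ux x-used (length bs) 1 ≤ 2 * H
          tx≤ = ℕₚ.≤-trans (tree-cost-≤ {st₀} {x} Ux x-used (length bs) 1) (ℕₚ.≤-reflexive (trans (cong (λ n → 2 ^ n * 2) ∣bs∣) (ℕₚ.*-comm H 2)))
          module P = Grown (grow-path Ux x-used as as∈ I step-refl root hx (ℕₚ.≤-trans (ℕₚ.+-monoʳ-≤ (5 * κ) (ℕₚ.m≤m+n _ _)) budget))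
          arith : ∀ k a h → k + 4 * h + a ≡ k + (a + 4 * h)
          arith = solve-∀
          arith′ : ∀ k a h → k + 2 * h + (a + 2 * h) ≡ k + (a + 4 * h)
          arith′ = solve-∀
          budget-x : 5 * κ + tree-cost {st₀} {x} Ux x-used (length bs) 1 ≤ #free P.final
          budget-x = ℕₚ.+-cancelʳ-≤ (length as) _ _ (ℕₚ.≤-trans (ℕₚ.+-monoˡ-≤ (length as) (ℕₚ.+-monoʳ-≤ (5 * κ) (ℕₚ.≤-trans tx≤ (ℕₚ.*-monoˡ-≤ H {2} {4} (s≤s (s≤s z≤n))))))
            (ℕₚ.≤-trans (ℕₚ.≤-reflexive (arith (5 * κ) (length as) H)) (ℕₚ.≤-trans budget (cost P.step))))
          GX : Grown st₀ st₀ x (bs ʳ++ (as ʳ++ [])) (2 ^ length bs * 1) (length as + tree-cost {st₀} {x} Ux x-used (length bs) 1)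
          GX = grow-tree {st₀} {x} Ux x-used bs bs∈ (record { P }) budget-x
          module X = Grown GX
          st₁ = X.final
          y-used₁ : st₁ y ≢ free
          y-used₁ = nonfree X.step y-used
          budget-y : 5 * κ + 2 * H ≤ #free st₁
          budget-y = ℕₚ.+-cancelʳ-≤ (length as + 2 * H) _ _ (ℕₚ.≤-trans (ℕₚ.≤-reflexive (arith′ (5 * κ) (length as) H))
            (ℕₚ.≤-trans budget (ℕₚ.≤-trans (cost X.step) (ℕₚ.+-monoʳ-≤ (#free st₁) (ℕₚ.+-monoʳ-≤ (length as) tx≤)))))
          ty≤ : tree-cost {st₁} {y} Uy y-used₁ (length se) 1 ≤ 2 * H
          ty≤ = ℕₚ.≤-trans (tree-cost-≤ {st₁} {y} Uy y-used₁ (length se) 1) (ℕₚ.≤-reflexive (trans (cong (λ n → 2 ^ n * 2) ∣se∣) (ℕₚ.*-comm H 2)))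
          Q : Grown st₁ st₁ y [] 1 0
          Q = grow-path Uy y-used₁ [] [] X.inv step-refl root (quiet X.step y y-used (λ e → x≢y (sym e)) hy) (ℕₚ.≤-trans (ℕₚ.+-monoʳ-≤ (5 * κ) z≤n) budget-y)
          GY : Grown st₁ st₁ y (se ʳ++ []) (2 ^ length se * 1) (tree-cost {st₁} {y} Uy y-used₁ (length se) 1)
          GY = grow-tree {st₁} {y} Uy y-used₁ se se∈ Q (ℕₚ.≤-trans (ℕₚ.+-monoʳ-≤ (5 * κ) ty≤) budget-y)
          module Y = Grown GY
          st₂ = Y.final
          ∣X∣ : length (map proj₁ X.nodes) ≡ H
          ∣X∣ = trans (length-map proj₁ X.nodes) (trans X.size (trans (ℕₚ.*-identityʳ _) (cong (2 ^_) ∣bs∣)))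
          ∣Y∣ : length (map proj₁ Y.nodes) ≡ H
          ∣Y∣ = trans (length-map proj₁ Y.nodes) (trans Y.size (trans (ℕₚ.*-identityʳ _) (cong (2 ^_) ∣se∣)))

          assemble : (∃₂ λ u v → u ∈ map proj₁ X.nodes × v ∈ map proj₁ Y.nodes × adj c u v ≡ true) → Connected st₀ x y (as ++ bs ++ c ∷ es)
          assemble (u , v , u∈ , v∈ , ad) = subst (Connected st₀ x y)
            (trans (ʳ++-ʳ++ bs) (trans (ʳ++-ʳ++ as) (cong (λ e → as ++ bs ++ c ∷ e) (reverse-involutive es))))
            (join I X.inv Y.inv x-used y-used X.step Y.step
              (All.lookup (Frontier.branches X.frontier) (proj₂ (node-of u∈))) (All.lookup (Frontier.branches Y.frontier) (proj₂ (node-of v∈))) ad)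

module Host where

  open SumLib
  open NatSum
  open Extension
  open import Data.Bool using (not)
  import Data.Bool.Properties as Boolₚ
  import Data.List.Membership.Propositional as M
  open import Data.List.Membership.Propositional.Properties using (∈-cartesianProduct⁻)
  import Data.List.Membership.DecPropositional as DecM
  open import Data.List.Relation.Unary.All as All using ([]; _∷_)
  import Data.List.Relation.Unary.All.Properties as Allₚ
  open import Data.List.Relation.Unary.AllPairs using ([]; _∷_)
  import Data.List.Relation.Unary.Any as Any
  import Data.List.Relation.Unary.Unique.Propositional.Properties as Uniq
  open import Data.Nat using (ℕ; zero; suc; _+_; _*_; _∸_; _≤_; _<_; z≤n; s≤s; NonZero)
  import Data.Nat as ℕ
  import Data.Nat.Properties as ℕₚ
  open import Data.Nat.Tactic.RingSolver using (solve-∀)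
  import Data.Sum as Sum

  -- adj c is pseudorandom of density 1/q for every colour c : discrepancy is a Chebyshev bound on its degrees.
  module PseudorandomHost {V C : Set} (FV : Finite V) (_≟C_ : DecidableEquality C) (R : List C) (R! : Unique R)
                          (adj : C → V → V → Bool) (adj-sym : ∀ c x y → adj c x y ≡ true → adj c y x ≡ true)
                          (q M : ℕ) where

    open Finite FV using (_≟_; complete)
    private Vs = elems FV

    VSet : Set
    VSet = V → Bool

    deg : C → V → VSet → ℕ
    deg c x Y = count Vs (λ y → adj c x y ∧ Y y)

    Discrepant : C → V → VSet → ℕ → Set
    Discrepant c x Y g = q * deg c x Y + g ≤ count Vs Y ⊎ count Vs Y + g ≤ q * deg c x Y

    module _ (discrepancy : ∀ {c} → c ∈ R → ∀ (X Y : VSet) g → (∀ x → X x ≡ true → Discrepant c x Y g) → count Vs X * (g * g) ≤ M * count Vs Y)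
             (κ : ℕ) .{{_ : NonZero κ}} (ρM≤κ² : length R * M ≤ κ * κ) where

      RV : List (C × V)
      RV = cartesianProduct R Vs

      discrepancy-pairs : ∀ (S : C × V → Bool) Y g → (∀ c x → c ∈ R → S (c , x) ≡ true → Discrepant c x Y g) → count RV S * (g * g) ≤ κ * κ * count Vs Y
      discrepancy-pairs S Y g h = begin
        count RV S * (g * g) ≡⟨ cong (_* (g * g)) (∑-× R Vs _) ⟩
        ∑ R (λ c → count Vs (λ x → S (c , x))) * (g * g) ≡⟨ sym (∑-*ʳ R (g * g) _) ⟩
        ∑ R (λ c → count Vs (λ x → S (c , x)) * (g * g)) ≤⟨ ∑-mono∈ R (λ c c∈ → discrepancy c∈ (λ x → S (c , x)) Y g (λ x → h c x c∈)) ⟩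
        ∑ R (λ _ → M * count Vs Y) ≡⟨ ∑-const R _ ⟩
        length R * (M * count Vs Y) ≡⟨ sym (ℕₚ.*-assoc (length R) M _) ⟩
        length R * M * count Vs Y ≤⟨ ℕₚ.*-monoˡ-≤ (count Vs Y) ρM≤κ² ⟩
        κ * κ * count Vs Y ∎
        where open ℕₚ.≤-Reasoning

      deg-none : ∀ {c x Y} → (∀ y → Y y ≡ true → adj c x y ≡ false) → deg c x Y ≡ 0
      deg-none {c} {x} {Y} h = ∑-zero∈ Vs (λ y _ → none y)
        where
        none : ∀ y → [ adj c x y ∧ Y y ]ᵇ ≡ 0
        none y with Y y in eq
        ... | true  = cong (λ b → [ b ∧ true ]ᵇ) (h y eq)
        ... | false = cong [_]ᵇ (Boolₚ.∧-zeroʳ (adj c x y))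

      cancel-square : ∀ a b m → a * (b * b) ≤ m * b → a * b ≤ m
      cancel-square a zero m _ = ℕₚ.≤-trans (ℕₚ.≤-reflexive (ℕₚ.*-zeroʳ a)) z≤n
      cancel-square a b@(suc _) m le = ℕₚ.*-cancelʳ-≤ (a * b) m b (ℕₚ.≤-trans (ℕₚ.≤-reflexive (ℕₚ.*-assoc a b b)) le)

      no-edge : ∀ {c x Y} → (∀ y → Y y ≡ true → adj c x y ≡ false) → Discrepant c x Y (count Vs Y)
      no-edge {c} {x} {Y} h = inj₁ (ℕₚ.≤-reflexive (cong (_+ count Vs Y) (trans (cong (q *_) (deg-none {c} {x} {Y} h)) (ℕₚ.*-zeroʳ q))))

      dense : ∀ {c} → c ∈ R → ∀ Xs Ys → Unique Xs → Unique Ys → M < length Xs * length Ys → ∃₂ λ u v → u ∈ Xs × v ∈ Ys × adj c u v ≡ true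
      dense {c} c∈ Xs Ys X! Y! lt with Any.any? (λ u → Any.any? (λ v → adj c u v Boolₚ.≟ true) Ys) Xs
      ... | yes ∃uv with M.find ∃uv
      ... | u , u∈ , ∃v with M.find ∃v
      ... | v , v∈ , ad = u , v , u∈ , v∈ , ad
      dense {c} c∈ Xs Ys X! Y! lt | no ¬∃ = contradiction (begin
        length Xs * length Ys ≤⟨ ℕₚ.*-mono-≤ (count-unique FV X!) (count-unique FV Y!) ⟩
        count Vs X * count Vs Y ≤⟨ cancel-square (count Vs X) (count Vs Y) M (discrepancy c∈ X Y (count Vs Y) (λ x Xx → no-edge {c} {x} {Y} (λ y Yy → none x y Xx Yy))) ⟩
        M ∎) (ℕₚ.<⇒≱ lt)
        where
        open ℕₚ.≤-Reasoning
        X Y : VSet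
        X x = ⌊ DecM._∈?_ _≟_ x Xs ⌋
        Y y = ⌊ DecM._∈?_ _≟_ y Ys ⌋
        mem : ∀ {x xs} → ⌊ DecM._∈?_ _≟_ x xs ⌋ ≡ true → x ∈ xs
        mem {x} {xs} e with DecM._∈?_ _≟_ x xs
        ... | yes x∈ = x∈
        none : ∀ x y → X x ≡ true → Y y ≡ true → adj c x y ≡ false
        none x y Xx Yy = Sum.[ (λ e → contradiction (M.lose (mem Xx) (M.lose (mem Yy) e)) ¬∃) , (λ e → e) ]′ (bool-cases (adj c x y))

      -- W is cleaned by deleting, one at a time, vertices of small degree into what is left of it.
      record Cleaned (W₀ : VSet) : Set where
        field
          W      : VSet
          W⊆W₀   : ∀ x → W x ≡ true → W₀ x ≡ true
          large  : 10 * κ ≤ count Vs W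
          small  : count Vs W ≤ 11 * κ
          degree : ∀ x → W x ≡ true → ∀ {c} → c ∈ R → 6 * κ ≤ q * deg c x W

      low-degree-pairs : ∀ S W → (∀ c x → c ∈ R → S (c , x) ≡ true → q * deg c x W < 6 * κ) → 10 * κ ≤ count Vs W → count Vs W ≤ 11 * κ → count RV S < κ
      low-degree-pairs S W low large small = ℕₚ.≰⇒> λ κ≤b → ℕₚ.<⇒≱ (ℕₚ.*-monoˡ-< κ {11} {16} (ℕₚ.≤ᵇ⇒≤ 12 16 _)) (ℕₚ.≤-trans (ℕₚ.*-monoʳ-≤ 16 κ≤b) 16b≤11κ)
        where
        open ℕₚ.≤-Reasoning
        w = count Vs W
        b = count RV S
        g = w ∸ 6 * κ
        6κ≤w : 6 * κ ≤ w
        6κ≤w = ℕₚ.≤-trans (ℕₚ.*-monoˡ-≤ κ {6} {10} (ℕₚ.≤ᵇ⇒≤ 6 10 _)) large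
        split : 6 * κ + g ≡ w
        split = ℕₚ.m+[n∸m]≡n 6κ≤w
        4κ≤g : 4 * κ ≤ g
        4κ≤g = ℕₚ.+-cancelˡ-≤ (6 * κ) _ _ (ℕₚ.≤-trans (ℕₚ.≤-reflexive (sym (ℕₚ.*-distribʳ-+ κ 6 4))) (ℕₚ.≤-trans large (ℕₚ.≤-reflexive (sym split))))
        arith₁ : ∀ b κ → κ * κ * (16 * b) ≡ b * (4 * κ * (4 * κ))
        arith₁ = solve-∀
        instance
          κ²≢0 : NonZero (κ * κ)
          κ²≢0 = ℕₚ.m*n≢0 κ κ
        16b≤11κ : 16 * b ≤ 11 * κ
        16b≤11κ = ℕₚ.*-cancelˡ-≤ (κ * κ) (begin
          κ * κ * (16 * b) ≡⟨ arith₁ b κ ⟩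
          b * (4 * κ * (4 * κ)) ≤⟨ ℕₚ.*-monoʳ-≤ b (ℕₚ.*-mono-≤ 4κ≤g 4κ≤g) ⟩
          b * (g * g) ≤⟨ discrepancy-pairs S W g (λ c x c∈ Sp → inj₁ (ℕₚ.≤-trans (ℕₚ.+-monoˡ-≤ g (ℕₚ.<⇒≤ (low c x c∈ Sp))) (ℕₚ.≤-reflexive split))) ⟩
          κ * κ * w ≤⟨ ℕₚ.*-monoʳ-≤ (κ * κ) small ⟩
          κ * κ * (11 * κ) ∎)

      deg-mono : ∀ {c x Y Y′} → (∀ y → Y y ≡ true → Y′ y ≡ true) → deg c x Y ≤ deg c x Y′
      deg-mono {c} {x} h = count-mono Vs (λ y e → cong₂ _∧_ (proj₁ (∧-true e)) (h y (proj₂ (∧-true {adj c x y} e))))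

      private
        _≟P_ = ≡-dec _≟C_ _≟_

      RV! : Unique RV
      RV! = Uniq.cartesianProduct⁺ R! (Finite.distinct FV)

      clean : ∀ W₀ → count Vs W₀ ≡ 11 * κ → Cleaned W₀
      clean W₀ ∣W₀∣ = go κ 0 (λ _ → false) W₀ (λ _ e → e) (ℕₚ.≤-reflexive (trans (sym ∣W₀∣) (sym (ℕₚ.+-identityʳ _)))) z≤n (λ _ _ _ ()) (λ _ _ ()) refl
        where
        go : ∀ fuel b S W → (∀ x → W x ≡ true → W₀ x ≡ true) → 11 * κ ≤ count Vs W + b → b ≤ count RV S →
             (∀ c x → c ∈ R → S (c , x) ≡ true → q * deg c x W < 6 * κ) → (∀ c x → S (c , x) ≡ true → W x ≡ false) → b + fuel ≡ κ → Cleaned W₀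
        go fuel b S W W⊆ size b≤ low away eq = step fuel eq
          where
          large : 10 * κ ≤ count Vs W
          large = ℕₚ.+-cancelʳ-≤ κ _ _ (ℕₚ.≤-trans (ℕₚ.≤-reflexive (ℕₚ.+-comm (10 * κ) κ)) (ℕₚ.≤-trans size (ℕₚ.+-monoʳ-≤ (count Vs W) (ℕₚ.≤-trans (ℕₚ.m≤m+n b fuel) (ℕₚ.≤-reflexive eq)))))
          small : count Vs W ≤ 11 * κ
          small = ℕₚ.≤-trans (count-mono Vs W⊆) (ℕₚ.≤-reflexive ∣W₀∣)
          b<κ : b < κ
          b<κ = ℕₚ.≤-<-trans b≤ (low-degree-pairs S W low large small)
          step : ∀ fuel → b + fuel ≡ κ → Cleaned W₀
          step zero eq = contradiction b<κ (ℕₚ.≤⇒≯ (ℕₚ.≤-reflexive (trans (sym eq) (ℕₚ.+-identityʳ b))))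
          step (suc fuel) eq with Any.any? (λ c → Any.any? (λ x → (W x Boolₚ.≟ true) ×-dec (q * deg c x W ℕ.<? 6 * κ)) Vs) R
          ... | no ¬bad = record { W = W ; W⊆W₀ = W⊆ ; large = large ; small = small
                  ; degree = λ x Wx c∈ → ℕₚ.≮⇒≥ (λ lt → ¬bad (M.lose c∈ (M.lose (complete x) (Wx , lt)))) }
          ... | yes ∃bad with M.find ∃bad
          ... | c , c∈ , ∃x with M.find ∃x
          ... | x , _ , Wx , lt = go fuel (suc b) S′ W′ (λ y e → W⊆ y (W′⊆ y e)) size′ b≤′ low′ away′ (trans (sym (ℕₚ.+-suc b fuel)) eq)
            where
            S′ : C × V → Bool
            S′ p = S p ∨ ⌊ p ≟P (c , x) ⌋
            W′ : VSet
            W′ y = W y ∧ not ⌊ y ≟ x ⌋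
            W′⊆ : ∀ y → W′ y ≡ true → W y ≡ true
            W′⊆ y e = proj₁ (∧-true e)
            size′ : 11 * κ ≤ count Vs W′ + suc b
            size′ = ℕₚ.≤-trans size (ℕₚ.≤-trans (ℕₚ.+-monoˡ-≤ b (ℕₚ.≤-trans (∑-mono Vs split) (ℕₚ.≤-reflexive (trans (∑-∙ Vs _ _) (cong (count Vs W′ +_) (count-≟ FV x)))))) (ℕₚ.≤-reflexive (ℕₚ.+-assoc (count Vs W′) 1 b)))
              where
              split : ∀ y → [ W y ]ᵇ ≤ [ W′ y ]ᵇ + [ ⌊ y ≟ x ⌋ ]ᵇ
              split y with W y | y ≟ x
              ... | false | _     = z≤n
              ... | true  | yes _ = s≤s z≤n
              ... | true  | no _  = s≤s z≤n
            S-c-x : S (c , x) ≡ false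
            S-c-x = Sum.[ (λ e → true≢false Wx (away c x e)) , (λ e → e) ]′ (bool-cases (S (c , x)))
            b≤′ : suc b ≤ count RV S′
            b≤′ = ℕₚ.≤-trans (s≤s b≤) (ℕₚ.≤-trans (ℕₚ.≤-reflexive (trans (ℕₚ.+-comm 1 _) (trans (cong (count RV S +_) (sym one)) (sym (∑-∙ RV _ _))))) (∑-mono RV split))
              where
              one : ∑ RV (λ p → [ ⌊ p ≟P (c , x) ⌋ ]ᵇ) ≡ 1
              one = trans (∑-δ∈ RV RV! (c , x) (∈-cartesianProduct⁺ c∈ (complete x)) _ (λ p _ ne → off p ne)) on
                where
                off : ∀ p → p ≢ (c , x) → [ ⌊ p ≟P (c , x) ⌋ ]ᵇ ≡ 0
                off p ne with p ≟P (c , x)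
                ... | yes e = contradiction e ne
                ... | no _  = refl
                on : [ ⌊ (c , x) ≟P (c , x) ⌋ ]ᵇ ≡ 1
                on with (c , x) ≟P (c , x)
                ... | yes _ = refl
                ... | no ne = contradiction refl ne
              split : ∀ p → [ S p ]ᵇ + [ ⌊ p ≟P (c , x) ⌋ ]ᵇ ≤ [ S′ p ]ᵇ
              split p with p ≟P (c , x)
              ... | yes refl rewrite S-c-x = s≤s z≤n
              ... | no _ with S p
              ... | true  = s≤s z≤n
              ... | false = z≤n
            low′ : ∀ d y → d ∈ R → S′ (d , y) ≡ true → q * deg d y W′ < 6 * κ
            low′ d y d∈ e with ∨-true {S (d , y)} e
            ... | inj₁ s = ℕₚ.≤-<-trans (ℕₚ.*-monoʳ-≤ q (deg-mono {d} {y} W′⊆)) (low d y d∈ s)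
            ... | inj₂ t with (d , y) ≟P (c , x)
            ... | yes refl = ℕₚ.≤-<-trans (ℕₚ.*-monoʳ-≤ q (deg-mono {c} {x} W′⊆)) lt
            away′ : ∀ d y → S′ (d , y) ≡ true → W′ y ≡ false
            away′ d y e with ∨-true {S (d , y)} e
            ... | inj₁ s = cong (_∧ not ⌊ y ≟ x ⌋) (away d y s)
            ... | inj₂ t with (d , y) ≟P (c , x)
            ... | yes refl with x ≟ x
            ... | yes _ = Boolₚ.∧-zeroʳ (W x)
            ... | no ne = contradiction refl ne

      -- E is split into a clean part W and the part A of the vertices with many neighbours in W.
      module Split (E : VSet) (W₀ : VSet) (W₀⊆E : ∀ x → W₀ x ≡ true → E x ≡ true) (∣W₀∣ : count Vs W₀ ≡ 11 * κ) where
        open Cleaned (clean W₀ ∣W₀∣) public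

        rich : C → V → Bool
        rich c x = ⌊ 6 * κ ℕ.≤? q * deg c x W ⌋

        rich-true : ∀ {c x} → rich c x ≡ true → 6 * κ ≤ q * deg c x W
        rich-true {c} {x} e with 6 * κ ℕ.≤? q * deg c x W
        ... | yes le = le

        poor : ∀ {c x} → rich c x ≡ false → q * deg c x W < 6 * κ
        poor {c} {x} e with 6 * κ ℕ.≤? q * deg c x W
        ... | no ¬le = ℕₚ.≰⇒> ¬le

        A-candidate A U : VSet
        A-candidate x = E x ∧ not (W₀ x)
        A x = A-candidate x ∧ not (any (λ c → not (rich c x)) R)
        U x = A x ∨ W x

        A-rich : ∀ {x} → A x ≡ true → ∀ {c} → c ∈ R → rich c x ≡ true
        A-rich {x} Ax {c} c∈ = Sum.[ (λ e → e) , (λ e → true≢false (proj₂ (∧-true {A-candidate x} Ax)) (cong not (any-intro _ c∈ (cong not e)))) ]′ (bool-cases (rich c x))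

        A⊆E : ∀ x → A x ≡ true → E x ≡ true
        A⊆E x e = proj₁ (∧-true (proj₁ (∧-true {A-candidate x} e)))

        A∩W : ∀ x → A x ≡ true → W x ≡ false
        A∩W x e = Sum.[ (λ w → true≢false (W⊆W₀ x w) (notW₀ (proj₂ (∧-true {E x} (proj₁ (∧-true {A-candidate x} e)))))) , (λ e′ → e′) ]′ (bool-cases (W x))
          where
          notW₀ : not (W₀ x) ≡ true → W₀ x ≡ false
          notW₀ h with W₀ x
          ... | false = refl

        U⊆E : ∀ x → U x ≡ true → E x ≡ true
        U⊆E x e with ∨-true {A x} e
        ... | inj₁ a = A⊆E x a
        ... | inj₂ w = W₀⊆E x (W⊆W₀ x w)

        U-degree : ∀ {x} → U x ≡ true → ∀ {c} → c ∈ R → 6 * κ ≤ q * deg c x W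
        U-degree {x} e {c} c∈ with ∨-true {A x} e
        ... | inj₁ a = rich-true {c} {x} (A-rich {x} a c∈)
        ... | inj₂ w = degree x w c∈

        ∣A∣ : count Vs E ≤ count Vs A + 12 * κ
        ∣A∣ = begin
          count Vs E ≤⟨ ∑-mono Vs pointwise ⟩
          ∑ Vs (λ x → [ A x ]ᵇ + ([ W₀ x ]ᵇ + ∑ R (λ c → [ S (c , x) ]ᵇ))) ≡⟨ trans (∑-∙ Vs _ _) (cong (count Vs A +_) (trans (∑-∙ Vs _ _) (cong₂ _+_ ∣W₀∣ (trans (∑-swap Vs R _) (sym (∑-× R Vs _)))))) ⟩
          count Vs A + (11 * κ + count RV S) ≤⟨ ℕₚ.+-monoʳ-≤ (count Vs A) (ℕₚ.+-monoʳ-≤ (11 * κ) (ℕₚ.<⇒≤ (low-degree-pairs S W (λ c x _ e → poor {c} {x} (not-true (proj₂ (∧-true {A-candidate x} e)))) large small))) ⟩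
          count Vs A + (11 * κ + κ) ≡⟨ cong (count Vs A +_) (ℕₚ.+-comm (11 * κ) κ) ⟩
          count Vs A + 12 * κ ∎
          where
          open ℕₚ.≤-Reasoning
          not-true : ∀ {b} → not b ≡ true → b ≡ false
          not-true {false} _ = refl
          S : C × V → Bool
          S (c , x) = A-candidate x ∧ not (rich c x)
          pointwise : ∀ x → [ E x ]ᵇ ≤ [ A x ]ᵇ + ([ W₀ x ]ᵇ + ∑ R (λ c → [ S (c , x) ]ᵇ))
          pointwise x = cases (E x) (W₀ x) (bool-cases (any (λ c → not (rich c x)) R)) refl refl
            where
            cases : ∀ e w → any (λ c → not (rich c x)) R ≡ true ⊎ any (λ c → not (rich c x)) R ≡ false → E x ≡ e → W₀ x ≡ w →
                    [ e ]ᵇ ≤ [ A x ]ᵇ + ([ w ]ᵇ + ∑ R (λ c → [ S (c , x) ]ᵇ))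
            cases false w _ _ _ = z≤n
            cases true true _ _ _ = ℕₚ.≤-trans (s≤s z≤n) (ℕₚ.m≤n+m _ [ A x ]ᵇ)
            cases true false (inj₂ none) Ex Wx = ℕₚ.≤-trans (ℕₚ.≤-reflexive (sym (cong [_]ᵇ (cong₂ _∧_ (cong₂ _∧_ Ex (cong not Wx)) (cong not none))))) (ℕₚ.m≤m+n _ _)
            cases true false (inj₁ some) Ex Wx with any-elim (λ c → not (rich c x)) R some
            ... | c , c∈ , e = ℕₚ.≤-trans (ℕₚ.≤-trans (ℕₚ.≤-reflexive (sym (cong [_]ᵇ (cong₂ _∧_ (cong₂ _∧_ Ex (cong not Wx)) e)))) (∑-term-≤ R (λ c → [ S (c , x) ]ᵇ) c∈)) (ℕₚ.m≤n+m _ [ A x ]ᵇ)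

        ∣U∣ : count Vs E ≤ count Vs U + 2 * κ
        ∣U∣ = ℕₚ.+-cancelʳ-≤ (10 * κ) _ _ (begin
          count Vs E + 10 * κ ≤⟨ ℕₚ.+-mono-≤ ∣A∣ large ⟩
          count Vs A + 12 * κ + count Vs W ≡⟨ arith (count Vs A) (count Vs W) κ ⟩
          count Vs A + count Vs W + 2 * κ + 10 * κ ≤⟨ ℕₚ.+-monoˡ-≤ (10 * κ) (ℕₚ.+-monoˡ-≤ (2 * κ) (subst (_≤ count Vs U) (∑-∙ Vs _ _) (∑-mono Vs pointwise))) ⟩
          count Vs U + 2 * κ + 10 * κ ∎)
          where
          open ℕₚ.≤-Reasoning
          arith : ∀ a w κ → a + 12 * κ + w ≡ a + w + 2 * κ + 10 * κ
          arith = solve-∀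
          pointwise : ∀ x → [ A x ]ᵇ + [ W x ]ᵇ ≤ [ U x ]ᵇ
          pointwise x with A x in a | W x in w
          ... | false | _     = ℕₚ.≤-refl
          ... | true  | false = ℕₚ.≤-refl
          ... | true  | true  = true≢false w (A∩W x a)

        Ps : List (C × V)
        Ps = Data.List.filter (λ (c , x) → U x Boolₚ.≟ true) RV

        ∈Ps : ∀ {c x} → c ∈ R → U x ≡ true → (c , x) ∈ Ps
        ∈Ps c∈ Ux = ∈-filter⁺ (λ (c , x) → U x Boolₚ.≟ true) (∈-cartesianProduct⁺ c∈ (complete _)) Ux

        Ps! : Unique Ps
        Ps! = Uniq.filter⁺ (λ (c , x) → U x Boolₚ.≟ true) RV!

        open Extendable FV (≡-dec _≟C_ _≟_) Ps Ps! (λ (c , x) y → adj c x y) κ hiding (Vs)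

        pairs-count : ∀ S → ∣ S ∣ ≡ count RV (λ p → S p ∧ ⌊ U (proj₂ p) Boolₚ.≟ true ⌋)
        pairs-count S = go RV
          where
          go : ∀ xs → count (Data.List.filter (λ (c , x) → U x Boolₚ.≟ true) xs) S ≡ count xs (λ p → S p ∧ ⌊ U (proj₂ p) Boolₚ.≟ true ⌋)
          go [] = refl
          go ((c , x) ∷ xs) with U x Boolₚ.≟ true
          ... | yes _ = cong₂ _+_ (cong [_]ᵇ (sym (Boolₚ.∧-identityʳ (S (c , x))))) (go xs)
          ... | no _  = trans (go xs) (cong (λ b → [ b ]ᵇ + count xs (λ p → S p ∧ ⌊ U (proj₂ p) Boolₚ.≟ true ⌋)) (sym (Boolₚ.∧-zeroʳ (S (c , x)))))

        in-Ps : ∀ (S : C × V → Bool) {c x} → c ∈ R → S (c , x) ∧ ⌊ U x Boolₚ.≟ true ⌋ ≡ true → S (c , x) ≡ true × U x ≡ true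
        in-Ps S {c} {x} c∈ e with U x Boolₚ.≟ true
        ... | yes Ux = proj₁ (∧-true e) , Ux
        ... | no _   = true≢false e (Boolₚ.∧-zeroʳ (S (c , x)))

        joined : Joined
        joined S X none = cancel-square ∣ S ∣ (count Vs X) (κ * κ) (subst (λ n → n * (count Vs X * count Vs X) ≤ κ * κ * count Vs X) (sym (pairs-count S))
          (discrepancy-pairs (λ p → S p ∧ ⌊ U (proj₂ p) Boolₚ.≟ true ⌋) X (count Vs X) (λ c x c∈ e → let (Sp , Ux) = in-Ps S c∈ e in no-edge {c} {x} {X} (λ y Xy → none (c , x) (∈Ps c∈ Ux) Sp y Xy))))

        initially-extendable : ∀ st → (∀ y → W y ≡ true → st y ≡ free) → Extendable st
        initially-extendable st W-free S S≤2κ = ℕₚ.≤-trans (ℕₚ.≮⇒≥ few) Y≤φ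
          where
          Y : VSet
          Y y = Γ S y ∧ W y
          Y≤φ : count Vs Y ≤ φ st S
          Y≤φ = ∑-mono Vs pointwise
            where
            pointwise : ∀ y → [ Y y ]ᵇ ≤ gain S y (st y)
            pointwise y with W y in w
            ... | false = ℕₚ.≤-trans (ℕₚ.≤-reflexive (cong [_]ᵇ (Boolₚ.∧-zeroʳ (Γ S y)))) z≤n
            ... | true rewrite W-free y w = ℕₚ.≤-reflexive (cong [_]ᵇ (Boolₚ.∧-identityʳ (Γ S y)))
          instance
            κ²≢0 : NonZero (κ * κ)
            κ²≢0 = ℕₚ.m*n≢0 κ κ
          few : ¬ (count Vs Y < 2 * ∣ S ∣)
          few lt = ℕₚ.<⇒≱ lt (ℕₚ.≤-trans (ℕₚ.*-monoˡ-≤ ∣ S ∣ {2} {4} (s≤s (s≤s z≤n))) (ℕₚ.*-cancelˡ-≤ (κ * κ) (begin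
            κ * κ * (4 * ∣ S ∣) ≡⟨ arith κ ∣ S ∣ ⟩
            ∣ S ∣ * (2 * κ * (2 * κ)) ≡⟨ cong (_* (2 * κ * (2 * κ))) (pairs-count S) ⟩
            count RV (λ p → S p ∧ ⌊ U (proj₂ p) Boolₚ.≟ true ⌋) * (2 * κ * (2 * κ)) ≤⟨ discrepancy-pairs _ Y (2 * κ) (λ c x c∈ e → inj₂ (many c x c∈ (in-Ps S c∈ e))) ⟩
            κ * κ * count Vs Y ∎)))
            where
            open ℕₚ.≤-Reasoning
            arith : ∀ κ s → κ * κ * (4 * s) ≡ s * (2 * κ * (2 * κ))
            arith = solve-∀
            arith′ : ∀ κ → 2 * (2 * κ) + 2 * κ ≡ 6 * κ
            arith′ = solve-∀
            many : ∀ c x → c ∈ R → S (c , x) ≡ true × U x ≡ true → count Vs Y + 2 * κ ≤ q * deg c x Y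
            many c x c∈ (Sp , Ux) = begin
              count Vs Y + 2 * κ ≤⟨ ℕₚ.+-monoˡ-≤ (2 * κ) (ℕₚ.≤-trans (ℕₚ.<⇒≤ lt) (ℕₚ.*-monoʳ-≤ 2 S≤2κ)) ⟩
              2 * (2 * κ) + 2 * κ ≡⟨ arith′ κ ⟩
              6 * κ ≤⟨ U-degree {x} Ux c∈ ⟩
              q * deg c x W ≤⟨ ℕₚ.*-monoʳ-≤ q (count-mono Vs {λ y → adj c x y ∧ W y} {λ y → adj c x y ∧ Y y} (λ y e → let (ad , w) = ∧-true {adj c x y} e in cong₂ _∧_ ad (cong₂ _∧_ (Γ-intro {S} {y} (∈Ps c∈ Ux) Sp ad) w))) ⟩
              q * deg c x Y ∎

      center : ∀ (Y : VSet) D n → 4 * (q * D) ≤ n → n + 4 * κ < 4 * count Vs Y → ∃ λ v → Y v ≡ true × (∀ {c} → c ∈ R → D ≤ deg c v Y)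
      center Y D n 4qD≤n many with Any.any? (λ v → (Y v Boolₚ.≟ true) ×-dec All.all? (λ c → D ℕ.≤? deg c v Y) R) Vs
      ... | yes ∃v with M.find ∃v
      ... | v , _ , Yv , ds = v , Yv , λ c∈ → All.lookup ds c∈
      center Y D n 4qD≤n many | no ¬∃ = contradiction many (ℕₚ.≤⇒≯ (begin
          4 * count Vs Y ≡⟨ cong (4 *_) (sym split) ⟩
          4 * (q * D + g) ≡⟨ ℕₚ.*-distribˡ-+ 4 (q * D) g ⟩
          4 * (q * D) + 4 * g ≤⟨ ℕₚ.+-mono-≤ 4qD≤n (ℕₚ.*-monoʳ-≤ 4 g≤κ) ⟩
          n + 4 * κ ∎))
        where
        open ℕₚ.≤-Reasoning
        y = count Vs Y
        g = y ∸ q * D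
        qD≤y : q * D ≤ y
        qD≤y = ℕₚ.*-cancelˡ-≤ 4 (ℕₚ.≤-trans 4qD≤n (ℕₚ.≤-trans (ℕₚ.m≤m+n n _) (ℕₚ.<⇒≤ many)))
        split : q * D + g ≡ y
        split = ℕₚ.m+[n∸m]≡n qD≤y
        y>0 : 0 < y
        y>0 = ℕₚ.*-cancelˡ-< 4 0 y (ℕₚ.≤-<-trans z≤n many)
        S : C × V → Bool
        S (c , x) = Y x ∧ ⌊ deg c x Y ℕ.<? D ⌋
        S-low : ∀ {c x} → S (c , x) ≡ true → deg c x Y < D
        S-low {c} {x} e with deg c x Y ℕ.<? D | ∧-true {Y x} e
        ... | yes lt | _ = lt
        y≤S : y ≤ count RV S
        y≤S = ℕₚ.≤-trans (∑-mono Vs pointwise) (ℕₚ.≤-reflexive (trans (∑-swap Vs R _) (sym (∑-× R Vs _))))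
          where
          pointwise : ∀ x → [ Y x ]ᵇ ≤ ∑ R (λ c → [ S (c , x) ]ᵇ)
          pointwise x with Y x in Yx
          ... | false = z≤n
          ... | true with All.all? (λ c → D ℕ.≤? deg c x Y) R
          ... | yes ds = contradiction (M.lose (complete x) (Yx , ds)) ¬∃
          ... | no ¬ds with M.find (Allₚ.¬All⇒Any¬ (λ c → D ℕ.≤? deg c x Y) R ¬ds)
          ... | c , c∈ , ¬le = ℕₚ.≤-trans (ℕₚ.≤-reflexive (sym is-one)) (∑-term-≤ R (λ c → [ ⌊ deg c x Y ℕ.<? D ⌋ ]ᵇ) c∈)
            where
            is-one : [ ⌊ deg c x Y ℕ.<? D ⌋ ]ᵇ ≡ 1
            is-one with deg c x Y ℕ.<? D
            ... | yes _ = refl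
            ... | no ¬lt = contradiction (ℕₚ.≰⇒> ¬le) ¬lt
        g²≤κ² : g * g ≤ κ * κ
        g²≤κ² = ℕₚ.*-cancelˡ-≤ y {{ℕ.>-nonZero y>0}} (ℕₚ.≤-trans (ℕₚ.*-monoˡ-≤ (g * g) y≤S) (ℕₚ.≤-trans (discrepancy-pairs S Y g (λ c x _ e → inj₁ (ℕₚ.≤-trans (ℕₚ.+-monoˡ-≤ g (ℕₚ.*-monoʳ-≤ q (ℕₚ.<⇒≤ (S-low {c} {x} e)))) (ℕₚ.≤-reflexive split)))) (ℕₚ.≤-reflexive (ℕₚ.*-comm (κ * κ) y))))
        g≤κ : g ≤ κ
        g≤κ = ℕₚ.≮⇒≥ (λ κ<g → ℕₚ.<⇒≱ (ℕₚ.*-mono-< κ<g κ<g) g²≤κ²)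

module Embed where

  open SumLib
  open NatSum
  open Extension
  open Connect
  open Host
  open import Data.Bool using (not)
  import Data.Fin as Fin
  import Data.Fin.Properties as Finₚ
  open import Data.List using (drop)
  open import Data.List.Properties using (length-drop; take++drop≡id; length-filter; map-++)
  open import Data.List.Membership.Propositional.Properties using (∈-allFin)
  import Data.List.Membership.DecPropositional as DecM
  open import Data.List.Relation.Unary.All as All using ([]; _∷_)
  import Data.List.Relation.Unary.All.Properties as Allₚ
  open import Data.List.Relation.Unary.AllPairs using ([]; _∷_)
  import Data.List.Relation.Unary.Unique.Propositional.Properties as Uniq
  open import Data.Nat using (ℕ; suc; _+_; _*_; _^_; _∸_; _≤_; _<_; z≤n; s≤s; NonZero)
  import Data.Nat as ℕ
  import Data.Nat.Properties as ℕₚ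
  open import Data.Nat.Tactic.RingSolver using (solve-∀)
  import Data.Sum as Sum
  open import Relation.Nullary.Decidable using (¬?)

  Fin-finite : ∀ n → Finite (Fin n)
  Fin-finite n = record { elems = allFin n ; complete = ∈-allFin ; distinct = Uniq.allFin⁺ n ; _≟_ = Finₚ._≟_ }

  module Greedy {V : Set} (FV : Finite V) (v₀ : V) where
    open Finite FV using (_≟_)
    private Vs = elems FV

    avoiding : (V → Bool) → List V → V → Bool
    avoiding Y taken y = Y y ∧ not ⌊ DecM._∈?_ _≟_ y taken ⌋

    avoiding-∉ : ∀ {Y taken y} → avoiding Y taken y ≡ true → Y y ≡ true × ¬ (y ∈ taken)
    avoiding-∉ {Y} {taken} {y} e with ∧-true {Y y} e
    ... | Yy , n with DecM._∈?_ _≟_ y taken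
    ... | no y∉ = Yy , y∉

    avoiding-count : ∀ Y taken → count Vs Y ≤ count Vs (avoiding Y taken) + length taken
    avoiding-count Y taken = ℕₚ.≤-trans (∑-mono Vs split) (ℕₚ.≤-trans (ℕₚ.≤-reflexive (∑-∙ Vs _ _)) (ℕₚ.+-monoʳ-≤ (count Vs (avoiding Y taken)) (count-member FV taken)))
      where
      split : ∀ y → [ Y y ]ᵇ ≤ [ avoiding Y taken y ]ᵇ + [ ⌊ DecM._∈?_ _≟_ y taken ⌋ ]ᵇ
      split y with Y y | DecM._∈?_ _≟_ y taken
      ... | false | _     = z≤n
      ... | true  | yes _ = s≤s z≤n
      ... | true  | no _  = s≤s z≤n

    override : ∀ {J : Set} (_≟J_ : DecidableEquality J) {B : Set} → J → B → (J → B) → J → B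
    override _≟J_ j w f j′ = if ⌊ j′ ≟J j ⌋ then w else f j′

    override-same : ∀ {J : Set} (_≟J_ : DecidableEquality J) {B : Set} j (w : B) f → override _≟J_ j w f j ≡ w
    override-same _≟J_ j w f with j ≟J j
    ... | yes _ = refl
    ... | no ne = contradiction refl ne

    override-other : ∀ {J : Set} (_≟J_ : DecidableEquality J) {B : Set} j (w : B) f {j′} → j′ ≢ j → override _≟J_ j w f j′ ≡ f j′
    override-other _≟J_ j w f {j′} ne with j′ ≟J j
    ... | yes e = contradiction e ne
    ... | no _  = refl

    greedy : ∀ {J : Set} (_≟J_ : DecidableEquality J) (N : J → V → Bool) I m → Unique I → length I ≤ m → (∀ {j} → j ∈ I → m ≤ count Vs (N j)) →
             ∃ λ (f : J → V) → (∀ {j} → j ∈ I → N j (f j) ≡ true) × (∀ {j j′} → j ∈ I → j′ ∈ I → f j ≡ f j′ → j ≡ j′)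
    greedy _≟J_ N [] m _ _ _ = (λ _ → v₀) , (λ ()) , (λ ())
    greedy _≟J_ N (j ∷ I) m (j∉ ∷ u) (s≤s {n = m′} le) many with greedy _≟J_ N I (suc m′) u (ℕₚ.m≤n⇒m≤1+n le) (λ j∈ → many (there j∈))
    ... | f , ok , inj with count-any Vs (avoiding (N j) (map f I)) (ℕₚ.+-cancelʳ-≤ (length (map f I)) 1 _ (ℕₚ.≤-trans (s≤s (ℕₚ.≤-trans (ℕₚ.≤-reflexive (length-map f I)) le)) (ℕₚ.≤-trans (many (here refl)) (avoiding-count (N j) (map f I)))))
    ... | w , _ , aw = f′ , ok′ , inj′
      where
      f′ = override _≟J_ j w f
      Nw : N j w ≡ true
      Nw = proj₁ (avoiding-∉ {N j} {map f I} {w} aw)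
      w∉ : ¬ (w ∈ map f I)
      w∉ = proj₂ (avoiding-∉ {N j} {map f I} {w} aw)
      at-j : f′ j ≡ w
      at-j = override-same _≟J_ j w f
      at-I : ∀ {j′} → j′ ∈ I → f′ j′ ≡ f j′
      at-I j′∈ = override-other _≟J_ j w f (λ e → All.lookup j∉ j′∈ (sym e))
      ok′ : ∀ {j′} → j′ ∈ j ∷ I → N j′ (f′ j′) ≡ true
      ok′ (here refl) = trans (cong (N j) at-j) Nw
      ok′ (there j′∈) = trans (cong (N _) (at-I j′∈)) (ok j′∈)
      inj′ : ∀ {a b} → a ∈ j ∷ I → b ∈ j ∷ I → f′ a ≡ f′ b → a ≡ b
      inj′ (here refl) (here refl) _ = refl
      inj′ (here refl) (there b∈) e = contradiction (subst (_∈ map f I) (sym (trans (sym at-j) (trans e (at-I b∈)))) (∈-map⁺ f b∈)) w∉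
      inj′ (there a∈) (here refl) e = contradiction (subst (_∈ map f I) (trans (sym (at-I a∈)) (trans e at-j)) (∈-map⁺ f a∈)) w∉
      inj′ (there a∈) (there b∈) e = inj a∈ b∈ (trans (sym (at-I a∈)) (trans e (at-I b∈)))

  module Stars {V C : Set} (FV : Finite V) (v₀ : V) (adj : C → V → V → Bool) (R : List C) (irreflexive : ∀ c x → c ∈ R → adj c x x ≡ false)
               (Δ : ℕ) (col : Fin Δ → Fin Δ → C) (col∈R : ∀ i j → i ≢ j → col i j ∈ R) (A : V → Bool) where
    open Finite FV using (_≟_)
    open Greedy FV v₀
    private Vs = elems FV

    module _ (center : ∀ Y → count Vs A ≤ count Vs Y + Δ * Δ → ∃ λ v → Y v ≡ true × (∀ {c} → c ∈ R → Δ ≤ count Vs (λ y → adj c v y ∧ Y y))) where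

      Row : (V → Bool) → Fin Δ → Set
      Row Y i = ∃ λ (f : Fin Δ → V) → (∀ j → Y (f j) ≡ true) × (∀ {j j′} → f j ≡ f j′ → j ≡ j′) × (∀ j → i ≢ j → adj (col i j) (f i) (f j) ≡ true)

      row : ∀ Y → count Vs A ≤ count Vs Y + Δ * Δ → ∀ i → Row Y i
      row Y big i with center Y big
      ... | v , Yv , rich with greedy Finₚ._≟_ (λ j y → adj (col i j) v y ∧ Y y) I Δ (Uniq.filter⁺ _ (Uniq.allFin⁺ Δ))
            (ℕₚ.≤-trans (length-filter (λ j → ¬? (i Finₚ.≟ j)) (allFin Δ)) (ℕₚ.≤-reflexive (length-tabulate {n = Δ} (λ j → j)))) (λ {j} j∈ → rich (col∈R i j (proj₂ (∈-filter⁻ (λ j → ¬? (i Finₚ.≟ j)) {xs = allFin Δ} j∈))))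
        where I = filter (λ j → ¬? (i Finₚ.≟ j)) (allFin Δ)
      ... | f , ok , inj = f′ , Y-f′ , inj′ , edge
        where
        I = filter (λ j → ¬? (i Finₚ.≟ j)) (allFin Δ)
        ∈I : ∀ {j} → i ≢ j → j ∈ I
        ∈I {j} ne = ∈-filter⁺ (λ j → ¬? (i Finₚ.≟ j)) (∈-allFin j) ne
        f′ = override Finₚ._≟_ i v f
        at-i : f′ i ≡ v
        at-i = override-same Finₚ._≟_ i v f
        at-j : ∀ {j} → i ≢ j → f′ j ≡ f j
        at-j ne = override-other Finₚ._≟_ i v f (ne ∘ sym)
        adj-f : ∀ {j} → i ≢ j → adj (col i j) v (f j) ≡ true
        adj-f ne = proj₁ (∧-true (ok (∈I ne)))
        v≢f : ∀ {j} → i ≢ j → v ≢ f j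
        v≢f {j} ne e = true≢false (trans (cong (adj (col i j) v) e) (adj-f ne)) (irreflexive (col i j) v (col∈R i j ne))
        Y-f′ : ∀ j → Y (f′ j) ≡ true
        Y-f′ j with i Finₚ.≟ j
        ... | yes refl = trans (cong Y at-i) Yv
        ... | no ne = trans (cong Y (at-j ne)) (proj₂ (∧-true {adj (col i j) v (f j)} (ok (∈I ne))))
        inj′ : ∀ {j j′} → f′ j ≡ f′ j′ → j ≡ j′
        inj′ {j} {j′} e with i Finₚ.≟ j | i Finₚ.≟ j′
        ... | yes refl | yes refl = refl
        ... | yes refl | no ne = contradiction (trans (sym at-i) (trans e (at-j ne))) (v≢f ne)
        ... | no ne | yes refl = contradiction (trans (sym at-i) (trans (sym e) (at-j ne))) (v≢f ne)
        ... | no ne | no ne′ = inj (∈I ne) (∈I ne′) (trans (sym (at-j ne)) (trans e (at-j ne′)))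
        edge : ∀ j → i ≢ j → adj (col i j) (f′ i) (f′ j) ≡ true
        edge j ne = trans (cong₂ (adj (col i j)) at-i (at-j ne)) (adj-f ne)

      Rows : List (Fin Δ) → Set
      Rows is = ∃ λ (s : Fin Δ → Fin Δ → V) → (∀ {i} → i ∈ is → ∀ j → A (s i j) ≡ true)
        × (∀ {i i′ j j′} → i ∈ is → i′ ∈ is → s i j ≡ s i′ j′ → i ≡ i′ × j ≡ j′)
        × (∀ {i} → i ∈ is → ∀ j → i ≢ j → adj (col i j) (s i i) (s i j) ≡ true)

      rows : ∀ is → Unique is → length is ≤ Δ → Rows is
      rows [] _ _ = (λ _ _ → v₀) , (λ ()) , (λ ()) , (λ ())
      rows (i ∷ is) (i∉ ∷ u) le with rows is u (ℕₚ.<⇒≤ le)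
      ... | s , A-s , inj , edges with row (avoiding A taken) big i
        where
        taken = map (λ (i , j) → s i j) (cartesianProduct is (allFin Δ))
        big : count Vs A ≤ count Vs (avoiding A taken) + Δ * Δ
        big = ℕₚ.≤-trans (avoiding-count A taken) (ℕₚ.+-monoʳ-≤ (count Vs (avoiding A taken)) (ℕₚ.≤-trans (ℕₚ.≤-reflexive (trans (length-map (λ (i , j) → s i j) (cartesianProduct is (allFin Δ))) (trans (length-cartesianProduct is (allFin Δ)) (cong (length is *_) (length-tabulate {n = Δ} (λ j → j)))))) (ℕₚ.*-monoˡ-≤ Δ (ℕₚ.<⇒≤ le))))
      ... | f , Y-f , f-inj , f-edge = s′ , A-s′ , inj′ , edges′
        where
        taken = map (λ (i , j) → s i j) (cartesianProduct is (allFin Δ))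
        s′ = override Finₚ._≟_ i f s
        at-i : ∀ j → s′ i j ≡ f j
        at-i j = cong (λ g → g j) (override-same Finₚ._≟_ i f s)
        at-is : ∀ {i′} → i′ ∈ is → ∀ j → s′ i′ j ≡ s i′ j
        at-is i′∈ j = cong (λ g → g j) (override-other Finₚ._≟_ i f s (λ e → All.lookup i∉ i′∈ (sym e)))
        new : ∀ {i′} j j′ → i′ ∈ is → f j ≢ s i′ j′
        new j j′ i′∈ e = proj₂ (avoiding-∉ {A} {taken} {f j} (Y-f j)) (subst (_∈ taken) (sym e) (∈-map⁺ (λ (i , j) → s i j) (∈-cartesianProduct⁺ i′∈ (∈-allFin j′))))
        A-s′ : ∀ {i′} → i′ ∈ i ∷ is → ∀ j → A (s′ i′ j) ≡ true
        A-s′ (here refl) j = trans (cong A (at-i j)) (proj₁ (avoiding-∉ {A} {taken} {f j} (Y-f j)))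
        A-s′ (there i′∈) j = trans (cong A (at-is i′∈ j)) (A-s i′∈ j)
        inj′ : ∀ {a b j j′} → a ∈ i ∷ is → b ∈ i ∷ is → s′ a j ≡ s′ b j′ → a ≡ b × j ≡ j′
        inj′ (here refl) (here refl) e = refl , f-inj (trans (sym (at-i _)) (trans e (at-i _)))
        inj′ (here refl) (there b∈) e = contradiction (trans (sym (at-i _)) (trans e (at-is b∈ _))) (new _ _ b∈)
        inj′ (there a∈) (here refl) e = contradiction (trans (sym (at-i _)) (trans (sym e) (at-is a∈ _))) (new _ _ a∈)
        inj′ (there a∈) (there b∈) e = inj a∈ b∈ (trans (sym (at-is a∈ _)) (trans e (at-is b∈ _)))
        edges′ : ∀ {i′} → i′ ∈ i ∷ is → ∀ j → i′ ≢ j → adj (col i′ j) (s′ i′ i′) (s′ i′ j) ≡ true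
        edges′ (here refl) j ne = trans (cong₂ (adj (col _ j)) (at-i _) (at-i j)) (f-edge j ne)
        edges′ (there i′∈) j ne = trans (cong₂ (adj (col _ j)) (at-is i′∈ _) (at-is i′∈ j)) (edges i′∈ j ne)

      stars : ∃ λ (s : Fin Δ → Fin Δ → V) → (∀ i j → A (s i j) ≡ true) × (∀ {i i′ j j′} → s i j ≡ s i′ j′ → i ≡ i′ × j ≡ j′)
              × (∀ i j → i ≢ j → adj (col i j) (s i i) (s i j) ≡ true)
      stars with rows (allFin Δ) (Uniq.allFin⁺ Δ) (ℕₚ.≤-reflexive (length-tabulate {n = Δ} (λ j → j)))
      ... | s , A-s , inj , edges = s , (λ i → A-s (∈-allFin i)) , (λ {i} {i′} → inj (∈-allFin i) (∈-allFin i′)) , (λ i → edges (∈-allFin i))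

  module Assign {K V : Set} (_≟K_ : DecidableEquality K) where

    assign : List K → List V → (K → V) → K → V
    assign []       _        φ u = φ u
    assign (_ ∷ _)  []       φ u = φ u
    assign (k ∷ ks) (z ∷ zs) φ u = if ⌊ u ≟K k ⌋ then z else assign ks zs φ u

    assign-∉ : ∀ ks zs φ {u} → ¬ (u ∈ ks) → assign ks zs φ u ≡ φ u
    assign-∉ [] zs φ _ = refl
    assign-∉ (_ ∷ _) [] φ _ = refl
    assign-∉ (k ∷ ks) (z ∷ zs) φ {u} u∉ with u ≟K k
    ... | yes e = contradiction (here e) u∉
    ... | no _  = assign-∉ ks zs φ (u∉ ∘ there)

    map-assign : ∀ ks zs φ → Unique ks → length ks ≡ length zs → map (assign ks zs φ) ks ≡ zs
    map-assign [] [] φ _ _ = refl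
    map-assign (k ∷ ks) (z ∷ zs) φ (k∉ ∷ u) e = cong₂ _∷_ head (trans (map-cong∈ ks (λ {j} j∈ → tail j j∈)) (map-assign ks zs φ u (ℕₚ.suc-injective e)))
      where
      head : assign (k ∷ ks) (z ∷ zs) φ k ≡ z
      head with k ≟K k
      ... | yes _ = refl
      ... | no ne = contradiction refl ne
      tail : ∀ j → j ∈ ks → assign (k ∷ ks) (z ∷ zs) φ j ≡ assign ks zs φ j
      tail j j∈ with j ≟K k
      ... | yes refl = contradiction refl (All.lookup k∉ j∈)
      ... | no _ = refl
      map-cong∈ : ∀ {f g : K → V} (xs : List K) → (∀ {x} → x ∈ xs → f x ≡ g x) → map f xs ≡ map g xs
      map-cong∈ [] _ = refl
      map-cong∈ (x ∷ xs) h = cong₂ _∷_ (h (here refl)) (map-cong∈ xs (λ x∈ → h (there x∈)))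

  split-around : ∀ {A : Set} h (xs : List A) → suc (h + h) ≤ length xs →
    ∃₂ λ as bs → ∃₂ λ c es → xs ≡ as ++ bs ++ c ∷ es × length bs ≡ h × length es ≡ h × length as < length xs
  split-around {A} h xs le = as , bs , go (drop h ys) refl
    where
    L = length xs
    as ys bs : List A
    as = take (L ∸ suc (h + h)) xs
    ys = drop (L ∸ suc (h + h)) xs
    bs = take h ys
    ∣ys∣ : length ys ≡ suc (h + h)
    ∣ys∣ = trans (length-drop (L ∸ suc (h + h)) xs) (ℕₚ.m∸[m∸n]≡n le)
    ∣bs∣ : length bs ≡ h
    ∣bs∣ = trans (length-take h ys) (trans (cong (h ℕ.⊓_) ∣ys∣) (ℕₚ.m≤n⇒m⊓n≡m (ℕₚ.m≤n⇒m≤1+n (ℕₚ.m≤m+n h h))))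
    ∣as∣ : length as < L
    ∣as∣ = ℕₚ.≤-<-trans (ℕₚ.≤-reflexive (trans (length-take (L ∸ suc (h + h)) xs) (ℕₚ.m≤n⇒m⊓n≡m (ℕₚ.m∸n≤m L (suc (h + h)))))) (ℕₚ.∸-monoʳ-< {L} {suc (h + h)} {0} (s≤s z≤n) le)
    ∣rest∣ : length (drop h ys) ≡ suc h
    ∣rest∣ = trans (length-drop h ys) (trans (cong (_∸ h) ∣ys∣) (ℕₚ.m+n∸n≡m (suc h) h))
    go : ∀ zs → drop h ys ≡ zs → ∃₂ λ c es → xs ≡ as ++ bs ++ c ∷ es × length bs ≡ h × length es ≡ h × length as < L
    go [] e = contradiction (trans (sym ∣rest∣) (cong length e)) (λ ())
    go (c ∷ es) e = c , es , trans (sym (take++drop≡id (L ∸ suc (h + h)) xs)) (cong (as ++_) (trans (sym (take++drop≡id h ys)) (cong (bs ++_) e))) ,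
      ∣bs∣ , ℕₚ.suc-injective (trans (sym (cong length e)) ∣rest∣) , ∣as∣

  module EdgeColours {n : ℕ} {C : Set} (f : Fin n → Fin n → C) where

    cols : Fin n → List (Fin n) → List C
    cols u []       = []
    cols u (v ∷ vs) = f u v ∷ cols v vs

    length-cols : ∀ u vs → length (cols u vs) ≡ length vs
    length-cols u []       = refl
    length-cols u (v ∷ vs) = cong suc (length-cols v vs)

  -- A subdivision of a clique with its branching vertices and their neighbours (slots h i j) and the rest of each path (mid).
  module Assembly {V C : Set} (FV : Finite V) (_≟C_ : DecidableEquality C) (R : List C)
                  (adj : C → V → V → Bool) (adj-sym : ∀ c x y → adj c x y ≡ true → adj c y x ≡ true)
                  (U : V → Bool) (Ps : List (C × V)) (Ps! : Unique Ps) (∈Ps : ∀ {c x} → c ∈ R → U x ≡ true → (c , x) ∈ Ps)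
                  (κ : ℕ) .{{_ : NonZero κ}} (joined : Connection.Joined FV _≟C_ R adj adj-sym U Ps Ps! ∈Ps κ)
                  (M H : ℕ) (dense : ∀ {c} → c ∈ R → ∀ Xs Ys → Unique Xs → Unique Ys → M < length Xs * length Ys → ∃₂ λ u v → u ∈ Xs × v ∈ Ys × adj c u v ≡ true)
                  (M<4^H : M < 2 ^ H * 2 ^ H) (2^H≤2κ : 2 ^ H ≤ 2 * κ)
                  (Δ n : ℕ) (f : Fin n → Fin n → C) (slot : Fin Δ → Fin Δ → Fin n) (slot-injective : ∀ {i j i′ j′} → slot i j ≡ slot i′ j′ → i ≡ i′ × j ≡ j′)
                  (mid : Fin Δ × Fin Δ → List (Fin n)) (s : Fin Δ → Fin Δ → V) (s-injective : ∀ {i j i′ j′} → s i j ≡ s i′ j′ → i ≡ i′ × j ≡ j′)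
                  (room : n + 27 * κ ≤ count (elems FV) U) where

    open Finite FV using (_≟_)
    open Connection FV _≟C_ R adj adj-sym U Ps Ps! ∈Ps κ public hiding (φ)
    open Assign {Fin n} {V} Finₚ._≟_
    open EdgeColours f


    length-walk : ∀ {cs x zs} → Walk joined cs x zs → length zs ≡ length cs
    length-walk []      = refl
    length-walk (_ ∷ w) = cong suc (length-walk w)

    tail : Fin Δ × Fin Δ → List (Fin n)
    tail (i , j) = mid (i , j) ++ [ slot j i ]

    Chain : (Fin n → V) → Fin Δ × Fin Δ → Set
    Chain φ (i , j) = Walk joined (cols (slot i j) (tail (i , j))) (φ (slot i j)) (map φ (tail (i , j)))

    record Partial (done todo : List (Fin Δ × Fin Δ)) : Set where
      field
        φ       : Fin n → V
        st      : State
        dom     : List (Fin n)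
        inv     : Inv st
        dom!    : Unique dom
        placed  : ∀ {u} → u ∈ dom → U (φ u) ≡ true × st (φ u) ≢ free
        φ-inj   : ∀ {u v} → u ∈ dom → v ∈ dom → φ u ≡ φ v → u ≡ v
        size    : count Vs U ≤ #free st + length dom
        dom⊆    : ∀ {u} → u ∈ dom → (∃₂ λ i j → u ≡ slot i j) ⊎ (∃ λ t → t ∈ done × u ∈ mid t)
        slots∈  : ∀ i j → slot i j ∈ dom
        mids∈   : ∀ {t u} → t ∈ done → u ∈ mid t → u ∈ dom
        φ-slot  : ∀ i j → φ (slot i j) ≡ s i j
        chains  : ∀ {t} → t ∈ done → Chain φ t
        roots   : ∀ {i j} → (i , j) ∈ todo → Childless st (s i j) × Childless st (s j i)

    record Admissible (t : Fin Δ × Fin Δ) : Set where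
      field
        ordered  : proj₁ t Fin.< proj₂ t
        mid!     : Unique (mid t)
        off-slot : ∀ {u} → u ∈ mid t → ∀ i j → u ≢ slot i j
        disjoint : ∀ {t′ u} → u ∈ mid t → u ∈ mid t′ → t ≡ t′
        colours  : All (_∈ R) (cols (slot (proj₁ t) (proj₂ t)) (tail t))
        long     : suc (H + H) ≤ suc (length (mid t))

    ordered-≢ : ∀ {i j : Fin Δ} → i Fin.< j → i ≢ j
    ordered-≢ lt refl = ℕₚ.<-irrefl refl lt

    module Placing {i j done todo} (ad : Admissible (i , j)) (P : Partial done ((i , j) ∷ todo)) where
      open Partial P
      module A = Admissible ad
      t = (i , j)
      x y : V
      x = s i j
      y = s j i
      i≢j : i ≢ j
      i≢j = ordered-≢ A.ordered
      ds = cols (slot i j) (tail t)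
      ∣tail∣ : length (tail t) ≡ suc (length (mid t))
      ∣tail∣ = trans (length-++ (mid t)) (ℕₚ.+-comm _ 1)
      ∣ds∣ : length ds ≡ suc (length (mid t))
      ∣ds∣ = trans (length-cols (slot i j) (tail t)) ∣tail∣
      placed-s : ∀ a b → U (s a b) ≡ true × st (s a b) ≢ free
      placed-s a b = subst (λ z → U z ≡ true × st z ≢ free) (φ-slot a b) (placed (slots∈ a b))
      module _ (t∉done : ¬ (t ∈ done)) where

        mid∉dom : ∀ {u} → u ∈ mid t → ¬ (u ∈ dom)
        mid∉dom u∈ u∈dom with dom⊆ u∈dom
        ... | inj₁ (a , b , e) = A.off-slot u∈ a b e
        ... | inj₂ (t′ , t′∈ , u∈′) = t∉done (subst (_∈ done) (sym (A.disjoint u∈ u∈′)) t′∈)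
        dom′ = mid t ++ dom
        dom′! : Unique dom′
        dom′! = Uniq.++⁺ A.mid! dom! (λ (u∈ , u∈dom) → mid∉dom u∈ u∈dom)
        fits : length (mid t) + length dom ≤ n
        fits = ℕₚ.≤-trans (ℕₚ.≤-reflexive (sym (length-++ (mid t)))) (ℕₚ.≤-trans (length-unique (Fin-finite n) dom′!) (ℕₚ.≤-reflexive (length-tabulate {n = n} (λ z → z))))
        room′ : length (mid t) + 27 * κ ≤ #free st
        room′ = ℕₚ.+-cancelʳ-≤ (length dom) _ _ (ℕₚ.≤-trans (ℕₚ.≤-reflexive (arith (length (mid t)) (length dom) (27 * κ))) (ℕₚ.≤-trans (ℕₚ.+-monoˡ-≤ (27 * κ) fits) (ℕₚ.≤-trans room size)))
          where
          arith : ∀ m d k → m + k + d ≡ m + d + k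
          arith = solve-∀

        link : Connected joined st x y ds
        link = go (split-around H ds (subst (suc (H + H) ≤_) (sym ∣ds∣) A.long))
          where
          go : (∃₂ λ as bs → ∃₂ λ c es → ds ≡ as ++ bs ++ c ∷ es × length bs ≡ H × length es ≡ H × length as < length ds) → Connected joined st x y ds
          go (as , bs , c , es , ds≡ , ∣bs∣ , ∣es∣ , ∣as∣) = subst (Connected joined st x y) (sym ds≡) Zc
            where
            colours : All (_∈ R) (as ++ bs ++ c ∷ es)
            colours = subst (All (_∈ R)) ds≡ A.colours
            c∷es∈ = Allₚ.++⁻ʳ bs (Allₚ.++⁻ʳ as colours)
            budget : 5 * κ + (length as + 4 * 2 ^ length es) ≤ #free st
            budget = begin
              5 * κ + (length as + 4 * 2 ^ length es) ≤⟨ ℕₚ.+-monoʳ-≤ (5 * κ) (ℕₚ.+-mono-≤ (ℕₚ.≤-pred (ℕₚ.≤-trans ∣as∣ (ℕₚ.≤-reflexive ∣ds∣))) (ℕₚ.*-monoʳ-≤ 4 (ℕₚ.≤-trans (ℕₚ.≤-reflexive (cong (2 ^_) ∣es∣)) 2^H≤2κ))) ⟩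
              5 * κ + (length (mid t) + 4 * (2 * κ)) ≡⟨ arith κ (length (mid t)) ⟩
              length (mid t) + 13 * κ ≤⟨ ℕₚ.+-monoʳ-≤ (length (mid t)) (ℕₚ.*-monoˡ-≤ κ {13} {27} (ℕₚ.≤ᵇ⇒≤ 13 27 _)) ⟩
              length (mid t) + 27 * κ ≤⟨ room′ ⟩
              #free st ∎
              where
              open ℕₚ.≤-Reasoning
              arith : ∀ κ m → 5 * κ + (m + 4 * (2 * κ)) ≡ m + 13 * κ
              arith = solve-∀
            Zc : Connected joined st x y (as ++ bs ++ c ∷ es)
            Zc = connect joined M dense inv (proj₁ (placed-s i j)) (proj₁ (placed-s j i)) (proj₂ (placed-s i j)) (proj₂ (placed-s j i))
                   (λ e → i≢j (proj₁ (s-injective e))) (proj₁ (roots (here refl))) (proj₂ (roots (here refl)))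
                   as bs c es (Allₚ.++⁻ˡ as colours) (Allₚ.++⁻ˡ bs (Allₚ.++⁻ʳ as colours)) (All.head c∷es∈) (All.tail c∷es∈) (trans ∣bs∣ (sym ∣es∣))
                   (subst (λ h → M < 2 ^ h * 2 ^ h) (sym ∣es∣) M<4^H) budget

        module _ (todo-ordered : All (λ t′ → proj₁ t′ Fin.< proj₂ t′) todo) (t∉todo : All (t ≢_) todo) (Zc : Connected joined st x y ds) where
          module Z = Connected Zc

          ∣inner∣ : length (mid t) ≡ length Z.inner
          ∣inner∣ = ℕₚ.suc-injective (sym (trans (ℕₚ.+-comm 1 _) (trans (sym (length-++ Z.inner)) (trans (length-walk Z.walk) ∣ds∣))))
          φ′ = assign (mid t) Z.inner φ
          old : ∀ {u} → u ∈ dom → φ′ u ≡ φ u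
          old u∈ = assign-∉ (mid t) Z.inner φ (λ u∈mid → mid∉dom u∈mid u∈)
          new : map φ′ (mid t) ≡ Z.inner
          new = map-assign (mid t) Z.inner φ A.mid! ∣inner∣
          new∈ : ∀ {u} → u ∈ mid t → φ′ u ∈ Z.inner
          new∈ u∈ = subst (φ′ _ ∈_) new (∈-map⁺ φ′ u∈)
          used : ∀ {z} → st z ≢ free → Z.final z ≢ free
          used ne e = ne (trans (sym (Z.keep _ ne)) e)
          placed′ : ∀ {u} → u ∈ dom′ → U (φ′ u) ≡ true × Z.final (φ′ u) ≢ free
          placed′ u∈ with ∈-++⁻ (mid t) u∈
          ... | inj₁ u∈mid = Inv.inU inv _ (λ e → contradiction (trans (sym (Z.inner-free (new∈ u∈mid))) e) (λ ())) , Z.inner-used (new∈ u∈mid)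
          ... | inj₂ u∈dom = subst (λ z → U z ≡ true × Z.final z ≢ free) (sym (old u∈dom)) (proj₁ (placed u∈dom) , used (proj₂ (placed u∈dom)))
          map-injective : ∀ (g : Fin n → V) ks → Unique (map g ks) → ∀ {u v} → u ∈ ks → v ∈ ks → g u ≡ g v → u ≡ v
          map-injective g (k ∷ ks) _ (here refl) (here refl) _ = refl
          map-injective g (k ∷ ks) (g∉ ∷ _) (here refl) (there v∈) e = contradiction e (All.lookup g∉ (∈-map⁺ g v∈))
          map-injective g (k ∷ ks) (g∉ ∷ _) (there u∈) (here refl) e = contradiction (sym e) (All.lookup g∉ (∈-map⁺ g u∈))
          map-injective g (k ∷ ks) (_ ∷ g!) (there u∈) (there v∈) e = map-injective g ks g! u∈ v∈ e
          clash : ∀ {u v} → u ∈ mid t → v ∈ dom → φ′ u ≢ φ′ v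
          clash u∈ v∈ e = proj₂ (placed v∈) (trans (cong st (sym (trans e (old v∈)))) (Z.inner-free (new∈ u∈)))
          φ-inj′ : ∀ {u v} → u ∈ dom′ → v ∈ dom′ → φ′ u ≡ φ′ v → u ≡ v
          φ-inj′ u∈ v∈ e with ∈-++⁻ (mid t) u∈ | ∈-++⁻ (mid t) v∈
          ... | inj₁ a | inj₁ b = map-injective φ′ (mid t) (subst Unique (sym new) Z.inner!) a b e
          ... | inj₁ a | inj₂ b = contradiction e (clash a b)
          ... | inj₂ a | inj₁ b = contradiction (sym e) (clash b a)
          ... | inj₂ a | inj₂ b = φ-inj a b (trans (sym (old a)) (trans e (old b)))
          size′ : count Vs U ≤ #free Z.final + length dom′
          size′ = ℕₚ.≤-trans size (ℕₚ.≤-trans (ℕₚ.+-monoˡ-≤ (length dom) Z.cost) (ℕₚ.≤-reflexive (trans (ℕₚ.+-assoc (#free Z.final) _ _) (cong (#free Z.final +_) (trans (cong (_+ length dom) (sym ∣inner∣)) (sym (length-++ (mid t))))))))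
          dom⊆′ : ∀ {u} → u ∈ dom′ → (∃₂ λ a b → u ≡ slot a b) ⊎ (∃ λ t′ → t′ ∈ t ∷ done × u ∈ mid t′)
          dom⊆′ u∈ with ∈-++⁻ (mid t) u∈
          ... | inj₁ u∈mid = inj₂ (t , here refl , u∈mid)
          ... | inj₂ u∈dom = Sum.map₂ (λ (t′ , t′∈ , m) → t′ , there t′∈ , m) (dom⊆ u∈dom)
          map-old : ∀ (ks : List (Fin n)) → (∀ {u} → u ∈ ks → u ∈ dom) → map φ′ ks ≡ map φ ks
          map-old [] _ = refl
          map-old (k ∷ ks) h = cong₂ _∷_ (old (h (here refl))) (map-old ks (λ u∈ → h (there u∈)))
          chains′ : ∀ {t′} → t′ ∈ t ∷ done → Chain φ′ t′
          chains′ (here refl) = subst₂ (λ a zs → Walk joined ds a zs) (sym (trans (old (slots∈ i j)) (φ-slot i j)))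
            (sym (trans (map-++ φ′ (mid t) [ slot j i ]) (cong₂ _++_ new (cong [_] (trans (old (slots∈ j i)) (φ-slot j i)))))) Z.walk
          chains′ {t′@(a , b)} (there t′∈) = subst₂ (λ z zs → Walk joined (cols (slot a b) (tail t′)) z zs) (sym (old (slots∈ a b)))
            (sym (map-old (tail t′) (λ u∈ → Sum.[ (λ u∈mid → mids∈ t′∈ u∈mid) , (λ { (here refl) → slots∈ b a }) ]′ (∈-++⁻ (mid t′) u∈)))) (chains t′∈)
          roots′ : ∀ {a b} → (a , b) ∈ todo → Childless Z.final (s a b) × Childless Z.final (s b a)
          roots′ {a} {b} t′∈ = quiet a b (proj₁ (roots (there t′∈))) ne₁ ne₂ , quiet b a (proj₂ (roots (there t′∈))) ne₃ ne₄
            where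
            quiet : ∀ a b → Childless st (s a b) → (a , b) ≢ (i , j) → (a , b) ≢ (j , i) → Childless Z.final (s a b)
            quiet a b h n₁ n₂ = Z.quiet (s a b) (proj₂ (placed-s a b)) (λ e → let (p , q) = s-injective e in n₁ (cong₂ _,_ p q)) (λ e → let (p , q) = s-injective e in n₂ (cong₂ _,_ p q)) h
            a<b = All.lookup todo-ordered t′∈
            t≢ = All.lookup t∉todo t′∈
            ne₁ : (a , b) ≢ (i , j)
            ne₁ e = t≢ (sym e)
            ne₂ : (a , b) ≢ (j , i)
            ne₂ e = ℕₚ.<-asym a<b (subst₂ Fin._<_ (sym (cong proj₂ e)) (sym (cong proj₁ e)) A.ordered)
            ne₃ : (b , a) ≢ (i , j)
            ne₃ e = ℕₚ.<-asym a<b (subst₂ Fin._<_ (sym (cong proj₁ e)) (sym (cong proj₂ e)) A.ordered)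
            ne₄ : (b , a) ≢ (j , i)
            ne₄ e = t≢ (cong₂ _,_ (sym (cong proj₂ e)) (sym (cong proj₁ e)))

          slots∈′ : ∀ a b → slot a b ∈ dom′
          slots∈′ a b = ∈-++⁺ʳ (mid t) (slots∈ a b)
          mids∈′ : ∀ {t′ u} → t′ ∈ t ∷ done → u ∈ mid t′ → u ∈ dom′
          mids∈′ (here refl) u∈ = ∈-++⁺ˡ u∈
          mids∈′ (there t∈)  u∈ = ∈-++⁺ʳ (mid t) (mids∈ t∈ u∈)
          φ-slot′ : ∀ a b → φ′ (slot a b) ≡ s a b
          φ-slot′ a b = trans (old (slots∈ a b)) (φ-slot a b)

          placement : Partial (t ∷ done) todo
          placement .Partial.φ = φ′
          placement .Partial.st = Z.final
          placement .Partial.dom = dom′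
          placement .Partial.inv = Z.inv
          placement .Partial.dom! = dom′!
          placement .Partial.placed {u} = placed′ {u}
          placement .Partial.φ-inj {u} {v} = φ-inj′ {u} {v}
          placement .Partial.size = size′
          placement .Partial.dom⊆ {u} = dom⊆′ {u}
          placement .Partial.slots∈ = slots∈′
          placement .Partial.mids∈ {t′} {u} = mids∈′ {t′} {u}
          placement .Partial.φ-slot = φ-slot′
          placement .Partial.chains {t′} = chains′ {t′}
          placement .Partial.roots {a} {b} = roots′ {a} {b}

        placed-path : All (λ t′ → proj₁ t′ Fin.< proj₂ t′) todo → All (t ≢_) todo → Partial (t ∷ done) todo
        placed-path todo-ordered t∉todo = placement todo-ordered t∉todo link

    record Complete (todo done : List (Fin Δ × Fin Δ)) : Set where
      field
        {finished} : List (Fin Δ × Fin Δ)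
        partial    : Partial finished []
        ⊇todo      : ∀ {t} → t ∈ todo → t ∈ finished
        ⊇done      : ∀ {t} → t ∈ done → t ∈ finished

    place-all : ∀ todo {done} → All Admissible todo → Unique todo → (∀ {t} → t ∈ done → ¬ (t ∈ todo)) → Partial done todo → Complete todo done
    place-all [] {done} _ _ _ P = record { finished = done ; partial = P ; ⊇todo = λ () ; ⊇done = λ t∈ → t∈ }
    place-all (t ∷ todo) {done} (ad ∷ ads) (t∉ ∷ todo!) fresh P = record
      { finished = R.finished ; partial = R.partial ; ⊇todo = ⊇todo′ ; ⊇done = λ {t′} t∈ → R.⊇done {t′} (there t∈) }
      where
      next : Partial (t ∷ done) todo
      next = Placing.placed-path {proj₁ t} {proj₂ t} {done} {todo} ad P (λ t∈ → fresh t∈ (here refl)) (All.map (λ {t′} → Admissible.ordered {t′}) ads) t∉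
      fresh′ : ∀ {t′} → t′ ∈ t ∷ done → ¬ (t′ ∈ todo)
      fresh′ (here refl)  t∈ = All.lookup t∉ t∈ refl
      fresh′ (there t′∈) t∈ = fresh t′∈ (there t∈)
      rest : Complete todo (t ∷ done)
      rest = place-all todo {t ∷ done} ads todo! fresh′ next
      module R = Complete rest
      ⊇todo′ : ∀ {t′} → t′ ∈ t ∷ todo → t′ ∈ R.finished
      ⊇todo′ (here refl) = R.⊇done (here refl)
      ⊇todo′ (there t∈)  = R.⊇todo t∈

module DistanceHost where

  open import Defs using (FiniteField)
  import Defs
  open SumLib
  module ℤΣ = IntSum
  open IntSum using (ind; ind-yes; ind-no)
  module ℕΣ = NatSum
  open NatSum using (count; [_]ᵇ)
  open FieldLib
  open Poly using (Vec-finite)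
  open Spectral using (square-mono; module SpectralBound)
  open import Data.Integer as ℤ using (ℤ; +_; 0ℤ; 1ℤ; +≤+)
  import Data.Integer.Properties as ℤₚ
  open import Data.Integer.Tactic.RingSolver using (solve-∀)
  open import Data.Nat as ℕ using (ℕ; suc)
  open import Data.Nat.Primality using (Prime)
  import Data.Nat.Properties as ℕₚ
  import Data.Sum as Sum
  open import Data.Vec using ([]; _∷_)

  ∑-pos : ∀ {A : Set} (xs : List A) (f : A → ℕ) → ℤΣ.∑ xs (λ x → + f x) ≡ + ℕΣ.∑ xs f
  ∑-pos []       f = refl
  ∑-pos (x ∷ xs) f = trans (cong (λ z → + f x ℤ.+ z) (∑-pos xs f)) (sym (ℤₚ.pos-+ (f x) _))

  module DistanceGraphs (𝔽 : FiniteField) where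
    open Field 𝔽

    V : ℕ → Set
    V = Vec F

    ‖_‖ : ∀ {d} → V d → F
    ‖ x ‖ = Defs.‖_‖ 𝔽 x

    _⊝_ : ∀ {d} → V d → V d → V d
    _⊝_ = Defs._-ᵥ_ 𝔽

    adj : ∀ {d} → F → V d → V d → Bool
    adj r x y = ⌊ ‖ x ⊝ y ‖ ≟F r ⌋

    adj-true : ∀ {d} r (x y : V d) → adj r x y ≡ true → ‖ x ⊝ y ‖ ≡ r
    adj-true r x y e with ‖ x ⊝ y ‖ ≟F r
    ... | yes eq = eq

    adj-intro : ∀ {d} r (x y : V d) → ‖ x ⊝ y ‖ ≡ r → adj r x y ≡ true
    adj-intro r x y eq with ‖ x ⊝ y ‖ ≟F r
    ... | yes _ = refl
    ... | no ne = contradiction eq ne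

    ‖⊝‖-sym : ∀ {d} (x y : V d) → ‖ x ⊝ y ‖ ≡ ‖ y ⊝ x ‖
    ‖⊝‖-sym []      []      = refl
    ‖⊝‖-sym (a ∷ x) (b ∷ y) = cong₂ _⊕_ (solve 2 (λ a b → (a :- b) :* (a :- b) := (b :- a) :* (b :- a)) refl a b) (‖⊝‖-sym x y)

    ‖x⊝x‖ : ∀ {d} (x : V d) → ‖ x ⊝ x ‖ ≡ 0F
    ‖x⊝x‖ []      = refl
    ‖x⊝x‖ (a ∷ x) = trans (cong₂ _⊕_ (solve 1 (λ a → (a :- a) :* (a :- a) := con 0ℤ) refl a) (‖x⊝x‖ x)) (⊕-identityˡ 0F)

    adj-sym : ∀ {d} r (x y : V d) → adj r x y ≡ true → adj r y x ≡ true
    adj-sym r x y e = adj-intro r y x (trans (‖⊝‖-sym y x) (adj-true r x y e))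

    adj-irreflexive : ∀ {d} r (x : V d) → r ≢ 0F → adj r x x ≡ false
    adj-irreflexive r x r≢0 with ‖ x ⊝ x ‖ ≟F r
    ... | yes e = contradiction (trans (sym e) (‖x⊝x‖ x)) r≢0
    ... | no _  = refl

  module SphereDiscrepancy (𝔽 : FiniteField) (p k : ℕ) (pr : Prime p) (p≢2 : p ≢ 2) (1≤k : 1 ℕ.≤ k) (q≡p^k : FiniteField.order 𝔽 ≡ p ℕ.^ k) (d : ℕ) where
    open Field 𝔽
    open DistanceGraphs 𝔽

    private
      e : F → ℤ
      e = SpectralBound.e 𝔽 p k pr p≢2 1≤k q≡p^k
      FV = Vec-finite finite d
      W = elems FV

    module _ (r : F) (r≢0 : r ≢ 0F) (Y : V d → Bool) where
      private
        y = count W Y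
        deg : V d → ℕ
        deg x = count W (λ y → adj r x y ∧ Y y)
        g : V d → ℤ
        g v = + [ Y v ]ᵇ
        D = SpectralBound.discrepancy 𝔽 p k pr p≢2 1≤k q≡p^k r r≢0 g

        D≡ : ∀ x → D x ≡ + (q ℕ.* deg x) ℤ.- + y
        D≡ x = trans (ℤΣ.∑-cong W term) (trans (ℤΣ.∑-minus W _ _) (cong₂ ℤ._-_ (trans (ℤΣ.∑-*ˡ W (+ q) _) (trans (cong (+ q ℤ.*_) (∑-pos W _)) (sym (ℤₚ.pos-* q (deg x))))) (∑-pos W _)))
          where
          ind-adj : ∀ v → ind (‖ x ⊝ v ‖ ⊕ ⊖ r ≟F 0F) ≡ + [ adj r x v ]ᵇ
          ind-adj v with ‖ x ⊝ v ‖ ≟F r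
          ... | yes e = ind-yes (‖ x ⊝ v ‖ ⊕ ⊖ r ≟F 0F) (trans (cong (_⊕ ⊖ r) e) (⊖-inverseʳ r))
          ... | no ne = ind-no (‖ x ⊝ v ‖ ⊕ ⊖ r ≟F 0F) (λ e → ne (x⊖y≡0 e))
          bits : ∀ a b → + [ b ]ᵇ ℤ.* (+ q ℤ.* + [ a ]ᵇ ℤ.- 1ℤ) ≡ + q ℤ.* + [ a ∧ b ]ᵇ ℤ.- + [ b ]ᵇ
          bits a true with a
          ... | true  = ℤₚ.*-identityˡ (+ q ℤ.* 1ℤ ℤ.- 1ℤ)
          ... | false = ℤₚ.*-identityˡ (+ q ℤ.* 0ℤ ℤ.- 1ℤ)
          bits true false = zero (+ q)
            where
            zero : ∀ q → 0ℤ ℤ.* (q ℤ.* 1ℤ ℤ.- 1ℤ) ≡ q ℤ.* 0ℤ ℤ.- 0ℤ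
            zero = solve-∀
          bits false false = zero (+ q)
            where
            zero : ∀ q → 0ℤ ℤ.* (q ℤ.* 0ℤ ℤ.- 1ℤ) ≡ q ℤ.* 0ℤ ℤ.- 0ℤ
            zero = solve-∀
          term : ∀ v → g v ℤ.* e (‖ x ⊝ v ‖ ⊕ ⊖ r) ≡ + q ℤ.* + [ adj r x v ∧ Y v ]ᵇ ℤ.- + [ Y v ]ᵇ
          term v = trans (cong (λ z → g v ℤ.* (+ q ℤ.* z ℤ.- 1ℤ)) (ind-adj v)) (bits (adj r x v) (Y v))

        g²≡ : ℤΣ.∑ W (λ v → g v ℤ.* g v) ≡ + y
        g²≡ = trans (ℤΣ.∑-cong W (λ v → bit (Y v))) (∑-pos W _)
          where
          bit : ∀ b → + [ b ]ᵇ ℤ.* + [ b ]ᵇ ≡ + [ b ]ᵇ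
          bit true  = refl
          bit false = refl

      degree-discrepancy : ∀ (X : V d → Bool) n → (∀ x → X x ≡ true → q ℕ.* deg x ℕ.+ n ℕ.≤ y ⊎ y ℕ.+ n ℕ.≤ q ℕ.* deg x) →
                           count W X ℕ.* (n ℕ.* n) ℕ.≤ 5 ℕ.* q ℕ.^ suc d ℕ.* y
      degree-discrepancy X n far = ℤₚ.drop‿+≤+ (begin
        + (count W X ℕ.* (n ℕ.* n)) ≡⟨ cong +_ (sym (ℕΣ.∑-*ʳ W (n ℕ.* n) _)) ⟩
        + ℕΣ.∑ W (λ x → [ X x ]ᵇ ℕ.* (n ℕ.* n)) ≡⟨ sym (∑-pos W _) ⟩
        ℤΣ.∑ W (λ x → + ([ X x ]ᵇ ℕ.* (n ℕ.* n))) ≤⟨ ℤΣ.∑-mono W pointwise ⟩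
        ℤΣ.∑ W (λ x → D x ℤ.* D x) ≤⟨ SpectralBound.discrepancy-bound 𝔽 p k pr p≢2 1≤k q≡p^k r r≢0 g ⟩
        + 5 ℤ.* + (q ℕ.^ suc d) ℤ.* ℤΣ.∑ W (λ v → g v ℤ.* g v) ≡⟨ cong₂ ℤ._*_ (sym (ℤₚ.pos-* 5 (q ℕ.^ suc d))) g²≡ ⟩
        + (5 ℕ.* q ℕ.^ suc d) ℤ.* + y ≡⟨ sym (ℤₚ.pos-* (5 ℕ.* q ℕ.^ suc d) y) ⟩
        + (5 ℕ.* q ℕ.^ suc d ℕ.* y) ∎)
        where
        open ℤₚ.≤-Reasoning
        gap : ∀ {a b} → a ℕ.+ n ℕ.≤ b → + n ℤ.≤ + b ℤ.- + a
        gap {a} {b} le = subst (ℤ._≤ + b ℤ.- + a) (trans (cong (λ z → z ℤ.- + a) (ℤₚ.pos-+ a n)) (cancel (+ a) (+ n))) (ℤₚ.+-monoˡ-≤ (ℤ.- + a) (+≤+ le))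
          where
          cancel : ∀ a n → a ℤ.+ n ℤ.- a ≡ n
          cancel = solve-∀
        flip : ∀ a b → (a ℤ.- b) ℤ.* (a ℤ.- b) ≡ (b ℤ.- a) ℤ.* (b ℤ.- a)
        flip = solve-∀
        pointwise : ∀ x → + ([ X x ]ᵇ ℕ.* (n ℕ.* n)) ℤ.≤ D x ℤ.* D x
        pointwise x with X x in Xx
        ... | false = ℤΣ.0≤i*i (D x)
        ... | true = subst₂ ℤ._≤_ (trans (sym (ℤₚ.pos-* n n)) (cong +_ (sym (ℕₚ.+-identityʳ (n ℕ.* n))))) (cong₂ ℤ._*_ (sym (D≡ x)) (sym (D≡ x)))
          (Sum.[ (λ le → subst (+ n ℤ.* + n ℤ.≤_) (flip (+ y) (+ (q ℕ.* deg x))) (square-mono (+≤+ ℕ.z≤n) (gap le))) , (λ le → square-mono (+≤+ ℕ.z≤n) (gap le)) ]′ (far x Xx))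

module Numerics where

  open import Data.Nat using (ℕ; zero; suc; _+_; _*_; _^_; _∸_; _≤_; _<_; z≤n; s≤s; NonZero; ⌈_/2⌉)
  import Data.Nat as ℕ
  open import Data.Nat.Induction using (<-rec)
  open import Data.Nat.Logarithm using (⌈log₂_⌉; ⌈log₂⌉-mono-≤; ⌈log₂⌈n/2⌉⌉≡⌈log₂n⌉∸1; ⌈log₂2^n⌉≡n)
  import Data.Nat.Properties as ℕₚ
  open import Data.Nat.Tactic.RingSolver using (solve-∀)

  square-cancel-< : ∀ {m n} → m * m < n * n → m < n
  square-cancel-< lt = ℕₚ.≰⇒> (λ le → ℕₚ.<⇒≱ lt (ℕₚ.*-mono-≤ le le))

  square-cancel-≤ : ∀ {m n} → m * m ≤ n * n → m ≤ n
  square-cancel-≤ le = ℕₚ.≮⇒≥ (λ lt → ℕₚ.<⇒≱ (ℕₚ.*-mono-< lt lt) le)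

  n≤⌈n/2⌉+⌈n/2⌉ : ∀ n → n ≤ ⌈ n /2⌉ + ⌈ n /2⌉
  n≤⌈n/2⌉+⌈n/2⌉ n = subst (_≤ ⌈ n /2⌉ + ⌈ n /2⌉) (ℕₚ.⌊n/2⌋+⌈n/2⌉≡n n) (ℕₚ.+-monoˡ-≤ ⌈ n /2⌉ (ℕₚ.⌊n/2⌋≤⌈n/2⌉ n))

  ⌈n/2⌉+⌈n/2⌉≤1+n : ∀ n → ⌈ n /2⌉ + ⌈ n /2⌉ ≤ suc n
  ⌈n/2⌉+⌈n/2⌉≤1+n n = subst (⌈ n /2⌉ + ⌈ n /2⌉ ≤_) (ℕₚ.⌊n/2⌋+⌈n/2⌉≡n (suc n)) (ℕₚ.+-monoʳ-≤ ⌈ n /2⌉ (ℕₚ.⌊n/2⌋≤⌈n/2⌉ (suc n)))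

  n≤2^⌈log₂n⌉ : ∀ n → n ≤ 2 ^ ⌈log₂ n ⌉
  n≤2^⌈log₂n⌉ = <-rec (λ n → n ≤ 2 ^ ⌈log₂ n ⌉) step
    where
    step : ∀ n → (∀ {m} → m < n → m ≤ 2 ^ ⌈log₂ m ⌉) → n ≤ 2 ^ ⌈log₂ n ⌉
    step zero _ = z≤n
    step (suc zero) _ = ℕₚ.m^n>0 2 ⌈log₂ 1 ⌉
    step n@(suc (suc m)) rec = begin
      n ≤⟨ n≤⌈n/2⌉+⌈n/2⌉ n ⟩
      ⌈ n /2⌉ + ⌈ n /2⌉ ≤⟨ ℕₚ.+-mono-≤ half half ⟩
      2 ^ (L ∸ 1) + 2 ^ (L ∸ 1) ≡⟨ cong (2 ^ (L ∸ 1) +_) (sym (ℕₚ.+-identityʳ _)) ⟩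
      2 ^ (1 + (L ∸ 1)) ≡⟨ cong (2 ^_) (ℕₚ.m+[n∸m]≡n (subst (_≤ L) (⌈log₂2^n⌉≡n 1) (⌈log₂⌉-mono-≤ (s≤s (s≤s (z≤n {m})))))) ⟩
      2 ^ L ∎
      where
      open ℕₚ.≤-Reasoning
      L = ⌈log₂ n ⌉
      half : ⌈ n /2⌉ ≤ 2 ^ (L ∸ 1)
      half = subst (λ l → ⌈ n /2⌉ ≤ 2 ^ l) (⌈log₂⌈n/2⌉⌉≡⌈log₂n⌉∸1 n) (rec (ℕₚ.⌈n/2⌉<n m))

  ⌈√⌉ : ∀ m → ∃ λ κ → m ≤ κ * κ × (∀ {j} → j < κ → j * j < m)
  ⌈√⌉ zero = 0 , z≤n , λ ()
  ⌈√⌉ (suc m) with ⌈√⌉ m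
  ... | κ , m≤κ² , least with suc m ℕ.≤? κ * κ
  ... | yes le = κ , le , λ j<κ → ℕₚ.m≤n⇒m≤1+n (least j<κ)
  ... | no ¬le = suc κ , ℕₚ.≤-trans (s≤s m≤κ²) (ℕₚ.*-mono-< (ℕₚ.n<1+n κ) (ℕₚ.n<1+n κ)) , λ j≤κ → ℕₚ.≤-<-trans (ℕₚ.*-mono-≤ (ℕₚ.≤-pred j≤κ) (ℕₚ.≤-pred j≤κ)) (ℕₚ.≰⇒> ¬le)

  least-power : ∀ {M κ} .{{_ : NonZero κ}} → M ≤ κ * κ → ∀ b → M < 2 ^ b * 2 ^ b → ∃ λ h → M < 2 ^ h * 2 ^ h × 2 ^ h ≤ 2 * κ × h ≤ b
  least-power {κ = suc κ} M≤κ² zero M<1 = 0 , M<1 , s≤s z≤n , z≤n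
  least-power {M} {κ} M≤κ² (suc b) M<4^b with M ℕ.<? 2 ^ b * 2 ^ b
  ... | yes lt = let (h , P , le , h≤b) = least-power M≤κ² b lt in h , P , le , ℕₚ.m≤n⇒m≤1+n h≤b
  ... | no ¬lt = suc b , M<4^b , ℕₚ.*-monoʳ-≤ 2 (square-cancel-≤ {2 ^ b} {κ} (ℕₚ.≤-trans (ℕₚ.≮⇒≥ ¬lt) M≤κ²)) , ℕₚ.≤-refl

  5q^d<4^ : ∀ q λ′ d → q ≤ 2 ^ λ′ → let m = 3 + λ′ * d in 5 * q ^ d < 2 ^ ⌈ m /2⌉ * 2 ^ ⌈ m /2⌉
  5q^d<4^ q λ′ d q≤2^λ = begin-strict
    5 * q ^ d ≤⟨ ℕₚ.*-monoʳ-≤ 5 (ℕₚ.^-monoˡ-≤ d q≤2^λ) ⟩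
    5 * (2 ^ λ′) ^ d <⟨ ℕₚ.*-monoˡ-< ((2 ^ λ′) ^ d) {{ℕₚ.m^n≢0 (2 ^ λ′) d {{ℕₚ.m^n≢0 2 λ′}}}} (ℕₚ.≤ᵇ⇒≤ 6 8 _) ⟩
    2 ^ 3 * (2 ^ λ′) ^ d ≡⟨ cong (8 *_) (ℕₚ.^-*-assoc 2 λ′ d) ⟩
    2 ^ 3 * 2 ^ (λ′ * d) ≡⟨ sym (ℕₚ.^-distribˡ-+-* 2 3 (λ′ * d)) ⟩
    2 ^ (3 + λ′ * d) ≤⟨ ℕₚ.^-monoʳ-≤ 2 (n≤⌈n/2⌉+⌈n/2⌉ (3 + λ′ * d)) ⟩
    2 ^ (b + b) ≡⟨ ℕₚ.^-distribˡ-+-* 2 b b ⟩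
    2 ^ b * 2 ^ b ∎
    where
    open ℕₚ.≤-Reasoning
    b = ⌈ 3 + λ′ * d /2⌉

  path-length : ∀ {h} λ′ d → h ≤ ⌈ 3 + λ′ * suc d /2⌉ → 3 + (h + h) ≤ (d + 2) * λ′ + 16
  path-length {h} λ′ d h≤ = begin
    3 + (h + h) ≤⟨ ℕₚ.+-monoʳ-≤ 3 (ℕₚ.≤-trans (ℕₚ.+-mono-≤ h≤ h≤) (⌈n/2⌉+⌈n/2⌉≤1+n (3 + λ′ * suc d))) ⟩
    7 + λ′ * suc d ≤⟨ ℕₚ.m≤m+n _ (λ′ + 9) ⟩
    7 + λ′ * suc d + (λ′ + 9) ≡⟨ arith λ′ d ⟩
    (d + 2) * λ′ + 16 ∎
    where
    open ℕₚ.≤-Reasoning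
    arith : ∀ l d → 7 + l * suc d + (l + 9) ≡ (d + 2) * l + 16
    arith = solve-∀

  module _ {q d ρ κ : ℕ} (3≤q : 3 ≤ q) (2≤d : 2 ≤ d) (1≤ρ : 1 ≤ ρ) (least : ∀ {j} → j < κ → j * j < ρ * (5 * q ^ suc d)) (large : ρ * (5 * q ^ suc d) ≤ κ * κ) where
    open ℕₚ.≤-Reasoning

    12≤κ : 12 ≤ κ
    12≤κ = square-cancel-< {11} (begin-strict
      121 <⟨ ℕₚ.≤ᵇ⇒≤ 122 135 _ ⟩
      1 * (5 * 3 ^ 3) ≤⟨ ℕₚ.*-mono-≤ 1≤ρ (ℕₚ.*-monoʳ-≤ 5 (ℕₚ.≤-trans (ℕₚ.^-monoˡ-≤ 3 3≤q) (ℕₚ.^-monoʳ-≤ q {{ℕ.>-nonZero (ℕₚ.≤-trans (s≤s z≤n) 3≤q)}} (s≤s 2≤d)))) ⟩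
      ρ * (5 * q ^ suc d) ≤⟨ large ⟩
      κ * κ ∎)

    n+29κ≤N : ∀ {n N} → n ≤ N → (72 * 72) * ρ * q ^ (d + 1) ≤ (N ∸ n) * (N ∸ n) → n + 29 * κ ≤ N
    n+29κ≤N {n} {N} n≤N big = begin
      n + 29 * κ ≤⟨ ℕₚ.+-monoʳ-≤ n (close κ 12≤κ least) ⟩
      n + (N ∸ n) ≡⟨ ℕₚ.m+[n∸m]≡n n≤N ⟩
      N ∎
      where
      close : ∀ κ → 12 ≤ κ → (∀ {j} → j < κ → j * j < ρ * (5 * q ^ suc d)) → 29 * κ ≤ N ∸ n
      close (suc j) (s≤s 11≤j) least = begin
        29 * suc j ≡⟨ arith₁ j ⟩
        29 * j + 29 ≤⟨ ℕₚ.+-monoʳ-≤ (29 * j) (ℕₚ.≤-trans (ℕₚ.≤ᵇ⇒≤ 29 33 _) (ℕₚ.*-monoʳ-≤ 3 11≤j)) ⟩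
        29 * j + 3 * j ≡⟨ arith₂ j ⟩
        32 * j ≤⟨ square-cancel-≤ (begin
          32 * j * (32 * j) ≡⟨ arith₃ j ⟩
          1024 * (j * j) ≤⟨ ℕₚ.*-monoʳ-≤ 1024 (ℕₚ.<⇒≤ (least (ℕₚ.n<1+n j))) ⟩
          1024 * (ρ * (5 * q ^ suc d)) ≡⟨ arith₄ ρ (q ^ suc d) ⟩
          5120 * (ρ * q ^ suc d) ≤⟨ ℕₚ.*-monoˡ-≤ (ρ * q ^ suc d) (ℕₚ.≤ᵇ⇒≤ 5120 5184 _) ⟩
          5184 * (ρ * q ^ suc d) ≡⟨ trans (sym (ℕₚ.*-assoc 5184 ρ _)) (cong (λ e → 5184 * ρ * q ^ e) (ℕₚ.+-comm 1 d)) ⟩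
          (72 * 72) * ρ * q ^ (d + 1) ≤⟨ big ⟩
          (N ∸ n) * (N ∸ n) ∎) ⟩
        N ∸ n ∎
        where
        arith₁ : ∀ j → 29 * suc j ≡ 29 * j + 29
        arith₁ = solve-∀
        arith₂ : ∀ j → 29 * j + 3 * j ≡ 32 * j
        arith₂ = solve-∀
        arith₃ : ∀ j → 32 * j * (32 * j) ≡ 1024 * (j * j)
        arith₃ = solve-∀
        arith₄ : ∀ r x → 1024 * (r * (5 * x)) ≡ 5120 * (r * x)
        arith₄ = solve-∀

  4qΔ≤N : ∀ {q d ρ N Δ} → 1 ≤ q → 3 ≤ d → 1 ≤ ρ → (72 * 72) * ρ * q ^ (d + 1) < N * N → Δ * Δ ≤ N → 4 * (q * Δ) ≤ N
  4qΔ≤N {q} {d} {ρ} {N} {Δ} 1≤q 3≤d 1≤ρ big Δ²≤N = square-cancel-≤ (begin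
    4 * (q * Δ) * (4 * (q * Δ)) ≡⟨ arith q Δ ⟩
    16 * (q * q) * (Δ * Δ) ≤⟨ ℕₚ.*-mono-≤ (ℕₚ.*-monoˡ-≤ (q * q) (ℕₚ.≤ᵇ⇒≤ 16 72 _)) Δ²≤N ⟩
    72 * (q * q) * N ≤⟨ ℕₚ.*-monoˡ-≤ N 72q²≤N ⟩
    N * N ∎)
    where
    open ℕₚ.≤-Reasoning
    arith : ∀ q Δ → 4 * (q * Δ) * (4 * (q * Δ)) ≡ 16 * (q * q) * (Δ * Δ)
    arith = solve-∀
    arith′ : ∀ q → 72 * (q * q) * (72 * (q * q)) ≡ 5184 * 1 * (q * (q * (q * (q * 1))))
    arith′ = solve-∀
    72q²≤N : 72 * (q * q) ≤ N
    72q²≤N = ℕₚ.<⇒≤ (square-cancel-< (begin-strict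
      72 * (q * q) * (72 * (q * q)) ≡⟨ arith′ q ⟩
      (72 * 72) * 1 * q ^ 4 ≤⟨ ℕₚ.*-mono-≤ (ℕₚ.*-monoʳ-≤ 5184 1≤ρ) (ℕₚ.^-monoʳ-≤ q {{ℕ.>-nonZero 1≤q}} (ℕₚ.+-monoˡ-≤ 1 3≤d)) ⟩
      (72 * 72) * ρ * q ^ (d + 1) <⟨ big ⟩
      N * N ∎))

  many-left : ∀ {n N κ Δ a y} → 1 ≤ κ → n + 29 * κ ≤ N → 2 * (Δ * Δ) ≤ n + Δ → N ≤ a + 12 * κ → a ≤ y + Δ * Δ → N + 4 * κ < 4 * y
  many-left {n} {N} {κ} {Δ} {a} {y} 1≤κ room keys N≤a a≤y = ℕₚ.+-cancelʳ-< (4 * (Δ * Δ) + 48 * κ + 3 * Δ) _ _ (begin-strict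
    N + 4 * κ + (4 * (Δ * Δ) + 48 * κ + 3 * Δ) ≤⟨ ℕₚ.+-monoʳ-≤ (N + 4 * κ) (ℕₚ.+-monoʳ-≤ (4 * (Δ * Δ) + 48 * κ) (3Δ Δ)) ⟩
    N + 4 * κ + (4 * (Δ * Δ) + 48 * κ + (2 * (Δ * Δ) + 1)) ≡⟨ arith₁ N κ (Δ * Δ) ⟩
    N + (3 * (2 * (Δ * Δ)) + (52 * κ + 1)) <⟨ ℕₚ.+-monoʳ-< N (ℕₚ.+-mono-≤-< (ℕₚ.*-monoʳ-≤ 3 keys) (ℕₚ.<-≤-trans (ℕₚ.+-monoʳ-< (52 * κ) (ℕₚ.≤-trans (s≤s (s≤s z≤n)) (ℕₚ.*-monoʳ-≤ 35 1≤κ))) (ℕₚ.≤-reflexive (arith₂ κ)))) ⟩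
    N + (3 * (n + Δ) + 87 * κ) ≡⟨ arith₃ N n Δ κ ⟩
    N + 3 * (n + 29 * κ) + 3 * Δ ≤⟨ ℕₚ.+-monoˡ-≤ (3 * Δ) (ℕₚ.+-monoʳ-≤ N (ℕₚ.*-monoʳ-≤ 3 room)) ⟩
    N + 3 * N + 3 * Δ ≤⟨ ℕₚ.+-monoˡ-≤ (3 * Δ) (ℕₚ.*-monoʳ-≤ 4 (ℕₚ.≤-trans N≤a (ℕₚ.+-monoˡ-≤ (12 * κ) a≤y))) ⟩
    4 * (y + Δ * Δ + 12 * κ) + 3 * Δ ≡⟨ arith₄ y (Δ * Δ) κ Δ ⟩
    4 * y + (4 * (Δ * Δ) + 48 * κ + 3 * Δ) ∎)
    where
    open ℕₚ.≤-Reasoning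
    arith₁ : ∀ N κ x → N + 4 * κ + (4 * x + 48 * κ + (2 * x + 1)) ≡ N + (3 * (2 * x) + (52 * κ + 1))
    arith₁ = solve-∀
    arith₂ : ∀ κ → 52 * κ + 35 * κ ≡ 87 * κ
    arith₂ = solve-∀
    arith₃ : ∀ N n Δ κ → N + (3 * (n + Δ) + 87 * κ) ≡ N + 3 * (n + 29 * κ) + 3 * Δ
    arith₃ = solve-∀
    arith₄ : ∀ y x κ Δ → 4 * (y + x + 12 * κ) + 3 * Δ ≡ 4 * y + (4 * x + 48 * κ + 3 * Δ)
    arith₄ = solve-∀
    3Δ : ∀ Δ → 3 * Δ ≤ 2 * (Δ * Δ) + 1
    3Δ zero = z≤n
    3Δ (suc zero) = ℕₚ.≤-refl
    3Δ Δ@(suc (suc k)) = begin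
      3 * Δ ≤⟨ ℕₚ.*-monoˡ-≤ Δ (ℕₚ.≤-trans (ℕₚ.n≤1+n 3) (ℕₚ.*-monoʳ-≤ 2 (s≤s (s≤s (z≤n {k}))))) ⟩
      2 * Δ * Δ ≡⟨ ℕₚ.*-assoc 2 Δ Δ ⟩
      2 * (Δ * Δ) ≤⟨ ℕₚ.m≤m+n _ 1 ⟩
      2 * (Δ * Δ) + 1 ∎

module Subdivide where

  open import Defs
  open SumLib
  open NatSum
  open Embed
  open import Data.Empty using (⊥-elim)
  import Data.Fin as Fin
  import Data.Fin.Properties as Finₚ
  open import Data.List using (concatMap; initLast; _∷ʳ′_)
  open import Data.List.Properties using (++-assoc)
  import Data.List.Membership.Propositional as M
  open import Data.List.Membership.Propositional.Properties using (∈-concatMap⁻)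
  open import Data.List.Relation.Unary.All as All using ([]; _∷_)
  import Data.List.Relation.Unary.All.Properties as Allₚ
  open import Data.List.Relation.Unary.AllPairs using ([]; _∷_)
  import Data.List.Relation.Unary.Unique.Propositional.Properties as Uniq
  open import Data.Nat using (ℕ; zero; suc; _+_; _*_; _≤_; _<_; z≤n; s≤s)
  import Data.Nat.Properties as ℕₚ
  open import Data.Nat.Tactic.RingSolver using (solve-∀)
  import Data.Sum as Sum
  open import Relation.Binary.Definitions using (Tri)

  split-ends : ∀ {A : Set} m (xs : List A) → 2 + m ≤ length xs → ∃₂ λ a mid → ∃ λ b → xs ≡ a ∷ mid ++ [ b ] × m ≤ length mid
  split-ends m (a ∷ xs) (s≤s le) with initLast xs
  ... | mid ∷ʳ′ b = a , mid , b , refl , ℕₚ.≤-pred (ℕₚ.≤-trans le (ℕₚ.≤-reflexive (trans (length-++ mid) (ℕₚ.+-comm _ 1))))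

  consec-snoc : ∀ {A : Set} {u v : A} xs {b z} → Consec u v (xs ++ b ∷ z ∷ []) → Consec u v (xs ++ [ b ]) ⊎ (u ≡ b × v ≡ z)
  consec-snoc []           here              = inj₂ (refl , refl)
  consec-snoc []           (there (there ()))
  consec-snoc (x ∷ [])     here              = inj₁ here
  consec-snoc (x ∷ y ∷ xs) here              = inj₁ here
  consec-snoc (x ∷ xs)     (there c)         = Sum.map₁ there (consec-snoc xs c)

  consec-last : ∀ {A : Set} xs (b z : A) → Consec b z (xs ++ b ∷ z ∷ [])
  consec-last []       b z = here
  consec-last (x ∷ xs) b z = there (consec-last xs b z)

  length-filter-count : ∀ {A : Set} {P : A → Set} (P? : ∀ x → Dec (P x)) xs → length (filter P? xs) ≡ ∑ xs (λ x → [ ⌊ P? x ⌋ ]ᵇ)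
  length-filter-count P? [] = refl
  length-filter-count P? (x ∷ xs) with P? x
  ... | yes _ = cong suc (length-filter-count P? xs)
  ... | no _  = length-filter-count P? xs

  pairs : ∀ Δ → List (Fin Δ × Fin Δ)
  pairs Δ = cartesianProduct (allFin Δ) (allFin Δ)

  increasing : ∀ Δ → List (Fin Δ × Fin Δ)
  increasing Δ = filter (λ (i , j) → i Finₚ.<? j) (pairs Δ)

  ∈-increasing : ∀ {Δ} {i j : Fin Δ} → i Fin.< j → (i , j) ∈ increasing Δ
  ∈-increasing {i = i} {j} i<j = ∈-filter⁺ (λ (i , j) → i Finₚ.<? j) (Finite.complete (×-finite (Fin-finite _) (Fin-finite _)) (i , j)) i<j

  ∈-increasing⁻ : ∀ {Δ} {t : Fin Δ × Fin Δ} → t ∈ increasing Δ → proj₁ t Fin.< proj₂ t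
  ∈-increasing⁻ {Δ} t∈ = proj₂ (∈-filter⁻ (λ (i , j) → i Finₚ.<? j) {xs = pairs Δ} t∈)

  increasing! : ∀ Δ → Unique (increasing Δ)
  increasing! Δ = Uniq.filter⁺ (λ (i , j) → i Finₚ.<? j) (Finite.distinct (×-finite (Fin-finite Δ) (Fin-finite Δ)))

  ∣pairs∣ : ∀ Δ → length (pairs Δ) ≡ Δ * Δ
  ∣pairs∣ Δ = trans (length-cartesianProduct (allFin Δ) (allFin Δ)) (cong₂ _*_ (length-tabulate {n = Δ} (λ z → z)) (length-tabulate {n = Δ} (λ z → z)))

  2∣increasing∣+Δ : ∀ Δ → Δ * Δ ≡ length (increasing Δ) + length (increasing Δ) + Δ
  2∣increasing∣+Δ Δ = begin
    Δ * Δ ≡⟨ trans (sym (∣pairs∣ Δ)) (trans (sym (ℕₚ.*-identityʳ _)) (sym (∑-const (pairs Δ) 1))) ⟩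
    ∑ (pairs Δ) (λ _ → 1) ≡⟨ ∑-cong (pairs Δ) (λ (i , j) → trichotomy i j) ⟩
    ∑ (pairs Δ) (λ (i , j) → [ ⌊ i Finₚ.<? j ⌋ ]ᵇ + ([ ⌊ j Finₚ.<? i ⌋ ]ᵇ + [ ⌊ j Finₚ.≟ i ⌋ ]ᵇ)) ≡⟨ trans (∑-∙ (pairs Δ) _ _) (cong₂ _+_ below (trans (∑-∙ (pairs Δ) _ _) (cong₂ _+_ above diagonal))) ⟩
    P + (P + Δ) ≡⟨ sym (ℕₚ.+-assoc P P Δ) ⟩
    P + P + Δ ∎
    where
    open ≡-Reasoning
    P = length (increasing Δ)
    trichotomy : ∀ (i j : Fin Δ) → 1 ≡ [ ⌊ i Finₚ.<? j ⌋ ]ᵇ + ([ ⌊ j Finₚ.<? i ⌋ ]ᵇ + [ ⌊ j Finₚ.≟ i ⌋ ]ᵇ)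
    trichotomy i j with i Finₚ.<? j | j Finₚ.<? i | j Finₚ.≟ i
    ... | yes p | yes p′ | _ = ⊥-elim (ℕₚ.<-asym p p′)
    ... | yes p | no _ | yes refl = ⊥-elim (ℕₚ.<-irrefl refl p)
    ... | yes _ | no _ | no _ = refl
    ... | no _ | yes p | yes refl = ⊥-elim (ℕₚ.<-irrefl refl p)
    ... | no _ | yes _ | no _ = refl
    ... | no _ | no _ | yes _ = refl
    ... | no ¬p | no ¬p′ | no ne = ⊥-elim (Sum.[ ¬p′ , (λ le → ne (Finₚ.toℕ-injective le)) ]′ (ℕₚ.m≤n⇒m<n∨m≡n (ℕₚ.≮⇒≥ ¬p)))
    below : ∑ (pairs Δ) (λ (i , j) → [ ⌊ i Finₚ.<? j ⌋ ]ᵇ) ≡ P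
    below = sym (length-filter-count (λ (i , j) → i Finₚ.<? j) (pairs Δ))
    above : ∑ (pairs Δ) (λ (i , j) → [ ⌊ j Finₚ.<? i ⌋ ]ᵇ) ≡ P
    above = trans (∑-× (allFin Δ) (allFin Δ) _) (trans (∑-swap (allFin Δ) (allFin Δ) _) (trans (sym (∑-× (allFin Δ) (allFin Δ) _)) below))
    diagonal : ∑ (pairs Δ) (λ (i , j) → [ ⌊ j Finₚ.≟ i ⌋ ]ᵇ) ≡ Δ
    diagonal = trans (∑-× (allFin Δ) (allFin Δ) _) (trans (∑-cong (allFin Δ) (λ i → count-≟ (Fin-finite Δ) i)) (trans (∑-const (allFin Δ) 1) (trans (ℕₚ.*-identityʳ _) (length-tabulate {n = Δ} (λ z → z)))))

  -- slot i i is the branching vertex i, and slot i j is its neighbour on the path towards j.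
  record CliqueSubdivision (Δ n m : ℕ) (Adj : Fin n → Fin n → Set) : Set where
    field
      slot           : Fin Δ → Fin Δ → Fin n
      mid            : Fin Δ × Fin Δ → List (Fin n)
      slot-injective : ∀ {i j i′ j′} → slot i j ≡ slot i′ j′ → i ≡ i′ × j ≡ j′
      mid!           : ∀ {i j} → i Fin.< j → Unique (mid (i , j))
      off-slot       : ∀ {i j u} → i Fin.< j → u ∈ mid (i , j) → ∀ i′ j′ → u ≢ slot i′ j′
      disjoint       : ∀ {t t′ u} → u ∈ mid t → u ∈ mid t′ → t ≡ t′
      long           : ∀ {i j} → i Fin.< j → m ≤ length (mid (i , j))
      star           : ∀ {i j} → i ≢ j → Adj (slot i i) (slot i j)
      middle         : ∀ {i j} → i Fin.< j → ∀ {u v} → Consec u v (slot i j ∷ mid (i , j) ++ [ slot j i ]) → Adj u v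

    Covered : Fin n → Set
    Covered u = (∃₂ λ i j → u ≡ slot i j) ⊎ (∃₂ λ i j → i Fin.< j × u ∈ mid (i , j))

    data Edge (u v : Fin n) : Set where
      star-edge   : ∀ {i j} → i ≢ j → u ≡ slot i i → v ≡ slot i j → Edge u v
      middle-edge : ∀ {i j} → i Fin.< j → Consec u v (slot i j ∷ mid (i , j) ++ [ slot j i ]) → Edge u v
      reverse     : Edge v u → Edge u v

    slots : List (Fin n)
    slots = map (uncurry slot) (pairs Δ)

    slots! : Unique slots
    slots! = Uniq.map⁺ (λ {x} {y} e → let (p , q) = slot-injective e in cong₂ _,_ p q) (Finite.distinct (×-finite (Fin-finite Δ) (Fin-finite Δ)))

    mids : List (Fin Δ × Fin Δ) → List (Fin n)
    mids = concatMap mid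

    mids! : ∀ ts → Unique ts → All (λ t → proj₁ t Fin.< proj₂ t) ts → Unique (mids ts)
    mids! [] _ _ = []
    mids! (t ∷ ts) (t∉ ∷ u) (lt ∷ lts) = Uniq.++⁺ (mid! lt) (mids! ts u lts) apart
      where
      apart : ∀ {w} → ¬ (w ∈ mid t × w ∈ mids ts)
      apart (w∈ , w∈′) with M.find (∈-concatMap⁻ mid {xs = ts} w∈′)
      ... | t′ , t′∈ , w∈t′ = All.lookup t∉ t′∈ (disjoint w∈ w∈t′)

    mids-long : ∀ ts → All (λ t → proj₁ t Fin.< proj₂ t) ts → length ts * m ≤ length (mids ts)
    mids-long [] _ = z≤n
    mids-long (t ∷ ts) (lt ∷ lts) = ℕₚ.≤-trans (ℕₚ.+-mono-≤ (long lt) (mids-long ts lts)) (ℕₚ.≤-reflexive (sym (length-++ (mid t))))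

    2Δ²≤n+Δ : 2 ≤ m → 2 * (Δ * Δ) ≤ n + Δ
    2Δ²≤n+Δ 2≤m = begin
      2 * (Δ * Δ) ≡⟨ arith (Δ * Δ) P Δ (2∣increasing∣+Δ Δ) ⟩
      Δ * Δ + P * 2 + Δ ≤⟨ ℕₚ.+-monoˡ-≤ Δ (begin
        Δ * Δ + P * 2 ≤⟨ ℕₚ.+-mono-≤ (ℕₚ.≤-reflexive (sym (trans (length-map (uncurry slot) (pairs Δ)) (∣pairs∣ Δ)))) (ℕₚ.≤-trans (ℕₚ.*-monoʳ-≤ P 2≤m) (mids-long (increasing Δ) ordered)) ⟩
        length slots + length (mids (increasing Δ)) ≡⟨ sym (length-++ slots) ⟩
        length (slots ++ mids (increasing Δ)) ≤⟨ length-unique (Fin-finite n) (Uniq.++⁺ slots! (mids! (increasing Δ) (increasing! Δ) ordered) apart) ⟩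
        length (allFin n) ≡⟨ length-tabulate {n = n} (λ z → z) ⟩
        n ∎) ⟩
      n + Δ ∎
      where
      open ℕₚ.≤-Reasoning
      P = length (increasing Δ)
      ordered : All (λ t → proj₁ t Fin.< proj₂ t) (increasing Δ)
      ordered = All.tabulate ∈-increasing⁻
      apart : ∀ {w} → ¬ (w ∈ slots × w ∈ mids (increasing Δ))
      apart (w∈ , w∈′) with ∈-map⁻ (uncurry slot) w∈ | M.find (∈-concatMap⁻ mid {xs = increasing Δ} w∈′)
      ... | (i , j) , _ , w≡ | t , t∈ , w∈t = off-slot (∈-increasing⁻ t∈) w∈t i j w≡
      arith : ∀ x P Δ → x ≡ P + P + Δ → 2 * x ≡ x + P * 2 + Δ
      arith x P Δ e = trans (cong (λ y → x + (y + 0)) e) (rearrange x P Δ)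
        where
        rearrange : ∀ x P Δ → x + (P + P + Δ + 0) ≡ x + P * 2 + Δ
        rearrange = solve-∀

    Δ²≤n : 2 ≤ m → Δ * Δ ≤ n
    Δ²≤n 2≤m = ℕₚ.+-cancelʳ-≤ (Δ * Δ) _ _ (begin
      Δ * Δ + Δ * Δ ≡⟨ cong (Δ * Δ +_) (sym (ℕₚ.+-identityʳ _)) ⟩
      2 * (Δ * Δ) ≤⟨ 2Δ²≤n+Δ 2≤m ⟩
      n + Δ ≤⟨ ℕₚ.+-monoʳ-≤ n (Δ≤Δ² Δ) ⟩
      n + Δ * Δ ∎)
      where
      open ℕₚ.≤-Reasoning
      Δ≤Δ² : ∀ Δ → Δ ≤ Δ * Δ
      Δ≤Δ² zero    = z≤n
      Δ≤Δ² (suc Δ) = ℕₚ.m≤m+n (suc Δ) _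

  module _ {𝔽 : FiniteField} {Δ ℓ m : ℕ} {H : DistanceGraph 𝔽} (S : SubdivisionOfK 𝔽 Δ ℓ H) (3+m≤ℓ : 3 + m ≤ ℓ) where
    open DistanceGraph H
    open SubdivisionOfK S

    private
      ends : ∀ i j (p : i Fin.< j) → ∃₂ λ a mid → ∃ λ b → internal i j p ≡ a ∷ mid ++ [ b ] × m ≤ length mid
      ends i j p = split-ends m (internal i j p) (ℕₚ.≤-pred (ℕₚ.≤-trans 3+m≤ℓ (pathLong i j p)))

      first last : ∀ i j → i Fin.< j → Fin n
      first i j p = proj₁ (ends i j p)
      last i j p = proj₁ (proj₂ (proj₂ (ends i j p)))

      inner : ∀ i j → i Fin.< j → List (Fin n)
      inner i j p = proj₁ (proj₂ (ends i j p))

      internal≡ : ∀ i j p → internal i j p ≡ first i j p ∷ inner i j p ++ [ last i j p ]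
      internal≡ i j p = proj₁ (proj₂ (proj₂ (proj₂ (ends i j p))))

      path≡ : ∀ i j p → pathOf i j p ≡ branch i ∷ first i j p ∷ inner i j p ++ last i j p ∷ branch j ∷ []
      path≡ i j p = cong (branch i ∷_) (trans (cong (_++ [ branch j ]) (internal≡ i j p)) (cong (first i j p ∷_) (++-assoc (inner i j p) _ _)))

      internal! : ∀ i j p → Unique (first i j p ∷ inner i j p ++ [ last i j p ])
      internal! i j p with pathUnique i j p
      ... | _ ∷ u = subst Unique (internal≡ i j p) (Uniq-++ˡ (internal i j p) u)
        where
        Uniq-++ˡ : ∀ {A : Set} (xs : List A) {ys} → Unique (xs ++ ys) → Unique xs
        Uniq-++ˡ []       _        = []
        Uniq-++ˡ (x ∷ xs) (x∉ ∷ u) = Allₚ.++⁻ˡ xs x∉ ∷ Uniq-++ˡ xs u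

      internal∈ : ∀ {i j p u} → u ∈ first i j p ∷ inner i j p ++ [ last i j p ] → u ∈ internal i j p
      internal∈ {i} {j} {p} u∈ = subst (_ ∈_) (sym (internal≡ i j p)) u∈

      first∈ : ∀ i j p → first i j p ∈ internal i j p
      first∈ i j p = internal∈ (here refl)
      inner∈ : ∀ {i j p u} → u ∈ inner i j p → u ∈ internal i j p
      inner∈ u∈ = internal∈ (there (∈-++⁺ˡ u∈))
      last∈ : ∀ i j p → last i j p ∈ internal i j p
      last∈ i j p = internal∈ (there (∈-++⁺ʳ (inner i j p) (here refl)))

      first∉ : ∀ {i j p} → ¬ (first i j p ∈ inner i j p ++ [ last i j p ])
      first∉ {i} {j} {p} u∈ with internal! i j p
      ... | u∉ ∷ _ = All.lookup u∉ u∈ refl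

      inner-last : ∀ {i j p} → Unique (inner i j p) × ¬ (last i j p ∈ inner i j p)
      inner-last {i} {j} {p} with internal! i j p
      ... | _ ∷ u = snoc (inner i j p) u
        where
        snoc : ∀ {A : Set} (xs : List A) {y} → Unique (xs ++ [ y ]) → Unique xs × ¬ (y ∈ xs)
        snoc [] _ = [] , λ ()
        snoc (x ∷ xs) (x∉ ∷ u) with snoc xs u
        ... | xs! , y∉ = Allₚ.++⁻ˡ xs x∉ ∷ xs! , λ { (here refl) → All.lookup x∉ (∈-++⁺ʳ xs (here refl)) refl ; (there y∈) → y∉ y∈ }

      place : ∀ {i j : Fin Δ} → Tri (i Fin.< j) (i ≡ j) (j Fin.< i) → Fin n
      place {i} {j} (tri< p _ _) = first i j p
      place {i} {j} (tri≈ _ _ _) = branch i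
      place {i} {j} (tri> _ _ p) = last j i p

      slot : Fin Δ → Fin Δ → Fin n
      slot i j = place (Finₚ.<-cmp i j)

      innerᵈ : ∀ {i j} → Dec (i Fin.< j) → List (Fin n)
      innerᵈ {i} {j} (yes p) = inner i j p
      innerᵈ         (no _)  = []

      mid : Fin Δ × Fin Δ → List (Fin n)
      mid (i , j) = innerᵈ (i Finₚ.<? j)

      mid≡ : ∀ {i j} (p : i Fin.< j) → mid (i , j) ≡ inner i j p
      mid≡ {i} {j} p with i Finₚ.<? j
      ... | yes p′ = cong (inner i j) (ℕₚ.<-irrelevant p′ p)
      ... | no ¬p  = contradiction p ¬p

      slot< : ∀ {i j} (p : i Fin.< j) → slot i j ≡ first i j p
      slot< {i} {j} p with Finₚ.<-cmp i j
      ... | tri< p′ _ _ = cong (first i j) (ℕₚ.<-irrelevant p′ p)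
      ... | tri≈ ¬p _ _ = contradiction p ¬p
      ... | tri> ¬p _ _ = contradiction p ¬p

      slot> : ∀ {i j} (p : i Fin.< j) → slot j i ≡ last i j p
      slot> {i} {j} p with Finₚ.<-cmp j i
      ... | tri< _ _ ¬p = contradiction p ¬p
      ... | tri≈ _ _ ¬p = contradiction p ¬p
      ... | tri> _ _ p′ = cong (last i j) (ℕₚ.<-irrelevant p′ p)

      slot-diag : ∀ i → slot i i ≡ branch i
      slot-diag i with Finₚ.<-cmp i i
      ... | tri< p _ _ = contradiction p (ℕₚ.<-irrefl refl)
      ... | tri≈ _ _ _ = refl
      ... | tri> _ _ p = contradiction p (ℕₚ.<-irrefl refl)

      first≢last : ∀ {i j p i′ j′ p′} → first i j p ≢ last i′ j′ p′
      first≢last {i} {j} {p} {i′} {j′} {p′} e with internalDisjoint i j p i′ j′ p′ _ (first∈ i j p) (subst (_∈ internal i′ j′ p′) (sym e) (last∈ i′ j′ p′))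
      ... | refl , refl = first∉ {i} {j} {p} (∈-++⁺ʳ (inner i j p) (here (trans e (cong (last i j) (ℕₚ.<-irrelevant p′ p)))))

      not-branch : ∀ {i j p u k} → u ∈ internal i j p → u ≡ branch k → ∀ {X : Set} → X
      not-branch {i} {j} {p} {u} {k} u∈ e = ⊥-elim (internalNotBranch i j p u u∈ k e)

      place-injective : ∀ {i j i′ j′} (t : Tri (i Fin.< j) (i ≡ j) (j Fin.< i)) (t′ : Tri (i′ Fin.< j′) (i′ ≡ j′) (j′ Fin.< i′)) → place t ≡ place t′ → i ≡ i′ × j ≡ j′
      place-injective {i} {j} {i′} {j′} (tri< p _ _) (tri< p′ _ _) e = internalDisjoint i j p i′ j′ p′ _ (first∈ i j p) (subst (_∈ internal i′ j′ p′) (sym e) (first∈ i′ j′ p′))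
      place-injective {i} {j} (tri< p _ _) (tri≈ _ _ _) e = not-branch (first∈ i j p) e
      place-injective (tri< p _ _) (tri> _ _ p′) e = contradiction e first≢last
      place-injective {i′ = i′} {j′} (tri≈ _ _ _) (tri< p′ _ _) e = not-branch (first∈ i′ j′ p′) (sym e)
      place-injective (tri≈ _ refl _) (tri≈ _ refl _) e = branchInj e , branchInj e
      place-injective {i′ = i′} {j′} (tri≈ _ _ _) (tri> _ _ p′) e = not-branch (last∈ j′ i′ p′) (sym e)
      place-injective (tri> _ _ p) (tri< p′ _ _) e = contradiction (sym e) first≢last
      place-injective {i} {j} (tri> _ _ p) (tri≈ _ _ _) e = not-branch (last∈ j i p) e
      place-injective {i} {j} {i′} {j′} (tri> _ _ p) (tri> _ _ p′) e with internalDisjoint j i p j′ i′ p′ _ (last∈ j i p) (subst (_∈ internal j′ i′ p′) (sym e) (last∈ j′ i′ p′))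
      ... | e₁ , e₂ = e₂ , e₁

      off-place : ∀ {i j u} (p : i Fin.< j) → u ∈ inner i j p → ∀ {i′ j′} (t : Tri (i′ Fin.< j′) (i′ ≡ j′) (j′ Fin.< i′)) → u ≢ place t
      off-place {i} {j} {u} p u∈ {i′} {j′} (tri< p′ _ _) refl with internalDisjoint i j p i′ j′ p′ _ (inner∈ u∈) (first∈ i′ j′ p′)
      ... | refl , refl = first∉ {i} {j} {p′} (∈-++⁺ˡ (subst (λ r → first i j p′ ∈ inner i j r) (ℕₚ.<-irrelevant p p′) u∈))
      off-place {i} {j} p u∈ (tri≈ _ _ _) e = not-branch (inner∈ {i} {j} {p} u∈) e
      off-place {i} {j} {u} p u∈ {i′} {j′} (tri> _ _ p′) refl with internalDisjoint i j p j′ i′ p′ _ (inner∈ u∈) (last∈ j′ i′ p′)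
      ... | refl , refl = proj₂ (inner-last {i} {j} {p′}) (subst (λ r → last i j p′ ∈ inner i j r) (ℕₚ.<-irrelevant p p′) u∈)

      mid-inner : ∀ {i j u} → u ∈ mid (i , j) → ∃ λ p → u ∈ inner i j p
      mid-inner {i} {j} u∈ with i Finₚ.<? j
      ... | yes p = p , u∈

      adjacent : ∀ {i j u v} (p : i Fin.< j) → Consec u v (branch i ∷ first i j p ∷ inner i j p ++ last i j p ∷ branch j ∷ []) → Adj u v
      adjacent {i} {j} {u} {v} p c = pathWalk i j p u v (subst (Consec u v) (sym (path≡ i j p)) c)

      star-at : ∀ {i j} → i ≢ j → (t : Tri (i Fin.< j) (i ≡ j) (j Fin.< i)) → Adj (branch i) (place t)
      star-at _ (tri< p _ _) = adjacent p here
      star-at i≢j (tri≈ _ e _) = contradiction e i≢j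
      star-at {i} {j} _ (tri> _ _ p) = adjSym (adjacent p (there (consec-last (first j i p ∷ inner j i p) _ _)))

      route≡ : ∀ {i j} (p : i Fin.< j) → _≡_ {A = List (Fin n)} (slot i j ∷ mid (i , j) ++ [ slot j i ]) (first i j p ∷ inner i j p ++ [ last i j p ])
      route≡ p rewrite slot< p | mid≡ p | slot> p = refl

      consec-init : ∀ {A : Set} {u v : A} xs {b z} → Consec u v (xs ++ [ b ]) → Consec u v (xs ++ b ∷ z ∷ [])
      consec-init []           (there ())
      consec-init (x ∷ [])     here      = here
      consec-init (x ∷ y ∷ xs) here      = here
      consec-init (x ∷ xs)     (there c) = there (consec-init xs c)

    subdivision : CliqueSubdivision Δ n m Adj
    subdivision = record
      { slot = slot
      ; mid = mid
      ; slot-injective = λ {i} {j} {i′} {j′} → place-injective (Finₚ.<-cmp i j) (Finₚ.<-cmp i′ j′)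
      ; mid! = λ {i} {j} p → subst Unique (sym (mid≡ p)) (proj₁ (inner-last {i} {j} {p}))
      ; off-slot = λ {i} {j} p u∈ i′ j′ → off-place p (subst (_ ∈_) (mid≡ p) u∈) (Finₚ.<-cmp i′ j′)
      ; disjoint = λ {t} {t′} → mid-disjoint t t′
      ; long = λ {i} {j} p → subst (λ xs → m ≤ length xs) (sym (mid≡ p)) (proj₂ (proj₂ (proj₂ (proj₂ (ends i j p)))))
      ; star = λ {i} {j} i≢j → subst (λ u → Adj u (slot i j)) (sym (slot-diag i)) (star-at i≢j (Finₚ.<-cmp i j))
      ; middle = λ {i} {j} p {u} {v} c → adjacent p (there (consec-init (first i j p ∷ inner i j p) (subst (Consec u v) (route≡ p) c)))
      }
      where
      mid-disjoint : ∀ t t′ {u} → u ∈ mid t → u ∈ mid t′ → t ≡ t′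
      mid-disjoint (i , j) (i′ , j′) u∈ u∈′ with mid-inner u∈ | mid-inner u∈′
      ... | p , a | p′ , b with internalDisjoint i j p i′ j′ p′ _ (inner∈ a) (inner∈ b)
      ... | refl , refl = refl

    open CliqueSubdivision subdivision using (Covered; Edge; star-edge; middle-edge; reverse)

    covered : ∀ v → Covered v
    covered v with coversVertices v
    ... | inj₁ (k , e) = inj₁ (k , k , trans e (sym (slot-diag k)))
    ... | inj₂ (i , j , p , v∈) with subst (v ∈_) (internal≡ i j p) v∈
    ... | here e = inj₁ (i , j , trans e (sym (slot< p)))
    ... | there v∈′ with ∈-++⁻ (inner i j p) v∈′
    ... | inj₁ w = inj₂ (i , j , p , subst (v ∈_) (sym (mid≡ p)) w)
    ... | inj₂ (here e) = inj₁ (j , i , trans e (sym (slot> p)))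

    edge : ∀ {u v} → Adj u v → Edge u v
    edge {u} {v} a with coversEdges u v a
    ... | i , j , p , c = Sum.[ on-path i j p , (λ c → reverse (on-path i j p c)) ]′ c
      where
      on-path : ∀ i j p {u v} → Consec u v (pathOf i j p) → Edge u v
      on-path i j p {u} {v} c with subst (Consec u v) (path≡ i j p) c
      ... | here = star-edge {i = i} {j = j} (λ { refl → ℕₚ.<-irrefl refl p }) (sym (slot-diag i)) (sym (slot< p))
      ... | there c′ with consec-snoc (first i j p ∷ inner i j p) c′
      ... | inj₁ c″ = middle-edge p (subst (Consec u v) (sym (route≡ p)) c″)
      ... | inj₂ (u≡ , v≡) = reverse (star-edge {i = j} {j = i} (λ { refl → ℕₚ.<-irrefl refl p }) (trans v≡ (sym (slot-diag j))) (trans u≡ (sym (slot> p))))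

module Universal where

  open import Defs using (Consec; here; there)
  open SumLib
  open NatSum
  open Extension
  open Connect
  open Host
  open Embed
  open Numerics
  open Subdivide
  import Data.Fin as Fin
  import Data.Fin.Properties as Finₚ
  open import Data.List.Properties using (map-∘; ∷-injectiveˡ; ∷-injectiveʳ)
  import Data.List.Membership.DecPropositional as DecM
  open import Data.List.Relation.Unary.All as All using ([]; _∷_)
  import Data.List.Relation.Unary.Unique.Propositional.Properties as Uniq
  open import Data.Nat using (ℕ; suc; _+_; _*_; _^_; _≤_; _<_; z≤n; s≤s; NonZero)
  import Data.Nat as ℕ
  import Data.Nat.Properties as ℕₚ
  open import Data.Nat.Tactic.RingSolver using (solve-∀)

  map-≡-at : ∀ {A B : Set} {f g : A → B} xs → map f xs ≡ map g xs → ∀ {x} → x ∈ xs → f x ≡ g x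
  map-≡-at (x ∷ xs) e (here refl) = ∷-injectiveˡ e
  map-≡-at (x ∷ xs) e (there x∈)  = map-≡-at xs (∷-injectiveʳ e) x∈

  module Membership {V : Set} (FV : Finite V) where
    open Finite FV using (_≟_)

    member : List V → V → Bool
    member zs x = ⌊ DecM._∈?_ _≟_ x zs ⌋

    member⁻ : ∀ {zs x} → member zs x ≡ true → x ∈ zs
    member⁻ {zs} {x} e with DecM._∈?_ _≟_ x zs
    ... | yes x∈ = x∈

    member⁺ : ∀ {zs x} → x ∈ zs → member zs x ≡ true
    member⁺ {zs} {x} x∈ with DecM._∈?_ _≟_ x zs
    ... | yes _  = refl
    ... | no x∉ = contradiction x∈ x∉

  module Placement {V C : Set} (FV : Finite V) (v₀ : V) (_≟C_ : DecidableEquality C) (R : List C)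
                   (adj : C → V → V → Bool) (adj-sym : ∀ c x y → adj c x y ≡ true → adj c y x ≡ true)
                   (U A W : V → Bool) (A⊆U : ∀ {x} → A x ≡ true → U x ≡ true) (W⊆U : ∀ {x} → W x ≡ true → U x ≡ true) (A∩W : ∀ x → A x ≡ true → W x ≡ false)
                   (Ps : List (C × V)) (Ps! : Unique Ps) (∈Ps : ∀ {c x} → c ∈ R → U x ≡ true → (c , x) ∈ Ps) (κ : ℕ) .{{_ : NonZero κ}}
                   (joined : Connection.Joined FV _≟C_ R adj adj-sym U Ps Ps! ∈Ps κ)
                   (initially-extendable : ∀ st → (∀ y → W y ≡ true → st y ≡ free) → Connection.Extendable FV _≟C_ R adj adj-sym U Ps Ps! ∈Ps κ st)
                   (M h : ℕ) (dense : ∀ {c} → c ∈ R → ∀ Xs Ys → Unique Xs → Unique Ys → M < length Xs * length Ys → ∃₂ λ u v → u ∈ Xs × v ∈ Ys × adj c u v ≡ true)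
                   (M<4^h : M < 2 ^ h * 2 ^ h) (2^h≤2κ : 2 ^ h ≤ 2 * κ)
                   {Δ n m : ℕ} (Adj : Fin n → Fin n → Set) (f : Fin n → Fin n → C) (f∈R : ∀ {u v} → Adj u v → f u v ∈ R)
                   (S : CliqueSubdivision Δ n m Adj) (h+h≤m : h + h ≤ m)
                   (s : Fin Δ → Fin Δ → V) (s∈A : ∀ i j → A (s i j) ≡ true) (s-injective : ∀ {i j i′ j′} → s i j ≡ s i′ j′ → i ≡ i′ × j ≡ j′)
                   (room : n + 27 * κ ≤ count (elems FV) U) where
    open Finite FV using (_≟_; complete)
    open CliqueSubdivision S
    open EdgeColours f
    open Membership FV

    open Assembly FV _≟C_ R adj adj-sym U Ps Ps! ∈Ps κ joined M h dense M<4^h 2^h≤2κ Δ n f slot slot-injective mid s s-injective room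
    open Assign {Fin n} {V} Finₚ._≟_

    private
      values : List V
      values = map (uncurry s) (pairs Δ)

      ∈pairs : ∀ i j → (i , j) ∈ pairs Δ
      ∈pairs i j = Finite.complete (×-finite (Fin-finite Δ) (Fin-finite Δ)) (i , j)

      φ₀ : Fin n → V
      φ₀ = assign slots values (λ _ → v₀)

      φ₀-slot : ∀ i j → φ₀ (slot i j) ≡ s i j
      φ₀-slot i j = map-≡-at {f = λ t → φ₀ (uncurry slot t)} {g = uncurry s} (pairs Δ)
        (trans (map-∘ (pairs Δ)) (map-assign slots values (λ _ → v₀) slots! (trans (length-map (uncurry slot) (pairs Δ)) (sym (length-map (uncurry s) (pairs Δ)))))) (∈pairs i j)

      status : Bool → Bool → Status (C × V)
      status true false = free
      status _    _     = outside

      st₀ : State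
      st₀ y = status (U y) (member values y)

      not-child : ∀ {u w p} → status u w ≢ child p
      not-child {true}  {true}  ()
      not-child {true}  {false} ()
      not-child {false} {_}     ()

      inv₀ : Inv st₀
      inv₀ .Inv.wf {y} {p} e = contradiction e (not-child {U y} {member values y} {p})
      inv₀ .Inv.ext = initially-extendable st₀ (λ y Wy → cong₂ status (W⊆U Wy) (unused y Wy))
        where
        unused : ∀ y → W y ≡ true → member values y ≡ false
        unused y Wy with bool-cases (member values y)
        ... | inj₂ e = e
        ... | inj₁ e with ∈-map⁻ (uncurry s) (member⁻ {values} e)
        ... | (i , j) , _ , refl = true≢false Wy (A∩W y (s∈A i j))
      inv₀ .Inv.inU y ne with bool-cases (U y)
      ... | inj₁ e = e
      ... | inj₂ e = contradiction (cong (λ u → status u (member values y)) e) ne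
      inv₀ .Inv.fresh y _ z c e = not-child {U z} {member values z} {c , y} e

      is-slot : ∀ {u} → u ∈ slots → ∃₂ λ i j → u ≡ slot i j
      is-slot u∈ with ∈-map⁻ (uncurry slot) u∈
      ... | (i , j) , _ , e = i , j , e

      placed₀ : ∀ {u} → u ∈ slots → U (φ₀ u) ≡ true × st₀ (φ₀ u) ≢ free
      placed₀ u∈ with is-slot u∈
      ... | i , j , refl = subst (λ z → U z ≡ true × st₀ z ≢ free) (sym (φ₀-slot i j)) (A⊆U (s∈A i j) , not-free)
        where
        not-free : st₀ (s i j) ≢ free
        not-free e = contradiction (trans (sym e) (trans (cong (status (U (s i j))) (member⁺ {values} (∈-map⁺ (uncurry s) (∈pairs i j)))) (used (U (s i j))))) (λ ())
          where
          used : ∀ u → status u true ≡ outside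
          used true  = refl
          used false = refl

      φ₀-inj : ∀ {u v} → u ∈ slots → v ∈ slots → φ₀ u ≡ φ₀ v → u ≡ v
      φ₀-inj u∈ v∈ e with is-slot u∈ | is-slot v∈
      ... | i , j , refl | i′ , j′ , refl = let (p , p′) = s-injective (trans (sym (φ₀-slot i j)) (trans e (φ₀-slot i′ j′))) in cong₂ slot p p′

      size₀ : count Vs U ≤ #free st₀ + length slots
      size₀ = begin
        count Vs U ≤⟨ ∑-mono Vs (λ y → pointwise (U y) (member values y)) ⟩
        ∑ Vs (λ y → [ isFree st₀ y ]ᵇ + [ member values y ]ᵇ) ≡⟨ ∑-∙ Vs _ _ ⟩
        #free st₀ + count Vs (member values) ≤⟨ ℕₚ.+-monoʳ-≤ (#free st₀) (count-member FV values) ⟩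
        #free st₀ + length values ≡⟨ cong (#free st₀ +_) (trans (length-map (uncurry s) (pairs Δ)) (sym (length-map (uncurry slot) (pairs Δ)))) ⟩
        #free st₀ + length slots ∎
        where
        open ℕₚ.≤-Reasoning
        pointwise : ∀ u w → [ u ]ᵇ ≤ [ freeᵇ (status u w) ]ᵇ + [ w ]ᵇ
        pointwise true  true  = s≤s z≤n
        pointwise true  false = s≤s z≤n
        pointwise false _     = z≤n

      initial : Partial [] (increasing Δ)
      initial .Partial.φ = φ₀
      initial .Partial.st = st₀
      initial .Partial.dom = slots
      initial .Partial.inv = inv₀
      initial .Partial.dom! = slots!
      initial .Partial.placed {u} = placed₀ {u}
      initial .Partial.φ-inj {u} {v} = φ₀-inj {u} {v}
      initial .Partial.size = size₀
      initial .Partial.dom⊆ u∈ = inj₁ (is-slot u∈)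
      initial .Partial.slots∈ i j = ∈-map⁺ (uncurry slot) (∈pairs i j)
      initial .Partial.mids∈ ()
      initial .Partial.φ-slot = φ₀-slot
      initial .Partial.chains ()
      initial .Partial.roots {i} {j} _ = (λ z c → not-child {U z} {member values z} {c , s i j}) , (λ z c → not-child {U z} {member values z} {c , s j i})

      cols∈R : ∀ x xs → (∀ {u v} → Consec u v (x ∷ xs) → Adj u v) → All (_∈ R) (cols x xs)
      cols∈R x []       _ = []
      cols∈R x (y ∷ ys) w = f∈R (w here) ∷ cols∈R y ys (λ c → w (there c))

      admissible : ∀ {t} → proj₁ t Fin.< proj₂ t → Admissible t
      admissible {i , j} i<j = record
        { ordered = i<j ; mid! = mid! i<j ; off-slot = λ {u} → off-slot i<j ; disjoint = λ {t′} {u} → disjoint {i , j} {t′} {u}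
        ; colours = cols∈R (slot i j) (mid (i , j) ++ [ slot j i ]) (middle i<j)
        ; long = s≤s (ℕₚ.≤-trans h+h≤m (long i<j)) }

      complete-assembly : Complete (increasing Δ) []
      complete-assembly = place-all (increasing Δ) {[]} (All.tabulate (λ {t} t∈ → admissible {t} (∈-increasing⁻ t∈))) (increasing! Δ) (λ ()) initial

      module Result = Complete complete-assembly
      open Partial Result.partial

      walk-consec : ∀ {u v} φ x xs → Walk joined (cols x xs) (φ x) (map φ xs) → Consec u v (x ∷ xs) → adj (f u v) (φ u) (φ v) ≡ true
      walk-consec φ x (y ∷ ys) (a ∷ w) here      = a
      walk-consec φ x (y ∷ ys) (a ∷ w) (there c) = walk-consec φ y ys w c

      ∈dom : ∀ {u} → Covered u → u ∈ dom
      ∈dom (inj₁ (i , j , refl))       = slots∈ i j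
      ∈dom (inj₂ (i , j , i<j , u∈)) = mids∈ (Result.⊇todo (∈-increasing i<j)) u∈

    placement : ∃ λ φ → (∀ {u v} → Covered u → Covered v → φ u ≡ φ v → u ≡ v) × (∀ {u} → Covered u → U (φ u) ≡ true) × (∀ i j → φ (slot i j) ≡ s i j)
                × (∀ {i j} → i Fin.< j → ∀ {u v} → Consec u v (slot i j ∷ mid (i , j) ++ [ slot j i ]) → adj (f u v) (φ u) (φ v) ≡ true)
    placement = φ , (λ cu cv → φ-inj (∈dom cu) (∈dom cv)) , (λ cu → proj₁ (placed (∈dom cu))) , φ-slot
      , (λ {i} {j} i<j → walk-consec φ (slot i j) (mid (i , j) ++ [ slot j i ]) (chains (Result.⊇todo (∈-increasing i<j))))

  module UniversalHost {V C : Set} (FV : Finite V) (v₀ : V) (_≟C_ : DecidableEquality C) (R : List C) (R! : Unique R)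
                       (adj : C → V → V → Bool) (adj-sym : ∀ c x y → adj c x y ≡ true → adj c y x ≡ true)
                       (irreflexive : ∀ c x → c ∈ R → adj c x x ≡ false) (q M : ℕ)
                       (discrepancy : ∀ {c} → c ∈ R → ∀ X Y g → (∀ x → X x ≡ true → PseudorandomHost.Discrepant FV _≟C_ R R! adj adj-sym q M c x Y g) → count (elems FV) X * (g * g) ≤ M * count (elems FV) Y)
                       (κ : ℕ) .{{_ : NonZero κ}} (ρM≤κ² : length R * M ≤ κ * κ)
                       (h : ℕ) (M<4^h : M < 2 ^ h * 2 ^ h) (2^h≤2κ : 2 ^ h ≤ 2 * κ)
                       {Δ n m : ℕ} (Adj : Fin n → Fin n → Set) (f : Fin n → Fin n → C) (f∈R : ∀ {u v} → Adj u v → f u v ∈ R)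
                       (S : CliqueSubdivision Δ n m Adj) (h+h≤m : h + h ≤ m) (2≤m : 2 ≤ m)
                       (E : List V) (E! : Unique E) (room : n + 29 * κ ≤ length E) (4qΔ≤E : 4 * (q * Δ) ≤ length E) where
    open Finite FV using (_≟_; complete)
    open CliqueSubdivision S
    open Membership FV
    private
      Vs = elems FV

      11κ≤E : 11 * κ ≤ length E
      11κ≤E = ℕₚ.≤-trans (ℕₚ.≤-trans (ℕₚ.*-monoˡ-≤ κ (ℕₚ.≤ᵇ⇒≤ 11 29 _)) (ℕₚ.m≤n+m _ n)) room

      W₀ = take (11 * κ) E

      ∣take∣ : length W₀ ≡ 11 * κ
      ∣take∣ = trans (length-take (11 * κ) E) (ℕₚ.m≤n⇒m⊓n≡m 11κ≤E)

      ∣W₀∣ : count Vs (member W₀) ≡ 11 * κ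
      ∣W₀∣ = trans (ℕₚ.≤-antisym (count-member FV W₀) (count-unique FV (Uniq.take⁺ (11 * κ) E!))) ∣take∣

      take⊆ : ∀ {A : Set} k (xs : List A) {x} → x ∈ take k xs → x ∈ xs
      take⊆ (suc k) (y ∷ xs) (here e)   = here e
      take⊆ (suc k) (y ∷ xs) (there x∈) = there (take⊆ k xs x∈)

      W₀⊆E : ∀ x → member W₀ x ≡ true → member E x ≡ true
      W₀⊆E x e = member⁺ (take⊆ (11 * κ) E (member⁻ e))

      E≤count : length E ≤ count Vs (member E)
      E≤count = count-unique FV E!

    open PseudorandomHost.Split FV _≟C_ R R! adj adj-sym q M discrepancy κ ρM≤κ² (member E) (member W₀) W₀⊆E ∣W₀∣

    private
      1≤κ : 1 ≤ κ
      1≤κ = ℕ.>-nonZero⁻¹ κ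

      star-center : ∀ Y → count Vs A ≤ count Vs Y + Δ * Δ → ∃ λ v → Y v ≡ true × (∀ {c} → c ∈ R → Δ ≤ count Vs (λ y → adj c v y ∧ Y y))
      star-center Y A≤Y = PseudorandomHost.center FV _≟C_ R R! adj adj-sym q M discrepancy κ ρM≤κ² Y Δ (length E) 4qΔ≤E
        (many-left {n} {length E} {κ} {Δ} {count Vs A} {count Vs Y} 1≤κ room (2Δ²≤n+Δ 2≤m) (ℕₚ.≤-trans E≤count ∣A∣) A≤Y)

      col : Fin Δ → Fin Δ → C
      col i j = f (slot i i) (slot i j)

      placed-stars = Stars.stars FV v₀ adj R irreflexive Δ col (λ i j i≢j → f∈R (star i≢j)) A star-center

      s : Fin Δ → Fin Δ → V
      s = proj₁ placed-stars

      s∈A : ∀ i j → A (s i j) ≡ true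
      s∈A = proj₁ (proj₂ placed-stars)

      s-injective : ∀ {i j i′ j′} → s i j ≡ s i′ j′ → i ≡ i′ × j ≡ j′
      s-injective {i} {j} {i′} {j′} = proj₁ (proj₂ (proj₂ placed-stars)) {i} {i′} {j} {j′}

      s-adj : ∀ i j → i ≢ j → adj (col i j) (s i i) (s i j) ≡ true
      s-adj = proj₂ (proj₂ (proj₂ placed-stars))

      roomU : n + 27 * κ ≤ count Vs U
      roomU = ℕₚ.+-cancelʳ-≤ (2 * κ) _ _ (ℕₚ.≤-trans (ℕₚ.≤-reflexive (arith n κ)) (ℕₚ.≤-trans room (ℕₚ.≤-trans E≤count ∣U∣)))
        where
        arith : ∀ n κ → n + 27 * κ + 2 * κ ≡ n + 29 * κ
        arith = solve-∀

      dense-host : ∀ {c} → c ∈ R → ∀ Xs Ys → Unique Xs → Unique Ys → M < length Xs * length Ys → ∃₂ λ u v → u ∈ Xs × v ∈ Ys × adj c u v ≡ true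
      dense-host = PseudorandomHost.dense FV _≟C_ R R! adj adj-sym q M discrepancy κ ρM≤κ²

      placement = Placement.placement FV v₀ _≟C_ R adj adj-sym U A W (λ {x} → ∨-trueˡ {A x} {W x}) (λ {x} → ∨-trueʳ {A x} {W x}) A∩W Ps Ps! ∈Ps κ joined initially-extendable
        M h dense-host M<4^h 2^h≤2κ Adj f f∈R S h+h≤m s s∈A s-injective roomU

      φ = proj₁ placement
      φ-slot = proj₁ (proj₂ (proj₂ (proj₂ placement)))

    embedding : ∃ λ φ → (∀ {u v} → Covered u → Covered v → φ u ≡ φ v → u ≡ v) × (∀ {u} → Covered u → φ u ∈ E)
                × (∀ {i j} → i ≢ j → adj (f (slot i i) (slot i j)) (φ (slot i i)) (φ (slot i j)) ≡ true)
                × (∀ {i j} → i Fin.< j → ∀ {u v} → Consec u v (slot i j ∷ mid (i , j) ++ [ slot j i ]) → adj (f u v) (φ u) (φ v) ≡ true)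
    embedding = φ , proj₁ (proj₂ placement) , (λ {u} cu → member⁻ (U⊆E (φ u) (proj₁ (proj₂ (proj₂ placement)) cu)))
      , (λ {i} {j} i≢j → trans (cong₂ (adj (col i j)) (φ-slot i i) (φ-slot i j)) (s-adj i j i≢j))
      , proj₂ (proj₂ (proj₂ (proj₂ placement)))

module Main where

  open import Defs
  open SumLib
  open FieldLib
  open Poly using (Vec-finite)
  open Weil using (module WeilBound)
  open DistanceHost using (module DistanceGraphs; module SphereDiscrepancy)
  open Numerics
  open Subdivide
  open Universal
  import Data.Fin as Fin
  import Data.Fin.Properties as Finₚ
  open import Data.Nat using (ℕ; suc; _+_; _*_; _^_; _∸_; _≤_; _<_; z≤n; s≤s; NonZero; ⌈_/2⌉)
  import Data.Nat as ℕ
  open import Data.Nat.Logarithm using (⌈log₂_⌉)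
  open import Data.Nat.Primality using (Prime)
  import Data.Nat.Properties as ℕₚ
  import Data.Sum as Sum

  -- Without colours there are no paths, so the subdivided clique has at most one vertex.
  no-colours : ∀ (𝔽 : FiniteField) {d Δ ℓ H} (E : List (Vec (FiniteField.F 𝔽) d)) {m} → m < length E * length E → IsRDistance 𝔽 [] H → SubdivisionOfK 𝔽 Δ ℓ H → Contains 𝔽 E H
  no-colours 𝔽 {H = H} (x ∷ _) _ noAdj S = (λ _ → x) , (λ {u} {v} _ → same u v) , (λ _ → here refl) , (λ u v a → contradiction (noAdj u v a) (λ ()))
    where
    open DistanceGraph H
    open SubdivisionOfK S
    no-pair : ∀ i j → ¬ (i Fin.< j)
    no-pair i j p with internal i j p | pathWalk i j p
    ... | []    | w = contradiction (noAdj _ _ (w _ _ here)) (λ ())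
    ... | _ ∷ _ | w = contradiction (noAdj _ _ (w _ _ here)) (λ ())
    same-branch : ∀ i j → i ≡ j
    same-branch i j with Finₚ.<-cmp i j
    ... | tri< p _ _ = contradiction p (no-pair i j)
    ... | tri≈ _ e _ = e
    ... | tri> _ _ p = contradiction p (no-pair j i)
    is-branch : ∀ v → ∃ λ i → v ≡ branch i
    is-branch v = Sum.[ (λ b → b) , (λ (i , j , p , _) → contradiction p (no-pair i j)) ]′ (coversVertices v)
    same : ∀ u v → u ≡ v
    same u v with is-branch u | is-branch v
    ... | i , u≡ | j , v≡ = trans u≡ (trans (cong branch (same-branch i j)) (sym v≡))

  module _ (𝔽 : FiniteField) (p k : ℕ) (pr : Prime p) (p≢2 : p ≢ 2) (1≤k : 1 ≤ k) (q≡p^k : FiniteField.order 𝔽 ≡ p ^ k) (d : ℕ) (2≤d : 2 ≤ d)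
           (E : List (Vec (FiniteField.F 𝔽) d)) (E! : Unique E) (R : List (FiniteField.F 𝔽)) (R! : Unique R) (R≢0 : ∀ r → r ∈ R → ¬ (r ≡ FiniteField.0# 𝔽)) (1≤ρ : 1 ≤ length R)
           (Δ : ℕ) (H : DistanceGraph 𝔽) (isR : IsRDistance 𝔽 R H) (S : SubdivisionOfK 𝔽 Δ ((d + 2) * ⌈log₂ FiniteField.order 𝔽 ⌉ + 16) H) where
    open Field 𝔽 using (F; q; 0F; _≟F_; finite)
    open DistanceGraphs 𝔽 using (adj; adj-true; adj-sym; adj-irreflexive; ‖⊝‖-sym)
    open DistanceGraph H

    private
      M = 5 * q ^ suc d
      L = ⌈log₂ q ⌉

      3≤q : 3 ≤ q
      3≤q = WeilBound.3≤q 𝔽 p k pr p≢2 1≤k q≡p^k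

    module _ (κ : ℕ) .{{_ : NonZero κ}} (ρM≤κ² : length R * M ≤ κ * κ)
             (h : ℕ) (M<4^h : M < 2 ^ h * 2 ^ h) (2^h≤2κ : 2 ^ h ≤ 2 * κ) (h≤ : h ≤ ⌈ 3 + L * suc d /2⌉)
             (room : n + 29 * κ ≤ length E) (4qΔ≤E : 4 * (q * Δ) ≤ length E) where
      private
        m = (h + h) ℕ.⊔ 2

        3+m≤ℓ : 3 + m ≤ (d + 2) * L + 16
        3+m≤ℓ = Sum.[ (λ le → subst (λ x → 3 + x ≤ (d + 2) * L + 16) (sym (ℕₚ.m≤n⇒m⊔n≡n le)) (ℕₚ.≤-trans (ℕₚ.≤ᵇ⇒≤ 5 16 _) (ℕₚ.m≤n+m 16 _)))
          , (λ le → subst (λ x → 3 + x ≤ (d + 2) * L + 16) (sym (ℕₚ.m≥n⇒m⊔n≡m le)) (path-length L d h≤)) ]′ (ℕₚ.≤-total (h + h) 2)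

        CS : CliqueSubdivision Δ n m Adj
        CS = subdivision S 3+m≤ℓ

        open CliqueSubdivision CS

        EmbeddedIn : (Fin n → Vec F d) → Set
        EmbeddedIn φ = (∀ {u v} → Covered u → Covered v → φ u ≡ φ v → u ≡ v) × (∀ {u} → Covered u → φ u ∈ E)
          × (∀ {i j} → i ≢ j → adj (f (slot i i) (slot i j)) (φ (slot i i)) (φ (slot i j)) ≡ true)
          × (∀ {i j} → i Fin.< j → ∀ {u v} → Consec u v (slot i j ∷ mid (i , j) ++ [ slot j i ]) → adj (f u v) (φ u) (φ v) ≡ true)

        embedded = UniversalHost.embedding {Vec F d} {F} (Vec-finite finite d) (replicate d 0F) _≟F_ R R! adj adj-sym (λ c x c∈ → adj-irreflexive c x (R≢0 c c∈)) q M
          (λ {c} c∈ X Y g → SphereDiscrepancy.degree-discrepancy 𝔽 p k pr p≢2 1≤k q≡p^k d c (R≢0 c c∈) Y X g) κ ρM≤κ² h M<4^h 2^h≤2κ {Δ} {n} {m} Adj f (λ {u} {v} → isR u v) CS (ℕₚ.m≤m⊔n (h + h) 2) (ℕₚ.m≤n⊔m (h + h) 2) E E! room 4qΔ≤E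

        edges : ∀ φ → EmbeddedIn φ → ∀ {u v} → Edge u v → Adj u v → Defs.‖_‖ 𝔽 (Defs._-ᵥ_ 𝔽 (φ u) (φ v)) ≡ f u v
        edges φ (_ , _ , star , _) {u} {v} (star-edge i≢j refl refl) a = adj-true (f u v) (φ u) (φ v) (star i≢j)
        edges φ (_ , _ , _ , middle) {u} {v} (middle-edge i<j c) a = adj-true (f u v) (φ u) (φ v) (middle i<j c)
        edges φ em {u} {v} (reverse e) a = trans (‖⊝‖-sym (φ u) (φ v)) (trans (edges φ em e (adjSym a)) (fSym (adjSym a)))

        conclude : ∃ EmbeddedIn → Contains 𝔽 E H
        conclude (φ , em@(inj , φ∈E , _)) = φ , (λ {u} {v} → inj (covered S 3+m≤ℓ u) (covered S 3+m≤ℓ v)) , (λ v → φ∈E (covered S 3+m≤ℓ v)) , (λ u v a → edges φ em (edge S 3+m≤ℓ a) a)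

      contained : Contains 𝔽 E H
      contained = conclude embedded

    contains : (72 * 72) * length R * q ^ (d + 1) < length E * length E → n ≤ length E → (72 * 72) * length R * q ^ (d + 1) ≤ (length E ∸ n) * (length E ∸ n) →
               3 ≤ d ⊎ (d ≡ 2 × 4 * q * Δ ≤ length E) → Contains 𝔽 E H
    contains N²> n≤N gap dim = with-root (⌈√⌉ (length R * M))
      where
      4qΔ≤E : 4 * (q * Δ) ≤ length E
      4qΔ≤E = Sum.[ (λ 3≤d → 4qΔ≤N {q} {d} {length R} {length E} {Δ} (ℕₚ.≤-trans (s≤s z≤n) 3≤q) 3≤d 1≤ρ N²> (ℕₚ.≤-trans (CliqueSubdivision.Δ²≤n (subdivision {m = 2} S (ℕₚ.≤-trans (ℕₚ.≤ᵇ⇒≤ 5 16 _) (ℕₚ.m≤n+m 16 _))) ℕₚ.≤-refl) n≤N))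
             , (λ (_ , le) → subst (_≤ length E) (ℕₚ.*-assoc 4 q Δ) le) ]′ dim
      with-root : (∃ λ κ → length R * M ≤ κ * κ × (∀ {j} → j < κ → j * j < length R * M)) → Contains 𝔽 E H
      with-root (κ , ρM≤κ² , least) = with-power (least-power {M} {κ} {{κ≢0}} M≤κ² ⌈ 3 + L * suc d /2⌉ (5q^d<4^ q L (suc d) (n≤2^⌈log₂n⌉ q)))
        where
        κ≢0 : NonZero κ
        κ≢0 = ℕ.>-nonZero (ℕₚ.≤-trans (s≤s z≤n) (12≤κ {q} {d} {length R} {κ} 3≤q 2≤d 1≤ρ least ρM≤κ²))
        M≤κ² : M ≤ κ * κ
        M≤κ² = ℕₚ.≤-trans (ℕₚ.≤-trans (ℕₚ.≤-reflexive (sym (ℕₚ.*-identityˡ M))) (ℕₚ.*-monoˡ-≤ M 1≤ρ)) ρM≤κ²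
        with-power : (∃ λ h → M < 2 ^ h * 2 ^ h × 2 ^ h ≤ 2 * κ × h ≤ ⌈ 3 + L * suc d /2⌉) → Contains 𝔽 E H
        with-power (h , M<4^h , 2^h≤2κ , h≤) = contained κ {{κ≢0}} ρM≤κ² h M<4^h 2^h≤2κ h≤ (n+29κ≤N {q} {d} {length R} {κ} 3≤q 2≤d 1≤ρ least ρM≤κ² {n} {length E} n≤N gap) 4qΔ≤E

open import Defs
open import Data.Nat using (ℕ; _+_; _*_; _^_; _∸_; _≤_; _<_)
open import Data.Nat.Logarithm using (⌈log₂_⌉)
open import Data.Vec using (Vec)
open import Data.List using (List; length)
open import Data.List.Membership.Propositional using (_∈_)
open import Data.List.Relation.Unary.Unique.Propositional using (Unique)
open import Data.Product using (_×_)
open import Data.Sum using (_⊎_)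
open import Relation.Nullary using (¬_)
open import Relation.Binary.PropositionalEquality using (_≡_)

theorem1p7 : (𝔽 : FiniteField) → OddPrimePower (FiniteField.order 𝔽)
    → (d : ℕ) → 2 ≤ d
    → (E : List (Vec (FiniteField.F 𝔽) d)) → Unique E
    → (R : List (FiniteField.F 𝔽)) → Unique R
    → (∀ r → r ∈ R → ¬ (r ≡ FiniteField.0# 𝔽))
    → (72 * 72) * length R * FiniteField.order 𝔽 ^ (d + 1) < length E * length E
    → (Δ : ℕ) → (H : DistanceGraph 𝔽) → IsRDistance 𝔽 R H
    → SubdivisionOfK 𝔽 Δ ((d + 2) * ⌈log₂ FiniteField.order 𝔽 ⌉ + 16) H
    → DistanceGraph.n H ≤ length E
    → (72 * 72) * length R * FiniteField.order 𝔽 ^ (d + 1)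
    ≤ (length E ∸ DistanceGraph.n H) * (length E ∸ DistanceGraph.n H)
    → (3 ≤ d ⊎ (d ≡ 2 × 4 * FiniteField.order 𝔽 * Δ ≤ length E))
    → Contains 𝔽 E H
theorem1p7 𝔽 _ _ _ E _ [] _ _ N²> _ _ isR S _ _ _ = Main.no-colours 𝔽 E N²> isR S
theorem1p7 𝔽 (p , k , pr , p≢2 , 1≤k , q≡p^k) d 2≤d E E! R@(_ ∷ _) R! R≢0 N²> Δ H isR S n≤N gap dim =
  Main.contains 𝔽 p k pr p≢2 1≤k q≡p^k d 2≤d E E! R R! R≢0 (Data.Nat.s≤s Data.Nat.z≤n) Δ H isR S N²> n≤N gap dim
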